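{- Fix $r\in\mathbb{N}$, suppose $n$ is sufficiently large (depending on $r$), and let $A\subseteq A_n$ be product-free with $\mu(A)>n^{ -r}$. Then there exist $t\le 4r$ and a $t$-umvirate $U$ such that the density $|A\cap U|/|U|$ of $A$ inside $U$ is at least $n^{t/4}\mu(A)$.
   Context: $\mu$ is the uniform probability measure on $A_n$. A subset $A$ of a group is product-free if there are no $a,b,c\in A$ with $ab=c$. A dictator is a set $\mathcal{D}_{i\to j}=\{\sigma\in A_n:\sigma(i)=j\}$. For $t\ge 1$, a $t$-umvirate is a nonempty intersection of $t$ distinct dictators; equivalently, for ordered tuples $(i_1,\dots,i_t)$ and $(j_1,\dots,j_t)$ of distinct elements of $[n]$, it is the set of $\sigma\in A_n$ with $\sigma(i_k)=j_k$ for all $k$. -}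

module Defs where

open import Data.Nat using (ℕ; zero; suc; _+_; _*_; _%_; _<ᵇ_; _≡ᵇ_)
open import Data.Bool using (Bool; true; false; _∧_; not; if_then_else_)
open import Data.Fin using (Fin; toℕ)
open import Data.Vec using (Vec; []; _∷_; lookup; tabulate)
open import Data.List using (List; []; _∷_; [_]; map; allFin; cartesianProductWith; length; filterᵇ; concatMap)
open import Data.Bool.ListAction using (and)
open import Relation.Binary.PropositionalEquality using (_≡_)

-- A permutation of [n] = Fin n in one-line notation: σ is the vector (σ(0), …, σ(n-1)).
Perm : ℕ → Set
Perm n = Vec (Fin n) n

allVecs : (m n : ℕ) → List (Vec (Fin n) m)
allVecs zero    n = [ [] ]
allVecs (suc m) n = cartesianProductWith _∷_ (allFin n) (allVecs m n)

pairs : (n : ℕ) → (Fin n → Fin n → Bool) → List Bool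
pairs n f = concatMap (λ i → map (f i) (allFin n)) (allFin n)

isBijᵇ : ∀ {n} → Perm n → Bool
isBijᵇ {n} σ = and (pairs n (λ i j →
  if toℕ i <ᵇ toℕ j then not (toℕ (lookup σ i) ≡ᵇ toℕ (lookup σ j)) else true))

inversions : ∀ {n} → Perm n → ℕ
inversions {n} σ = length (filterᵇ (λ b → b) (pairs n (λ i j →
  (toℕ i <ᵇ toℕ j) ∧ (toℕ (lookup σ j) <ᵇ toℕ (lookup σ i)))))

isAltᵇ : ∀ {n} → Perm n → Bool
isAltᵇ σ = isBijᵇ σ ∧ (inversions σ % 2 ≡ᵇ 0)

-- the elements of A_n, listed without repetition
altGroup : (n : ℕ) → List (Perm n)
altGroup n = filterᵇ isAltᵇ (allVecs n n)

_∘ₚ_ : ∀ {n} → Perm n → Perm n → Perm n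
σ ∘ₚ τ = tabulate (λ k → lookup σ (lookup τ k))

count : (n : ℕ) → (Perm n → Bool) → ℕ
count n P = length (filterᵇ P (altGroup n))

-- A subset of A_n is given by a Boolean predicate (only its values on A_n matter).
-- Product-free: no a, b, c ∈ A with a b = c.
ProductFree : ∀ {n} → (Perm n → Bool) → Set
ProductFree {n} A = (a b : Perm n) → isAltᵇ a ≡ true → isAltᵇ b ≡ true →
  A a ≡ true → A b ≡ true → A (a ∘ₚ b) ≡ false

Distinct : ∀ {n t} → Vec (Fin n) t → Set
Distinct {t = t} v = (k l : Fin t) → lookup v k ≡ lookup v l → k ≡ l

-- the set {σ : σ(i_k) = j_k for all k} (intersected with A_n when counted)
umvirateᵇ : ∀ {n t} → Vec (Fin n) t → Vec (Fin n) t → Perm n → Bool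
umvirateᵇ {n} {t} is js σ = and (map (λ k → toℕ (lookup σ (lookup is k)) ≡ᵇ toℕ (lookup js k)) (allFin t))

module Submission where

-- Let f be the indicator of A, of mean α > n^(-r); as A is product-free, ⟨f ∗ f, f⟩ = 0. Put w = 3 r + 1 and split f into α, the
-- parts g_d of level 1 ≤ d ≤ 8 w (depending on d values of σ, orthogonal to everything depending on d - 1 values) and a rest v. Then
--   0 = α³ + Σ_d ⟨g_d ∗ g_d, g_d⟩ + ⟨f ∗ v, f⟩,
-- and if A had no bump, all error terms would be o(α³):
-- (1) ‖g ∗ g‖² ≤ C n^(-d) ‖g‖⁴ on level d: convolution multiplies the matrices M g I J = E g 1[σ I = J], |I| = |J| = d, whose
--     Hilbert–Schmidt norm is n^(-d/2) ‖g‖ up to constants. With ‖g_d‖² ≤ α this settles d > 3 r.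
-- (2) For d ≤ 3 r, ‖g_d‖² ≤ C α² n^(d/4 + 1/24): given random letters ψ_1, …, ψ_K, reading σ at the last row with the same letter
--     produces independent uniform coordinates. This turns f into a function on a product space, whose restrictions have small mean
--     because A has no bump, and whose weight on level d dominates ‖g_d‖². That weight is bounded by the level inequality,
--     a consequence of the fourth moment inequality for functions with small restrictions.
-- (3) ‖f ∗ v‖² ≤ C n^(-w) ‖f‖² ‖v‖²: double transpositions have a spectral gap of order 1/n on functions without low levels, and an
--     eigenvector of many commuting double transpositions has many orthogonal translates under swaps of their supports, so that
--     Bessel's inequality applies.

-- The exponent 1/4 comes from the levels k ≤ 3 r. If restricting f to k values multiplies its mean
-- by at most B = n^(k/4), the level inequality bounds ‖g_k‖² by about α² B, hence the squared
-- level-k term by n^(-k) (α² B)³ = α⁶ / B. This 1 / B pays for all losses. They are measured by q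
-- of order n^(1/24): B is q^(6 k), so a few factors q and all constants depending on r stay below
-- it. For k > 3 r, n^(-k) α³ is already below α⁶ / n. A_n is not a product, so hypercontractivity
-- is applied to an image of f on a genuine product space, whose restrictions correspond to
-- umvirates. Only rationals occur: roots become powers of `root n`, Hölder's inequality is used
-- with powers of two as exponents, error terms are compared through their squares, and limits
-- become bounds with error 2^(-k) for every k. Levels are spans of indicators, so comparing ‖z‖
-- with the norm of its matrix means inverting a frame operator, which on a single level is a scalar
-- up to a relative error of order 1/n.

open import Defs
open import Level using (0ℓ)
open import Function using (_⟨_⟩_)
open import Data.Nat as ℕ using (ℕ; zero; suc; s≤s; z≤n; _∸_; pred)
import Data.Nat.Properties as ℕ
open import Data.Nat.DivMod using (_/_; m/n*n≤m; m%n<n; m≡m%n+[m/n]*n)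
import Data.Integer as ℤ
import Data.Integer.Properties as ℤ
open import Data.Rational as ℚ using (ℚ; 0ℚ; 1ℚ; _+_; _*_; _-_; -_; _≤_; _<_; _<?_; _≤?_; 1/_; nonNegative; positive; toℚᵘ; *≤*)
open import Data.Rational.Properties hiding (_≟_; _<?_; _≤?_)
import Data.Rational.Unnormalised as ℚᵘ
import Data.Rational.Unnormalised.Properties as ℚᵘ
open import Data.Fin as Fin using (Fin; zero; suc; toℕ)
open import Data.Fin.Properties as Fin using (_≟_; any?; punchOut-injective; injective⇒≤)
open import Data.Bool using (Bool; true; false; _∧_; _xor_)
open import Data.Bool.ListAction using (and)
open import Data.Maybe using (Maybe; just; nothing)
open import Data.Product using (_×_; _,_; Σ; proj₁; proj₂; ∃; ∃-syntax)
open import Data.Sum using (_⊎_; inj₁; inj₂)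
open import Data.Unit using (⊤; tt)
open import Data.Empty using (⊥; ⊥-elim)
open import Data.Vec using (Vec; []; _∷_; lookup)
open import Data.Vec.Properties using (≡-dec; ∷-injective; ∷-injectiveˡ; ∷-injectiveʳ; lookup∘tabulate; tabulate∘lookup; tabulate-cong; lookup-map; lookup-allFin)
open import Data.List as List using (List; []; _∷_; cartesianProductWith; length; filterᵇ)
open import Data.List.Properties using (map-tabulate)
open import Data.List.Relation.Unary.Any using (here; there)
open import Data.List.Membership.Propositional using (_∈_)
open import Data.List.Membership.Propositional.Properties using (∈-cartesianProductWith⁺; ∈-cartesianProductWith⁻; ∈-allFin)
open import Relation.Binary.PropositionalEquality hiding (J)
open import Relation.Nullary using (Dec; yes; no; ¬_)
open import Relation.Nullary.Decidable using (map′; _×-dec_; ¬?; decidable-stable)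
open import Tactic.RingSolver using (solve-∀)
open import Tactic.RingSolver.Core.AlmostCommutativeRing using (AlmostCommutativeRing; fromCommutativeRing)

-- Rational numbers and positive functionals

ringℚ : AlmostCommutativeRing 0ℓ 0ℓ
ringℚ = fromCommutativeRing +-*-commutativeRing λ x → is0 x
  where
  is0 : ∀ x → Maybe (0ℚ ≡ x)
  is0 x with 0ℚ ℚ.≟ x
  ... | yes p = just p
  ... | no _  = nothing

nat : ℕ → ℚ
nat zero    = 0ℚ
nat (suc n) = 1ℚ + nat n

-- Most numerical inequalities below are closed this way: the difference is displayed as a visibly
-- nonnegative term, typically a sum of squares, and only a ring identity is left for the solver.
cert : ∀ {a b e} → 0ℚ ≤ e → b ≡ a + e → a ≤ b
cert {a} {b} {e} 0≤e eq = ≤-trans (≤-reflexive (sym (+-identityʳ a))) (≤-trans (+-monoʳ-≤ a 0≤e) (≤-reflexive (sym eq)))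

diff : ∀ {a b} → a ≤ b → 0ℚ ≤ b - a
diff {a} {b} p = subst (_≤ b - a) (+-inverseʳ a) (+-monoˡ-≤ (- a) p)

undiff : ∀ {a b} → 0ℚ ≤ b - a → a ≤ b
undiff {a} {b} p = cert p (l a b)
  where
  l : ∀ a b → b ≡ a + (b - a)
  l = solve-∀ ringℚ

0≤+ : ∀ {a b} → 0ℚ ≤ a → 0ℚ ≤ b → 0ℚ ≤ a + b
0≤+ p q = +-mono-≤ p q

0≤* : ∀ {a b} → 0ℚ ≤ a → 0ℚ ≤ b → 0ℚ ≤ a * b
0≤* {a} {b} p q = subst (_≤ a * b) (*-zeroʳ a) (*-monoˡ-≤-nonNeg a {{nonNegative p}} q)

*-monoʳ : ∀ {c a b} → 0ℚ ≤ c → a ≤ b → c * a ≤ c * b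
*-monoʳ {c} p q = *-monoˡ-≤-nonNeg c {{nonNegative p}} q

*-monoˡ : ∀ {c a b} → 0ℚ ≤ c → a ≤ b → a * c ≤ b * c
*-monoˡ {c} p q = *-monoʳ-≤-nonNeg c {{nonNegative p}} q

*-mono : ∀ {a b c d} → 0ℚ ≤ a → 0ℚ ≤ d → a ≤ b → c ≤ d → a * c ≤ b * d
*-mono pa pd p q = ≤-trans (*-monoʳ pa q) (*-monoˡ pd p)

neg≥0 : ∀ {a} → a ≤ 0ℚ → 0ℚ ≤ - a
neg≥0 {a} p = subst (0ℚ ≤_) (+-identityˡ (- a)) (diff p)

0≤sq : ∀ a → 0ℚ ≤ a * a
0≤sq a with ≤-total 0ℚ a
... | inj₁ p = 0≤* p p
... | inj₂ p = subst (0ℚ ≤_) (l a) (0≤* (neg≥0 p) (neg≥0 p))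
  where
  l : ∀ a → (- a) * (- a) ≡ a * a
  l = solve-∀ ringℚ

0<1 : 0ℚ < 1ℚ
0<1 = positive⁻¹ 1ℚ

0≤1 : 0ℚ ≤ 1ℚ
0≤1 = <⇒≤ 0<1

0≤nat : ∀ n → 0ℚ ≤ nat n
0≤nat zero    = ≤-refl
0≤nat (suc n) = 0≤+ 0≤1 (0≤nat n)

0<nat : ∀ n → 0ℚ < nat (suc n)
0<nat n = +-mono-<-≤ 0<1 (0≤nat n)

inv : ∀ x → 0ℚ < x → ℚ
inv x p = 1/_ x {{pos⇒nonZero x {{positive p}}}}

inv-r : ∀ x (p : 0ℚ < x) → x * inv x p ≡ 1ℚ
inv-r x p = *-inverseʳ x {{pos⇒nonZero x {{positive p}}}}

0<inv : ∀ x (p : 0ℚ < x) → 0ℚ < inv x p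
0<inv x p = positive⁻¹ _ {{1/pos⇒pos x {{positive p}}}}

0<* : ∀ {a b} → 0ℚ < a → 0ℚ < b → 0ℚ < a * b
0<* {a} {b} p q = subst (_< a * b) (*-zeroʳ a) (*-monoʳ-<-pos a {{positive p}} q)

*-cancelˡ : ∀ {c a b} → 0ℚ < c → c * a ≤ c * b → a ≤ b
*-cancelˡ {c} p q = *-cancelˡ-≤-pos c {{positive p}} q

≤-cong : ∀ {a b c d} → a ≡ b → c ≡ d → a ≤ c → b ≤ d
≤-cong refl refl p = p

<⇒≱ : ∀ {a b} → a < b → ¬ (b ≤ a)
<⇒≱ p q = <-irrefl refl (<-≤-trans p q)

sq-zero : ∀ a → a * a ≤ 0ℚ → a ≡ 0ℚ
sq-zero a p with ≤-total 0ℚ a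
... | inj₁ q = ≤-antisym (≮⇒≥ λ r → <⇒≱ (0<* r r) p) q
... | inj₂ q = ≤-antisym q (≮⇒≥ λ r → <⇒≱ (subst (0ℚ <_) (l a) (0<* (neg r) (neg r))) p)
  where
  l : ∀ a → (- a) * (- a) ≡ a * a
  l = solve-∀ ringℚ
  neg : a < 0ℚ → 0ℚ < - a
  neg r = neg-antimono-< r

-- Sums, expectations, conditional expectations and their iterates are all positive linear
-- functionals, so Cauchy-Schwarz is proved once for all of them. With antisymmetry of the order,
-- monotonicity also yields `ext`, which stands in for function extensionality.
record PLF (Ω : Set) : Set where
  field
    ap   : (Ω → ℚ) → ℚ
    add  : ∀ f g → ap (λ ω → f ω + g ω) ≡ ap f + ap g
    scl  : ∀ c f → ap (λ ω → c * f ω) ≡ c * ap f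
    mono : ∀ {f g} → (∀ ω → f ω ≤ g ω) → ap f ≤ ap g

  ext : ∀ {f g} → (∀ ω → f ω ≡ g ω) → ap f ≡ ap g
  ext p = ≤-antisym (mono λ ω → ≤-reflexive (p ω)) (mono λ ω → ≤-reflexive (sym (p ω)))

  zer : ap (λ _ → 0ℚ) ≡ 0ℚ
  zer = trans (ext λ _ → sym (*-zeroˡ 0ℚ)) (trans (scl 0ℚ (λ _ → 0ℚ)) (*-zeroˡ (ap λ _ → 0ℚ)))

  nonneg : ∀ {f} → (∀ ω → 0ℚ ≤ f ω) → 0ℚ ≤ ap f
  nonneg p = ≤-trans (≤-reflexive (sym zer)) (mono p)

  sclr : ∀ c f → ap (λ ω → f ω * c) ≡ ap f * c
  sclr c f = trans (ext λ ω → *-comm (f ω) c) (trans (scl c f) (*-comm c _))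

  neg : ∀ f → ap (λ ω → - f ω) ≡ - ap f
  neg f = trans (ext λ ω → l (f ω)) (trans (scl (- 1ℚ) f) (sym (l (ap f))))
    where
    l : ∀ a → - a ≡ (- 1ℚ) * a
    l = solve-∀ ringℚ

  sub : ∀ f g → ap (λ ω → f ω - g ω) ≡ ap f - ap g
  sub f g = trans (add f (λ ω → - g ω)) (cong (ap f +_) (neg g))

  sqs : ∀ f → 0ℚ ≤ ap (λ ω → f ω * f ω)
  sqs f = nonneg λ ω → 0≤sq (f ω)

  -- discriminant of the nonnegative quadratic form  ap (af + bg)²
  quad : ∀ a b (f g : Ω → ℚ) → ap (λ ω → (a * f ω + b * g ω) * (a * f ω + b * g ω))
       ≡ a * a * ap (λ ω → f ω * f ω) + (1ℚ + 1ℚ) * (a * b) * ap (λ ω → f ω * g ω) + b * b * ap (λ ω → g ω * g ω)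
  quad a b f g = trans (ext λ ω → l a b (f ω) (g ω))
    (trans (add _ _) (cong₂ _+_ (trans (add _ _) (cong₂ _+_ (scl (a * a) (λ ω → f ω * f ω)) (scl ((1ℚ + 1ℚ) * (a * b)) (λ ω → f ω * g ω)))) (scl (b * b) (λ ω → g ω * g ω))))
    where
    l : ∀ a b x y → (a * x + b * y) * (a * x + b * y)
      ≡ a * a * (x * x) + (1ℚ + 1ℚ) * (a * b) * (x * y) + b * b * (y * y)
    l = solve-∀ ringℚ

  cs : ∀ (f g : Ω → ℚ) → ap (λ ω → f ω * g ω) * ap (λ ω → f ω * g ω) ≤ ap (λ ω → f ω * f ω) * ap (λ ω → g ω * g ω)
  cs f g with 0ℚ <? ap (λ ω → g ω * g ω)
  ... | yes p = *-cancelˡ p (undiff (subst (0ℚ ≤_) (trans (quad c (- b) f g) (l a b c)) (sqs λ ω → c * f ω + (- b) * g ω)))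
    where
    a = ap (λ ω → f ω * f ω) ; b = ap (λ ω → f ω * g ω) ; c = ap (λ ω → g ω * g ω)
    l : ∀ a b c → c * c * a + (1ℚ + 1ℚ) * (c * (- b)) * b + (- b) * (- b) * c ≡ c * (a * c) - c * (b * b)
    l = solve-∀ ringℚ
  ... | no q = subst (_≤ a * c) (sym bb0) (0≤* (sqs f) (sqs g))
    where
    a = ap (λ ω → f ω * f ω) ; b = ap (λ ω → f ω * g ω) ; c = ap (λ ω → g ω * g ω)
    c≡0 : c ≡ 0ℚ
    c≡0 = ≤-antisym (≮⇒≥ q) (sqs g)
    l : ∀ a b t → 1ℚ * 1ℚ * a + (1ℚ + 1ℚ) * (1ℚ * (- (t * b))) * b + (- (t * b)) * (- (t * b)) * 0ℚ
      ≡ a - (t + t) * (b * b)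
    l = solve-∀ ringℚ
    -- Here g has norm 0, so the quadratic form is affine along g; being nonnegative for every t, it
    -- forces b = 0. The value of t in `bb≤0` makes the left side equal to 2 a, whence a ≤ 0, and t
    -- = 1 then gives b² ≤ 0.
    key : ∀ t → (t + t) * (b * b) ≤ a
    key t = undiff (subst (0ℚ ≤_)
      (trans (quad 1ℚ (- (t * b)) f g) (trans (cong (λ z → 1ℚ * 1ℚ * a + (1ℚ + 1ℚ) * (1ℚ * (- (t * b))) * b + (- (t * b)) * (- (t * b)) * z) c≡0) (l a b t)))
      (sqs λ ω → 1ℚ * f ω + (- (t * b)) * g ω))
    bb≤0 : b * b ≤ 0ℚ
    bb≤0 = ≮⇒≥ λ r →
      let t = inv (b * b) r * a
          m : ∀ i a b → (i * a + i * a) * b ≡ (b * i) * a + (b * i) * a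
          m = solve-∀ ringℚ
          e : (t + t) * (b * b) ≡ a + a
          e = trans (m (inv (b * b) r) a (b * b)) (trans (cong (λ z → z * a + z * a) (inv-r (b * b) r)) (cong₂ _+_ (*-identityˡ a) (*-identityˡ a)))
          a≤0 : a ≤ 0ℚ
          a≤0 = undiff (subst (0ℚ ≤_) (n a) (diff (subst (_≤ a) e (key t))))
          k1 = key 1ℚ
      in <⇒≱ r (≤-trans (cert (0≤sq b) (o (b * b))) (≤-trans k1 a≤0))
      where
      n : ∀ a → a - (a + a) ≡ 0ℚ - a
      n = solve-∀ ringℚ
      o : ∀ x → (1ℚ + 1ℚ) * x ≡ x + x
      o = solve-∀ ringℚ
    bb0 : b * b ≡ 0ℚ
    bb0 = ≤-antisym bb≤0 (0≤sq b)

  amgm : ∀ c (p : 0ℚ < c) (f g : Ω → ℚ) → ap (λ ω → (1ℚ + 1ℚ) * (f ω * g ω)) ≤ c * ap (λ ω → f ω * f ω) + inv c p * ap (λ ω → g ω * g ω)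
  amgm c p f g = ≤-trans (mono {g = λ ω → c * (f ω * f ω) + inv c p * (g ω * g ω)} λ ω → pt (f ω) (g ω))
    (≤-reflexive (trans (add (λ ω → c * (f ω * f ω)) (λ ω → inv c p * (g ω * g ω))) (cong₂ _+_ (scl c (λ ω → f ω * f ω)) (scl (inv c p) (λ ω → g ω * g ω)))))
    where
    i = inv c p
    l : ∀ c i x y → c * (x * x) + i * (y * y) ≡ (1ℚ + 1ℚ) * ((c * i) * (x * y)) + i * ((c * x - y) * (c * x - y)) + (1ℚ - c * i) * (c * (x * x))
    l = solve-∀ ringℚ
    m : ∀ X A B → (1ℚ + 1ℚ) * (1ℚ * X) + A + (1ℚ - 1ℚ) * B ≡ (1ℚ + 1ℚ) * X + A
    m = solve-∀ ringℚ
    pt : ∀ x y → (1ℚ + 1ℚ) * (x * y) ≤ c * (x * x) + i * (y * y)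
    pt x y = cert (0≤* (<⇒≤ (0<inv c p)) (0≤sq (c * x - y)))
      (trans (l c i x y) (trans (cong (λ z → (1ℚ + 1ℚ) * (z * (x * y)) + i * ((c * x - y) * (c * x - y)) + (1ℚ - z) * (c * (x * x))) (inv-r c p))
        (m (x * y) _ (c * (x * x)))))

sumL : ∀ {A : Set} → List A → (A → ℚ) → ℚ
sumL []       f = 0ℚ
sumL (x ∷ xs) f = f x + sumL xs f

sumF : ∀ {n} → (Fin n → ℚ) → ℚ
sumF {zero}  f = 0ℚ
sumF {suc n} f = f zero + sumF (λ i → f (suc i))

private
  addl : ∀ a b c d → (a + b) + (c + d) ≡ (a + c) + (b + d)
  addl = solve-∀ ringℚ

listP : ∀ {A : Set} → List A → PLF A
listP xs = record { ap = sumL xs ; add = ad xs ; scl = sc xs ; mono = mo xs }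
  where
  ad : ∀ xs f g → sumL xs (λ ω → f ω + g ω) ≡ sumL xs f + sumL xs g
  ad []       f g = refl
  ad (x ∷ xs) f g = trans (cong (f x + g x +_) (ad xs f g)) (addl (f x) (g x) _ _)
  sc : ∀ xs c f → sumL xs (λ ω → c * f ω) ≡ c * sumL xs f
  sc []       c f = sym (*-zeroʳ c)
  sc (x ∷ xs) c f = trans (cong (c * f x +_) (sc xs c f)) (sym (*-distribˡ-+ c (f x) _))
  mo : ∀ xs {f g} → (∀ ω → f ω ≤ g ω) → sumL xs f ≤ sumL xs g
  mo []       p = ≤-refl
  mo (x ∷ xs) p = +-mono-≤ (p x) (mo xs p)

finP : ∀ n → PLF (Fin n)
finP n = record { ap = sumF ; add = ad n ; scl = sc n ; mono = mo n }
  where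
  ad : ∀ n (f g : Fin n → ℚ) → sumF (λ ω → f ω + g ω) ≡ sumF f + sumF g
  ad zero    f g = refl
  ad (suc n) f g = trans (cong (f zero + g zero +_) (ad n _ _)) (addl (f zero) (g zero) _ _)
  sc : ∀ n c (f : Fin n → ℚ) → sumF (λ ω → c * f ω) ≡ c * sumF f
  sc zero    c f = sym (*-zeroʳ c)
  sc (suc n) c f = trans (cong (c * f zero +_) (sc n c _)) (sym (*-distribˡ-+ c (f zero) _))
  mo : ∀ n {f g : Fin n → ℚ} → (∀ ω → f ω ≤ g ω) → sumF f ≤ sumF g
  mo zero    p = ≤-refl
  mo (suc n) p = +-mono-≤ (p zero) (mo n λ i → p (suc i))

scaleP : ∀ {Ω} c → 0ℚ ≤ c → PLF Ω → PLF Ω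
scaleP c p B = record
  { ap   = λ f → c * ap f
  ; add  = λ f g → trans (cong (c *_) (add f g)) (*-distribˡ-+ c _ _)
  ; scl  = λ d f → trans (cong (c *_) (scl d f)) (trans (sym (*-assoc c d _)) (trans (cong (_* ap f) (*-comm c d)) (*-assoc d c _)))
  ; mono = λ q → *-monoʳ p (mono q) }
  where open PLF B

-- A functional given by finite weighted sums, hence commuting with every linear functional.
Finitary : ∀ {X} → PLF X → Set₁
Finitary {X} A = ∀ {Ω} (B : PLF Ω) (f : X → Ω → ℚ) → PLF.ap B (λ ω → PLF.ap A (λ x → f x ω)) ≡ PLF.ap A (λ x → PLF.ap B (f x))

listP-fin : ∀ {A : Set} (xs : List A) → Finitary (listP xs)
listP-fin []       B f = PLF.zer B
listP-fin (x ∷ xs) B f = trans (PLF.add B _ _) (cong (PLF.ap B (f x) +_) (listP-fin xs B f))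

finP-fin : ∀ n → Finitary (finP n)
finP-fin zero    B f = PLF.zer B
finP-fin (suc n) B f = trans (PLF.add B _ _) (cong (PLF.ap B (f zero) +_) (finP-fin n B (λ i → f (suc i))))

scaleP-fin : ∀ {Ω} c p (A : PLF Ω) → Finitary A → Finitary (scaleP c p A)
scaleP-fin c p A fin B f = trans (PLF.scl B c _) (cong (c *_) (fin B f))

infixr 2 _⊗_
_⊗_ : ∀ {X Y : Set} → PLF X → PLF Y → PLF (X × Y)
A ⊗ B = record
  { ap   = λ f → PLF.ap A λ x → PLF.ap B λ y → f (x , y)
  ; add  = λ f g → trans (PLF.ext A λ x → PLF.add B _ _) (PLF.add A _ _)
  ; scl  = λ c f → trans (PLF.ext A λ x → PLF.scl B c _) (PLF.scl A c _)
  ; mono = λ p → PLF.mono A λ x → PLF.mono B λ y → p (x , y) }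

⊗-fin : ∀ {X Y} (A : PLF X) (B : PLF Y) → Finitary A → Finitary B → Finitary (A ⊗ B)
⊗-fin A B a b C f = trans (a C _) (PLF.ext A λ x → b C _)

mul0ˡ : ∀ {a b} → a ≡ 0ℚ → a * b ≡ 0ℚ
mul0ˡ {b = b} refl = *-zeroˡ b

mul0ʳ : ∀ {a b} → b ≡ 0ℚ → a * b ≡ 0ℚ
mul0ʳ {a} refl = *-zeroʳ a

mul1ˡ : ∀ {a b} → a ≡ 1ℚ → a * b ≡ b
mul1ˡ {b = b} refl = *-identityˡ b

add0ˡ : ∀ {a b} → a ≡ 0ℚ → a + b ≡ b
add0ˡ {b = b} refl = +-identityˡ b

add0ʳ : ∀ {a b} → b ≡ 0ℚ → a + b ≡ a
add0ʳ {a} refl = +-identityʳ a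

-- Levels of functions on product spaces

import Data.Vec as Vec

record Prob (X : Set) : Set₁ where
  field
    plf : PLF X
    one : PLF.ap plf (λ _ → 1ℚ) ≡ 1ℚ
    fin : Finitary plf
  open PLF plf public renaming (ap to avg)

  avg-const : ∀ c → avg (λ _ → c) ≡ c
  avg-const c = trans (ext λ _ → sym (*-identityʳ c)) (trans (scl c (λ _ → 1ℚ)) (trans (cong (c *_) one) (*-identityʳ c)))

module Product {X : Set} (𝒫 : Prob X) where
  open Prob 𝒫

  -- Conditional expectation: coordinates marked `just x` are frozen at x, the others are averaged.
  Er : ∀ {k} → Vec (Maybe X) k → PLF (Vec X k)
  Er [] = record { ap = λ f → f [] ; add = λ _ _ → refl ; scl = λ _ _ → refl ; mono = λ p → p [] }
  Er (nothing ∷ ρ) = record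
    { ap   = λ f → avg λ x → PLF.ap (Er ρ) λ φ → f (x ∷ φ)
    ; add  = λ f g → trans (ext λ x → PLF.add (Er ρ) _ _) (add _ _)
    ; scl  = λ c f → trans (ext λ x → PLF.scl (Er ρ) c _) (scl c _)
    ; mono = λ p → mono λ x → PLF.mono (Er ρ) λ φ → p (x ∷ φ) }
  Er (just x ∷ ρ) = record
    { ap   = λ f → PLF.ap (Er ρ) λ φ → f (x ∷ φ)
    ; add  = λ f g → PLF.add (Er ρ) _ _
    ; scl  = λ c f → PLF.scl (Er ρ) c _
    ; mono = λ p → PLF.mono (Er ρ) λ φ → p (x ∷ φ) }

  Er-fin : ∀ {k} (ρ : Vec (Maybe X) k) → Finitary (Er ρ)
  Er-fin []            B f = refl
  Er-fin (nothing ∷ ρ) B f = trans (fin B _) (ext λ x → Er-fin ρ B λ φ → f (x ∷ φ))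
  Er-fin (just x ∷ ρ)  B f = Er-fin ρ B λ φ → f (x ∷ φ)

  Er-one : ∀ {k} (ρ : Vec (Maybe X) k) → PLF.ap (Er ρ) (λ _ → 1ℚ) ≡ 1ℚ
  Er-one []            = refl
  Er-one (nothing ∷ ρ) = trans (ext λ _ → Er-one ρ) one
  Er-one (just x ∷ ρ)  = Er-one ρ

  Er-const : ∀ {k} (ρ : Vec (Maybe X) k) c → PLF.ap (Er ρ) (λ _ → c) ≡ c
  Er-const ρ c = trans (PLF.ext (Er ρ) λ _ → sym (*-identityʳ c))
    (trans (PLF.scl (Er ρ) c (λ _ → 1ℚ)) (trans (cong (c *_) (Er-one ρ)) (*-identityʳ c)))

  free : ∀ k → Vec (Maybe X) k
  free k = Vec.replicate k nothing

  𝔼 : ∀ {k} → (Vec X k → ℚ) → ℚ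
  𝔼 {k} = PLF.ap (Er (free k))

  cnt : ∀ {k} → Vec (Maybe X) k → ℕ
  cnt []            = 0
  cnt (nothing ∷ ρ) = cnt ρ
  cnt (just _ ∷ ρ)  = suc (cnt ρ)

  cnt-free : ∀ k → cnt (free k) ≡ 0
  cnt-free zero    = refl
  cnt-free (suc k) = cnt-free k

  bar : ∀ {k} → (Vec X (suc k) → ℚ) → Vec X k → ℚ
  bar f φ = avg λ x → f (x ∷ φ)

  -- With `bar` this is the Efron-Stein decomposition in the first coordinate. Degrees and levels
  -- iterate it, which replaces sums over sets of coordinates by recursion on the length.
  dif : ∀ {k} → (Vec X (suc k) → ℚ) → X → Vec X k → ℚ
  dif f x φ = f (x ∷ φ) - bar f φ

  x-x : ∀ a → a - a ≡ 0ℚ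
  x-x = +-inverseʳ

  avg-dif : ∀ {k} (f : Vec X (suc k) → ℚ) φ → avg (λ x → dif f x φ) ≡ 0ℚ
  avg-dif f φ = trans (sub _ _) (trans (cong (λ z → bar f φ - z) (avg-const (bar f φ))) (x-x (bar f φ)))

  bar-dif : ∀ {k} (f : Vec X (suc k) → ℚ) x φ → f (x ∷ φ) ≡ bar f φ + dif f x φ
  bar-dif f x φ = l (f (x ∷ φ)) (bar f φ)
    where
    l : ∀ a b → a ≡ b + (a - b)
    l = solve-∀ ringℚ

  orth : ∀ {k} (f h : Vec X (suc k) → ℚ) φ →
    avg (λ x → f (x ∷ φ) * h (x ∷ φ)) ≡ bar f φ * bar h φ + avg (λ x → dif f x φ * dif h x φ)
  orth f h φ = trans (ext λ x → l (f (x ∷ φ)) (h (x ∷ φ)) F H)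
    (trans (add (λ x → F * H + dif f x φ * dif h x φ) (λ x → F * dif h x φ + H * dif f x φ))
      (trans (cong₂ _+_
        (trans (add (λ _ → F * H) _) (cong (_+ avg (λ x → dif f x φ * dif h x φ)) (avg-const (F * H))))
        (trans (add (λ x → F * dif h x φ) (λ x → H * dif f x φ)) (cong₂ _+_ (trans (scl F _) (trans (cong (F *_) (avg-dif h φ)) (*-zeroʳ F)))
          (trans (scl H _) (trans (cong (H *_) (avg-dif f φ)) (*-zeroʳ H))))))
      (+-identityʳ _)))
    where
    F = bar f φ ; H = bar h φ
    l : ∀ a b F H → a * b ≡ (F * H + (a - F) * (b - H)) + (F * (b - H) + H * (a - F))
    l = solve-∀ ringℚ

  Er-orth : ∀ {k} (ρ : Vec (Maybe X) k) (f h : Vec X (suc k) → ℚ) →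
    PLF.ap (Er (nothing ∷ ρ)) (λ φ → f φ * h φ)
    ≡ PLF.ap (Er ρ) (λ φ → bar f φ * bar h φ) + avg (λ x → PLF.ap (Er ρ) λ φ → dif f x φ * dif h x φ)
  Er-orth ρ f h = trans (sym (fin (Er ρ) _)) (trans (PLF.ext (Er ρ) (orth f h))
    (trans (PLF.add (Er ρ) _ _) (cong (PLF.ap (Er ρ) (λ φ → bar f φ * bar h φ) +_) (fin (Er ρ) _))))

  -- Shifted by one: `Deg d` means degree less than d, so `Deg zero` is the zero function and a
  -- deviation in a coordinate simply lowers the index.
  Deg : ℕ → ∀ {k} → (Vec X k → ℚ) → Set
  Deg zero            f = ∀ φ → f φ ≡ 0ℚ
  Deg (suc d) {zero}  f = ⊤
  Deg (suc d) {suc k} f = Deg (suc d) (bar f) × (∀ x → Deg d (dif f x))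

  Deg-ext : ∀ d {k} {f g : Vec X k → ℚ} → (∀ φ → f φ ≡ g φ) → Deg d f → Deg d g
  Deg-ext zero            p q φ = trans (sym (p φ)) (q φ)
  Deg-ext (suc d) {zero}  p q = tt
  Deg-ext (suc d) {suc k} p (q , r) =
    Deg-ext (suc d) (λ φ → ext λ x → p (x ∷ φ)) q ,
    λ x → Deg-ext d (λ φ → cong₂ _-_ (p (x ∷ φ)) (ext λ y → p (y ∷ φ))) (r x)

  Deg-zero : ∀ d {k} {f : Vec X k → ℚ} → (∀ φ → f φ ≡ 0ℚ) → Deg d f
  Deg-zero zero            p = p
  Deg-zero (suc d) {zero}  p = tt
  Deg-zero (suc d) {suc k} {f} p =
    Deg-zero (suc d) b0 , λ x → Deg-zero d λ φ → trans (cong₂ _-_ (p (x ∷ φ)) (b0 φ)) (x-x 0ℚ)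
    where
    b0 : ∀ φ → bar f φ ≡ 0ℚ
    b0 φ = trans (ext λ x → p (x ∷ φ)) (avg-const 0ℚ)

  Deg-+ : ∀ d {k} {f g : Vec X k → ℚ} → Deg d f → Deg d g → Deg d (λ φ → f φ + g φ)
  Deg-+ zero            p q φ = trans (cong₂ _+_ (p φ) (q φ)) (+-identityʳ 0ℚ)
  Deg-+ (suc d) {zero}  p q = tt
  Deg-+ (suc d) {suc k} {f} {g} (p , p') (q , q') =
    Deg-ext (suc d) (λ φ → sym (add (λ x → f (x ∷ φ)) (λ x → g (x ∷ φ)))) (Deg-+ (suc d) p q) ,
    λ x → Deg-ext d (λ φ → trans (l (f (x ∷ φ)) (bar f φ) (g (x ∷ φ)) (bar g φ)) (cong (λ z → f (x ∷ φ) + g (x ∷ φ) - z) (sym (add (λ x → f (x ∷ φ)) (λ x → g (x ∷ φ)))))) (Deg-+ d (p' x) (q' x))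
    where
    l : ∀ a b c e → (a - b) + (c - e) ≡ (a + c) - (b + e)
    l = solve-∀ ringℚ

  Deg-* : ∀ d {k} c {f : Vec X k → ℚ} → Deg d f → Deg d (λ φ → c * f φ)
  Deg-* zero            c p φ = trans (cong (c *_) (p φ)) (*-zeroʳ c)
  Deg-* (suc d) {zero}  c p = tt
  Deg-* (suc d) {suc k} c {f} (p , p') =
    Deg-ext (suc d) (λ φ → sym (scl c (λ x → f (x ∷ φ)))) (Deg-* (suc d) c p) ,
    λ x → Deg-ext d (λ φ → trans (l c (f (x ∷ φ)) (bar f φ)) (cong (λ z → c * f (x ∷ φ) - z) (sym (scl c (λ x → f (x ∷ φ)))))) (Deg-* d c (p' x))
    where
    l : ∀ c a b → c * (a - b) ≡ c * a - c * b
    l = solve-∀ ringℚ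

  Deg-avg : ∀ d {k} {f : X → Vec X k → ℚ} → (∀ y → Deg d (f y)) → Deg d (λ φ → avg λ y → f y φ)
  Deg-avg zero            p φ = trans (ext λ y → p y φ) (avg-const 0ℚ)
  Deg-avg (suc d) {zero}  p = tt
  Deg-avg (suc d) {suc k} {f} p =
    Deg-ext (suc d) comm (Deg-avg (suc d) (λ y → proj₁ (p y))) ,
    λ x → Deg-ext d (λ φ → trans (sub (λ y → f y (x ∷ φ)) (λ y → bar (f y) φ)) (cong (λ z → avg (λ y → f y (x ∷ φ)) - z) (comm φ))) (Deg-avg d λ y → proj₂ (p y) x)
    where
    comm : ∀ φ → avg (λ y → bar (f y) φ) ≡ bar (λ φ → avg λ y → f y φ) φ
    comm φ = fin plf (λ x y → f y (x ∷ φ))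

  Deg-suc : ∀ d {k} {f : Vec X k → ℚ} → Deg d f → Deg (suc d) f
  Deg-suc zero            p = Deg-zero 1 p
  Deg-suc (suc d) {zero}  p = tt
  Deg-suc (suc d) {suc k} (p , q) = Deg-suc (suc d) p , λ x → Deg-suc d (q x)

  -- Under the shift, degrees a - 1 and b - 1 add up to at most c - 1. By `orth`, the deviation of a
  -- product consists of two mixed terms, in which one factor has lost a degree, and of the centred
  -- product of two deviations, in which both have.
  Deg-mul : ∀ a b c {k} {f g : Vec X k → ℚ} → a ℕ.+ b ℕ.≤ suc c → Deg a f → Deg b g → Deg c (λ φ → f φ * g φ)
  Deg-mul zero    b       c {g = g} le p q = Deg-zero c λ φ → trans (cong (_* g φ) (p φ)) (*-zeroˡ (g φ))
  Deg-mul (suc a) zero    c {f = f} le p q = Deg-zero c λ φ → trans (cong (f φ *_) (q φ)) (*-zeroʳ (f φ))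
  Deg-mul (suc a) (suc b) zero    le p q with ℕ.≤-trans (ℕ.≤-reflexive (cong suc (sym (ℕ.+-suc a b)))) le
  ... | s≤s ()
  Deg-mul (suc a) (suc b) (suc c) {zero} le p q = tt
  Deg-mul (suc a) (suc b) (suc c) {suc k} {f} {g} le (p , p') (q , q') =
    Deg-ext (suc c) (λ φ → sym (orth f g φ)) (Deg-+ (suc c) (Deg-mul (suc a) (suc b) (suc c) le p q) DD) ,
    λ x → Deg-ext c (λ φ → trans (l (f (x ∷ φ)) (g (x ∷ φ)) (bar f φ) (bar g φ) _) (cong (λ z → f (x ∷ φ) * g (x ∷ φ) - z) (sym (orth f g φ))))
      (Deg-+ c (Deg-+ c (Deg-mul (suc a) b c le₁ p (q' x)) (Deg-mul a (suc b) c le₂ (p' x) q))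
        (Deg-+ c (dd x) (Deg-* c (- 1ℚ) (Deg-avg c dd))))
    where
    le₁ : suc a ℕ.+ b ℕ.≤ suc c
    le₁ = ℕ.≤-pred (ℕ.≤-trans (ℕ.≤-reflexive (cong suc (sym (ℕ.+-suc a b)))) le)
    le₂ : a ℕ.+ suc b ℕ.≤ suc c
    le₂ = ℕ.≤-trans (ℕ.≤-reflexive (ℕ.+-suc a b)) le₁
    dd : ∀ x → Deg c (λ φ → dif f x φ * dif g x φ)
    dd x = Deg-mul a b c (ℕ.≤-trans (ℕ.n≤1+n _) le₁) (p' x) (q' x)
    DD : Deg (suc c) (λ φ → avg λ x → dif f x φ * dif g x φ)
    DD = Deg-suc c (Deg-avg c dd)
    l : ∀ a b F G D → (F * (b - G) + (a - F) * G) + ((a - F) * (b - G) + (- 1ℚ) * D) ≡ a * b - (F * G + D)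
    l = solve-∀ ringℚ

  Lv₀ : ℕ → ℚ → ℚ
  Lv₀ zero    v = v
  Lv₀ (suc _) v = 0ℚ

  -- Index shifted by one: Lv (suc d) is the projection onto the d-th level, Lv zero = 0.
  Lv : ℕ → ∀ {k} → (Vec X k → ℚ) → Vec X k → ℚ
  Lv zero    f φ       = 0ℚ
  Lv (suc d) f []      = Lv₀ d (f [])
  Lv (suc d) f (x ∷ φ) = Lv (suc d) (bar f) φ + Lv d (dif f x) φ

  Lv-ext : ∀ d {k} {f g : Vec X k → ℚ} → (∀ φ → f φ ≡ g φ) → ∀ φ → Lv d f φ ≡ Lv d g φ
  Lv-ext zero    p φ       = refl
  Lv-ext (suc d) p []      = cong (Lv₀ d) (p [])
  Lv-ext (suc d) p (x ∷ φ) = cong₂ _+_ (Lv-ext (suc d) (λ φ → ext λ x → p (x ∷ φ)) φ)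
    (Lv-ext d (λ φ → cong₂ _-_ (p (x ∷ φ)) (ext λ y → p (y ∷ φ))) φ)

  Lv-lin : ∀ d {k} (Y : PLF X) → Finitary Y → (g : X → Vec X k → ℚ) →
    ∀ φ → PLF.ap Y (λ y → Lv d (g y) φ) ≡ Lv d (λ φ → PLF.ap Y λ y → g y φ) φ
  Lv-lin zero    Y fY g φ  = PLF.zer Y
  Lv-lin (suc zero) Y fY g []   = refl
  Lv-lin (suc (suc d)) Y fY g []   = PLF.zer Y
  Lv-lin (suc d) Y fY g (x ∷ φ) = trans (PLF.add Y _ _) (cong₂ _+_
    (trans (Lv-lin (suc d) Y fY (λ y → bar (g y)) φ) (Lv-ext (suc d) comm φ))
    (trans (Lv-lin d Y fY (λ y → dif (g y) x) φ) (Lv-ext d (λ φ → trans (PLF.sub Y _ _) (cong (λ z → PLF.ap Y (λ y → g y (x ∷ φ)) - z) (comm φ))) φ)))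
    where
    comm : ∀ φ → PLF.ap Y (λ y → bar (g y) φ) ≡ bar (λ φ → PLF.ap Y λ y → g y φ) φ
    comm φ = fin Y (λ x y → g y (x ∷ φ))

  Lv-sub : ∀ d {k} (f g : Vec X k → ℚ) φ → Lv d (λ φ → f φ - g φ) φ ≡ Lv d f φ - Lv d g φ
  Lv-sub zero          f g φ  = sym (x-x 0ℚ)
  Lv-sub (suc zero)    f g [] = refl
  Lv-sub (suc (suc d)) f g [] = sym (x-x 0ℚ)
  Lv-sub (suc d) f g (x ∷ φ) = trans (cong₂ _+_
      (trans (Lv-ext (suc d) (λ φ → sub _ _) φ) (Lv-sub (suc d) (bar f) (bar g) φ))
      (trans (Lv-ext d (λ φ → trans (cong (λ z → f (x ∷ φ) - g (x ∷ φ) - z) (sub _ _)) (m (f (x ∷ φ)) (g (x ∷ φ)) (bar f φ) (bar g φ))) φ) (Lv-sub d (dif f x) (dif g x) φ)))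
    (l (Lv (suc d) (bar f) φ) _ (Lv d (dif f x) φ) _)
    where
    l : ∀ a b c e → (a - b) + (c - e) ≡ (a + c) - (b + e)
    l = solve-∀ ringℚ
    m : ∀ a b c e → a - b - (c - e) ≡ (a - c) - (b - e)
    m = solve-∀ ringℚ

  Lv-zero : ∀ d {k} {f : Vec X k → ℚ} → (∀ φ → f φ ≡ 0ℚ) → ∀ φ → Lv d f φ ≡ 0ℚ
  Lv-zero d {f = f} p φ = trans (Lv-ext d (λ φ → trans (p φ) (sym (x-x (f φ)))) φ) (trans (Lv-sub d f f φ) (x-x (Lv d f φ)))

  bar-Lv : ∀ d {k} (f : Vec X (suc k) → ℚ) φ → bar (Lv (suc d) f) φ ≡ Lv (suc d) (bar f) φ
  bar-Lv d f φ = trans (add _ _) (trans (cong₂ _+_ (avg-const (Lv (suc d) (bar f) φ))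
    (trans (Lv-lin d plf fin (dif f) φ) (Lv-zero d (avg-dif f) φ))) (+-identityʳ _))

  dif-Lv : ∀ d {k} (f : Vec X (suc k) → ℚ) x φ → dif (Lv (suc d) f) x φ ≡ Lv d (dif f x) φ
  dif-Lv d f x φ = trans (cong (λ z → Lv (suc d) (bar f) φ + Lv d (dif f x) φ - z) (bar-Lv d f φ)) (l (Lv (suc d) (bar f) φ) (Lv d (dif f x) φ))
    where
    l : ∀ a b → a + b - a ≡ b
    l = solve-∀ ringℚ

  Pure₀ : ℕ → ℚ → Set
  Pure₀ zero    v = ⊤
  Pure₀ (suc _) v = v ≡ 0ℚ

  -- Homogeneous counterpart of `Deg` with the same shift: `Pure (suc d)` holds of the functions
  -- lying entirely in level d.
  Pure : ℕ → ∀ {k} → (Vec X k → ℚ) → Set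
  Pure zero            h = ∀ φ → h φ ≡ 0ℚ
  Pure (suc d) {zero}  h = Pure₀ d (h [])
  Pure (suc d) {suc k} h = Pure (suc d) (bar h) × (∀ x → Pure d (dif h x))

  Pure-ext : ∀ d {k} {f g : Vec X k → ℚ} → (∀ φ → f φ ≡ g φ) → Pure d f → Pure d g
  Pure-ext zero            p q φ = trans (sym (p φ)) (q φ)
  Pure-ext (suc zero) {zero}  p q = tt
  Pure-ext (suc (suc d)) {zero}  p q = trans (sym (p [])) q
  Pure-ext (suc d) {suc k} p (q , r) =
    Pure-ext (suc d) (λ φ → ext λ x → p (x ∷ φ)) q ,
    λ x → Pure-ext d (λ φ → cong₂ _-_ (p (x ∷ φ)) (ext λ y → p (y ∷ φ))) (r x)

  Pure-Lv : ∀ d {k} (f : Vec X k → ℚ) → Pure d (Lv d f)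
  Pure-Lv zero          f φ = refl
  Pure-Lv (suc zero)    {zero} f = tt
  Pure-Lv (suc (suc d)) {zero} f = refl
  Pure-Lv (suc d) {suc k} f =
    Pure-ext (suc d) (λ φ → sym (bar-Lv d f φ)) (Pure-Lv (suc d) (bar f)) ,
    λ x → Pure-ext d (λ φ → sym (dif-Lv d f x φ)) (Pure-Lv d (dif f x))

  Pure⇒Deg : ∀ d {k} {f : Vec X k → ℚ} → Pure d f → Deg d f
  Pure⇒Deg zero            p = p
  Pure⇒Deg (suc d) {zero}  p = tt
  Pure⇒Deg (suc d) {suc k} (p , q) = Pure⇒Deg (suc d) p , λ x → Pure⇒Deg d (q x)

  -- `Lv` and `Pure` follow the same recursion, so `Er-orth` splits both pairings into the same two
  -- smaller ones. Together with `Pure-Lv` this makes `Lv d` the orthogonal projection onto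
  -- `Pure d`.
  Lv-adj : ∀ d {k} (f h : Vec X k → ℚ) → Pure d h → 𝔼 (λ φ → f φ * h φ) ≡ 𝔼 (λ φ → Lv d f φ * h φ)
  Lv-adj zero {k} f h p = PLF.ext (Er (free k)) λ φ → trans (cong (f φ *_) (p φ)) (trans (*-zeroʳ (f φ)) (sym (*-zeroˡ (h φ))))
  Lv-adj (suc zero)    {zero} f h p = refl
  Lv-adj (suc (suc d)) {zero} f h p = trans (cong (f [] *_) p) (trans (*-zeroʳ (f [])) (sym (*-zeroˡ (h []))))
  Lv-adj (suc d) {suc k} f h (p , q) = trans (Er-orth (free k) f h) (trans (cong₂ _+_
      (trans (Lv-adj (suc d) (bar f) (bar h) p) (PLF.ext (Er (free k)) λ φ → cong (_* bar h φ) (sym (bar-Lv d f φ))))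
      (ext λ x → trans (Lv-adj d (dif f x) (dif h x) (q x)) (PLF.ext (Er (free k)) λ φ → cong (_* dif h x φ) (sym (dif-Lv d f x φ)))))
    (sym (Er-orth (free k) (Lv (suc d) f) h)))

  Lv-sq : ∀ d {k} (f : Vec X k → ℚ) → 𝔼 (λ φ → f φ * Lv d f φ) ≡ 𝔼 (λ φ → Lv d f φ * Lv d f φ)
  Lv-sq d f = Lv-adj d f (Lv d f) (Pure-Lv d f)

-- Hypercontractivity

-- The recursion is dictated by the constant `C'` of the inductive step on the degree.
fourConst : ℕ → ℚ
fourConst zero    = 0ℚ
fourConst (suc d) = nat 64 * (fourConst d * (1ℚ + nat d)) + nat 6 * (1ℚ + nat 4 * fourConst d)

0≤fourConst : ∀ d → 0ℚ ≤ fourConst d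
0≤fourConst zero    = ≤-refl
0≤fourConst (suc d) = 0≤+ (0≤* (0≤nat 64) (0≤* (0≤fourConst d) (0≤+ 0≤1 (0≤nat d)))) (0≤* (0≤nat 6) (0≤+ 0≤1 (0≤* (0≤nat 4) (0≤fourConst d))))

module Hypercontractivity {X : Set} (𝒫 : Prob X) where
  open Prob 𝒫
  open Product 𝒫
  open ≤-Reasoning

  -- Globalness: freezing at most j coordinates never raises the mean of F above G. It is used with
  -- F the square of a function and says that its mass is not concentrated on a few coordinates.
  Glob : ∀ {k} → ℕ → ℚ → (Vec X k → ℚ) → Set
  Glob {k} j G F = ∀ (ρ : Vec (Maybe X) k) → cnt ρ ℕ.≤ j → PLF.ap (Er ρ) F ≤ G

  module _ {Ω : Set} (B : PLF Ω) where
    -- Functions take values in L² of an auxiliary functional B. The induction on the degree passes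
    -- from h to the family of all its martingale increments (`Hf`), so the fourth moment inequality
    -- has to be stated for vector values from the start.
    nrm : ∀ {k} → (Vec X k → Ω → ℚ) → Vec X k → ℚ
    nrm h φ = PLF.ap B λ ω → h φ ω * h φ ω

    0≤nrm : ∀ {k} (h : Vec X k → Ω → ℚ) φ → 0ℚ ≤ nrm h φ
    0≤nrm h φ = PLF.sqs B (h φ)

  vbar : ∀ {Ω : Set} {k} → (Vec X (suc k) → Ω → ℚ) → Vec X k → Ω → ℚ
  vbar h φ ω = bar (λ φ → h φ ω) φ

  vdif : ∀ {Ω : Set} {k} → (Vec X (suc k) → Ω → ℚ) → X → Vec X k → Ω → ℚ
  vdif h x φ ω = dif (λ φ → h φ ω) x φ

  module _ {Ω : Set} (B : PLF Ω) where
    private module B = PLF B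

    nrm-split : ∀ {k} (h : Vec X (suc k) → Ω → ℚ) φ →
      avg (λ x → nrm B h (x ∷ φ)) ≡ nrm B (vbar h) φ + avg (λ x → nrm B (vdif h x) φ)
    nrm-split h φ = trans (sym (fin B _)) (trans (B.ext λ ω → orth (λ φ → h φ ω) (λ φ → h φ ω) φ)
      (trans (B.add _ _) (cong (nrm B (vbar h) φ +_) (fin B _))))

    Er-split : ∀ {k} (h : Vec X (suc k) → Ω → ℚ) (ρ : Vec (Maybe X) k) →
      PLF.ap (Er (nothing ∷ ρ)) (nrm B h) ≡ PLF.ap (Er ρ) (nrm B (vbar h)) + PLF.ap (Er ρ) (λ φ → avg λ x → nrm B (vdif h x) φ)
    Er-split h ρ = trans (sym (fin (Er ρ) _)) (trans (PLF.ext (Er ρ) (nrm-split h)) (PLF.add (Er ρ) _ _))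

    -- Let G and u be the squared norms of mean and deviation, and p their inner product, so that
    -- |h|² = G + 2 p + u. Cauchy-Schwarz, p² ≤ G u, removes p from the square of this except for
    -- the term 4 G p, which is linear in the deviation and averages to 0.
    fourth : ∀ {k} (h : Vec X (suc k) → Ω → ℚ) φ →
      avg (λ x → nrm B h (x ∷ φ) * nrm B h (x ∷ φ)) ≤
        nrm B (vbar h) φ * nrm B (vbar h) φ + (nat 8 * (nrm B (vbar h) φ * avg (λ x → nrm B (vdif h x) φ))
        + nat 3 * avg (λ x → nrm B (vdif h x) φ * nrm B (vdif h x) φ))
    fourth h φ = begin
        avg (λ x → nrm B h (x ∷ φ) * nrm B h (x ∷ φ))
          ≤⟨ mono pt ⟩
        avg (λ x → (G * G + (nat 8 * (G * u x) + nat 3 * (u x * u x))) + nat 4 * (G * p x))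
          ≡⟨ add _ _ ⟩
        avg (λ x → G * G + (nat 8 * (G * u x) + nat 3 * (u x * u x))) + avg (λ x → nat 4 * (G * p x))
          ≡⟨ cong₂ _+_ (trans (add _ _) (cong₂ _+_ (avg-const (G * G)) (trans (add _ _)
               (cong₂ _+_ (trans (scl (nat 8) _) (cong (nat 8 *_) (scl G u))) (scl (nat 3) _)))))
               (trans (scl (nat 4) _) (trans (cong (nat 4 *_) (trans (scl G p) (trans (cong (G *_) p0) (*-zeroʳ G)))) (*-zeroʳ (nat 4)))) ⟩
        (G * G + (nat 8 * (G * avg u) + nat 3 * avg (λ x → u x * u x))) + 0ℚ
          ≡⟨ +-identityʳ _ ⟩
        G * G + (nat 8 * (G * avg u) + nat 3 * avg (λ x → u x * u x)) ∎
      where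
      G = nrm B (vbar h) φ
      u p : X → ℚ
      u x = nrm B (vdif h x) φ
      p x = B.ap λ ω → vbar h φ ω * vdif h x φ ω
      p0 : avg p ≡ 0ℚ
      p0 = trans (sym (fin B _)) (trans (B.ext λ ω → trans (scl (vbar h φ ω) _) (trans (cong (vbar h φ ω *_) (avg-dif (λ φ → h φ ω) φ)) (*-zeroʳ (vbar h φ ω)))) B.zer)
      e1 : ∀ a g → a * a ≡ g * g + ((1ℚ + 1ℚ) * (g * (a - g)) + (a - g) * (a - g))
      e1 = solve-∀ ringℚ
      N≡ : ∀ x → nrm B h (x ∷ φ) ≡ G + ((1ℚ + 1ℚ) * p x + u x)
      N≡ x = trans (B.ext λ ω → e1 (h (x ∷ φ) ω) (vbar h φ ω)) (trans (B.add _ _) (cong (G +_) (trans (B.add _ _) (cong (_+ u x) (B.scl (1ℚ + 1ℚ) _)))))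
      e2 : ∀ G p u → (G * G + (nat 8 * (G * u) + nat 3 * (u * u))) + nat 4 * (G * p)
        ≡ (G + ((1ℚ + 1ℚ) * p + u)) * (G + ((1ℚ + 1ℚ) * p + u)) + (nat 6 * (G * u - p * p) + nat 2 * ((p - u) * (p - u)))
      e2 = solve-∀ ringℚ
      pt : ∀ x → nrm B h (x ∷ φ) * nrm B h (x ∷ φ) ≤ (G * G + (nat 8 * (G * u x) + nat 3 * (u x * u x))) + nat 4 * (G * p x)
      pt x = subst (λ z → z * z ≤ (G * G + (nat 8 * (G * u x) + nat 3 * (u x * u x))) + nat 4 * (G * p x)) (sym (N≡ x))
        (cert (0≤+ (0≤* (0≤nat 6) (diff (B.cs (vbar h φ) (vdif h x φ)))) (0≤* (0≤nat 2) (0≤sq (p x - u x)))) (e2 G (p x) (u x)))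

    -- Predictable quadratic variation of the martingale revealing the coordinates from last to first.
    V : ∀ {k} → (Vec X k → Ω → ℚ) → Vec X k → ℚ
    V h []      = 0ℚ
    V h (_ ∷ φ) = avg (λ y → nrm B (vdif h y) φ) + V (vbar h) φ

    -- The sum of the expected fourth powers of the increments; the base case is the fourth power of
    -- the mean, with which the martingale starts.
    Q : ∀ {k} → (Vec X k → Ω → ℚ) → ℚ
    Q {zero}  h = nrm B h [] * nrm B h []
    Q {suc k} h = avg (λ y → 𝔼 λ φ → nrm B (vdif h y) φ * nrm B (vdif h y) φ) + Q (vbar h)

    0≤V : ∀ {k} (h : Vec X k → Ω → ℚ) φ → 0ℚ ≤ V h φ
    0≤V h []      = ≤-refl
    0≤V h (_ ∷ φ) = 0≤+ (nonneg λ y → 0≤nrm B (vdif h y) φ) (0≤V (vbar h) φ)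

    -- Induction by `fourth`. `V h` is predictable: it does not depend on the first coordinate, over
    -- which |h|² averages to G + U. Hence E |h|² V is E (G + U) (U + V'), which contains both E G
    -- U, produced by `fourth`, and E G V', produced by the induction hypothesis.
    burkholder : ∀ {k} (h : Vec X k → Ω → ℚ) →
      𝔼 (λ φ → nrm B h φ * nrm B h φ) ≤ nat 8 * 𝔼 (λ φ → nrm B h φ * V h φ) + nat 3 * Q h
    burkholder {zero} h = cert (0≤* (0≤nat 2) (0≤sq (nrm B h []))) (e (nrm B h []))
      where
      e : ∀ a → nat 8 * (a * 0ℚ) + nat 3 * (a * a) ≡ a * a + nat 2 * (a * a)
      e = solve-∀ ringℚ
    burkholder {suc k} h = begin
        𝔼 (λ φ → nrm B h φ * nrm B h φ)
          ≡⟨ sym (fin E _) ⟩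
        𝔼 (λ φ → avg λ x → nrm B h (x ∷ φ) * nrm B h (x ∷ φ))
          ≤⟨ E.mono (fourth h) ⟩
        𝔼 (λ φ → G φ * G φ + (nat 8 * (G φ * U φ) + nat 3 * avg (λ x → nrm B (vdif h x) φ * nrm B (vdif h x) φ)))
          ≡⟨ trans (E.add _ _) (cong (𝔼 (λ φ → G φ * G φ) +_) (trans (E.add _ _) (cong₂ _+_ (E.scl (nat 8) _) (trans (E.scl (nat 3) _) (cong (nat 3 *_) (fin E _)))))) ⟩
        𝔼 (λ φ → G φ * G φ) + (nat 8 * 𝔼 (λ φ → G φ * U φ) + nat 3 * q)
          ≤⟨ +-monoˡ-≤ _ (burkholder (vbar h)) ⟩
        (nat 8 * 𝔼 (λ φ → G φ * V (vbar h) φ) + nat 3 * Q (vbar h)) + (nat 8 * 𝔼 (λ φ → G φ * U φ) + nat 3 * q)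
          ≤⟨ cert (0≤* (0≤nat 8) (E.nonneg λ φ → 0≤* (0≤U φ) (0≤+ (0≤U φ) (0≤V (vbar h) φ)))) (e1 (𝔼 λ φ → G φ * V (vbar h) φ) (Q (vbar h)) (𝔼 λ φ → G φ * U φ) q (𝔼 λ φ → U φ * (U φ + V (vbar h) φ))) ⟩
        nat 8 * (𝔼 (λ φ → G φ * V (vbar h) φ) + 𝔼 (λ φ → G φ * U φ) + 𝔼 (λ φ → U φ * (U φ + V (vbar h) φ))) + nat 3 * (q + Q (vbar h))
          ≡⟨ cong (λ z → nat 8 * z + nat 3 * (q + Q (vbar h))) NV ⟩
        nat 8 * 𝔼 (λ φ → nrm B h φ * V h φ) + nat 3 * Q h ∎
      where
      E = Er (free k)
      module E = PLF E
      G U : Vec X k → ℚ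
      G = nrm B (vbar h)
      U φ = avg λ x → nrm B (vdif h x) φ
      q = avg λ x → 𝔼 λ φ → nrm B (vdif h x) φ * nrm B (vdif h x) φ
      0≤U : ∀ φ → 0ℚ ≤ U φ
      0≤U φ = nonneg λ y → 0≤nrm B (vdif h y) φ
      e1 : ∀ a b c q e → nat 8 * (a + c + e) + nat 3 * (q + b) ≡ (nat 8 * a + nat 3 * b) + (nat 8 * c + nat 3 * q) + nat 8 * e
      e1 = solve-∀ ringℚ
      e2 : ∀ g u v → g * v + g * u + u * (u + v) ≡ (g + u) * (u + v)
      e2 = solve-∀ ringℚ
      NV : 𝔼 (λ φ → G φ * V (vbar h) φ) + 𝔼 (λ φ → G φ * U φ) + 𝔼 (λ φ → U φ * (U φ + V (vbar h) φ)) ≡ 𝔼 (λ φ → nrm B h φ * V h φ)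
      NV = trans (cong (_+ 𝔼 (λ φ → U φ * (U φ + V (vbar h) φ))) (sym (E.add _ _))) (trans (sym (E.add _ _))
        (trans (E.ext λ φ → trans (e2 (G φ) (U φ) (V (vbar h) φ)) (trans (cong (_* (U φ + V (vbar h) φ)) (sym (nrm-split h φ))) (sym (sclr (U φ + V (vbar h) φ) _)))) (fin E _)))

    Glob-bar : ∀ {k} (h : Vec X (suc k) → Ω → ℚ) j G → Glob j G (nrm B h) → Glob j G (nrm B (vbar h))
    Glob-bar h j G gl ρ le = ≤-trans (cert (PLF.nonneg (Er ρ) λ φ → nonneg λ x → 0≤nrm B (vdif h x) φ) (Er-split h ρ)) (gl (nothing ∷ ρ) le)

    Er-V-free : ∀ {k} (h : Vec X (suc k) → Ω → ℚ) G (ρ : Vec (Maybe X) k) →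
      PLF.ap (Er ρ) (V (vbar h)) ≤ PLF.ap (Er ρ) (nrm B (vbar h)) + nat (cnt ρ) * G →
      PLF.ap (Er (nothing ∷ ρ)) (V h) ≤ PLF.ap (Er (nothing ∷ ρ)) (nrm B h) + nat (cnt ρ) * G
    Er-V-free {k} h G ρ ih = begin
        avg (λ x → PLF.ap (Er ρ) (λ φ → U φ + V (vbar h) φ))
          ≡⟨ trans (avg-const _) (PLF.add (Er ρ) _ _) ⟩
        PLF.ap (Er ρ) U + PLF.ap (Er ρ) (V (vbar h))
          ≤⟨ +-monoʳ-≤ (PLF.ap (Er ρ) U) ih ⟩
        PLF.ap (Er ρ) U + (PLF.ap (Er ρ) (nrm B (vbar h)) + nat (cnt ρ) * G)
          ≡⟨ e (PLF.ap (Er ρ) U) (PLF.ap (Er ρ) (nrm B (vbar h))) (nat (cnt ρ) * G) ⟩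
        (PLF.ap (Er ρ) (nrm B (vbar h)) + PLF.ap (Er ρ) U) + nat (cnt ρ) * G
          ≡⟨ cong (_+ nat (cnt ρ) * G) (sym (Er-split h ρ)) ⟩
        PLF.ap (Er (nothing ∷ ρ)) (nrm B h) + nat (cnt ρ) * G ∎
      where
      U : Vec X k → ℚ
      U φ = avg λ x → nrm B (vdif h x) φ
      e : ∀ a b c → a + (b + c) ≡ (b + a) + c
      e = solve-∀ ringℚ

    -- On free coordinates the increments add up to at most |h|² by Pythagoras. On a frozen
    -- coordinate V is the same as if it were free, and the free mean of |h|² is at most G; so every
    -- frozen coordinate costs one G.
    Er-V : ∀ {k} (h : Vec X k → Ω → ℚ) j G → Glob j G (nrm B h) → ∀ ρ → cnt ρ ℕ.≤ j →
      PLF.ap (Er ρ) (V h) ≤ PLF.ap (Er ρ) (nrm B h) + nat (cnt ρ) * G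
    Er-V {zero} h j G gl [] le = cert (0≤nrm B h []) (e (nrm B h []) G)
      where
      e : ∀ a G → a + 0ℚ * G ≡ 0ℚ + a
      e = solve-∀ ringℚ
    Er-V {suc k} h j G gl (nothing ∷ ρ) le = Er-V-free h G ρ (Er-V (vbar h) j G (Glob-bar h j G gl) ρ le)
    Er-V {suc k} h j G gl (just x ∷ ρ) le = begin
        PLF.ap (Er ρ) (λ φ → V h (x ∷ φ))
          ≡⟨ sym (avg-const _) ⟩
        PLF.ap (Er (nothing ∷ ρ)) (V h)
          ≤⟨ Er-V-free h G ρ (Er-V (vbar h) j G (Glob-bar h j G gl) ρ le') ⟩
        PLF.ap (Er (nothing ∷ ρ)) (nrm B h) + nat (cnt ρ) * G
          ≤⟨ +-monoˡ-≤ (nat (cnt ρ) * G) (gl (nothing ∷ ρ) le') ⟩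
        G + nat (cnt ρ) * G
          ≤⟨ cert (PLF.nonneg (Er ρ) λ φ → 0≤nrm B h (x ∷ φ)) (e (PLF.ap (Er ρ) (λ φ → nrm B h (x ∷ φ))) G (nat (cnt ρ))) ⟩
        PLF.ap (Er ρ) (λ φ → nrm B h (x ∷ φ)) + (1ℚ + nat (cnt ρ)) * G ∎
      where
      le' = ℕ.≤-trans (ℕ.n≤1+n _) le
      e : ∀ a G c → a + (1ℚ + c) * G ≡ (G + c * G) + a
      e = solve-∀ ringℚ

    -- Freezing the coordinate at y spends one unit of the globalness of h. The deviation also has
    -- degree one less, so both budgets shrink together in the induction.
    Glob-dif : ∀ {k} (h : Vec X (suc k) → Ω → ℚ) j G → Glob (suc j) G (nrm B h) → ∀ y → Glob j (nat 4 * G) (nrm B (vdif h y))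
    Glob-dif h j G gl y ρ le = begin
        PLF.ap (Er ρ) (nrm B (vdif h y))
          ≤⟨ PLF.mono (Er ρ) (λ φ → ≤-trans (B.mono λ ω → cert (0≤sq (h (y ∷ φ) ω + vbar h φ ω)) (e1 (h (y ∷ φ) ω) (vbar h φ ω))) (≤-reflexive (trans (B.add _ _) (cong₂ _+_ (B.scl (nat 2) _) (B.scl (nat 2) _))))) ⟩
        PLF.ap (Er ρ) (λ φ → nat 2 * nrm B h (y ∷ φ) + nat 2 * nrm B (vbar h) φ)
          ≡⟨ trans (PLF.add (Er ρ) _ _) (cong₂ _+_ (PLF.scl (Er ρ) (nat 2) _) (PLF.scl (Er ρ) (nat 2) _)) ⟩
        nat 2 * PLF.ap (Er ρ) (λ φ → nrm B h (y ∷ φ)) + nat 2 * PLF.ap (Er ρ) (nrm B (vbar h))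
          ≤⟨ +-mono-≤ (*-monoʳ (0≤nat 2) (gl (just y ∷ ρ) (s≤s le))) (*-monoʳ (0≤nat 2) (Glob-bar h (suc j) G gl ρ (ℕ.≤-trans le (ℕ.n≤1+n _)))) ⟩
        nat 2 * G + nat 2 * G
          ≡⟨ e2 G ⟩
        nat 4 * G ∎
      where
      e1 : ∀ a b → nat 2 * (a * a) + nat 2 * (b * b) ≡ (a - b) * (a - b) + (a + b) * (a + b)
      e1 = solve-∀ ringℚ
      e2 : ∀ G → nat 2 * G + nat 2 * G ≡ nat 4 * G
      e2 = solve-∀ ringℚ

  -- The martingale increments of h, as a function with values in one larger space; its squared norm is V h.
  HΩ : ℕ → Set → Set
  HΩ zero    Ω = ⊥
  HΩ (suc k) Ω = (X × Ω) ⊎ HΩ k Ω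

  HB : ∀ k {Ω} → PLF Ω → PLF (HΩ k Ω)
  HB zero    B = listP Data.List.[]
    where import Data.List
  HB (suc k) B = record
    { ap   = λ f → PLF.ap (plf ⊗ B) (λ p → f (inj₁ p)) + PLF.ap (HB k B) (λ ω → f (inj₂ ω))
    ; add  = λ f g → trans (cong₂ _+_ (PLF.add (plf ⊗ B) _ _) (PLF.add (HB k B) _ _)) (l (PLF.ap (plf ⊗ B) (λ p → f (inj₁ p))) _ _ _)
    ; scl  = λ c f → trans (cong₂ _+_ (PLF.scl (plf ⊗ B) c _) (PLF.scl (HB k B) c _)) (sym (*-distribˡ-+ c _ _))
    ; mono = λ p → +-mono-≤ (PLF.mono (plf ⊗ B) λ q → p (inj₁ q)) (PLF.mono (HB k B) λ q → p (inj₂ q)) }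
    where
    l : ∀ a b c d → (a + b) + (c + d) ≡ (a + c) + (b + d)
    l = solve-∀ ringℚ

  Hf : ∀ {Ω : Set} {k} → (Vec X k → Ω → ℚ) → Vec X k → HΩ k Ω → ℚ
  Hf h (_ ∷ φ) (inj₁ (y , ω)) = vdif h y φ ω
  Hf h (_ ∷ φ) (inj₂ ω)       = Hf (vbar h) φ ω

  nrm-Hf : ∀ {Ω : Set} (B : PLF Ω) {k} (h : Vec X k → Ω → ℚ) φ → nrm (HB k B) (Hf h) φ ≡ V B h φ
  nrm-Hf B h []      = refl
  nrm-Hf B h (x ∷ φ) = cong (avg (λ y → nrm B (vdif h y) φ) +_) (nrm-Hf B (vbar h) φ)

  Deg-lift : ∀ d {k} {g : Vec X k → ℚ} {F : Vec X (suc k) → ℚ} → (∀ x φ → F (x ∷ φ) ≡ g φ) → Deg d g → Deg d F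
  Deg-lift zero    p q (x ∷ φ) = trans (p x φ) (q φ)
  Deg-lift (suc d) {g = g} {F} p q = Deg-ext (suc d) (λ φ → sym (bg φ)) q ,
    λ x → Deg-zero d λ φ → trans (cong₂ _-_ (p x φ) (bg φ)) (x-x (g φ))
    where
    bg : ∀ φ → bar F φ ≡ g φ
    bg φ = trans (ext λ x → p x φ) (avg-const (g φ))

  Deg-Hf : ∀ d {Ω : Set} {k} (h : Vec X k → Ω → ℚ) → (∀ ω → Deg (suc d) (λ φ → h φ ω)) → ∀ ω → Deg d (λ φ → Hf h φ ω)
  Deg-Hf d {k = suc k} h p (inj₁ (y , ω)) = Deg-lift d {g = dif (λ φ → h φ ω) y} (λ _ _ → refl) (proj₂ (p ω) y)
  Deg-Hf d {k = suc k} h p (inj₂ ω)       = Deg-lift d {g = λ φ → Hf (vbar h) φ ω} (λ _ _ → refl) (Deg-Hf d (vbar h) (λ ω → proj₁ (p ω)) ω)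

  FourNorm : ℕ → ℚ → Set₁
  FourNorm d C = ∀ {k} {Ω : Set} (B : PLF Ω) (h : Vec X k → Ω → ℚ) G → (∀ ω → Deg d (λ φ → h φ ω)) → Glob d G (nrm B h) →
    𝔼 (λ φ → nrm B h φ * nrm B h φ) ≤ C * (𝔼 (nrm B h) * G)

  module Step (d : ℕ) (C : ℚ) (0≤C : 0ℚ ≤ C) (ih : FourNorm d C) where

    -- Each deviation has lower degree and is global with bound 4 G, so the induction hypothesis
    -- bounds its fourth moment by its energy times G. The energies of all increments add up to E
    -- |h|².
    bound-Q : ∀ {k} {Ω : Set} (B : PLF Ω) (h : Vec X k → Ω → ℚ) G → 0ℚ ≤ G → (∀ ω → Deg (suc d) (λ φ → h φ ω)) → Glob (suc d) G (nrm B h) →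
      Q B h ≤ (1ℚ + nat 4 * C) * (𝔼 (nrm B h) * G)
    bound-Q {zero} B h G 0≤G dg gl = cert
        (0≤+ (0≤* n≥0 (diff (gl [] z≤n))) (0≤* (0≤* (0≤nat 4) 0≤C) (0≤* n≥0 0≤G))) (e C (nrm B h []) G)
      where
      n≥0 = 0≤nrm B h []
      e : ∀ C n G → (1ℚ + nat 4 * C) * (n * G) ≡ n * n + (n * (G - n) + (nat 4 * C) * (n * G))
      e = solve-∀ ringℚ
    bound-Q {suc k} B h G 0≤G dg gl = begin
        avg (λ y → 𝔼 λ φ → nrm B (vdif h y) φ * nrm B (vdif h y) φ) + Q B (vbar h)
          ≤⟨ +-mono-≤ (mono λ y → ih B (vdif h y) (nat 4 * G) (λ ω → proj₂ (dg ω) y) (Glob-dif B h d G gl y))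
               (bound-Q B (vbar h) G 0≤G (λ ω → proj₁ (dg ω)) (Glob-bar B h (suc d) G gl)) ⟩
        avg (λ y → C * (𝔼 (nrm B (vdif h y)) * (nat 4 * G))) + (1ℚ + nat 4 * C) * (𝔼 (nrm B (vbar h)) * G)
          ≡⟨ cong (_+ (1ℚ + nat 4 * C) * (𝔼 (nrm B (vbar h)) * G)) (trans (scl C _) (cong (C *_) (sclr (nat 4 * G) _))) ⟩
        C * (u * (nat 4 * G)) + (1ℚ + nat 4 * C) * (𝔼 (nrm B (vbar h)) * G)
          ≤⟨ cert (0≤* (nonneg λ y → PLF.nonneg (Er (free k)) (0≤nrm B (vdif h y))) 0≤G) (e C u (𝔼 (nrm B (vbar h))) G) ⟩
        (1ℚ + nat 4 * C) * ((𝔼 (nrm B (vbar h)) + u) * G)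
          ≡⟨ cong (λ z → (1ℚ + nat 4 * C) * (z * G)) (sym (trans (Er-split B h (free k)) (cong (𝔼 (nrm B (vbar h)) +_) (fin (Er (free k)) _)))) ⟩
        (1ℚ + nat 4 * C) * (𝔼 (nrm B h) * G) ∎
      where
      u = avg λ y → 𝔼 (nrm B (vdif h y))
      e : ∀ C u v G → (1ℚ + nat 4 * C) * ((v + u) * G) ≡ (C * (u * (nat 4 * G)) + (1ℚ + nat 4 * C) * (v * G)) + u * G
      e = solve-∀ ringℚ

    C' : ℚ
    C' = nat 64 * (C * (1ℚ + nat d)) + nat 6 * (1ℚ + nat 4 * C)

    -- In twice `burkholder`, 16 N V ≤ N² + 64 V² lets half of the left side absorb N². The
    -- remaining E V² is a fourth moment again, namely that of the vector of increments `Hf h`,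
    -- which has lower degree and is global by `Er-V`.
    step : FourNorm (suc d) C'
    step {k} B h G dg gl = +-cancel' (begin
        𝔼NN + 𝔼NN
          ≤⟨ +-mono-≤ (burkholder B h) (burkholder B h) ⟩
        (nat 8 * 𝔼NV + nat 3 * Q B h) + (nat 8 * 𝔼NV + nat 3 * Q B h)
          ≤⟨ cert (0≤+ (subst (0ℚ ≤_) eqS (E.nonneg λ φ → 0≤sq (nrm B h φ - nat 8 * V B h φ))) (0≤* (0≤nat 6) (diff (bound-Q B h G 0≤G dg gl))))
               (e1 𝔼NN 𝔼NV 𝔼VV (Q B h) ((1ℚ + nat 4 * C) * (n * G))) ⟩
        𝔼NN + (nat 64 * 𝔼VV + nat 6 * ((1ℚ + nat 4 * C) * (n * G)))
          ≤⟨ +-monoʳ-≤ 𝔼NN (+-monoˡ-≤ _ (*-monoʳ (0≤nat 64) VV≤)) ⟩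
        𝔼NN + (nat 64 * (C * (n * (G + nat d * G))) + nat 6 * ((1ℚ + nat 4 * C) * (n * G)))
          ≡⟨ cong (𝔼NN +_) (e2 C n G (nat d)) ⟩
        𝔼NN + C' * (n * G) ∎)
      where
      E = Er (free k)
      module E = PLF E
      n = 𝔼 (nrm B h)
      𝔼NN = 𝔼 (λ φ → nrm B h φ * nrm B h φ)
      𝔼NV = 𝔼 (λ φ → nrm B h φ * V B h φ)
      𝔼VV = 𝔼 (λ φ → V B h φ * V B h φ)
      +-cancel' : ∀ {a b} → a + a ≤ a + b → a ≤ b
      +-cancel' {a} {b} p = undiff (subst (0ℚ ≤_) (l a b) (diff p))
        where
        l : ∀ a b → (a + b) - (a + a) ≡ b - a
        l = solve-∀ ringℚ
      0≤G : 0ℚ ≤ G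
      0≤G = ≤-trans (E.nonneg (0≤nrm B h)) (gl (free k) (ℕ.≤-trans (ℕ.≤-reflexive (cnt-free k)) z≤n))
      e0 : ∀ a b → (a - nat 8 * b) * (a - nat 8 * b) ≡ a * a + ((- nat 16) * (a * b) + nat 64 * (b * b))
      e0 = solve-∀ ringℚ
      eqS : 𝔼 (λ φ → (nrm B h φ - nat 8 * V B h φ) * (nrm B h φ - nat 8 * V B h φ)) ≡ 𝔼NN + ((- nat 16) * 𝔼NV + nat 64 * 𝔼VV)
      eqS = trans (E.ext λ φ → e0 (nrm B h φ) (V B h φ)) (trans (E.add _ _) (cong (𝔼NN +_) (trans (E.add _ _) (cong₂ _+_ (E.scl (- nat 16) _) (E.scl (nat 64) _)))))
      e1 : ∀ N P V Q q → N + (nat 64 * V + nat 6 * q) ≡ ((nat 8 * P + nat 3 * Q) + (nat 8 * P + nat 3 * Q)) + ((N + ((- nat 16) * P + nat 64 * V)) + nat 6 * (q - Q))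
      e1 = solve-∀ ringℚ
      e2 : ∀ C n G d → nat 64 * (C * (n * (G + d * G))) + nat 6 * ((1ℚ + nat 4 * C) * (n * G)) ≡ (nat 64 * (C * (1ℚ + d)) + nat 6 * (1ℚ + nat 4 * C)) * (n * G)
      e2 = solve-∀ ringℚ
      nat-mono : ∀ {a b} → a ℕ.≤ b → nat a ≤ nat b
      nat-mono {b = b} z≤n = 0≤nat b
      nat-mono (s≤s p) = +-monoʳ-≤ 1ℚ (nat-mono p)
      glV : Glob d (G + nat d * G) (nrm (HB k B) (Hf h))
      glV ρ le = ≤-trans (≤-reflexive (PLF.ext (Er ρ) (nrm-Hf B h))) (≤-trans (Er-V B h (suc d) G gl ρ le')
        (+-mono-≤ (gl ρ le') (*-monoˡ 0≤G (nat-mono le))))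
        where le' = ℕ.≤-trans le (ℕ.n≤1+n d)
      V≤ : 𝔼 (V B h) ≤ n
      V≤ = ≤-trans (Er-V B h (suc d) G gl (free k) (ℕ.≤-trans (ℕ.≤-reflexive (cnt-free k)) z≤n))
        (≤-reflexive (trans (cong (λ z → n + nat z * G) (cnt-free k)) (trans (cong (n +_) (*-zeroˡ G)) (+-identityʳ n))))
      VV≤ : 𝔼VV ≤ C * (n * (G + nat d * G))
      VV≤ = begin
        𝔼VV ≡⟨ E.ext (λ φ → cong₂ _*_ (sym (nrm-Hf B h φ)) (sym (nrm-Hf B h φ))) ⟩
        𝔼 (λ φ → nrm (HB k B) (Hf h) φ * nrm (HB k B) (Hf h) φ) ≤⟨ ih (HB k B) (Hf h) (G + nat d * G) (Deg-Hf d h dg) glV ⟩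
        C * (𝔼 (nrm (HB k B) (Hf h)) * (G + nat d * G)) ≡⟨ cong (λ z → C * (z * (G + nat d * G))) (E.ext (nrm-Hf B h)) ⟩
        C * (𝔼 (V B h) * (G + nat d * G)) ≤⟨ *-monoʳ 0≤C (*-monoˡ (0≤+ 0≤G (0≤* (0≤nat d) 0≤G)) V≤) ⟩
        C * (n * (G + nat d * G)) ∎

  four-norm : ∀ d → FourNorm d (fourConst d)
  four-norm zero {k} B h G dg gl = ≤-reflexive (trans (PLF.ext (Er (free k)) λ φ → trans (cong₂ _*_ (n0 φ) (n0 φ)) (*-zeroˡ 0ℚ))
      (trans (PLF.zer (Er (free k))) (sym (*-zeroˡ (𝔼 (nrm B h) * G)))))
    where
    n0 : ∀ φ → nrm B h φ ≡ 0ℚ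
    n0 φ = trans (PLF.ext B λ ω → trans (cong₂ _*_ (dg ω φ) (dg ω φ)) (*-zeroˡ 0ℚ)) (PLF.zer B)
  four-norm (suc d) = Step.step d (fourConst d) (0≤fourConst d) (four-norm d)

-- The level inequality

-- pow2 s x = x ^ 2ˢ  and  Gp s x = x ^ (2ˢ - 1)
pow2 : ℕ → ℚ → ℚ
pow2 zero    x = x
pow2 (suc s) x = pow2 s (x * x)

Gp : ℕ → ℚ → ℚ
Gp zero    x = 1ℚ
Gp (suc s) x = x * Gp s (x * x)

pow2-mul : ∀ s x y → pow2 s (x * y) ≡ pow2 s x * pow2 s y
pow2-mul zero    x y = refl
pow2-mul (suc s) x y = trans (cong (pow2 s) (l x y)) (pow2-mul s (x * x) (y * y))
  where
  l : ∀ x y → (x * y) * (x * y) ≡ (x * x) * (y * y)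
  l = solve-∀ ringℚ

Gp-mul : ∀ s x y → Gp s (x * y) ≡ Gp s x * Gp s y
Gp-mul zero    x y = refl
Gp-mul (suc s) x y = trans (cong ((x * y) *_) (trans (cong (Gp s) (l x y)) (Gp-mul s (x * x) (y * y)))) (m x y (Gp s (x * x)) (Gp s (y * y)))
  where
  l : ∀ x y → (x * y) * (x * y) ≡ (x * x) * (y * y)
  l = solve-∀ ringℚ
  m : ∀ x y a b → (x * y) * (a * b) ≡ (x * a) * (y * b)
  m = solve-∀ ringℚ

0≤pow2 : ∀ s {x} → 0ℚ ≤ x → 0ℚ ≤ pow2 s x
0≤pow2 zero        p = p
0≤pow2 (suc s) {x} p = 0≤pow2 s (0≤sq x)

0<pow2 : ∀ s {x} → 0ℚ < x → 0ℚ < pow2 s x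
0<pow2 zero    p = p
0<pow2 (suc s) p = 0<pow2 s (0<* p p)

0≤Gp : ∀ s {x} → 0ℚ ≤ x → 0ℚ ≤ Gp s x
0≤Gp zero        p = 0≤1
0≤Gp (suc s) {x} p = 0≤* p (0≤Gp s (0≤sq x))

pow2-mono : ∀ s {x y} → 0ℚ ≤ x → x ≤ y → pow2 s x ≤ pow2 s y
pow2-mono zero    p q = q
pow2-mono (suc s) {x} {y} p q = pow2-mono s (0≤sq x) (*-mono p (≤-trans p q) q q)

pow2-mono< : ∀ s {x y} → 0ℚ ≤ x → x < y → pow2 s x < pow2 s y
pow2-mono< zero    p q = q
pow2-mono< (suc s) {x} {y} p q = pow2-mono< s (0≤sq x)
  (≤-<-trans (*-monoʳ p (<⇒≤ q)) (*-monoˡ-<-pos y {{positive (≤-<-trans p q)}} q))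

Gp-mono : ∀ s {x y} → 0ℚ ≤ x → x ≤ y → Gp s x ≤ Gp s y
Gp-mono zero    p q = ≤-refl
Gp-mono (suc s) {x} {y} p q = *-mono p (0≤Gp s (0≤sq y)) q (Gp-mono s (0≤sq x) (*-mono p (≤-trans p q) q q))

x*Gp : ∀ s x → x * Gp s x ≡ pow2 s x
x*Gp zero    x = *-identityʳ x
x*Gp (suc s) x = trans (sym (*-assoc x x _)) (x*Gp s (x * x))

pow2*Gp : ∀ s x → pow2 s x * Gp s x ≡ Gp (suc s) x
pow2*Gp zero    x = refl
pow2*Gp (suc s) x = trans (l (pow2 s (x * x)) x (Gp s (x * x))) (cong (x *_) (pow2*Gp s (x * x)))
  where
  l : ∀ a x b → a * (x * b) ≡ x * (a * b)
  l = solve-∀ ringℚ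

pow2-suc : ∀ s x → pow2 (suc s) x ≡ pow2 s x * pow2 s x
pow2-suc s x = pow2-mul s x x

-- The number of frozen coordinates that `power-norm` consumes: in degree d the fourth moment
-- inequality is used with index suc d, and every squaring doubles d.
dep : ℕ → ℕ → ℕ
dep zero    d = 0
dep (suc s) d = suc d ℕ.+ dep s (d ℕ.+ d)

powConst : ℕ → ℕ → ℚ
powConst zero    d = 1ℚ
powConst (suc s) d = powConst s (d ℕ.+ d) * (fourConst (suc d) * Gp s (fourConst (suc d)))

0≤powConst : ∀ s d → 0ℚ ≤ powConst s d
0≤powConst zero    d = 0≤1
0≤powConst (suc s) d = 0≤* (0≤powConst s (d ℕ.+ d)) (0≤* (0≤fourConst (suc d)) (0≤Gp s (0≤fourConst (suc d))))

-- 9^j is the price in `restrict` for freezing j coordinates.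
Kr : ℕ → ℚ
Kr zero    = 1ℚ
Kr (suc j) = nat 9 * Kr j

1≤Kr : ∀ j → 1ℚ ≤ Kr j
1≤Kr zero    = ≤-refl
1≤Kr (suc j) = ≤-trans (1≤Kr j) (cert (0≤* (0≤nat 8) (≤-trans 0≤1 (1≤Kr j))) (l (Kr j)))
  where
  l : ∀ a → nat 9 * a ≡ a + nat 8 * a
  l = solve-∀ ringℚ

Kr-mono : ∀ {i j} → i ℕ.≤ j → Kr i ≤ Kr j
Kr-mono {j = j} z≤n = 1≤Kr j
Kr-mono (s≤s p) = *-monoʳ (0≤nat 9) (Kr-mono p)

lvConst : ℕ → ℕ → ℚ
lvConst s d = powConst s d * Gp s (Kr (dep s d))

0≤lvConst : ∀ s d → 0ℚ ≤ lvConst s d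
0≤lvConst s d = 0≤* (0≤powConst s d) (0≤Gp s (≤-trans 0≤1 (1≤Kr (dep s d))))

-- A sum in place of a maximum: one constant that dominates `lvConst s e` for all e ≤ d, as the
-- induction on the level requires.
sumC : ℕ → ℕ → ℚ
sumC s zero    = lvConst s zero
sumC s (suc d) = lvConst s (suc d) + sumC s d

0≤sumC : ∀ s d → 0ℚ ≤ sumC s d
0≤sumC s zero    = 0≤lvConst s zero
0≤sumC s (suc d) = 0≤+ (0≤lvConst s (suc d)) (0≤sumC s d)

lv≤sumC : ∀ s d → lvConst s d ≤ sumC s d
lv≤sumC s zero    = ≤-refl
lv≤sumC s (suc d) = cert (0≤sumC s d) refl

sumC-mono : ∀ s {i j} → i ℕ.≤ j → sumC s i ≤ sumC s j
sumC-mono s {i} {j} le with ℕ.≤⇒≤′ le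
... | p = go p
  where
  go : ∀ {j} → i ℕ.≤′ j → sumC s i ≤ sumC s j
  go (ℕ.≤′-reflexive refl) = ≤-refl
  go (ℕ.≤′-step {n = n} p) = ≤-trans (go p) (cert (0≤lvConst s (suc n)) (+-comm (lvConst s (suc n)) (sumC s n)))

module LevelInequality {X : Set} (𝒫 : Prob X) where
  open Prob 𝒫
  open Product 𝒫
  open Hypercontractivity 𝒫
  open ≤-Reasoning

  pt : PLF ⊤
  pt = record { ap = λ f → f tt ; add = λ _ _ → refl ; scl = λ _ _ → refl ; mono = λ p → p tt }

  sq : ∀ {k} → (Vec X k → ℚ) → Vec X k → ℚ
  sq h φ = h φ * h φ

  -- A restriction is kept as a function of all k coordinates that ignores the overwritten ones, so
  -- it has the same type as the original function.
  ow : ∀ {k} → Vec (Maybe X) k → Vec X k → Vec X k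
  ow []            []      = []
  ow (nothing ∷ ρ) (x ∷ φ) = x ∷ ow ρ φ
  ow (just y ∷ ρ)  (x ∷ φ) = y ∷ ow ρ φ

  merge : ∀ {k} → Vec (Maybe X) k → Vec (Maybe X) k → Vec (Maybe X) k
  merge []            []       = []
  merge (nothing ∷ ρ) (m ∷ ρ') = m ∷ merge ρ ρ'
  merge (just y ∷ ρ)  (_ ∷ ρ') = just y ∷ merge ρ ρ'

  cnt-merge : ∀ {k} (ρ ρ' : Vec (Maybe X) k) → cnt (merge ρ ρ') ℕ.≤ cnt ρ' ℕ.+ cnt ρ
  cnt-merge []            []             = z≤n
  cnt-merge (nothing ∷ ρ) (nothing ∷ ρ') = cnt-merge ρ ρ'
  cnt-merge (nothing ∷ ρ) (just x ∷ ρ')  = s≤s (cnt-merge ρ ρ')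
  cnt-merge (just y ∷ ρ)  (nothing ∷ ρ') = ℕ.≤-trans (s≤s (cnt-merge ρ ρ')) (ℕ.≤-reflexive (sym (ℕ.+-suc (cnt ρ') (cnt ρ))))
  cnt-merge (just y ∷ ρ)  (just x ∷ ρ')  = s≤s (ℕ.≤-trans (cnt-merge ρ ρ') (ℕ.+-monoʳ-≤ (cnt ρ') (ℕ.n≤1+n _)))

  Er-ow : ∀ {k} (ρ ρ' : Vec (Maybe X) k) (f : Vec X k → ℚ) → PLF.ap (Er ρ') (λ φ → f (ow ρ φ)) ≡ PLF.ap (Er (merge ρ ρ')) f
  Er-ow []            []             f = refl
  Er-ow (nothing ∷ ρ) (nothing ∷ ρ') f = ext λ x → Er-ow ρ ρ' λ φ → f (x ∷ φ)
  Er-ow (nothing ∷ ρ) (just x ∷ ρ')  f = Er-ow ρ ρ' λ φ → f (x ∷ φ)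
  Er-ow (just y ∷ ρ)  (nothing ∷ ρ') f = trans (avg-const _) (Er-ow ρ ρ' λ φ → f (y ∷ φ))
  Er-ow (just y ∷ ρ)  (just x ∷ ρ')  f = Er-ow ρ ρ' λ φ → f (y ∷ φ)

  Er-ow-free : ∀ {k} (ρ : Vec (Maybe X) k) (f : Vec X k → ℚ) → 𝔼 (λ φ → f (ow ρ φ)) ≡ PLF.ap (Er ρ) f
  Er-ow-free ρ f = trans (Er-ow ρ (free _) f) (cong (λ z → PLF.ap (Er z) f) (mf ρ))
    where
    mf : ∀ {k} (ρ : Vec (Maybe X) k) → merge ρ (free k) ≡ ρ
    mf []            = refl
    mf (nothing ∷ ρ) = cong (nothing ∷_) (mf ρ)
    mf (just y ∷ ρ)  = cong (just y ∷_) (mf ρ)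

  Deg-ow : ∀ d {k} (ρ : Vec (Maybe X) k) {f : Vec X k → ℚ} → Deg d f → Deg d (λ φ → f (ow ρ φ))
  Deg-ow zero    ρ             p φ = p (ow ρ φ)
  Deg-ow (suc d) []            p = tt
  Deg-ow (suc d) (nothing ∷ ρ) (p , q) = Deg-ow (suc d) ρ p , λ x → Deg-ow d ρ (q x)
  Deg-ow (suc d) (just y ∷ ρ) {f} (p , q) = Deg-lift (suc d) {g = λ φ → f (y ∷ ow ρ φ)} {F = λ φ → f (ow (just y ∷ ρ) φ)} (λ _ _ → refl)
    (Deg-ow (suc d) ρ (Deg-ext (suc d) (λ φ → sym (bar-dif f y φ)) (Deg-+ (suc d) p (Deg-suc d (q y)))))

  -- The fourth moment inequality iterated along h, h², h⁴ and so on. Applied to every restriction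
  -- of h it also shows that h² squared is global, with C G² in place of G; this is what feeds the
  -- next step, where the degree has doubled.
  power-norm : ∀ s d {k} (h : Vec X k → ℚ) G → 0ℚ ≤ G → Deg (suc d) h → Glob (dep s d) G (sq h) →
    𝔼 (λ φ → pow2 (suc s) (h φ)) ≤ powConst s d * (𝔼 (sq h) * Gp s G)
  power-norm zero d h G 0≤G dg gl = ≤-reflexive (sym (trans (*-identityˡ _) (*-identityʳ _)))
  power-norm (suc s) d {k} h G 0≤G dg gl = begin
      𝔼 (λ φ → pow2 (suc s) (sq h φ))
        ≤⟨ power-norm s (d ℕ.+ d) (sq h) (C * (G * G)) (0≤* (0≤fourConst (suc d)) (0≤sq G)) (Deg-mul (suc d) (suc d) (suc (d ℕ.+ d)) (ℕ.≤-reflexive (cong suc (ℕ.+-suc d d))) dg dg) gl4 ⟩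
      P * (𝔼 (sq (sq h)) * Gp s (C * (G * G)))
        ≤⟨ *-monoʳ (0≤powConst s (d ℕ.+ d)) (*-monoˡ (0≤Gp s (0≤* (0≤fourConst (suc d)) (0≤sq G))) (four (free k) (ℕ.≤-trans (ℕ.≤-reflexive (cnt-free k)) z≤n))) ⟩
      P * (C * (𝔼 (sq h) * G) * Gp s (C * (G * G)))
        ≡⟨ cong (λ z → P * (C * (𝔼 (sq h) * G) * z)) (Gp-mul s C (G * G)) ⟩
      P * (C * (𝔼 (sq h) * G) * (Gp s C * Gp s (G * G)))
        ≡⟨ l P C (𝔼 (sq h)) G (Gp s C) (Gp s (G * G)) ⟩
      powConst (suc s) d * (𝔼 (sq h) * Gp (suc s) G) ∎
    where
    C = fourConst (suc d)
    P = powConst s (d ℕ.+ d)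
    l : ∀ P C n G a b → P * (C * (n * G) * (a * b)) ≡ (P * (C * a)) * (n * (G * b))
    l = solve-∀ ringℚ
    four : ∀ ρ → cnt ρ ℕ.≤ dep s (d ℕ.+ d) → PLF.ap (Er ρ) (sq (sq h)) ≤ C * (PLF.ap (Er ρ) (sq h) * G)
    four ρ le = ≤-cong (Er-ow-free ρ (sq (sq h))) (cong (λ z → C * (z * G)) (Er-ow-free ρ (sq h)))
      (four-norm (suc d) pt (λ φ _ → h (ow ρ φ)) G (λ _ → Deg-ow (suc d) ρ dg)
        λ ρ' le' → ≤-trans (≤-reflexive (Er-ow ρ ρ' (sq h))) (gl (merge ρ ρ') (ℕ.≤-trans (cnt-merge ρ ρ') (ℕ.+-mono-≤ le' le))))
    gl4 : Glob (dep s (d ℕ.+ d)) (C * (G * G)) (sq (sq h))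
    gl4 ρ le = ≤-trans (four ρ le) (*-monoʳ (0≤fourConst (suc d)) (*-monoˡ 0≤G (gl ρ (ℕ.≤-trans le (ℕ.m≤n+m _ (suc d))))))

  Lv-pred : ∀ i {k} (f : Vec X (suc k) → ℚ) x φ → Lv i f (x ∷ φ) ≡ Lv i (bar f) φ + Lv (pred i) (dif f x) φ
  Lv-pred zero    f x φ = sym (+-identityʳ 0ℚ)
  Lv-pred (suc i) f x φ = refl

  LvSq : ∀ i {k} (g : Vec X (suc k) → ℚ) φ →
    avg (λ x → sq (Lv i g) (x ∷ φ)) ≡ sq (Lv i (bar g)) φ + avg (λ x → sq (Lv (pred i) (dif g x)) φ)
  LvSq zero    g φ = trans (avg-const (0ℚ * 0ℚ)) (sym (trans (cong (0ℚ * 0ℚ +_) (avg-const (0ℚ * 0ℚ))) refl))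
  LvSq (suc i) g φ = trans (orth (Lv (suc i) g) (Lv (suc i) g) φ)
    (cong₂ _+_ (cong₂ _*_ (bar-Lv i g φ) (bar-Lv i g φ)) (ext λ x → cong₂ _*_ (dif-Lv i g x φ) (dif-Lv i g x φ)))

  𝔼LvSq : ∀ i {k} (g : Vec X (suc k) → ℚ) →
    𝔼 (sq (Lv i g)) ≡ 𝔼 (sq (Lv i (bar g))) + avg (λ x → 𝔼 (sq (Lv (pred i) (dif g x))))
  𝔼LvSq i {k} g = trans (sym (fin (Er (free k)) _)) (trans (PLF.ext (Er (free k)) (LvSq i g))
    (trans (PLF.add (Er (free k)) _ _) (cong (𝔼 (sq (Lv i (bar g))) +_) (fin (Er (free k)) _))))

  𝔼Lv-bar : ∀ i {k} (g : Vec X (suc k) → ℚ) → 𝔼 (sq (Lv i (bar g))) ≤ 𝔼 (sq (Lv i g))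
  𝔼Lv-bar i {k} g = cert (nonneg λ x → PLF.sqs (Er (free k)) (Lv (pred i) (dif g x))) (𝔼LvSq i g)

  jensen : ∀ (a : X → ℚ) → avg a * avg a ≤ avg (λ x → a x * a x)
  jensen a = ≤-cong (cong₂ _*_ (ext λ x → *-identityʳ (a x)) (ext λ x → *-identityʳ (a x)))
    (trans (cong (avg (λ x → a x * a x) *_) (trans (avg-const (1ℚ * 1ℚ)) refl)) (*-identityʳ _))
    (PLF.cs plf a (λ _ → 1ℚ))

  pred-∸ : ∀ e c → pred e ∸ c ≡ pred (e ∸ c)
  pred-∸ zero    zero    = refl
  pred-∸ zero    (suc c) = refl
  pred-∸ (suc e) zero    = refl
  pred-∸ (suc e) (suc c) = sym (ℕ.pred[m∸n]≡m∸[1+n] e c)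

  ∸-suc : ∀ e c → e ∸ suc c ≡ pred e ∸ c
  ∸-suc e c = trans (sym (ℕ.pred[m∸n]≡m∸[1+n] e c)) (sym (pred-∸ e c))

  -- The induction on the coordinates needs a whole family of functions of varying level.
  restrict : ∀ {k} {Ω : Set} (B : PLF Ω) (e : Ω → ℕ) (f : Vec X k → Ω → ℚ) Bd →
    (∀ ρ' → PLF.ap B (λ ω → 𝔼 (sq (Lv (e ω ∸ cnt ρ') (λ φ → f (ow ρ' φ) ω)))) ≤ Bd) →
    ∀ ρ → PLF.ap (Er ρ) (λ φ → PLF.ap B λ ω → sq (Lv (e ω) (λ φ → f φ ω)) φ) ≤ Kr (cnt ρ) * Bd
  restrict {zero} B e f Bd hyp [] = ≤-trans (≤-reflexive (PLF.ext B λ ω → cong (λ z → z * z) (Lv-ext (e ω) (λ { [] → refl }) []))) (≤-trans (hyp []) (≤-reflexive (sym (*-identityˡ Bd))))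
  restrict {suc k} {Ω} B e f Bd hyp (nothing ∷ ρ) = begin
      avg (λ x → PLF.ap (Er ρ) (λ φ → PLF.ap B λ ω → sq (Lv (e ω) (λ φ → f φ ω)) (x ∷ φ)))
        ≡⟨ sym (fin (Er ρ) _) ⟩
      PLF.ap (Er ρ) (λ φ → avg λ x → PLF.ap B λ ω → sq (Lv (e ω) (λ φ → f φ ω)) (x ∷ φ))
        ≡⟨ PLF.ext (Er ρ) (λ φ → trans (sym (fin B _)) (trans (PLF.ext B λ ω → LvSq (e ω) (λ φ → f φ ω) φ) (trans (PLF.add B _ _) (cong (PLF.ap B (λ ω → sq (Lv (e ω) (λ φ → vbar f φ ω)) φ) +_) (fin B _))))) ⟩
      PLF.ap (Er ρ) (λ φ → PLF.ap B' λ ω → sq (Lv (e' ω) (λ φ → f' φ ω)) φ)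
        ≤⟨ restrict B' e' f' Bd hyp' ρ ⟩
      Kr (cnt ρ) * Bd ∎
    where
    B' : PLF (Ω ⊎ (X × Ω))
    B' = record
      { ap   = λ f → PLF.ap B (λ p → f (inj₁ p)) + PLF.ap (plf ⊗ B) (λ ω → f (inj₂ ω))
      ; add  = λ f g → trans (cong₂ _+_ (PLF.add B _ _) (PLF.add (plf ⊗ B) _ _)) (l (PLF.ap B (λ p → f (inj₁ p))) _ _ _)
      ; scl  = λ c f → trans (cong₂ _+_ (PLF.scl B c _) (PLF.scl (plf ⊗ B) c _)) (sym (*-distribˡ-+ c _ _))
      ; mono = λ p → +-mono-≤ (PLF.mono B λ q → p (inj₁ q)) (PLF.mono (plf ⊗ B) λ q → p (inj₂ q)) }
      where
      l : ∀ a b c d → (a + b) + (c + d) ≡ (a + c) + (b + d)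
      l = solve-∀ ringℚ
    e' : Ω ⊎ (X × Ω) → ℕ
    e' (inj₁ ω)       = e ω
    e' (inj₂ (x , ω)) = pred (e ω)
    f' : Vec X k → Ω ⊎ (X × Ω) → ℚ
    f' φ (inj₁ ω)       = vbar f φ ω
    f' φ (inj₂ (x , ω)) = vdif f x φ ω
    hyp' : ∀ ρ' → PLF.ap B' (λ ω → 𝔼 (sq (Lv (e' ω ∸ cnt ρ') (λ φ → f' (ow ρ' φ) ω)))) ≤ Bd
    hyp' ρ' = ≤-trans (≤-reflexive (trans (cong (PLF.ap B (λ ω → 𝔼 (sq (Lv (e ω ∸ cnt ρ') (λ φ → vbar f (ow ρ' φ) ω)))) +_) (sym (fin B _)))
      (trans (sym (PLF.add B _ _)) (PLF.ext B λ ω → trans (cong (λ z → 𝔼 (sq (Lv (e ω ∸ cnt ρ') (λ φ → vbar f (ow ρ' φ) ω))) + avg (λ x → 𝔼 (sq (Lv z (λ φ → vdif f x (ow ρ' φ) ω))))) (pred-∸ (e ω) (cnt ρ')))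
        (sym (𝔼LvSq (e ω ∸ cnt ρ') (λ φ → f (ow (nothing ∷ ρ') φ) ω)))))))
      (hyp (nothing ∷ ρ'))
  restrict {suc k} {Ω} B e f Bd hyp (just x ∷ ρ) = begin
      PLF.ap (Er ρ) (λ φ → PLF.ap B λ ω → sq (Lv (e ω) (λ φ → f φ ω)) (x ∷ φ))
        ≤⟨ PLF.mono (Er ρ) (λ φ → PLF.mono B λ ω → three (a₁ ω φ) (a₂ ω φ) (a₃ ω φ) (Lv (e ω) (λ φ → f φ ω) (x ∷ φ)) (split ω φ)) ⟩
      PLF.ap (Er ρ) (λ φ → PLF.ap B λ ω → nat 3 * (a₁ ω φ * a₁ ω φ + (a₂ ω φ * a₂ ω φ + a₃ ω φ * a₃ ω φ)))
        ≡⟨ trans (PLF.ext (Er ρ) λ φ → trans (PLF.scl B (nat 3) _) (cong (nat 3 *_) (trans (PLF.add B _ _) (cong (PLF.ap B (λ ω → a₁ ω φ * a₁ ω φ) +_) (PLF.add B _ _)))))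
             (trans (PLF.scl (Er ρ) (nat 3) _) (cong (nat 3 *_) (trans (PLF.add (Er ρ) _ _) (cong (PLF.ap (Er ρ) (λ φ → PLF.ap B (λ ω → a₁ ω φ * a₁ ω φ)) +_) (PLF.add (Er ρ) _ _))))) ⟩
      nat 3 * (PLF.ap (Er ρ) (λ φ → PLF.ap B (λ ω → a₁ ω φ * a₁ ω φ)) + (PLF.ap (Er ρ) (λ φ → PLF.ap B (λ ω → a₂ ω φ * a₂ ω φ)) + PLF.ap (Er ρ) (λ φ → PLF.ap B (λ ω → a₃ ω φ * a₃ ω φ))))
        ≤⟨ *-monoʳ (0≤nat 3) (+-mono-≤ (restrict B e (vbar f) Bd hyp₁ ρ) (+-mono-≤ (restrict B (λ ω → pred (e ω)) (λ φ → f (x ∷ φ)) Bd (hyp₂ x) ρ) (restrict B (λ ω → pred (e ω)) (vbar f) Bd hyp₃ ρ))) ⟩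
      nat 3 * (Kr (cnt ρ) * Bd + (Kr (cnt ρ) * Bd + Kr (cnt ρ) * Bd))
        ≡⟨ l (Kr (cnt ρ)) Bd ⟩
      Kr (suc (cnt ρ)) * Bd ∎
    where
    l : ∀ a b → nat 3 * (a * b + (a * b + a * b)) ≡ nat 9 * a * b
    l = solve-∀ ringℚ
    a₁ a₂ a₃ : Ω → Vec X k → ℚ
    a₁ ω = Lv (e ω) (λ φ → vbar f φ ω)
    a₂ ω = Lv (pred (e ω)) (λ φ → f (x ∷ φ) ω)
    a₃ ω = Lv (pred (e ω)) (λ φ → vbar f φ ω)
    -- The deviation at x is the restriction to x minus the mean, and both enter one level lower.
    -- Three squares and the factor 3 of `three` make up the 9 of `Kr`.
    split : ∀ ω φ → Lv (e ω) (λ φ → f φ ω) (x ∷ φ) ≡ a₁ ω φ + (a₂ ω φ - a₃ ω φ)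
    split ω φ = trans (Lv-pred (e ω) (λ φ → f φ ω) x φ) (cong (a₁ ω φ +_) (Lv-sub (pred (e ω)) _ _ φ))
    three : ∀ a b c z → z ≡ a + (b - c) → z * z ≤ nat 3 * (a * a + (b * b + c * c))
    three a b c z p = subst (λ z → z * z ≤ nat 3 * (a * a + (b * b + c * c))) (sym p) (cert (0≤+ (0≤sq (a - b)) (0≤+ (0≤sq (a + c)) (0≤sq (b + c)))) (m a b c))
      where
      m : ∀ a b c → nat 3 * (a * a + (b * b + c * c)) ≡ (a + (b - c)) * (a + (b - c)) + ((a - b) * (a - b) + ((a + c) * (a + c) + (b + c) * (b + c)))
      m = solve-∀ ringℚ
    hyp₁ : ∀ ρ' → PLF.ap B (λ ω → 𝔼 (sq (Lv (e ω ∸ cnt ρ') (λ φ → vbar f (ow ρ' φ) ω)))) ≤ Bd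
    hyp₁ ρ' = ≤-trans (PLF.mono B λ ω → 𝔼Lv-bar (e ω ∸ cnt ρ') (λ φ → f (ow (nothing ∷ ρ') φ) ω)) (hyp (nothing ∷ ρ'))
    hyp₂ : ∀ y ρ' → PLF.ap B (λ ω → 𝔼 (sq (Lv (pred (e ω) ∸ cnt ρ') (λ φ → f (y ∷ ow ρ' φ) ω)))) ≤ Bd
    hyp₂ y ρ' = ≤-trans (PLF.mono B λ ω → ≤-trans (≤-reflexive (trans (cong (λ z → 𝔼 (sq (Lv z (λ φ → f (y ∷ ow ρ' φ) ω)))) (sym (∸-suc (e ω) (cnt ρ'))))
        (PLF.ext (Er (free k)) λ φ → cong (λ z → z * z) (Lv-ext (e ω ∸ suc (cnt ρ')) (λ φ → sym (avg-const (f (y ∷ ow ρ' φ) ω))) φ))))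
      (𝔼Lv-bar (e ω ∸ suc (cnt ρ')) (λ φ → f (ow (just y ∷ ρ') φ) ω))) (hyp (just y ∷ ρ'))
    hyp₃ : ∀ ρ' → PLF.ap B (λ ω → 𝔼 (sq (Lv (pred (e ω) ∸ cnt ρ') (λ φ → vbar f (ow ρ' φ) ω)))) ≤ Bd
    hyp₃ ρ' = begin
      PLF.ap B (λ ω → 𝔼 (sq (Lv (pred (e ω) ∸ cnt ρ') (λ φ → vbar f (ow ρ' φ) ω))))
        ≤⟨ PLF.mono B (λ ω → ≤-trans (PLF.mono (Er (free k)) λ φ → ≤-trans (≤-reflexive (cong (λ z → z * z) (sym (Lv-lin (pred (e ω) ∸ cnt ρ') plf fin (λ y φ → f (y ∷ ow ρ' φ) ω) φ)))) (jensen _)) (≤-reflexive (fin (Er (free k)) _))) ⟩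
      PLF.ap B (λ ω → avg λ y → 𝔼 (sq (Lv (pred (e ω) ∸ cnt ρ') (λ φ → f (y ∷ ow ρ' φ) ω))))
        ≡⟨ fin B _ ⟩
      avg (λ y → PLF.ap B λ ω → 𝔼 (sq (Lv (pred (e ω) ∸ cnt ρ') (λ φ → f (y ∷ ow ρ' φ) ω))))
        ≤⟨ mono (λ y → hyp₂ y ρ') ⟩
      avg (λ y → Bd)
        ≡⟨ avg-const Bd ⟩
      Bd ∎

  -- Repeated Cauchy-Schwarz for the measure with density f; each application doubles the exponent
  -- of h and keeps one factor f inside.
  hölder : ∀ s {k} (f h : Vec X k → ℚ) → (∀ φ → 0ℚ ≤ f φ) →
    pow2 s (𝔼 λ φ → f φ * h φ) ≤ Gp s (𝔼 f) * 𝔼 (λ φ → f φ * pow2 s (h φ))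
  hölder zero    f h p = ≤-reflexive (sym (*-identityˡ _))
  hölder (suc s) {k} f h p = begin
      pow2 s (𝔼fh * 𝔼fh)
        ≤⟨ pow2-mono s (0≤sq 𝔼fh) (≤-cong (cong₂ _*_ e1 e1) (cong (_* 𝔼 (λ φ → f φ * (h φ * h φ))) (E.ext λ φ → l1 (f φ))) (PLF.cs wt (λ _ → 1ℚ) h)) ⟩
      pow2 s (𝔼 f * 𝔼 (λ φ → f φ * (h φ * h φ)))
        ≡⟨ pow2-mul s (𝔼 f) _ ⟩
      pow2 s (𝔼 f) * pow2 s (𝔼 (λ φ → f φ * (h φ * h φ)))
        ≤⟨ *-monoʳ (0≤pow2 s (E.nonneg p)) (hölder s f (λ φ → h φ * h φ) p) ⟩
      pow2 s (𝔼 f) * (Gp s (𝔼 f) * 𝔼 (λ φ → f φ * pow2 s (h φ * h φ)))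
        ≡⟨ trans (sym (*-assoc (pow2 s (𝔼 f)) _ _)) (cong (_* 𝔼 (λ φ → f φ * pow2 s (h φ * h φ))) (pow2*Gp s (𝔼 f))) ⟩
      Gp (suc s) (𝔼 f) * 𝔼 (λ φ → f φ * pow2 s (h φ * h φ)) ∎
    where
    module E = PLF (Er (free k))
    𝔼fh = 𝔼 λ φ → f φ * h φ
    l0 : ∀ f c g → f * (c * g) ≡ c * (f * g)
    l0 = solve-∀ ringℚ
    l1 : ∀ f → f * (1ℚ * 1ℚ) ≡ f
    l1 = solve-∀ ringℚ
    wt : PLF (Vec X k)
    wt = record
      { ap   = λ g → 𝔼 λ φ → f φ * g φ
      ; add  = λ a b → trans (E.ext λ φ → *-distribˡ-+ (f φ) (a φ) (b φ)) (E.add _ _)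
      ; scl  = λ c a → trans (E.ext λ φ → l0 (f φ) c (a φ)) (E.scl c _)
      ; mono = λ q → E.mono λ φ → *-monoʳ (p φ) (q φ) }
    e1 : 𝔼 (λ φ → f φ * (1ℚ * h φ)) ≡ 𝔼fh
    e1 = E.ext λ φ → cong (f φ *_) (*-identityˡ (h φ))

  weight : ℕ → ∀ {k} → (Vec X k → ℚ) → ℚ
  weight d f = 𝔼 (sq (Lv d f))

  0≤weight : ∀ d {k} (f : Vec X k → ℚ) → 0ℚ ≤ weight d f
  0≤weight d {k} f = PLF.sqs (Er (free k)) (Lv d f)

  -- The weight is the correlation of f with its own level part. Hölder replaces it by a high moment
  -- of that part, f ≤ 1 then removes f, and `power-norm` applies because `restrict` derives the
  -- globalness of the level part from the weights of the restrictions of f.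
  level-step : ∀ s d {k} (f : Vec X k → ℚ) M → (∀ φ → 0ℚ ≤ f φ) → (∀ φ → f φ ≤ 1ℚ) → 0ℚ ≤ M →
    (∀ ρ → weight (suc d ∸ cnt ρ) (λ φ → f (ow ρ φ)) ≤ M) →
    pow2 (suc s) (weight (suc d) f) ≤ Gp (suc s) (𝔼 f) * (lvConst s d * (weight (suc d) f * Gp s M))
  level-step s d {k} f M 0≤f f≤1 0≤M hyp = begin
      pow2 (suc s) (weight (suc d) f)
        ≡⟨ cong (pow2 (suc s)) (sym (Lv-sq (suc d) f)) ⟩
      pow2 (suc s) (𝔼 λ φ → f φ * h φ)
        ≤⟨ hölder (suc s) f h 0≤f ⟩
      Gp (suc s) (𝔼 f) * 𝔼 (λ φ → f φ * pow2 (suc s) (h φ))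
        ≤⟨ *-monoʳ 0≤Gβ (E.mono λ φ → ≤-trans (*-monoˡ (0≤pow2 s (0≤sq (h φ))) (f≤1 φ)) (≤-reflexive (*-identityˡ _))) ⟩
      Gp (suc s) (𝔼 f) * 𝔼 (λ φ → pow2 (suc s) (h φ))
        ≤⟨ *-monoʳ 0≤Gβ (power-norm s d h (K * M) (0≤* 0≤K 0≤M) (Pure⇒Deg (suc d) (Pure-Lv (suc d) f)) gl) ⟩
      Gp (suc s) (𝔼 f) * (powConst s d * (weight (suc d) f * Gp s (K * M)))
        ≡⟨ cong (λ z → Gp (suc s) (𝔼 f) * (powConst s d * (weight (suc d) f * z))) (Gp-mul s K M) ⟩
      Gp (suc s) (𝔼 f) * (powConst s d * (weight (suc d) f * (Gp s K * Gp s M)))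
        ≡⟨ cong (Gp (suc s) (𝔼 f) *_) (l (powConst s d) (weight (suc d) f) (Gp s K) (Gp s M)) ⟩
      Gp (suc s) (𝔼 f) * (lvConst s d * (weight (suc d) f * Gp s M)) ∎
    where
    module E = PLF (Er (free k))
    h = Lv (suc d) f
    K = Kr (dep s d)
    0≤K = ≤-trans 0≤1 (1≤Kr (dep s d))
    0≤Gβ = 0≤Gp (suc s) (E.nonneg 0≤f)
    l : ∀ p w a b → p * (w * (a * b)) ≡ (p * a) * (w * b)
    l = solve-∀ ringℚ
    gl : Glob (dep s d) (K * M) (sq h)
    gl ρ le = ≤-trans (restrict pt (λ _ → suc d) (λ φ _ → f φ) M hyp ρ) (*-monoˡ 0≤M (Kr-mono le))

  Restr : ℕ → ℚ → ∀ {k} → (Vec X k → ℚ) → Set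
  Restr d γ f = ∀ ρ → cnt ρ ℕ.≤ d → PLF.ap (Er ρ) f ≤ γ

  module _ (s : ℕ) (γ Γ : ℚ) (0≤Γ : 0ℚ ≤ Γ) where

    Weight≤ : ℕ → Set
    Weight≤ d = ∀ {k} (f : Vec X k → ℚ) → (∀ φ → 0ℚ ≤ f φ) → (∀ φ → f φ ≤ 1ℚ) → Restr d γ f → weight (suc d) f ≤ Γ

    Restr-ow : ∀ {d e k} (f : Vec X k → ℚ) ρ → e ℕ.+ cnt ρ ℕ.≤ d → Restr d γ f → Restr e γ (λ φ → f (ow ρ φ))
    Restr-ow f ρ le re ρ' q = ≤-trans (≤-reflexive (Er-ow ρ ρ' f)) (re (merge ρ ρ') (ℕ.≤-trans (cnt-merge ρ ρ') (ℕ.≤-trans (ℕ.+-monoˡ-≤ (cnt ρ) q) le)))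

    weight-restricted : ∀ d → (∀ e → e ℕ.< d → Weight≤ e) → ∀ {k} (f : Vec X k → ℚ) →
      (∀ φ → 0ℚ ≤ f φ) → (∀ φ → f φ ≤ 1ℚ) → Restr d γ f → ∀ c → (ρ : Vec (Maybe X) k) → cnt ρ ≡ suc c →
      weight (d ∸ c) (λ φ → f (ow ρ φ)) ≤ Γ
    weight-restricted d ih {k} f 0≤f f≤1 re c ρ eq with d ∸ c in de
    ... | zero  = ≤-trans (≤-reflexive (PLF.zer (Er (free k)))) 0≤Γ
    ... | suc e = ih e (ℕ.≤-trans (s≤s (ℕ.m≤m+n e c)) (ℕ.≤-reflexive ec)) (λ φ → f (ow ρ φ)) (λ φ → 0≤f (ow ρ φ)) (λ φ → f≤1 (ow ρ φ))
        (Restr-ow f ρ (ℕ.≤-reflexive (trans (cong (e ℕ.+_) eq) (trans (ℕ.+-suc e c) ec))) re)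
      where
      ec : suc (e ℕ.+ c) ≡ d
      ec = trans (cong (ℕ._+ c) (sym de)) (ℕ.m∸n+n≡m {d} {c} (ℕ.<⇒≤ (ℕ.m∸n≢0⇒n<m {d} {c} λ z → ℕ.0≢1+n (trans (sym z) de))))

    -- Bootstrapping. Restrictions with something frozen concern lower levels, so their weights are
    -- at most Γ by induction. If the weight w of f exceeded Γ, then w itself would bound all of
    -- them, and `level-step` with M = w would become an inequality for w alone that forces w ≤ Γ.
    -- The number m is fuel for the strong induction on d.
    weight≤ : ∀ m D d → d ℕ.< m → d ℕ.≤ D → sumC s D * Gp (suc s) γ ≤ pow2 s Γ → Weight≤ d
    weight≤ (suc m) D d (s≤s d≤m) le cond {k} f 0≤f f≤1 re with weight (suc d) f ≤? Γ
    ... | yes p = p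
    ... | no q  = ⊥-elim (<⇒≱ (pow2-mono< s 0≤Γ Γ<w) (begin
        pow2 s w
          ≤⟨ *-cancelˡ 0<pw key ⟩
        Gp (suc s) (𝔼 f) * lvConst s d
          ≤⟨ *-mono (0≤Gp (suc s) 0≤β) (0≤sumC s D) (Gp-mono (suc s) 0≤β β≤γ) (≤-trans (lv≤sumC s d) (sumC-mono s le)) ⟩
        Gp (suc s) γ * sumC s D
          ≡⟨ *-comm (Gp (suc s) γ) (sumC s D) ⟩
        sumC s D * Gp (suc s) γ
          ≤⟨ cond ⟩
        pow2 s Γ ∎))
      where
      w = weight (suc d) f
      Γ<w = ≰⇒> q
      0<w = ≤-<-trans 0≤Γ Γ<w
      0<pw = 0<pow2 s 0<w
      0≤β : 0ℚ ≤ 𝔼 f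
      0≤β = PLF.nonneg (Er (free k)) 0≤f
      β≤γ : 𝔼 f ≤ γ
      β≤γ = re (free k) (ℕ.≤-trans (ℕ.≤-reflexive (cnt-free k)) z≤n)
      hyp : ∀ ρ → weight (suc d ∸ cnt ρ) (λ φ → f (ow ρ φ)) ≤ w
      hyp ρ with cnt ρ in eq
      ... | zero  = ≤-reflexive (PLF.ext (Er (free k)) λ φ → cong (λ z → z * z) (Lv-ext (suc d) (λ φ → cong f (ow0 ρ φ eq)) φ))
        where
        ow0 : ∀ {k} (ρ : Vec (Maybe X) k) φ → cnt ρ ≡ 0 → ow ρ φ ≡ φ
        ow0 []            []      p = refl
        ow0 (nothing ∷ ρ) (x ∷ φ) p = cong (x ∷_) (ow0 ρ φ p)
      ... | suc c = ≤-trans (weight-restricted d (λ e e<d → weight≤ m D e (ℕ.≤-trans e<d d≤m) (ℕ.≤-trans (ℕ.<⇒≤ e<d) le) cond) f 0≤f f≤1 re c ρ eq) (<⇒≤ Γ<w)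
      l : ∀ g c p → g * (c * p) ≡ p * (g * c)
      l = solve-∀ ringℚ
      key : pow2 s w * pow2 s w ≤ pow2 s w * (Gp (suc s) (𝔼 f) * lvConst s d)
      key = ≤-cong (pow2-suc s w) (trans (cong (λ z → Gp (suc s) (𝔼 f) * (lvConst s d * z)) (x*Gp s w)) (l (Gp (suc s) (𝔼 f)) (lvConst s d) (pow2 s w)))
        (level-step s d f w 0≤f f≤1 (<⇒≤ 0<w) hyp)

    -- A second pass of `level-step`, now with the crude bound Γ for all restricted weights. The
    -- gain is that the actual mean of f enters, in place of the bound γ for the means of its
    -- restrictions.
    level-inequality : ∀ d → sumC s d * Gp (suc s) γ ≤ pow2 s Γ → ∀ {k} (f : Vec X k → ℚ) →
      (∀ φ → 0ℚ ≤ f φ) → (∀ φ → f φ ≤ 1ℚ) → Restr d γ f →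
      pow2 (suc s) (weight (suc d) f) ≤ Gp (suc s) (𝔼 f) * (lvConst s d * (weight (suc d) f * Gp s Γ))
    level-inequality d cond {k} f 0≤f f≤1 re = level-step s d f Γ 0≤f f≤1 0≤Γ hyp
      where
      W : ∀ e → e ℕ.≤ d → Weight≤ e
      W e le = weight≤ (suc e) d e ℕ.≤-refl le cond
      hyp : ∀ ρ → weight (suc d ∸ cnt ρ) (λ φ → f (ow ρ φ)) ≤ Γ
      hyp ρ with cnt ρ in eq
      ... | zero  = W d ℕ.≤-refl (λ φ → f (ow ρ φ)) (λ φ → 0≤f (ow ρ φ)) (λ φ → f≤1 (ow ρ φ))
        (Restr-ow f ρ (ℕ.≤-reflexive (trans (cong (d ℕ.+_) eq) (ℕ.+-identityʳ d))) re)
      ... | suc c = weight-restricted d (λ e e<d → W e (ℕ.<⇒≤ e<d)) f 0≤f f≤1 re c ρ eq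

-- Finite sums and indicators

𝟙 : ∀ {P : Set} → Dec P → ℚ
𝟙 (yes _) = 1ℚ
𝟙 (no _)  = 0ℚ

𝟙-cong : ∀ {P Q : Set} (p : Dec P) (q : Dec Q) → (P → Q) → (Q → P) → 𝟙 p ≡ 𝟙 q
𝟙-cong (yes p) (yes q) f g = refl
𝟙-cong (yes p) (no q)  f g = ⊥-elim (q (f p))
𝟙-cong (no p)  (yes q) f g = ⊥-elim (p (g q))
𝟙-cong (no p)  (no q)  f g = refl

𝟙-yes : ∀ {P : Set} (p : Dec P) → P → 𝟙 p ≡ 1ℚ
𝟙-yes (yes _) x = refl
𝟙-yes (no q)  x = ⊥-elim (q x)

𝟙-no : ∀ {P : Set} (p : Dec P) → ¬ P → 𝟙 p ≡ 0ℚ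
𝟙-no (yes x) q = ⊥-elim (q x)
𝟙-no (no _)  q = refl

0≤𝟙 : ∀ {P : Set} (p : Dec P) → 0ℚ ≤ 𝟙 p
0≤𝟙 (yes _) = 0≤1
0≤𝟙 (no _)  = ≤-refl

𝟙≤1 : ∀ {P : Set} (p : Dec P) → 𝟙 p ≤ 1ℚ
𝟙≤1 (yes _) = ≤-refl
𝟙≤1 (no _)  = 0≤1

𝟙-× : ∀ {P Q R : Set} (r : Dec R) (p : Dec P) (q : Dec Q) → (R → P × Q) → (P → Q → R) → 𝟙 r ≡ 𝟙 p * 𝟙 q
𝟙-× r (yes p) (yes q) f g = 𝟙-yes r (g p q)
𝟙-× r (yes p) (no q)  f g = 𝟙-no r λ x → q (proj₂ (f x))
𝟙-× r (no p)  (yes q) f g = 𝟙-no r λ x → p (proj₁ (f x))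
𝟙-× r (no p)  (no q)  f g = 𝟙-no r λ x → p (proj₁ (f x))

𝟙-subst : ∀ {A : Set} {a b : A} (p : Dec (a ≡ b)) (F : A → ℚ) → 𝟙 p * F a ≡ 𝟙 p * F b
𝟙-subst (yes refl) F = refl
𝟙-subst {a = a} {b} (no _) F = trans (*-zeroˡ (F a)) (sym (*-zeroˡ (F b)))

sumF-δ : ∀ {n} (i : Fin n) (f : Fin n → ℚ) → sumF (λ j → 𝟙 (j ≟ i) * f j) ≡ f i
sumF-δ {suc n} zero f = trans (cong₂ _+_ (*-identityˡ (f zero))
  (trans (PLF.ext (finP n) λ j → *-zeroˡ (f (suc j))) (PLF.zer (finP n)))) (+-identityʳ (f zero))
sumF-δ {suc n} (suc i) f = trans (cong₂ _+_ (*-zeroˡ (f zero)) (trans (PLF.ext (finP n) λ j →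
    cong (_* f (suc j)) (𝟙-cong (suc j ≟ suc i) (j ≟ i) Fin.suc-injective (cong suc))) (sumF-δ i (λ j → f (suc j))))) (+-identityˡ _)

vecP : ∀ n m → PLF (Vec (Fin n) m)
vecP n zero    = record { ap = λ F → F [] ; add = λ _ _ → refl ; scl = λ _ _ → refl ; mono = λ p → p [] }
vecP n (suc m) = record
  { ap   = λ F → sumF λ i → PLF.ap (vecP n m) λ v → F (i ∷ v)
  ; add  = λ f g → trans (PLF.ext (finP n) λ x → PLF.add (vecP n m) _ _) (PLF.add (finP n) _ _)
  ; scl  = λ c f → trans (PLF.ext (finP n) λ x → PLF.scl (vecP n m) c _) (PLF.scl (finP n) c _)
  ; mono = λ {f} {g} p → PLF.mono (finP n) {f = λ x → PLF.ap (vecP n m) λ φ → f (x ∷ φ)} λ x → PLF.mono (vecP n m) λ φ → p (x ∷ φ) }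

sumV : ∀ {n m} → (Vec (Fin n) m → ℚ) → ℚ
sumV {n} {m} = PLF.ap (vecP n m)

vecP-fin : ∀ n m → Finitary (vecP n m)
vecP-fin n zero    B f = refl
vecP-fin n (suc m) B f = trans (finP-fin n B _) (PLF.ext (finP n) λ i → vecP-fin n m B λ v → f (i ∷ v))

infix 4 _≟V_
_≟V_ : ∀ {n m} (u v : Vec (Fin n) m) → Dec (u ≡ v)
_≟V_ = ≡-dec _≟_

𝟙-∷ : ∀ {n m} (i j : Fin n) (u v : Vec (Fin n) m) → 𝟙 (i ∷ u ≟V j ∷ v) ≡ 𝟙 (i ≟ j) * 𝟙 (u ≟V v)
𝟙-∷ i j u v = 𝟙-× (i ∷ u ≟V j ∷ v) (i ≟ j) (u ≟V v) ∷-injective (λ p q → cong₂ _∷_ p q)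

sumV-δ : ∀ {n m} (u : Vec (Fin n) m) (F : Vec (Fin n) m → ℚ) → sumV (λ v → 𝟙 (v ≟V u) * F v) ≡ F u
sumV-δ {n} []     F = trans (cong (_* F []) (𝟙-yes (_≟V_ {n} [] []) refl)) (*-identityˡ (F []))
sumV-δ {n} {suc m} (i ∷ u) F = trans (PLF.ext (finP n) λ j → trans (PLF.ext (vecP n m) λ v →
    trans (cong (_* F (j ∷ v)) (𝟙-∷ j i v u)) (*-assoc (𝟙 (j ≟ i)) _ _))
    (trans (PLF.scl (vecP n m) (𝟙 (j ≟ i)) _) (cong (𝟙 (j ≟ i) *_) (sumV-δ u λ v → F (j ∷ v)))))
  (sumF-δ i λ j → F (j ∷ u))

sumV-δ' : ∀ {n m} (u : Vec (Fin n) m) (F : Vec (Fin n) m → ℚ) → sumV (λ v → 𝟙 (u ≟V v) * F v) ≡ F u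
sumV-δ' {n} {m} u F = trans (PLF.ext (vecP n m) λ v → cong (_* F v) (𝟙-cong (u ≟V v) (v ≟V u) sym sym)) (sumV-δ u F)

lookup-ext : ∀ {A : Set} {m} {u v : Vec A m} → (∀ i → lookup u i ≡ lookup v i) → u ≡ v
lookup-ext {u = u} {v} p = trans (sym (tabulate∘lookup u)) (trans (tabulate-cong p) (tabulate∘lookup v))

Inj : ∀ {A B : Set} → (A → B) → Set
Inj f = ∀ {i j} → f i ≡ f j → i ≡ j

inj⇒surj : ∀ {n} {f : Fin n → Fin n} → Inj f → ∀ y → ∃ λ x → f x ≡ y
inj⇒surj {suc n} {f} inj y with any? (λ x → f x ≟ y)
... | yes p = p
... | no q  = ⊥-elim (ℕ.1+n≰n (injective⇒≤ {f = λ x → Fin.punchOut (ne x)} λ {x} {x'} e → inj (punchOut-injective (ne x) (ne x') e)))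
  where
  ne : ∀ x → ¬ y ≡ f x
  ne x e = q (x , sym e)

missing : ∀ {n k} (v : Vec (Fin n) k) → k ℕ.< n → ∃ λ p → ∀ i → ¬ lookup v i ≡ p
missing {n} {k} v k<n with any? (λ p → Fin.all? (λ i → ¬? (lookup v i ≟ p)))
... | yes (p , q) = p , q
... | no q = ⊥-elim (ℕ.<⇒≱ k<n (injective⇒≤ {f = λ p → proj₁ (hit p)} λ {p} {p'} e → trans (sym (proj₂ (hit p))) (trans (cong (lookup v) e) (proj₂ (hit p')))))
  where
  hit : ∀ p → ∃ λ i → lookup v i ≡ p
  hit p with any? (λ i → lookup v i ≟ p)
  ... | yes h = h
  ... | no h  = ⊥-elim (q (p , λ i e → h (i , e)))

-- The alternating group

module Parities where
  open import Data.Nat using (_<ᵇ_)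
  open import Data.Bool using (not)
  open import Data.Bool.Properties using (xor-assoc; xor-identityʳ; xor-same; xor-∧-commutativeRing)
  open import Data.Fin.Permutation using (permutation)
  open import Algebra.Bundles using (CommutativeRing)
  import Algebra.Properties.CommutativeMonoid.Sum (CommutativeRing.+-commutativeMonoid xor-∧-commutativeRing) as X

  xorF : ∀ {n} → (Fin n → Bool) → Bool
  xorF = X.sum

  xorF-cong : ∀ {n} {f g : Fin n → Bool} → (∀ i → f i ≡ g i) → xorF f ≡ xorF g
  xorF-cong p = X.sum-cong-≗ p

  xorF-false : ∀ n → xorF {n} (λ _ → false) ≡ false
  xorF-false zero    = refl
  xorF-false (suc n) = xorF-false n

  xorF-xor : ∀ {n} (f g : Fin n → Bool) → xorF (λ i → f i xor g i) ≡ xorF f xor xorF g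
  xorF-xor f g = X.∑-distrib-+ f g

  private
    row : ∀ {n} → (Fin n → Fin n → Bool) → Bool
    row s = xorF λ i → xorF λ j → s i j

  -- Every unordered pair contributes the same Boolean twice.
  row-symmetric : ∀ {n} (s : Fin n → Fin n → Bool) → (∀ i j → s i j ≡ s j i) → (∀ i → s i i ≡ false) → row s ≡ false
  row-symmetric {zero}  s p q = refl
  row-symmetric {suc n} s p q = trans (cong₂ _xor_ (cong (_xor xorF (λ j → s zero (suc j))) (q zero))
      (trans (xorF-xor (λ i → s (suc i) zero) (λ i → xorF λ j → s (suc i) (suc j)))
        (cong₂ _xor_ (xorF-cong λ i → p (suc i) zero) (row-symmetric (λ i j → s (suc i) (suc j)) (λ i j → p _ _) (λ i → q _)))))
    (trans (cong (xorF (λ j → s zero (suc j)) xor_) (xor-identityʳ _)) (xor-same (xorF λ j → s zero (suc j))))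

  _<F_ : ∀ {n} → Fin n → Fin n → Bool
  i <F j = toℕ i <ᵇ toℕ j

  <F-irrefl : ∀ {n} (i : Fin n) → i <F i ≡ false
  <F-irrefl i = lem (toℕ i)
    where
    lem : ∀ m → (m <ᵇ m) ≡ false
    lem zero    = refl
    lem (suc m) = lem m

  <F-flip : ∀ {n} (i j : Fin n) → ¬ i ≡ j → j <F i ≡ not (i <F j)
  <F-flip i j p = lem (toℕ i) (toℕ j) λ e → p (Fin.toℕ-injective e)
    where
    lem : ∀ a b → ¬ a ≡ b → (b <ᵇ a) ≡ not (a <ᵇ b)
    lem zero    zero    p = ⊥-elim (p refl)
    lem zero    (suc b) p = refl
    lem (suc a) zero    p = refl
    lem (suc a) (suc b) p = lem a b λ e → p (cong suc e)

  par : ∀ {n} → (Fin n → Fin n) → Bool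
  par f = row λ i j → (i <F j) ∧ (f j <F f i)

  par-cong : ∀ {n} {f g : Fin n → Fin n} → (∀ i → f i ≡ g i) → par f ≡ par g
  par-cong {f = f} {g} p = xorF-cong λ i → xorF-cong λ j → cong₂ (λ x y → (i <F j) ∧ (x <F y)) (p j) (p i)

  xorF-reindex : ∀ {n} (τ : Fin n → Fin n) → Inj τ → ∀ f → xorF (λ i → f (τ i)) ≡ xorF f
  xorF-reindex τ inj f = sym (X.sum-permute f (permutation τ from (λ y → proj₂ (s y)) (λ x → inj (proj₂ (s (τ x))))))
    where
    s = inj⇒surj inj
    from = λ y → proj₁ (s y)

  -- For a pair i, j take the three Booleans telling whether σ τ inverts it, whether σ inverts its
  -- image under τ, and whether τ inverts it. Each depends on the order of i and j, but their xor is
  -- symmetric (`table`), so the total vanishes; reindexing by τ turns the middle one into the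
  -- parity of σ.
  par-∘ : ∀ {n} (σ τ : Fin n → Fin n) → Inj σ → Inj τ → par (λ i → σ (τ i)) ≡ par σ xor par τ
  par-∘ {n} σ τ iσ iτ = cancel _ _ (trans (cong (par (λ i → σ (τ i)) xor_) (cong₂ _xor_ (sym reidx) refl)) total)
    where
    A B C : Fin n → Fin n → Bool
    A i j = i <F j
    B i j = τ i <F τ j
    C i j = σ (τ i) <F σ (τ j)
    u v w : Fin n → Fin n → Bool
    u i j = A i j ∧ C j i
    v i j = B i j ∧ C j i
    w i j = A i j ∧ B j i
    reidx : row v ≡ par σ
    reidx = trans (xorF-reindex τ iτ λ i → xorF λ j → (i <F τ j) ∧ (σ (τ j) <F σ i))
      (xorF-cong λ i → xorF-reindex τ iτ λ j → (i <F j) ∧ (σ j <F σ i))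
    s : Fin n → Fin n → Bool
    s i j = u i j xor (v i j xor w i j)
    table : ∀ a b c → (a ∧ not c) xor ((b ∧ not c) xor (a ∧ not b)) ≡ (not a ∧ c) xor ((not b ∧ c) xor (not a ∧ b))
    table false false false = refl
    table false false true  = refl
    table false true  false = refl
    table false true  true  = refl
    table true  false false = refl
    table true  false true  = refl
    table true  true  false = refl
    table true  true  true  = refl
    s-sym : ∀ i j → s i j ≡ s j i
    s-sym i j with i ≟ j
    ... | yes refl = refl
    ... | no p = trans
      (cong₂ (λ x y → (A i j ∧ x) xor ((B i j ∧ x) xor (A i j ∧ y))) (<F-flip (σ (τ i)) (σ (τ j)) λ e → p (iτ (iσ e))) (<F-flip (τ i) (τ j) λ e → p (iτ e)))
      (trans (table (A i j) (B i j) (C i j))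
        (cong₂ (λ x y → (x ∧ C i j) xor ((y ∧ C i j) xor (x ∧ B i j))) (sym (<F-flip i j p)) (sym (<F-flip (τ i) (τ j) λ e → p (iτ e)))))
    s-diag : ∀ i → s i i ≡ false
    s-diag i = cong₂ (λ x y → (x ∧ C i i) xor ((y ∧ C i i) xor (x ∧ B i i))) (<F-irrefl i) (<F-irrefl (τ i))
    row-xor : ∀ p q → row (λ i j → p i j xor q i j) ≡ row p xor row q
    row-xor p q = trans (xorF-cong λ i → xorF-xor (p i) (q i)) (xorF-xor (λ i → xorF (p i)) (λ i → xorF (q i)))
    total : par (λ i → σ (τ i)) xor (row v xor par τ) ≡ false
    total = trans (sym (trans (row-xor u (λ i j → v i j xor w i j)) (cong (row u xor_) (row-xor v w)))) (row-symmetric s s-sym s-diag)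
    cancel : ∀ x y → x xor y ≡ false → x ≡ y
    cancel false false p = refl
    cancel true  true  p = refl

  par-id : ∀ n → par {n} (λ i → i) ≡ false
  par-id n = trans (xorF-cong {n} λ i → trans (xorF-cong {n} λ j → lem (toℕ i) (toℕ j)) (xorF-false n)) (xorF-false n)
    where
    lem : ∀ a b → (a <ᵇ b) ∧ (b <ᵇ a) ≡ false
    lem zero    zero    = refl
    lem zero    (suc b) = refl
    lem (suc a) zero    = refl
    lem (suc a) (suc b) = lem a b

  abstract
    swap : ∀ {n} → Fin n → Fin n → Fin n → Fin n
    swap a b i with i ≟ a
    ... | yes _ = b
    ... | no _ with i ≟ b
    ...   | yes _ = a
    ...   | no _  = i

    swap-l : ∀ {n} (a b : Fin n) → swap a b a ≡ b
    swap-l a b with a ≟ a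
    ... | yes _ = refl
    ... | no q  = ⊥-elim (q refl)

    swap-r : ∀ {n} (a b : Fin n) → swap a b b ≡ a
    swap-r a b with b ≟ a
    ... | yes p = p
    ... | no _ with b ≟ b
    ...   | yes _ = refl
    ...   | no q  = ⊥-elim (q refl)

    swap-o : ∀ {n} {a b i : Fin n} → ¬ i ≡ a → ¬ i ≡ b → swap a b i ≡ i
    swap-o {a = a} {b} {i} p q with i ≟ a
    ... | yes r = ⊥-elim (p r)
    ... | no _ with i ≟ b
    ...   | yes r = ⊥-elim (q r)
    ...   | no _  = refl

    swap-inv : ∀ {n} (a b : Fin n) i → swap a b (swap a b i) ≡ i
    swap-inv a b i with i ≟ a
    ... | yes p = trans (swap-r a b) (sym p)
    ... | no p with i ≟ b
    ...   | yes q = trans (swap-l a b) (sym q)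
    ...   | no q  = swap-o p q

  swap-inj : ∀ {n} (a b : Fin n) → Inj (swap a b)
  swap-inj a b {i} {j} e = trans (sym (swap-inv a b i)) (trans (cong (swap a b) e) (swap-inv a b j))

  swap01 : ∀ {m} → Fin (suc (suc m)) → Fin (suc (suc m))
  swap01 zero          = suc zero
  swap01 (suc zero)    = zero
  swap01 (suc (suc i)) = suc (suc i)

  par-swap01 : ∀ m → par {suc (suc m)} swap01 ≡ true
  par-swap01 m = cong₂ (λ x y → not x xor (xorF {m} (λ _ → false) xor y)) (xorF-false m)
      (trans (xorF-cong {m} λ i → trans (xorF-cong {m} λ j → lem (toℕ i) (toℕ j)) (xorF-false m)) (xorF-false m)) ∙ cong (λ x → true xor (x xor false)) (xorF-false m)
    where
    _∙_ = trans
    lem : ∀ a b → (a <ᵇ b) ∧ (b <ᵇ a) ≡ false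
    lem zero    zero    = refl
    lem zero    (suc b) = refl
    lem (suc a) zero    = refl
    lem (suc a) (suc b) = lem a b

  -- For g with g 0 = a and g 1 = b, the transposition satisfies swap a b ∘ g = g ∘ swap01; taking
  -- parities, that of g cancels. The auxiliary point c is where the first swap in g has put 1.
  par-swap : ∀ {n} (a b : Fin n) → ¬ a ≡ b → par (swap a b) ≡ true
  par-swap {suc zero} zero zero p = ⊥-elim (p refl)
  par-swap {suc (suc m)} a b a≢b = fin (par (swap a b)) (par g)
      (trans (sym (par-∘ (swap a b) g (swap-inj a b) g-inj)) (trans (par-cong pt) (trans (par-∘ g swap01 g-inj s-inj) (cong (par g xor_) (par-swap01 m)))))
    where
    c = swap zero a (suc zero)
    g : Fin (suc (suc m)) → Fin (suc (suc m))
    g i = swap c b (swap zero a i)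
    g-inj : Inj g
    g-inj e = swap-inj zero a (swap-inj c b e)
    s-inj : Inj (swap01 {m})
    s-inj {zero} {zero} e = refl
    s-inj {suc zero} {suc zero} e = refl
    s-inj {suc (suc i)} {suc (suc j)} e = e
    s-inj {zero} {suc zero} ()
    s-inj {zero} {suc (suc j)} ()
    s-inj {suc zero} {zero} ()
    s-inj {suc zero} {suc (suc j)} ()
    s-inj {suc (suc i)} {zero} ()
    s-inj {suc (suc i)} {suc zero} ()
    a≢c : ¬ a ≡ c
    a≢c e with swap-inj zero a {zero} {suc zero} (trans (swap-l zero a) e)
    ... | ()
    g0 : g zero ≡ a
    g0 = trans (cong (swap c b) (swap-l zero a)) (swap-o a≢c a≢b)
    g1 : g (suc zero) ≡ b
    g1 = swap-l c b
    pt : ∀ i → swap a b (g i) ≡ g (swap01 i)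
    pt zero          = trans (cong (swap a b) g0) (trans (swap-l a b) (sym g1))
    pt (suc zero)    = trans (cong (swap a b) g1) (trans (swap-r a b) (sym g0))
    pt (suc (suc i)) = swap-o (λ e → neq (g-inj (trans e (sym g0)))) (λ e → neq' (g-inj (trans e (sym g1))))
      where
      neq : ¬ (suc (suc i)) ≡ zero
      neq ()
      neq' : ¬ (suc (suc i)) ≡ suc zero
      neq' ()
    fin : ∀ x y → x xor y ≡ y xor true → x ≡ true
    fin true  y     e = refl
    fin false false ()
    fin false true  ()

open Parities

module AlternatingGroups where
  open import Data.Nat using (_<ᵇ_; _≡ᵇ_; _%_)
  open import Data.Bool using (not; if_then_else_)
  open import Data.Bool.Properties using (xor-assoc)
  open import Data.List using (_++_; map; concat; foldr; allFin) renaming (tabulate to tabL)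
  open import Data.Vec using (tabulate)
  open import Function using (id)
  open import Axiom.UniquenessOfIdentityProofs using (module Decidable⇒UIP)
  import Data.Bool.Properties

  foldr-tab : ∀ {A B : Set} (op : B → B → B) (e : B) → (∀ x y z → op (op x y) z ≡ op x (op y z)) → (∀ x → op e x ≡ x) →
    ∀ xs ys → foldr op e (xs ++ ys) ≡ op (foldr op e xs) (foldr op e ys)
  foldr-tab op e as un []       ys = sym (un _)
  foldr-tab {A} op e as un (x ∷ xs) ys = trans (cong (op x) (foldr-tab {A} op e as un xs ys)) (sym (as x _ _))

  andF : ∀ {n} → (Fin n → Bool) → Bool
  andF {zero}  f = true
  andF {suc n} f = f zero ∧ andF (λ i → f (suc i))

  andF-intro : ∀ {n} (f : Fin n → Bool) → (∀ i → f i ≡ true) → andF f ≡ true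
  andF-intro {zero}  f p = refl
  andF-intro {suc n} f p = cong₂ _∧_ (p zero) (andF-intro _ λ i → p (suc i))

  andF-elim : ∀ {n} (f : Fin n → Bool) → andF f ≡ true → ∀ i → f i ≡ true
  andF-elim {suc n} f p i with f zero in eq
  andF-elim {suc n} f p zero    | true = eq
  andF-elim {suc n} f p (suc i) | true = andF-elim _ p i

  and-tab : ∀ {n} (f : Fin n → Bool) → and (tabL f) ≡ andF f
  and-tab {zero}  f = refl
  and-tab {suc n} f = cong (f zero ∧_) (and-tab (λ i → f (suc i)))

  xor-tab : ∀ {n} (f : Fin n → Bool) → foldr _xor_ false (tabL f) ≡ xorF f
  xor-tab {zero}  f = refl
  xor-tab {suc n} f = cong (f zero xor_) (xor-tab (λ i → f (suc i)))

  ∧-as : ∀ x y z → (x ∧ y) ∧ z ≡ x ∧ (y ∧ z)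
  ∧-as true  y z = refl
  ∧-as false y z = refl

  pairs-fold : ∀ {n} (op : Bool → Bool → Bool) (e : Bool) → (∀ x y z → op (op x y) z ≡ op x (op y z)) → (∀ x → op e x ≡ x) →
    (foldF : ∀ {m} → (Fin m → Bool) → Bool) → (∀ {m} (f : Fin m → Bool) → foldr op e (tabL f) ≡ foldF f) →
    (∀ {m} {f g : Fin m → Bool} → (∀ i → f i ≡ g i) → foldF f ≡ foldF g) →
    (f : Fin n → Fin n → Bool) → foldr op e (pairs n f) ≡ foldF λ i → foldF (f i)
  pairs-fold {n} op e as un foldF tab cg f = trans (cong (λ z → foldr op e (concat z)) (map-tabulate id (λ i → map (f i) (allFin n)))) (trans (go (λ i → map (f i) (allFin n)))
      (trans (tab λ i → foldr op e (map (f i) (allFin n))) (cg λ i → trans (cong (foldr op e) (map-tabulate id (f i))) (tab (f i)))))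
    where
    go : ∀ {m} (h : Fin m → List Bool) → foldr op e (concat (tabL h)) ≡ foldr op e (tabL λ i → foldr op e (h i))
    go {zero}  h = refl
    go {suc m} h = trans (foldr-tab {Bool} op e as un (h zero) _) (cong (op (foldr op e (h zero))) (go λ i → h (suc i)))

  andF-cong : ∀ {n} {f g : Fin n → Bool} → (∀ i → f i ≡ g i) → andF f ≡ andF g
  andF-cong {zero}  p = refl
  andF-cong {suc n} p = cong₂ _∧_ (p zero) (andF-cong λ i → p (suc i))

  isBij-spec : ∀ {n} (σ : Perm n) → isBijᵇ σ ≡ andF λ i → andF λ j → if toℕ i <ᵇ toℕ j then not (toℕ (lookup σ i) ≡ᵇ toℕ (lookup σ j)) else true
  isBij-spec {n} σ = pairs-fold {n} _∧_ true ∧-as (λ _ → refl) (λ {m} → andF {m}) (λ {m} → and-tab {m}) (λ {m} → andF-cong {m})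
    (λ i j → if toℕ i <ᵇ toℕ j then not (toℕ (lookup σ i) ≡ᵇ toℕ (lookup σ j)) else true)

  -- The group is defined by counting inversions modulo 2, whereas multiplicativity of the sign is
  -- proved for the xor over pairs; this is the bridge.
  even-spec : ∀ {n} (σ : Perm n) → (inversions σ % 2 ≡ᵇ 0) ≡ not (par (lookup σ))
  even-spec {n} σ = trans (cnt (pairs n f)) (cong not (pairs-fold _xor_ false xor-assoc (λ _ → refl) (λ {m} → xorF {m}) (λ {m} → xor-tab {m}) (λ {m} → xorF-cong {m}) f))
    where
    f : Fin n → Fin n → Bool
    f i j = (i <F j) ∧ (lookup σ j <F lookup σ i)
    ev : ∀ m → (suc m % 2 ≡ᵇ 0) ≡ not (m % 2 ≡ᵇ 0)
    ev zero          = refl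
    ev (suc zero)    = refl
    ev (suc (suc m)) = ev m
    cnt : ∀ xs → (length (filterᵇ (λ b → b) xs) % 2 ≡ᵇ 0) ≡ not (foldr _xor_ false xs)
    cnt []           = refl
    cnt (true ∷ xs)  = trans (ev (length (filterᵇ (λ b → b) xs))) (cong not (cnt xs))
    cnt (false ∷ xs) = cnt xs

  ∧-true : ∀ {a b} → a ∧ b ≡ true → a ≡ true × b ≡ true
  ∧-true {true} {true} p = refl , refl

  module Alternating (n : ℕ) where

    record El : Set where
      constructor el
      field
        fn : Perm n
        ok : isAltᵇ fn ≡ true
    open El public

    infixl 8 _$_
    _$_ : El → Fin n → Fin n
    g $ i = lookup (fn g) i

    fn-inj : ∀ {g h} → fn g ≡ fn h → g ≡ h
    fn-inj {el f p} {el .f q} refl = cong (el f) (Decidable⇒UIP.≡-irrelevant Data.Bool.Properties._≟_ p q)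

    El-ext : ∀ {g h} → (∀ i → g $ i ≡ h $ i) → g ≡ h
    El-ext p = fn-inj (lookup-ext p)

    bij⇒inj : (σ : Perm n) → isBijᵇ σ ≡ true → Inj (lookup σ)
    bij⇒inj σ p {i} {j} e with i ≟ j
    ... | yes q = q
    ... | no q with i <F j in eq
    ...   | true  = ⊥-elim (contra i j eq e)
      where
      contra : ∀ i j → i <F j ≡ true → ¬ lookup σ i ≡ lookup σ j
      contra i j lt e with andF-elim _ (andF-elim _ (trans (sym (isBij-spec σ)) p) i) j
      ... | r rewrite lt | e = absurd (toℕ (lookup σ j)) r
        where
        absurd : ∀ m → ¬ not (m ≡ᵇ m) ≡ true
        absurd zero ()
        absurd (suc m) = absurd m
    ...   | false = ⊥-elim (contra j i (trans (<F-flip i j q) (cong not eq)) (sym e))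
      where
      contra : ∀ i j → i <F j ≡ true → ¬ lookup σ i ≡ lookup σ j
      contra i j lt e with andF-elim _ (andF-elim _ (trans (sym (isBij-spec σ)) p) i) j
      ... | r rewrite lt | e = absurd (toℕ (lookup σ j)) r
        where
        absurd : ∀ m → ¬ not (m ≡ᵇ m) ≡ true
        absurd zero ()
        absurd (suc m) = absurd m

    inj⇒bij : (σ : Perm n) → Inj (lookup σ) → isBijᵇ σ ≡ true
    inj⇒bij σ inj = trans (isBij-spec σ) (andF-intro _ λ i → andF-intro _ λ j → go i j)
      where
      ne : ∀ a b → ¬ a ≡ b → not (a ≡ᵇ b) ≡ true
      ne zero    zero    p = ⊥-elim (p refl)
      ne zero    (suc b) p = refl
      ne (suc a) zero    p = refl
      ne (suc a) (suc b) p = ne a b λ e → p (cong suc e)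
      go : ∀ i j → (if toℕ i <ᵇ toℕ j then not (toℕ (lookup σ i) ≡ᵇ toℕ (lookup σ j)) else true) ≡ true
      go i j with i <F j in eq
      ... | false = refl
      ... | true  = ne _ _ λ e → F≢T (trans (sym (<F-irrefl i)) (trans (cong (i <F_) (inj (Fin.toℕ-injective e))) eq))
        where
        F≢T : ¬ false ≡ true
        F≢T ()

    $-inj : ∀ g → Inj (g $_)
    $-inj g = bij⇒inj (fn g) (proj₁ (∧-true (ok g)))

    $-par : ∀ g → par (g $_) ≡ false
    $-par g = l _ (trans (sym (even-spec (fn g))) (proj₂ (∧-true {isBijᵇ (fn g)} (ok g))))
      where
      l : ∀ b → not b ≡ true → b ≡ false
      l false p = refl

    infixl 7 _·_
    infix 9 _⁻¹
    abstract
      mk : (f : Fin n → Fin n) → Inj f → par f ≡ false → El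
      mk f inj p = el (tabulate f) (cong₂ _∧_
        (inj⇒bij (tabulate f) λ {i} {j} e → inj (trans (sym (lookup∘tabulate f i)) (trans e (lookup∘tabulate f j))))
        (trans (even-spec (tabulate f)) (cong not (trans (par-cong (lookup∘tabulate f)) p))))

      mk-$ : ∀ f (q : Inj f) (p : par f ≡ false) i → mk f q p $ i ≡ f i
      mk-$ f q p i = lookup∘tabulate f i

      _·_ : El → El → El
      g · h = mk (λ i → g $ (h $ i)) (λ e → $-inj h ($-inj g e)) (trans (par-∘ (g $_) (h $_) ($-inj g) ($-inj h)) (cong₂ _xor_ ($-par g) ($-par h)))

      ·-$ : ∀ g h i → (g · h) $ i ≡ g $ (h $ i)
      ·-$ g h i = lookup∘tabulate _ i

      ·-fn : ∀ g h → fn (g · h) ≡ fn g ∘ₚ fn h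
      ·-fn g h = refl

      unit : El
      unit = mk (λ i → i) (λ e → e) (par-id n)

      unit-$ : ∀ i → unit $ i ≡ i
      unit-$ i = lookup∘tabulate _ i

      inv$ : El → Fin n → Fin n
      inv$ g y = proj₁ (inj⇒surj ($-inj g) y)

      inv$-r : ∀ g y → g $ inv$ g y ≡ y
      inv$-r g y = proj₂ (inj⇒surj ($-inj g) y)

      inv$-l : ∀ g i → inv$ g (g $ i) ≡ i
      inv$-l g i = $-inj g (inv$-r g (g $ i))

      inv$-inj : ∀ g → Inj (inv$ g)
      inv$-inj g {i} {j} e = trans (sym (inv$-r g i)) (trans (cong (g $_) e) (inv$-r g j))

      _⁻¹ : El → El
      g ⁻¹ = mk (inv$ g) (inv$-inj g) (trans (sym (trans (par-∘ (g $_) (inv$ g) ($-inj g) (inv$-inj g)) (cong (_xor par (inv$ g)) ($-par g))))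
        (trans (par-cong (inv$-r g)) (par-id n)))

      ⁻¹-$ : ∀ g i → g ⁻¹ $ i ≡ inv$ g i
      ⁻¹-$ g i = lookup∘tabulate _ i

      $-⁻¹ : ∀ g i → g $ (g ⁻¹ $ i) ≡ i
      $-⁻¹ g i = trans (cong (g $_) (⁻¹-$ g i)) (inv$-r g i)

      ⁻¹-$' : ∀ g i → g ⁻¹ $ (g $ i) ≡ i
      ⁻¹-$' g i = trans (⁻¹-$ g (g $ i)) (inv$-l g i)

    assoc : ∀ a b c → (a · b) · c ≡ a · (b · c)
    assoc a b c = El-ext λ i → trans (·-$ (a · b) c i) (trans (·-$ a b _) (sym (trans (·-$ a (b · c) i) (cong (a $_) (·-$ b c i)))))

    idˡ : ∀ a → unit · a ≡ a
    idˡ a = El-ext λ i → trans (·-$ unit a i) (unit-$ _)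

    idʳ : ∀ a → a · unit ≡ a
    idʳ a = El-ext λ i → trans (·-$ a unit i) (cong (a $_) (unit-$ i))

    invʳ : ∀ a → a · a ⁻¹ ≡ unit
    invʳ a = El-ext λ i → trans (·-$ a (a ⁻¹) i) (trans ($-⁻¹ a i) (sym (unit-$ i)))

    invˡ : ∀ a → a ⁻¹ · a ≡ unit
    invˡ a = El-ext λ i → trans (·-$ (a ⁻¹) a i) (trans (⁻¹-$' a i) (sym (unit-$ i)))

    ⁻¹⁻¹ : ∀ a → (a ⁻¹) ⁻¹ ≡ a
    ⁻¹⁻¹ a = El-ext λ i → $-inj (a ⁻¹) (trans ($-⁻¹ (a ⁻¹) i) (sym (⁻¹-$' a i)))

    cons : ∀ σ b → isAltᵇ σ ≡ b → List El → List El
    cons σ true  p xs = el σ p ∷ xs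
    cons σ false p xs = xs

    collect : List (Perm n) → List El
    collect []       = []
    collect (σ ∷ xs) = cons σ (isAltᵇ σ) refl (collect xs)

    elems : List El
    elems = collect (allVecs n n)

    bq : Bool → ℚ
    bq true  = 1ℚ
    bq false = 0ℚ

    sum-collect : ∀ xs (F : Perm n → ℚ) → sumL (collect xs) (λ g → F (fn g)) ≡ sumL xs (λ σ → bq (isAltᵇ σ) * F σ)
    sum-collect []       F = refl
    sum-collect (σ ∷ xs) F = trans (go (isAltᵇ σ) refl) (cong (bq (isAltᵇ σ) * F σ +_) (sum-collect xs F))
      where
      go : ∀ b (p : isAltᵇ σ ≡ b) → sumL (cons σ b p (collect xs)) (λ g → F (fn g)) ≡ bq b * F σ + sumL (collect xs) (λ g → F (fn g))
      go true  p = cong (_+ sumL (collect xs) (λ g → F (fn g))) (sym (*-identityˡ (F σ)))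
      go false p = sym (trans (cong (_+ sumL (collect xs) (λ g → F (fn g))) (*-zeroˡ (F σ))) (+-identityˡ _))

    sum-++ : ∀ {A : Set} (xs ys : List A) f → sumL (xs ++ ys) f ≡ sumL xs f + sumL ys f
    sum-++ []       ys f = sym (+-identityˡ _)
    sum-++ (x ∷ xs) ys f = trans (cong (f x +_) (sum-++ xs ys f)) (sym (+-assoc (f x) _ _))

    sum-map : ∀ {A B : Set} (h : A → B) xs f → sumL (map h xs) f ≡ sumL xs λ x → f (h x)
    sum-map h []       f = refl
    sum-map h (x ∷ xs) f = cong (f (h x) +_) (sum-map h xs f)

    sum-allVecs : ∀ m k (F : Vec (Fin k) m → ℚ) → sumL (allVecs m k) F ≡ sumV F
    sum-allVecs zero    k F = +-identityʳ (F [])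
    sum-allVecs (suc m) k F = trans (go id) (PLF.ext (finP k) λ i → sum-allVecs m k λ v → F (i ∷ v))
      where
      go : ∀ {j} (h : Fin j → Fin k) → sumL (cartesianProductWith _∷_ (tabL h) (allVecs m k)) F ≡ sumF λ i → sumL (allVecs m k) λ v → F (h i ∷ v)
      go {zero}  h = refl
      go {suc j} h = trans (sum-++ (map (h zero ∷_) (allVecs m k)) _ F) (cong₂ _+_ (sum-map (h zero ∷_) (allVecs m k) F) (go λ i → h (suc i)))

    sum-elems : ∀ (F : Perm n → ℚ) → sumL elems (λ g → F (fn g)) ≡ sumV (λ σ → bq (isAltᵇ σ) * F σ)
    sum-elems F = trans (sum-collect (allVecs n n) F) (sum-allVecs n n _)

    infix 4 _≟E_
    _≟E_ : (g h : El) → Dec (g ≡ h)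
    g ≟E h with fn g ≟V fn h
    ... | yes p = yes (fn-inj p)
    ... | no q  = no λ e → q (cong fn e)

    δ-sum : ∀ h → sumL elems (λ g → 𝟙 (g ≟E h)) ≡ 1ℚ
    δ-sum h = trans (PLF.ext (listP elems) λ g → 𝟙-cong (g ≟E h) (fn g ≟V fn h) (cong fn) fn-inj)
      (trans (sum-elems λ σ → 𝟙 (σ ≟V fn h)) (trans (PLF.ext (vecP n n) λ σ → *-comm (bq (isAltᵇ σ)) _) (trans (sumV-δ (fn h) λ σ → bq (isAltᵇ σ)) (cong bq (ok h)))))

    -- By `δ-sum` every element is listed exactly once. Inserting the sum of 1[h = t g] over h and
    -- exchanging the two sums then takes the place of a permutation argument on the list.
    reindex : (t t⁻ : El → El) → (∀ g → t (t⁻ g) ≡ g) → (∀ g → t⁻ (t g) ≡ g) → ∀ F → sumL elems (λ g → F (t g)) ≡ sumL elems F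
    reindex t t⁻ p q F = begin
        sumL elems (λ g → F (t g))
          ≡⟨ E.ext (λ g → sym (trans (cong (_* F (t g)) (δ-sum (t g))) (*-identityˡ _))) ⟩
        sumL elems (λ g → sumL elems (λ h → 𝟙 (h ≟E t g)) * F (t g))
          ≡⟨ E.ext (λ g → trans (sym (E.sclr (F (t g)) _)) (E.ext λ h → trans (sym (𝟙-subst (h ≟E t g) F)) (cong (_* F h) (𝟙-cong (h ≟E t g) (g ≟E t⁻ h)
               (λ e → trans (sym (q g)) (cong t⁻ (sym e))) (λ e → trans (sym (p h)) (cong t (sym e))))))) ⟩
        sumL elems (λ g → sumL elems λ h → 𝟙 (g ≟E t⁻ h) * F h)
          ≡⟨ listP-fin elems (listP elems) (λ h g → 𝟙 (g ≟E t⁻ h) * F h) ⟩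
        sumL elems (λ h → sumL elems λ g → 𝟙 (g ≟E t⁻ h) * F h)
          ≡⟨ E.ext (λ h → trans (E.sclr (F h) _) (trans (cong (_* F h) (δ-sum (t⁻ h))) (*-identityˡ _))) ⟩
        sumL elems F ∎
      where
      open ≡-Reasoning
      module E = PLF (listP elems)

    card : ℚ
    card = sumL elems λ _ → 1ℚ

    0<card : 0ℚ < card
    0<card = <-≤-trans 0<1 (≤-trans (≤-reflexive (sym (δ-sum unit))) (PLF.mono (listP elems) λ g → 𝟙≤1 (g ≟E unit)))

    𝔾 : PLF El
    𝔾 = scaleP (inv card 0<card) (<⇒≤ (0<inv card 0<card)) (listP elems)

    E : (El → ℚ) → ℚ
    E = PLF.ap 𝔾

    𝔾-fin : Finitary 𝔾
    𝔾-fin = scaleP-fin (inv card 0<card) (<⇒≤ (0<inv card 0<card)) (listP elems) (listP-fin elems)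

    E-one : E (λ _ → 1ℚ) ≡ 1ℚ
    E-one = trans (*-comm (inv card 0<card) card) (inv-r card 0<card)

    E-const : ∀ c → E (λ _ → c) ≡ c
    E-const c = trans (PLF.ext 𝔾 λ _ → sym (*-identityʳ c)) (trans (PLF.scl 𝔾 c (λ _ → 1ℚ)) (trans (cong (c *_) E-one) (*-identityʳ c)))

    E-left : ∀ a F → E (λ g → F (a · g)) ≡ E F
    E-left a F = cong (inv card 0<card *_) (reindex (a ·_) (a ⁻¹ ·_)
      (λ g → trans (sym (assoc a (a ⁻¹) g)) (trans (cong (_· g) (invʳ a)) (idˡ g)))
      (λ g → trans (sym (assoc (a ⁻¹) a g)) (trans (cong (_· g) (invˡ a)) (idˡ g))) F)

    E-right : ∀ a F → E (λ g → F (g · a)) ≡ E F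
    E-right a F = cong (inv card 0<card *_) (reindex (_· a) (_· a ⁻¹)
      (λ g → trans (assoc g (a ⁻¹) a) (trans (cong (g ·_) (invˡ a)) (idʳ g)))
      (λ g → trans (assoc g a (a ⁻¹)) (trans (cong (g ·_) (invʳ a)) (idʳ g))) F)

    E-inv : ∀ F → E (λ g → F (g ⁻¹)) ≡ E F
    E-inv F = cong (inv card 0<card *_) (reindex _⁻¹ _⁻¹ ⁻¹⁻¹ ⁻¹⁻¹ F)

open AlternatingGroups

-- Statistics of tuples

open import Data.Vec using (map; tabulate; allFin)

InjV : ∀ {n m} → Vec (Fin n) m → Set
InjV v = Inj (lookup v)

InjV-tail : ∀ {n m} {i : Fin n} {v : Vec (Fin n) m} → InjV (i ∷ v) → InjV v
InjV-tail p e = Fin.suc-injective (p e)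

InjV-head : ∀ {n m} {i : Fin n} {v : Vec (Fin n) m} → InjV (i ∷ v) → ∀ a → ¬ lookup v a ≡ i
InjV-head p a e with p {suc a} {zero} e
... | ()

InjV-∷ : ∀ {n m} {i : Fin n} {v : Vec (Fin n) m} → (∀ a → ¬ lookup v a ≡ i) → InjV v → InjV (i ∷ v)
InjV-∷ p q {zero}  {zero}  e = refl
InjV-∷ p q {zero}  {suc b} e = ⊥-elim (p b (sym e))
InjV-∷ p q {suc a} {zero}  e = ⊥-elim (p a e)
InjV-∷ p q {suc a} {suc b} e = cong suc (q e)

-- For injective T this is the indicator of being an entry of T. Written as a sum over positions, it
-- can be exchanged with sums over points, which is how fresh points are eliminated later.
memb : ∀ {n m} → Vec (Fin n) m → Fin n → ℚ
memb T i = sumF λ b → 𝟙 (lookup T b ≟ i)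

match : ∀ {n m} → Vec (Fin n) m → Vec (Fin n) m → Fin n → Fin n → ℚ
match T J i j = sumF λ b → 𝟙 (lookup T b ≟ i) * 𝟙 (lookup J b ≟ j)

fresh : ∀ {n m} → Vec (Fin n) m → Vec (Fin n) m → Fin n → Fin n → ℚ
fresh T J i j = (1ℚ - memb T i) * (1ℚ - memb J j)

sumF-hit : ∀ {n m} {T : Vec (Fin n) m} → InjV T → ∀ a (F : Fin m → ℚ) → sumF (λ b → 𝟙 (lookup T b ≟ lookup T a) * F b) ≡ F a
sumF-hit {m = m} {T} inj a F = trans (PLF.ext (finP m) λ b → cong (_* F b) (𝟙-cong (lookup T b ≟ lookup T a) (b ≟ a) inj (cong (lookup T)))) (sumF-δ a F)

sumF-miss : ∀ {n m} {T : Vec (Fin n) m} {i} → (∀ a → ¬ lookup T a ≡ i) → ∀ (F : Fin m → ℚ) → sumF (λ b → 𝟙 (lookup T b ≟ i) * F b) ≡ 0ℚ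
sumF-miss {m = m} {T} {i} p F = trans (PLF.ext (finP m) λ b → trans (cong (_* F b) (𝟙-no (lookup T b ≟ i) (p b))) (*-zeroˡ (F b))) (PLF.zer (finP m))

memb-as : ∀ {n m} (T : Vec (Fin n) m) i → memb T i ≡ sumF (λ b → 𝟙 (lookup T b ≟ i) * 1ℚ)
memb-as {m = m} T i = PLF.ext (finP m) λ b → sym (*-identityʳ _)

memb-hit : ∀ {n m} {T : Vec (Fin n) m} → InjV T → ∀ a → memb T (lookup T a) ≡ 1ℚ
memb-hit {T = T} inj a = trans (memb-as T _) (sumF-hit {T = T} inj a λ _ → 1ℚ)

memb-miss : ∀ {n m} {T : Vec (Fin n) m} {i} → (∀ a → ¬ lookup T a ≡ i) → memb T i ≡ 0ℚ
memb-miss {T = T} {i} p = trans (memb-as T i) (sumF-miss {T = T} p λ _ → 1ℚ)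

sumF-memb : ∀ {n m} (T : Vec (Fin n) m) (F : Fin n → ℚ) → sumF (λ i → memb T i * F i) ≡ sumF (λ a → F (lookup T a))
sumF-memb {n} {m} T F = trans (PLF.ext (finP n) λ i → sym (PLF.sclr (finP m) (F i) _)) (trans (finP-fin m (finP n) λ b i → 𝟙 (lookup T b ≟ i) * F i)
  (PLF.ext (finP m) λ b → trans (PLF.ext (finP n) λ i → cong (_* F i) (𝟙-cong (lookup T b ≟ i) (i ≟ lookup T b) sym sym)) (sumF-δ (lookup T b) F)))

sumF-const : ∀ n → sumF {n} (λ _ → 1ℚ) ≡ nat n
sumF-const zero    = refl
sumF-const (suc n) = cong (1ℚ +_) (sumF-const n)

record Bij (n : ℕ) : Set where
  constructor bij
  field
    to  : Fin n → Fin n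
    inj : Inj to

module TupleCalculus (n : ℕ) where
  open Alternating n

  infixl 8 _∙_
  _∙_ : ∀ {k} → El → Vec (Fin n) k → Vec (Fin n) k
  g ∙ I = map (g $_) I

  lookup-∙ : ∀ {k} g (I : Vec (Fin n) k) i → lookup (g ∙ I) i ≡ g $ lookup I i
  lookup-∙ g I i = lookup-map i (g $_) I

  ·-∙ : ∀ {k} g h (I : Vec (Fin n) k) → (g · h) ∙ I ≡ g ∙ (h ∙ I)
  ·-∙ g h []      = refl
  ·-∙ g h (i ∷ I) = cong₂ _∷_ (·-$ g h i) (·-∙ g h I)

  unit-∙ : ∀ {k} (I : Vec (Fin n) k) → unit ∙ I ≡ I
  unit-∙ []      = refl
  unit-∙ (i ∷ I) = cong₂ _∷_ (unit-$ i) (unit-∙ I)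

  ⁻¹-∙ : ∀ {k} g (I : Vec (Fin n) k) → g ⁻¹ ∙ (g ∙ I) ≡ I
  ⁻¹-∙ g I = trans (sym (·-∙ (g ⁻¹) g I)) (trans (cong (_∙ I) (invˡ g)) (unit-∙ I))

  ∙-⁻¹ : ∀ {k} g (I : Vec (Fin n) k) → g ∙ (g ⁻¹ ∙ I) ≡ I
  ∙-⁻¹ g I = trans (sym (·-∙ g (g ⁻¹) I)) (trans (cong (_∙ I) (invʳ g)) (unit-∙ I))

  InjV-∙ : ∀ {k} g (I : Vec (Fin n) k) → InjV I → InjV (g ∙ I)
  InjV-∙ g I p {i} {j} e = p ($-inj g (trans (sym (lookup-∙ g I i)) (trans e (lookup-∙ g I j))))

  Pat : ∀ {k} → Vec (Fin n) k → Vec (Fin n) k → Set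
  Pat I J = ∀ i j → (lookup I i ≡ lookup I j → lookup J i ≡ lookup J j) × (lookup J i ≡ lookup J j → lookup I i ≡ lookup I j)

  -- The extension g of the tails is corrected by swapping g x with y. Equality of patterns
  -- guarantees that this moves an earlier value only if it belongs to the same point x.
  extendS : ∀ {k} (I J : Vec (Fin n) k) → Pat I J → ∃ λ (b : Bij n) → ∀ i → Bij.to b (lookup I i) ≡ lookup J i
  extendS []      []      p = bij (λ i → i) (λ e → e) , λ ()
  extendS (x ∷ I) (y ∷ J) p with extendS I J (λ i j → p (suc i) (suc j))
  ... | bij g gi , q = bij (λ i → swap c y (g i)) (λ e → gi (swap-inj c y e)) , λ { zero → swap-l c y ; (suc i) → go i }
    where
    c = g x
    go : ∀ i → swap c y (g (lookup I i)) ≡ lookup J i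
    go i = by (g (lookup I i) ≟ c)
      where
      by : Dec (g (lookup I i) ≡ c) → swap c y (g (lookup I i)) ≡ lookup J i
      by (yes e) = trans (cong (swap c y) e) (trans (swap-l c y) (proj₁ (p zero (suc i)) (sym (gi e))))
      by (no ne) = trans (swap-o ne λ e → ne (cong g (proj₂ (p (suc i) zero) (trans (sym (q i)) e)))) (q i)

  -- If the extension is odd, it is composed with a transposition of two points outside J. This is
  -- where the two spare points k + 2 ≤ n come from.
  extend : ∀ {k} (I J : Vec (Fin n) k) → suc (suc k) ℕ.≤ n → Pat I J → ∃ λ g → g ∙ I ≡ J
  extend {k} I J le p with extendS I J p
  ... | bij g gi , q with par g in eq
  ...   | false = mk g gi eq , lookup-ext λ i → trans (lookup-∙ (mk g gi eq) I i) (trans (mk-$ g gi eq _) (q i))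
  ...   | true  with missing J (ℕ.≤-trans (ℕ.n≤1+n _) le)
  ...     | a , a∉ with missing (a ∷ J) le
  ...       | b , b∉ = h , lookup-ext λ i → trans (lookup-∙ h I i) (trans (mk-$ f fi pf _) (trans (cong (swap a b) (q i)) (swap-o (a∉ i) (b∉ (suc i)))))
    where
    f : Fin n → Fin n
    f i = swap a b (g i)
    fi : Inj f
    fi e = gi (swap-inj a b e)
    pf : par f ≡ false
    pf = trans (par-∘ (swap a b) g (swap-inj a b) gi) (cong₂ _xor_ (par-swap a b (b∉ zero)) eq)
    h = mk f fi pf

  Pat-inj : ∀ {k} (I J : Vec (Fin n) k) → InjV I → InjV J → Pat I J
  Pat-inj I J p q i j = (λ e → cong (lookup J) (p e)) , (λ e → cong (lookup I) (q e))

  Pr : ∀ {k} → Vec (Fin n) k → Vec (Fin n) k → ℚ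
  Pr I J = E λ σ → 𝟙 (σ ∙ I ≟V J)

  ∙-move : ∀ {k} (σ : El) h (I J : Vec (Fin n) k) → 𝟙 (σ ∙ I ≟V J) ≡ 𝟙 ((h · σ) ∙ I ≟V h ∙ J)
  ∙-move σ h I J = 𝟙-cong (σ ∙ I ≟V J) ((h · σ) ∙ I ≟V h ∙ J) (λ e → trans (·-∙ h σ I) (cong (h ∙_) e))
    λ e → trans (sym (⁻¹-∙ h _)) (trans (cong (h ⁻¹ ∙_) (trans (sym (·-∙ h σ I)) e)) (⁻¹-∙ h J))

  Pr-left : ∀ {k} h (I J : Vec (Fin n) k) → Pr I J ≡ Pr I (h ∙ J)
  Pr-left h I J = trans (PLF.ext 𝔾 λ σ → ∙-move σ h I J) (E-left h λ σ → 𝟙 (σ ∙ I ≟V h ∙ J))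

  fall : ℕ → ℚ
  fall zero    = 1ℚ
  fall (suc k) = fall k * (nat n - nat k)

  Σ-col : ∀ {k} σ i (j : Fin n) (I J : Vec (Fin n) k) → 𝟙 (σ ∙ (i ∷ I) ≟V j ∷ J) ≡ 𝟙 (σ $ i ≟ j) * 𝟙 (σ ∙ I ≟V J)
  Σ-col σ i j I J = 𝟙-∷ (σ $ i) j (σ ∙ I) J

  sum-col : ∀ σ i → sumF (λ j → 𝟙 (σ $ i ≟ j)) ≡ 1ℚ
  sum-col σ i = trans (PLF.ext (finP n) λ j → trans (𝟙-cong (σ $ i ≟ j) (j ≟ σ $ i) sym sym) (sym (*-identityʳ _))) (sumF-δ (σ $ i) λ _ → 1ℚ)

  sum-row : ∀ σ j → sumF (λ i → 𝟙 (σ $ i ≟ j)) ≡ 1ℚ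
  sum-row σ j = trans (PLF.ext (finP n) λ i → trans (𝟙-cong (σ $ i ≟ j) (i ≟ inv$ σ j)
      (λ e → trans (sym (inv$-l σ i)) (cong (inv$ σ) e)) (λ e → trans (cong (σ $_) e) (inv$-r σ j))) (sym (*-identityʳ _))) (sumF-δ (inv$ σ j) λ _ → 1ℚ)

  -- Transitivity of the group on injective tuples makes the probability independent of the values.
  -- Summing over the value of one more entry leaves n - k admissible ones, all equally likely.
  Pr-fall : ∀ {k} (I J : Vec (Fin n) k) → suc (suc k) ℕ.≤ n → InjV I → InjV J → Pr I J * fall k ≡ 1ℚ
  Pr-fall []      []      le p q = trans (*-identityʳ _) (trans (PLF.ext 𝔾 λ σ → 𝟙-yes (_≟V_ {n} [] []) refl) E-one)
  Pr-fall {suc k} (i ∷ I) (j ∷ J) le p q = begin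
      c * (fall k * (nat n - nat k))
        ≡⟨ l c (fall k) (nat n - nat k) ⟩
      ((nat n - nat k) * c) * fall k
        ≡⟨ cong (_* fall k) (sym total) ⟩
      Pr I J * fall k
        ≡⟨ Pr-fall I J (ℕ.≤-trans (ℕ.n≤1+n _) le) (InjV-tail {v = I} p) (InjV-tail {v = J} q) ⟩
      1ℚ ∎
    where
    open ≡-Reasoning
    c = Pr (i ∷ I) (j ∷ J)
    l : ∀ a b d → a * (b * d) ≡ (d * a) * b
    l = solve-∀ ringℚ
    each : ∀ j' → Pr (i ∷ I) (j' ∷ J) ≡ (1ℚ - memb J j') * c
    each j' with any? (λ a → lookup J a ≟ j')
    ... | yes (a , e) = trans (trans (PLF.ext 𝔾 λ σ → 𝟙-no (σ ∙ (i ∷ I) ≟V j' ∷ J) λ eq →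
            InjV-head {v = I} p a ($-inj σ (trans (sym (lookup-∙ σ I a)) (trans (cong (λ v → lookup v a) (∷-injectiveʳ eq)) (trans e (sym (∷-injectiveˡ eq))))))) (PLF.zer 𝔾))
          (sym (trans (cong (λ z → (1ℚ - z) * c) (trans (cong (memb J) (sym e)) (memb-hit {T = J} (InjV-tail {v = J} q) a))) (m c)))
      where
      m : ∀ c → (1ℚ - 1ℚ) * c ≡ 0ℚ
      m = solve-∀ ringℚ
    ... | no ne with extend (j ∷ J) (j' ∷ J) le (Pat-inj (j ∷ J) (j' ∷ J) q (InjV-∷ {v = J} (λ a e → ne (a , e)) (InjV-tail {v = J} q)))
    ...   | h , he = trans (cong (Pr (i ∷ I)) (sym he)) (trans (sym (Pr-left h (i ∷ I) (j ∷ J))) (sym (trans (cong (λ z → (1ℚ - z) * c) (memb-miss {T = J} λ a e → ne (a , e))) (m c))))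
      where
      m : ∀ c → (1ℚ - 0ℚ) * c ≡ c
      m = solve-∀ ringℚ
    total : Pr I J ≡ (nat n - nat k) * c
    total = begin
      E (λ σ → 𝟙 (σ ∙ I ≟V J))
        ≡⟨ PLF.ext 𝔾 (λ σ → sym (trans (PLF.ext (finP n) λ j' → Σ-col σ i j' I J) (trans (PLF.sclr (finP n) _ _) (trans (cong (_* 𝟙 (σ ∙ I ≟V J)) (sum-col σ i)) (*-identityˡ _))))) ⟩
      E (λ σ → sumF λ j' → 𝟙 (σ ∙ (i ∷ I) ≟V j' ∷ J))
        ≡⟨ finP-fin n 𝔾 (λ j' σ → 𝟙 (σ ∙ (i ∷ I) ≟V j' ∷ J)) ⟩
      sumF (λ j' → Pr (i ∷ I) (j' ∷ J))
        ≡⟨ PLF.ext (finP n) each ⟩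
      sumF (λ j' → (1ℚ - memb J j') * c)
        ≡⟨ trans (PLF.sclr (finP n) c (λ j' → 1ℚ - memb J j')) (cong (_* c) (trans (PLF.sub (finP n) (λ _ → 1ℚ) (memb J)) (cong₂ _-_ (sumF-const n)
             (trans (PLF.ext (finP n) λ j' → sym (*-identityʳ (memb J j'))) (trans (sumF-memb J λ _ → 1ℚ) (sumF-const k)))))) ⟩
      (nat n - nat k) * c ∎

  -- The entries of the operator by which z acts on functions of k-tuples. Tuples with repetitions
  -- are included, so no subtype of injective tuples is carried around.
  M : (El → ℚ) → ∀ {k} → Vec (Fin n) k → Vec (Fin n) k → ℚ
  M z I J = E λ σ → z σ * 𝟙 (σ ∙ I ≟V J)

  Perp : ℕ → (El → ℚ) → Set
  Perp d z = ∀ (I J : Vec (Fin n) d) → M z I J ≡ 0ℚ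

  InV : ℕ → (El → ℚ) → Set
  InV d z = Σ (Vec (Fin n) d → Vec (Fin n) d → ℚ) λ c → ∀ σ → z σ ≡ sumV λ I → c I (σ ∙ I)

  M-head : ∀ z {k} i j (I J : Vec (Fin n) k) → M z (i ∷ I) (j ∷ J) ≡ M (λ σ → z σ * 𝟙 (σ $ i ≟ j)) I J
  M-head z i j I J = PLF.ext 𝔾 λ σ → trans (cong (z σ *_) (Σ-col σ i j I J)) (sym (*-assoc (z σ) _ _))

  M-col : ∀ z {k} i (I J : Vec (Fin n) k) → sumF (λ j → M z (i ∷ I) (j ∷ J)) ≡ M z I J
  M-col z i I J = trans (sym (finP-fin n 𝔾 λ j σ → z σ * 𝟙 (σ ∙ (i ∷ I) ≟V j ∷ J))) (PLF.ext 𝔾 λ σ →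
    trans (PLF.scl (finP n) (z σ) _) (cong (z σ *_) (trans (PLF.ext (finP n) λ j → Σ-col σ i j I J) (trans (PLF.sclr (finP n) _ _) (trans (cong (_* 𝟙 (σ ∙ I ≟V J)) (sum-col σ i)) (*-identityˡ _))))))

  M-row : ∀ z {k} j (I J : Vec (Fin n) k) → sumF (λ i → M z (i ∷ I) (j ∷ J)) ≡ M z I J
  M-row z j I J = trans (sym (finP-fin n 𝔾 λ i σ → z σ * 𝟙 (σ ∙ (i ∷ I) ≟V j ∷ J))) (PLF.ext 𝔾 λ σ →
    trans (PLF.scl (finP n) (z σ) _) (cong (z σ *_) (trans (PLF.ext (finP n) λ i → Σ-col σ i j I J) (trans (PLF.sclr (finP n) _ _) (trans (cong (_* 𝟙 (σ ∙ I ≟V J)) (sum-row σ j)) (*-identityˡ _))))))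

  M-+ : ∀ z y {k} (I J : Vec (Fin n) k) → M (λ σ → z σ + y σ) I J ≡ M z I J + M y I J
  M-+ z y I J = trans (PLF.ext 𝔾 λ σ → *-distribʳ-+ (𝟙 (σ ∙ I ≟V J)) (z σ) (y σ)) (PLF.add 𝔾 _ _)

  M-- : ∀ z y {k} (I J : Vec (Fin n) k) → M (λ σ → z σ - y σ) I J ≡ M z I J - M y I J
  M-- z y I J = trans (PLF.ext 𝔾 λ σ → l (z σ) (y σ) (𝟙 (σ ∙ I ≟V J))) (PLF.sub 𝔾 _ _)
    where
    l : ∀ a b c → (a - b) * c ≡ a * c - b * c
    l = solve-∀ ringℚ

  M-scl : ∀ a z {k} (I J : Vec (Fin n) k) → M (λ σ → a * z σ) I J ≡ a * M z I J
  M-scl a z I J = trans (PLF.ext 𝔾 λ σ → *-assoc a (z σ) _) (PLF.scl 𝔾 a _)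

  M-ext : ∀ {z y} → (∀ σ → z σ ≡ y σ) → ∀ {k} (I J : Vec (Fin n) k) → M z I J ≡ M y I J
  M-ext p I J = PLF.ext 𝔾 λ σ → cong (_* 𝟙 (σ ∙ I ≟V J)) (p σ)

  -- Building a function from a kernel c is adjoint to taking the matrix `M`. In particular the
  -- functions in `InV d` and in `Perp d` are orthogonal.
  E-kernel : ∀ {d} (c : Vec (Fin n) d → Vec (Fin n) d → ℚ) y →
    E (λ σ → sumV (λ I → c I (σ ∙ I)) * y σ) ≡ sumV (λ I → sumV λ J → c I J * M y I J)
  E-kernel {d} c y = begin
      E (λ σ → sumV (λ I → c I (σ ∙ I)) * y σ)
        ≡⟨ PLF.ext 𝔾 (λ σ → trans (sym (PLF.sclr (vecP n d) (y σ) _)) (PLF.ext (vecP n d) λ I → trans (*-comm (c I (σ ∙ I)) (y σ)) (sym (sumV-δ' (σ ∙ I) λ J → y σ * c I J)))) ⟩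
      E (λ σ → sumV λ I → sumV λ J → 𝟙 (σ ∙ I ≟V J) * (y σ * c I J))
        ≡⟨ vecP-fin n d 𝔾 (λ I σ → sumV λ J → 𝟙 (σ ∙ I ≟V J) * (y σ * c I J)) ⟩
      sumV (λ I → E λ σ → sumV λ J → 𝟙 (σ ∙ I ≟V J) * (y σ * c I J))
        ≡⟨ PLF.ext (vecP n d) (λ I → vecP-fin n d 𝔾 (λ J σ → 𝟙 (σ ∙ I ≟V J) * (y σ * c I J))) ⟩
      sumV (λ I → sumV λ J → E λ σ → 𝟙 (σ ∙ I ≟V J) * (y σ * c I J))
        ≡⟨ PLF.ext (vecP n d) (λ I → PLF.ext (vecP n d) λ J → trans (PLF.ext 𝔾 λ σ → l (𝟙 (σ ∙ I ≟V J)) (y σ) (c I J)) (PLF.scl 𝔾 (c I J) _)) ⟩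
      sumV (λ I → sumV λ J → c I J * M y I J) ∎
    where
    open ≡-Reasoning
    l : ∀ a b c → a * (b * c) ≡ c * (b * a)
    l = solve-∀ ringℚ

  InV-⊥ : ∀ {d z y} → InV d z → Perp d y → E (λ σ → z σ * y σ) ≡ 0ℚ
  InV-⊥ {d} {z} {y} (c , p) q = trans (PLF.ext 𝔾 λ σ → cong (_* y σ) (p σ)) (trans (E-kernel c y)
    (trans (PLF.ext (vecP n d) λ I → trans (PLF.ext (vecP n d) λ J → trans (cong (c I J *_) (q I J)) (*-zeroʳ (c I J))) (PLF.zer (vecP n d))) (PLF.zer (vecP n d))))

  Perp-down : ∀ {d z} → Fin n → Perp (suc d) z → Perp d z
  Perp-down {d} {z} i p I J = trans (sym (M-col z i I J)) (trans (PLF.ext (finP n) λ j → p (i ∷ I) (j ∷ J)) (PLF.zer (finP n)))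

  Perp-ext : ∀ {d z y} → (∀ σ → z σ ≡ y σ) → Perp d z → Perp d y
  Perp-ext e p I J = trans (sym (M-ext e I J)) (p I J)

  Perp-- : ∀ {d z y} → Perp d z → Perp d y → Perp d (λ σ → z σ - y σ)
  Perp-- {z = z} {y} p q I J = trans (M-- z y I J) (trans (cong₂ _-_ (p I J) (q I J)) (+-inverseʳ 0ℚ))

  Perp-scl : ∀ {d z} a → Perp d z → Perp d (λ σ → a * z σ)
  Perp-scl {z = z} a p I J = trans (M-scl a z I J) (trans (cong (a *_) (p I J)) (*-zeroʳ a))

  R : El → (El → ℚ) → El → ℚ
  R g z σ = z (σ · g)

  M-R : ∀ g z {k} (I J : Vec (Fin n) k) → M (R g z) I J ≡ M z (g ⁻¹ ∙ I) J
  M-R g z I J = trans (PLF.ext 𝔾 λ σ → cong (z (σ · g) *_) (𝟙-cong (σ ∙ I ≟V J) ((σ · g) ∙ (g ⁻¹ ∙ I) ≟V J) (trans (e σ)) (λ q → trans (sym (e σ)) q))) (E-right g λ σ → z σ * 𝟙 (σ ∙ (g ⁻¹ ∙ I) ≟V J))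
    where
    e : ∀ σ → (σ · g) ∙ (g ⁻¹ ∙ I) ≡ σ ∙ I
    e σ = trans (·-∙ σ g _) (cong (σ ∙_) (∙-⁻¹ g I))

  Perp-R : ∀ {d z} g → Perp d z → Perp d (R g z)
  Perp-R {z = z} g p I J = trans (M-R g z I J) (p (g ⁻¹ ∙ I) J)

  R-hom : ∀ g h z σ → R g (R h z) σ ≡ R (g · h) z σ
  R-hom g h z σ = cong z (assoc σ g h)

  R-iso : ∀ g z y → E (λ σ → R g z σ * R g y σ) ≡ E (λ σ → z σ * y σ)
  R-iso g z y = E-right g λ σ → z σ * y σ

  nrm² : (El → ℚ) → ℚ
  nrm² z = E λ σ → z σ * z σ

  0≤nrm² : ∀ z → 0ℚ ≤ nrm² z
  0≤nrm² z = PLF.sqs 𝔾 z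

-- Archimedean property, dyadic errors and total inverses

nat-ᵘ : ∀ k → toℚᵘ (nat k) ℚᵘ.≃ ℚᵘ.mkℚᵘ (ℤ.+ k) 0
nat-ᵘ zero    = ℚᵘ.*≡* refl
nat-ᵘ (suc k) = ℚᵘ.≃-trans (toℚᵘ-homo-+ 1ℚ (nat k)) (ℚᵘ.≃-trans (ℚᵘ.+-congʳ (toℚᵘ 1ℚ) (nat-ᵘ k))
  (ℚᵘ.*≡* (cong (λ z → z ℤ.* ℤ.+ 1) (cong (ℤ._+_ (ℤ.+ 1)) (ℤ.*-identityʳ (ℤ.+ k))))))

archimedes : ∀ q → ∃ λ k → q ≤ nat k
archimedes q = k , toℚᵘ-cancel-≤ (ℚᵘ.≤-trans le (ℚᵘ.≤-reflexive (ℚᵘ.≃-sym (nat-ᵘ k))))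
  where
  k = ℤ.∣ ℚ.↥ q ∣
  le : toℚᵘ q ℚᵘ.≤ ℚᵘ.mkℚᵘ (ℤ.+ k) 0
  le = go q
    where
    abs : ∀ i d → i ℤ.* ℤ.+ 1 ℤ.≤ ℤ.+ ℤ.∣ i ∣ ℤ.* ℤ.+ suc d
    abs (ℤ.+ m)      d = ℤ.≤-trans (ℤ.≤-reflexive (ℤ.*-identityʳ (ℤ.+ m))) (ℤ.≤-trans (ℤ.+≤+ (ℕ.m≤m*n m (suc d))) (ℤ.≤-reflexive (ℤ.pos-* m (suc d))))
    abs (ℤ.-[1+ m ]) d = ℤ.≤-trans (ℤ.≤-reflexive (ℤ.*-identityʳ ℤ.-[1+ m ])) (ℤ.≤-trans ℤ.-≤+ (ℤ.≤-reflexive (ℤ.pos-* (suc m) (suc d))))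
    go : ∀ q → toℚᵘ q ℚᵘ.≤ ℚᵘ.mkℚᵘ (ℤ.+ ℤ.∣ ℚ.↥ q ∣) 0
    go (ℚ.mkℚ i d c) = ℚᵘ.*≤* (abs i d)

½ : ℚ
½ = inv (1ℚ + 1ℚ) (0<nat 1)

½+½ : ∀ x → ½ * x + ½ * x ≡ x
½+½ x = trans (l ½ x) (trans (cong (_* x) (inv-r (1ℚ + 1ℚ) (0<nat 1))) (*-identityˡ x))
  where
  l : ∀ h x → h * x + h * x ≡ ((1ℚ + 1ℚ) * h) * x
  l = solve-∀ ringℚ

0≤½ : 0ℚ ≤ ½
0≤½ = <⇒≤ (0<inv (1ℚ + 1ℚ) (0<nat 1))

half : ℕ → ℚ
half zero    = 1ℚ
half (suc k) = ½ * half k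

0≤half : ∀ k → 0ℚ ≤ half k
0≤half zero    = 0≤1
0≤half (suc k) = 0≤* 0≤½ (0≤half k)

double : ∀ {a b} → (1ℚ + 1ℚ) * a ≤ (1ℚ + 1ℚ) * b → a ≤ b
double = *-cancelˡ (0<nat 1)

half-nat : ∀ k → half k * nat k ≤ 1ℚ
half-nat zero    = cert 0≤1 refl
half-nat (suc k) = double (≤-trans (≤-reflexive (l ½ (half k) (nat k) (inv-r (1ℚ + 1ℚ) (0<nat 1)))) (≤-trans (+-mono-≤ (h≤1 k) (half-nat k)) (≤-reflexive refl)))
  where
  m : ∀ i h n → (1ℚ + 1ℚ) * (i * h * (1ℚ + n)) ≡ ((1ℚ + 1ℚ) * i) * (h + h * n)
  m = solve-∀ ringℚ
  l : ∀ i h n → (1ℚ + 1ℚ) * i ≡ 1ℚ → (1ℚ + 1ℚ) * (i * h * (1ℚ + n)) ≡ h + h * n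
  l i h n e = trans (m i h n) (trans (cong (_* (h + h * n)) e) (*-identityˡ _))
  h≤1 : ∀ k → half k ≤ 1ℚ
  h≤1 zero    = ≤-refl
  h≤1 (suc k) = ≤-trans (cert (0≤* 0≤½ (0≤half k)) (sym (½+½ (half k)))) (h≤1 k)

-- Stands for letting k tend to infinity: by `half-nat` and the Archimedean property the error falls
-- below any positive gap x - y.
squeeze : ∀ x y B → 0ℚ ≤ B → (∀ k → x ≤ y + half k * B) → x ≤ y
squeeze x y B 0≤B hyp = ≮⇒≥ λ y<x →
  let e   = x - y
      0<e : 0ℚ < e
      0<e = subst (_< e) (+-inverseʳ y) (+-monoˡ-< (- y) y<x)
      q   = (B + B) * inv e 0<e
      k   = proj₁ (archimedes q)
      q≤k = proj₂ (archimedes q)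
      BB≤ : B + B ≤ nat k * e
      BB≤ = ≤-trans (≤-reflexive (trans (sym (*-identityʳ _)) (trans (cong ((B + B) *_) (sym (trans (*-comm (inv e 0<e) e) (inv-r e 0<e)))) (sym (*-assoc (B + B) _ e))))) (*-monoˡ (<⇒≤ 0<e) q≤k)
      hB : half k * (B + B) ≤ e
      hB = ≤-trans (*-monoʳ (0≤half k) BB≤) (≤-trans (≤-reflexive (sym (*-assoc (half k) (nat k) e))) (≤-trans (*-monoˡ (<⇒≤ 0<e) (half-nat k)) (≤-reflexive (*-identityˡ e))))
      e≤ : e ≤ half k * B
      e≤ = undiff (subst (0ℚ ≤_) (l x y (half k * B)) (diff (hyp k)))
      e≤0 : e ≤ 0ℚ
      e≤0 = undiff (subst (0ℚ ≤_) (m e (half k) B) (0≤+ (diff hB) (0≤+ (diff e≤) (diff e≤))))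
  in <⇒≱ 0<e e≤0
  where
  l : ∀ x y h → y + h - x ≡ h - (x - y)
  l = solve-∀ ringℚ
  m : ∀ e h B → (e - h * (B + B)) + ((h * B - e) + (h * B - e)) ≡ 0ℚ - e
  m = solve-∀ ringℚ

-- The default 0 keeps the product formula of `p` total and nonnegative, also when k exceeds n.
invd : ℚ → ℚ
invd x with 0ℚ <? x
... | yes p = inv x p
... | no _  = 0ℚ

0≤invd : ∀ x → 0ℚ ≤ invd x
0≤invd x with 0ℚ <? x
... | yes p = <⇒≤ (0<inv x p)
... | no _  = ≤-refl

invd-r : ∀ x → 0ℚ < x → x * invd x ≡ 1ℚ
invd-r x q with 0ℚ <? x
... | yes p = inv-r x p
... | no r  = ⊥-elim (r q)

nat-+ : ∀ m n → nat (m ℕ.+ n) ≡ nat m + nat n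
nat-+ zero    n = sym (+-identityˡ _)
nat-+ (suc m) n = trans (cong (1ℚ +_) (nat-+ m n)) (sym (+-assoc 1ℚ (nat m) (nat n)))

nat-mono : ∀ {a b} → a ℕ.≤ b → nat a ≤ nat b
nat-mono {b = b} z≤n = 0≤nat b
nat-mono (s≤s p) = +-monoʳ-≤ 1ℚ (nat-mono p)

1≤nat-diff : ∀ {n k} → k ℕ.< n → 1ℚ ≤ nat n - nat k
1≤nat-diff {n} {k} p = undiff (subst (0ℚ ≤_) (l (nat n) (nat k)) (diff (nat-mono p)))
  where
  l : ∀ n k → n - (1ℚ + k) ≡ n - k - 1ℚ
  l = solve-∀ ringℚ

decInj : ∀ {n m} (v : Vec (Fin n) m) → Dec (InjV v)
decInj []      = yes λ {i} → ⊥-elim (noFin i)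
  where
  noFin : ¬ Fin 0
  noFin ()
decInj (i ∷ v) with any? (λ a → lookup v a ≟ i) | decInj v
... | yes (a , e) | _     = no λ p → InjV-head {v = v} p a e
... | no q        | yes p = yes (InjV-∷ {v = v} (λ a e → q (a , e)) p)
... | no _        | no q  = no λ p → q (InjV-tail {v = v} p)

two^ : ℕ → ℚ
two^ zero    = 1ℚ
two^ (suc d) = two^ d + two^ d

0≤two^ : ∀ d → 0ℚ ≤ two^ d
0≤two^ zero    = 0≤1
0≤two^ (suc d) = 0≤+ (0≤two^ d) (0≤two^ d)

-- Comparison of a function with its matrix of coefficients

module FrameBounds (n : ℕ) where
  open Alternating n
  open TupleCalculus n

  -- 1 / (n (n - 1) ... (n - k + 1)), the common value of `Pr` on injective k-tuples.
  p : ℕ → ℚ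
  p zero    = 1ℚ
  p (suc k) = p k * invd (nat n - nat k)

  0≤p : ∀ k → 0ℚ ≤ p k
  0≤p zero    = 0≤1
  0≤p (suc k) = 0≤* (0≤p k) (0≤invd (nat n - nat k))

  p-fall : ∀ k → k ℕ.≤ n → p k * fall k ≡ 1ℚ
  p-fall zero    le = *-identityʳ 1ℚ
  p-fall (suc k) le = trans (l (p k) (invd (nat n - nat k)) (fall k) (nat n - nat k)) (trans (cong₂ _*_ (p-fall k (ℕ.≤-trans (ℕ.n≤1+n k) le)) (invd-r _ (<-≤-trans 0<1 (1≤nat-diff le)))) (*-identityʳ 1ℚ))
    where
    l : ∀ a b c d → (a * b) * (c * d) ≡ (a * c) * (d * b)
    l = solve-∀ ringℚ

  p-dec : ∀ k → p (suc k) ≤ p k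
  p-dec k = ≤-trans (*-monoʳ (0≤p k) inv≤1) (≤-reflexive (*-identityʳ _))
    where
    inv≤1 : invd (nat n - nat k) ≤ 1ℚ
    inv≤1 with 0ℚ <? (nat n - nat k)
    ... | no _  = 0≤1
    ... | yes q = *-cancelˡ q (≤-trans (≤-reflexive (inv-r _ q)) (≤-trans (1≤nat-diff k<n) (≤-reflexive (sym (*-identityʳ _)))))
      where
      k<n : k ℕ.< n
      k<n with k ℕ.<? n
      ... | yes r = r
      ... | no r  = ⊥-elim (<⇒≱ q (undiff (subst (0ℚ ≤_) (l (nat n) (nat k)) (diff (nat-mono (ℕ.≮⇒≥ r))))))
        where
        l : ∀ n k → k - n ≡ 0ℚ - (n - k)
        l = solve-∀ ringℚ

  Pr≡p : ∀ {k} (I J : Vec (Fin n) k) → suc (suc k) ℕ.≤ n → InjV I → InjV J → Pr I J ≡ p k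
  Pr≡p {k} I J le a b = trans (sym (*-identityʳ _)) (trans (cong (Pr I J *_) (sym (trans (*-comm (fall k) (p k)) (p-fall k (ℕ.≤-trans (ℕ.n≤1+n _) (ℕ.≤-trans (ℕ.n≤1+n _) le))))))
    (trans (sym (*-assoc (Pr I J) _ _)) (trans (cong (_* p k) (Pr-fall I J le a b)) (*-identityˡ _))))

  module Context {m₀ : ℕ} (T J : Vec (Fin n) m₀) where

    -- The joint probability of σ ∙ I = I' and σ ∙ T = J for injective tuples, as `joint` shows.
    -- Each pair i, i' either repeats a pair of T, J or is new on both sides; m counts the values
    -- prescribed so far.
    Rw : ∀ {d} → ℕ → Vec (Fin n) d → Vec (Fin n) d → ℚ
    Rw m []      []        = p m
    Rw m (i ∷ I) (i' ∷ I') = match T J i i' * Rw m I I' + fresh T J i i' * Rw (suc m) I I'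

  open Context using (Rw)

  Rw-∷ : ∀ {m₀} (T J : Vec (Fin n) m₀) t j {d} m (I I' : Vec (Fin n) d) → (∀ a → ¬ lookup I a ≡ t) → (∀ a → ¬ lookup I' a ≡ j) →
    Rw (t ∷ T) (j ∷ J) m I I' ≡ Rw T J m I I'
  Rw-∷ T J t j m []      []        q q' = refl
  Rw-∷ T J t j m (i ∷ I) (i' ∷ I') q q' = cong₂ _+_
    (cong₂ _*_ (add0ˡ {b = match T J i i'} (mul0ˡ e₁)) (Rw-∷ T J t j m I I' (λ a → q (suc a)) (λ a → q' (suc a))))
    (cong₂ _*_ (cong₂ (λ x y → (1ℚ - x) * (1ℚ - y)) (add0ˡ {b = memb T i} e₁) (add0ˡ {b = memb J i'} e₂))
      (Rw-∷ T J t j (suc m) I I' (λ a → q (suc a)) (λ a → q' (suc a))))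
    where
    e₁ : 𝟙 (t ≟ i) ≡ 0ℚ
    e₁ = 𝟙-no (t ≟ i) λ e → q zero (sym e)
    e₂ : 𝟙 (j ≟ i') ≡ 0ℚ
    e₂ = 𝟙-no (j ≟ i') λ e → q' zero (sym e)

  joint : ∀ {m d} (T J : Vec (Fin n) m) (I I' : Vec (Fin n) d) → suc (suc (d ℕ.+ m)) ℕ.≤ n → InjV T → InjV J → InjV I → InjV I' →
    E (λ σ → 𝟙 (σ ∙ I ≟V I') * 𝟙 (σ ∙ T ≟V J)) ≡ Rw T J m I I'
  joint T J [] [] le a b c d = trans (PLF.ext 𝔾 λ σ → trans (cong (_* 𝟙 (σ ∙ T ≟V J)) (𝟙-yes (_≟V_ {n} [] []) refl)) (*-identityˡ _)) (Pr≡p T J le a b)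
  joint {m} {suc d} T J (i ∷ I) (i' ∷ I') le iT iJ iI iI' = go (any? (λ a → lookup T a ≟ i))
    where
    LHS = E (λ σ → 𝟙 (σ ∙ (i ∷ I) ≟V i' ∷ I') * 𝟙 (σ ∙ T ≟V J))
    RHS = Rw T J m (i ∷ I) (i' ∷ I')
    old : ∀ a → lookup T a ≡ i → LHS ≡ RHS
    old a e = trans (PLF.ext 𝔾 pt) (trans (PLF.scl 𝔾 (𝟙 (lookup J a ≟ i')) _) (trans (cong (𝟙 (lookup J a ≟ i') *_) ih)
          (sym (trans (add0ʳ (mul0ˡ fr)) (cong (_* Rw T J m I I') mt)))))
      where
      ih = joint T J I I' (ℕ.≤-trans (ℕ.n≤1+n _) le) iT iJ (InjV-tail {v = I} iI) (InjV-tail {v = I'} iI')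
      mt : match T J i i' ≡ 𝟙 (lookup J a ≟ i')
      mt = trans (cong (λ z → match T J z i') (sym e)) (sumF-hit {T = T} iT a λ b → 𝟙 (lookup J b ≟ i'))
      fr : fresh T J i i' ≡ 0ℚ
      fr = trans (cong (λ z → (1ℚ - z) * (1ℚ - memb J i')) (trans (cong (memb T) (sym e)) (memb-hit {T = T} iT a))) (l (memb J i'))
        where
        l : ∀ x → (1ℚ - 1ℚ) * (1ℚ - x) ≡ 0ℚ
        l = solve-∀ ringℚ
      pt : ∀ σ → 𝟙 (σ ∙ (i ∷ I) ≟V i' ∷ I') * 𝟙 (σ ∙ T ≟V J) ≡ 𝟙 (lookup J a ≟ i') * (𝟙 (σ ∙ I ≟V I') * 𝟙 (σ ∙ T ≟V J))
      pt σ = trans (cong (_* 𝟙 (σ ∙ T ≟V J)) (Σ-col σ i i' I I')) (by (σ ∙ T ≟V J))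
        where
        l : ∀ a b → (a * b) * 1ℚ ≡ a * (b * 1ℚ)
        l = solve-∀ ringℚ
        z : ∀ a b c → (a * b) * 0ℚ ≡ c * (b * 0ℚ)
        z = solve-∀ ringℚ
        by : (r : Dec (σ ∙ T ≡ J)) → (𝟙 (σ $ i ≟ i') * 𝟙 (σ ∙ I ≟V I')) * 𝟙 r ≡ 𝟙 (lookup J a ≟ i') * (𝟙 (σ ∙ I ≟V I') * 𝟙 r)
        by (yes r) = trans (l (𝟙 (σ $ i ≟ i')) (𝟙 (σ ∙ I ≟V I'))) (cong (_* (𝟙 (σ ∙ I ≟V I') * 1ℚ)) (cong (λ x → 𝟙 (x ≟ i')) (trans (cong (σ $_) (sym e)) (trans (sym (lookup-∙ σ T a)) (cong (λ v → lookup v a) r)))))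
        by (no r)  = z (𝟙 (σ $ i ≟ i')) (𝟙 (σ ∙ I ≟V I')) (𝟙 (lookup J a ≟ i'))
    clash : (∀ a → ¬ lookup T a ≡ i) → ∀ a → lookup J a ≡ i' → LHS ≡ RHS
    clash nT a e = trans (trans (PLF.ext 𝔾 pt) (PLF.zer 𝔾)) (sym (trans (add0ʳ (mul0ˡ fr)) (mul0ˡ mt)))
      where
      mt : match T J i i' ≡ 0ℚ
      mt = sumF-miss {T = T} nT λ b → 𝟙 (lookup J b ≟ i')
      fr : fresh T J i i' ≡ 0ℚ
      fr = trans (cong (λ z → (1ℚ - memb T i) * (1ℚ - z)) (trans (cong (memb J) (sym e)) (memb-hit {T = J} iJ a))) (l (memb T i))
        where
        l : ∀ x → (1ℚ - x) * (1ℚ - 1ℚ) ≡ 0ℚ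
        l = solve-∀ ringℚ
      pt : ∀ σ → 𝟙 (σ ∙ (i ∷ I) ≟V i' ∷ I') * 𝟙 (σ ∙ T ≟V J) ≡ 0ℚ
      pt σ = by (σ ∙ (i ∷ I) ≟V i' ∷ I') (σ ∙ T ≟V J)
        where
        by : (r : Dec (σ ∙ (i ∷ I) ≡ i' ∷ I')) (r' : Dec (σ ∙ T ≡ J)) → 𝟙 r * 𝟙 r' ≡ 0ℚ
        by (no _)  r'       = *-zeroˡ (𝟙 r')
        by (yes _) (no _)   = *-zeroʳ 1ℚ
        by (yes r) (yes r') = ⊥-elim (nT a ($-inj σ (trans (sym (lookup-∙ σ T a)) (trans (cong (λ v → lookup v a) r') (trans e (sym (∷-injectiveˡ r)))))))
    -- A new pair is moved from I, I' to T, J. Since I and I' are injective, no later pair can meet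
    -- it, and `Rw-∷` returns to the original T and J.
    new : (∀ a → ¬ lookup T a ≡ i) → (∀ a → ¬ lookup J a ≡ i') → LHS ≡ RHS
    new nT nJ = trans (PLF.ext 𝔾 λ σ → trans (cong (_* 𝟙 (σ ∙ T ≟V J)) (Σ-col σ i i' I I')) (trans (l (𝟙 (σ $ i ≟ i')) (𝟙 (σ ∙ I ≟V I')) (𝟙 (σ ∙ T ≟V J))) (cong (𝟙 (σ ∙ I ≟V I') *_) (sym (Σ-col σ i i' T J)))))
          (trans (joint (i ∷ T) (i' ∷ J) I I' (ℕ.≤-trans (ℕ.≤-reflexive (cong (λ z → suc (suc z)) (ℕ.+-suc d m))) le) (InjV-∷ {v = T} nT iT) (InjV-∷ {v = J} nJ iJ) (InjV-tail {v = I} iI) (InjV-tail {v = I'} iI'))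
            (trans (Rw-∷ T J i i' (suc m) I I' (InjV-head {v = I} iI) (InjV-head {v = I'} iI'))
              (sym (trans (add0ˡ (mul0ˡ (sumF-miss {T = T} nT λ b → 𝟙 (lookup J b ≟ i'))))
                (mul1ˡ (trans (cong₂ (λ x y → (1ℚ - x) * (1ℚ - y)) (memb-miss {T = T} nT) (memb-miss {T = J} nJ)) (o 0ℚ)))))))
      where
      l : ∀ a b c → (a * b) * c ≡ b * (a * c)
      l = solve-∀ ringℚ
      o : ∀ z → (1ℚ - 0ℚ) * (1ℚ - 0ℚ) ≡ 1ℚ
      o _ = refl
    inner : (∀ a → ¬ lookup T a ≡ i) → Dec (∃ λ a → lookup J a ≡ i') → LHS ≡ RHS
    inner nT (yes (a , e)) = clash nT a e
    inner nT (no nJ)       = new nT λ a e → nJ (a , e)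
    go : Dec (∃ λ a → lookup T a ≡ i) → LHS ≡ RHS
    go (yes (a , e)) = old a e
    go (no nT)       = inner (λ a e → nT (a , e)) (any? (λ a → lookup J a ≟ i'))

  Kernel : ℕ → Set
  Kernel d = Vec (Fin n) d → Vec (Fin n) d → ℚ

  sumVV : ∀ {d} → Kernel d → ℚ
  sumVV Y = sumV λ I → sumV λ J → Y I J

  KP : ∀ d → PLF (Vec (Fin n) d × Vec (Fin n) d)
  KP d = vecP n d ⊗ vecP n d

  -- At every position, summing over the row entry alone or over the column entry alone gives 0. By
  -- `Harm-M` this is how orthogonality to fewer values appears in the matrix.
  Harm : ∀ d → Kernel d → Set
  Harm zero    Y = ⊤
  Harm (suc d) Y = (∀ j I J → sumF (λ i → Y (i ∷ I) (j ∷ J)) ≡ 0ℚ) × (∀ i I J → sumF (λ j → Y (i ∷ I) (j ∷ J)) ≡ 0ℚ) × (∀ i j → Harm d λ I J → Y (i ∷ I) (j ∷ J))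

  Harm-ext : ∀ d {Y Z : Kernel d} → (∀ I J → Y I J ≡ Z I J) → Harm d Y → Harm d Z
  Harm-ext zero    e h = tt
  Harm-ext (suc d) e (a , b , c) = (λ j I J → trans (PLF.ext (finP n) λ i → sym (e (i ∷ I) (j ∷ J))) (a j I J)) , (λ i I J → trans (PLF.ext (finP n) λ j → sym (e (i ∷ I) (j ∷ J))) (b i I J)) ,
    λ i j → Harm-ext d (λ I J → e (i ∷ I) (j ∷ J)) (c i j)

  Perp-head : ∀ {d z} → Perp (suc d) z → ∀ i j → Perp d (λ σ → z σ * 𝟙 (σ $ i ≟ j))
  Perp-head {z = z} q i j I J = trans (sym (M-head z i j I J)) (q (i ∷ I) (j ∷ J))

  Harm-M : ∀ d z → Perp d z → Harm (suc d) (M z)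
  Harm-M d z q = (λ j I J → trans (M-row z j I J) (q I J)) , (λ i I J → trans (M-col z i I J) (q I J)) , sub d q
    where
    sub : ∀ d → Perp d z → ∀ i j → Harm d λ I J → M z (i ∷ I) (j ∷ J)
    sub zero    q i j = tt
    sub (suc d) q i j = Harm-ext (suc d) (λ I J → sym (M-head z i j I J)) (Harm-M d (λ σ → z σ * 𝟙 (σ $ i ≟ j)) (Perp-head {z = z} q i j))

  module Elimination {m₀ : ℕ} (T J : Vec (Fin n) m₀) where

    sub : ∀ {d} → Vec (Fin n) m₀ → Vec (Fin m₀) d → Vec (Fin n) d
    sub T f = map (lookup T) f

    elim-match : (y : Fin n → Fin n → ℚ) → sumF (λ i → sumF λ j → match T J i j * y i j) ≡ sumF λ a → y (lookup T a) (lookup J a)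
    elim-match y = begin
        sumF (λ i → sumF λ j → match T J i j * y i j)
          ≡⟨ PLF.ext (finP n) (λ i → PLF.ext (finP n) λ j → sym (PLF.sclr (finP m₀) (y i j) _)) ⟩
        sumF (λ i → sumF λ j → sumF λ b → (𝟙 (lookup T b ≟ i) * 𝟙 (lookup J b ≟ j)) * y i j)
          ≡⟨ PLF.ext (finP n) (λ i → finP-fin m₀ (finP n) λ b j → (𝟙 (lookup T b ≟ i) * 𝟙 (lookup J b ≟ j)) * y i j) ⟩
        sumF (λ i → sumF λ b → sumF λ j → (𝟙 (lookup T b ≟ i) * 𝟙 (lookup J b ≟ j)) * y i j)
          ≡⟨ finP-fin m₀ (finP n) (λ b i → sumF λ j → (𝟙 (lookup T b ≟ i) * 𝟙 (lookup J b ≟ j)) * y i j) ⟩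
        sumF (λ b → sumF λ i → sumF λ j → (𝟙 (lookup T b ≟ i) * 𝟙 (lookup J b ≟ j)) * y i j)
          ≡⟨ PLF.ext (finP m₀) (λ b → trans (PLF.ext (finP n) λ i → trans (PLF.ext (finP n) λ j → *-assoc (𝟙 (lookup T b ≟ i)) _ _) (trans (PLF.scl (finP n) (𝟙 (lookup T b ≟ i)) _)
               (cong₂ _*_ (𝟙-cong (lookup T b ≟ i) (i ≟ lookup T b) sym sym) (trans (PLF.ext (finP n) λ j → cong (_* y i j) (𝟙-cong (lookup J b ≟ j) (j ≟ lookup J b) sym sym)) (sumF-δ (lookup J b) (y i))))))
               (sumF-δ (lookup T b) λ i → y i (lookup J b))) ⟩
        sumF (λ a → y (lookup T a) (lookup J a)) ∎
      where open ≡-Reasoning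

    -- The key exchange: multiplying out (1 - memb) (1 - memb), every term that leaves i or j
    -- unrestricted vanishes by harmonicity, so the sum over points outside T and J equals a sum
    -- over the points inside.
    elim-fresh : (y : Fin n → Fin n → ℚ) → (∀ j → sumF (λ i → y i j) ≡ 0ℚ) → (∀ i → sumF (y i) ≡ 0ℚ) →
      sumF (λ i → sumF λ j → fresh T J i j * y i j) ≡ sumF λ a → sumF λ b → y (lookup T a) (lookup J b)
    elim-fresh y r c = begin
        sumF (λ i → sumF λ j → fresh T J i j * y i j)
          ≡⟨ PLF.ext (finP n) (λ i → trans (PLF.ext (finP n) λ j → l₁ (memb T i) (memb J j) (y i j)) (trans (PLF.add (finP n) _ _) (cong₂ _+_ (trans (PLF.scl (finP n) (1ℚ - memb T i) (y i)) (mul0ʳ {1ℚ - memb T i} (c i))) refl))) ⟩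
        sumF (λ i → 0ℚ + sumF λ j → (memb T i - 1ℚ) * (memb J j * y i j))
          ≡⟨ PLF.ext (finP n) (λ i → trans (+-identityˡ _) (trans (PLF.scl (finP n) (memb T i - 1ℚ) _) (trans (cong ((memb T i - 1ℚ) *_) (sumF-memb J (y i))) (l₂ (memb T i) (B i))))) ⟩
        sumF (λ i → memb T i * B i - B i)
          ≡⟨ trans (PLF.sub (finP n) _ _) (cong₂ _-_ (sumF-memb T B) (trans (sym (finP-fin n (finP m₀) λ i b → y i (lookup J b))) (trans (PLF.ext (finP m₀) λ b → r (lookup J b)) (PLF.zer (finP m₀))))) ⟩
        sumF (λ a → B (lookup T a)) - 0ℚ
          ≡⟨ +-identityʳ _ ⟩
        sumF (λ a → sumF λ b → y (lookup T a) (lookup J b)) ∎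
      where
      open ≡-Reasoning
      B : Fin n → ℚ
      B i = sumF λ b → y i (lookup J b)
      l₁ : ∀ t j y → (1ℚ - t) * (1ℚ - j) * y ≡ (1ℚ - t) * y + (t - 1ℚ) * (j * y)
      l₁ = solve-∀ ringℚ
      l₂ : ∀ t b → (t - 1ℚ) * b ≡ t * b - b
      l₂ = solve-∀ ringℚ

    Ω : ∀ {d} → ℕ → Vec (Fin m₀) d → Vec (Fin m₀) d → ℚ
    Ω m []      []      = p m
    Ω m (a ∷ f) (b ∷ g) = 𝟙 (a ≟ b) * Ω m f g + Ω (suc m) f g

    -- A sum over all pairs of d-tuples of points collapses to a sum over maps f and g into the
    -- positions of T and J, whose number does not depend on n. The weights `Ω` record at each
    -- position whether a match or a fresh pair was eliminated.
    eliminate : ∀ d m (Y : Kernel d) → Harm d Y → sumVV (λ I I' → Y I I' * Rw T J m I I') ≡ sumV λ f → sumV λ g → Ω m f g * Y (sub T f) (sub J g)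
    eliminate zero    m Y h = *-comm (Y [] []) (p m)
    eliminate (suc d) m Y (r , c , h) = begin
        sumF (λ i → sumV λ I → sumF λ j → sumV λ I' → Y (i ∷ I) (j ∷ I') * Rw T J m (i ∷ I) (j ∷ I'))
          ≡⟨ PLF.ext (finP n) (λ i → finP-fin n (vecP n d) λ j I → sumV λ I' → Y (i ∷ I) (j ∷ I') * Rw T J m (i ∷ I) (j ∷ I')) ⟩
        sumF (λ i → sumF λ j → sumVV λ I I' → Y (i ∷ I) (j ∷ I') * (match T J i j * Rw T J m I I' + fresh T J i j * Rw T J (suc m) I I'))
          ≡⟨ PLF.ext (finP n) (λ i → PLF.ext (finP n) λ j → trans (PLF.ext (KP d) λ { (I , I') → l (Y (i ∷ I) (j ∷ I')) (match T J i j) (Rw T J m I I') (fresh T J i j) (Rw T J (suc m) I I') })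
               (trans (PLF.add (KP d) _ _) (cong₂ _+_ (PLF.scl (KP d) (match T J i j) _) (PLF.scl (KP d) (fresh T J i j) _)))) ⟩
        sumF (λ i → sumF λ j → match T J i j * A m i j + fresh T J i j * A (suc m) i j)
          ≡⟨ trans (PLF.ext (finP n) λ i → PLF.add (finP n) _ _) (PLF.add (finP n) _ _) ⟩
        sumF (λ i → sumF λ j → match T J i j * A m i j) + sumF (λ i → sumF λ j → fresh T J i j * A (suc m) i j)
          ≡⟨ cong₂ _+_ (elim-match (A m)) (elim-fresh (A (suc m)) rA cA) ⟩
        sumF (λ a → A m (lookup T a) (lookup J a)) + sumF (λ a → sumF λ b → A (suc m) (lookup T a) (lookup J b))
          ≡⟨ cong (_+ sumF (λ a → sumF λ b → A (suc m) (lookup T a) (lookup J b))) (PLF.ext (finP m₀) λ a → sym (trans (PLF.ext (finP m₀) λ b → cong (_* A m (lookup T a) (lookup J b)) (𝟙-cong (a ≟ b) (b ≟ a) sym sym)) (sumF-δ a λ b → A m (lookup T a) (lookup J b)))) ⟩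
        sumF (λ a → sumF λ b → 𝟙 (a ≟ b) * A m (lookup T a) (lookup J b)) + sumF (λ a → sumF λ b → A (suc m) (lookup T a) (lookup J b))
          ≡⟨ sym (trans (PLF.ext (finP m₀) λ a → PLF.add (finP m₀) _ _) (PLF.add (finP m₀) _ _)) ⟩
        sumF (λ a → sumF λ b → 𝟙 (a ≟ b) * A m (lookup T a) (lookup J b) + A (suc m) (lookup T a) (lookup J b))
          ≡⟨ PLF.ext (finP m₀) (λ a → PLF.ext (finP m₀) λ b → cong₂ (λ x y → 𝟙 (a ≟ b) * x + y) (eliminate d m _ (h _ _)) (eliminate d (suc m) _ (h _ _))) ⟩
        sumF (λ a → sumF λ b → 𝟙 (a ≟ b) * sumV (λ f → sumV λ g → Ω m f g * Z a b f g) + sumV (λ f → sumV λ g → Ω (suc m) f g * Z a b f g))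
          ≡⟨ PLF.ext (finP m₀) (λ a → PLF.ext (finP m₀) λ b → sym (trans (PLF.ext (vecP m₀ d ⊗ vecP m₀ d) λ { (f , g) → l' (𝟙 (a ≟ b)) (Ω m f g) (Ω (suc m) f g) (Z a b f g) }) (trans (PLF.add (vecP m₀ d ⊗ vecP m₀ d) _ _) (cong (_+ sumV (λ f → sumV λ g → Ω (suc m) f g * Z a b f g)) (PLF.scl (vecP m₀ d ⊗ vecP m₀ d) (𝟙 (a ≟ b)) _))))) ⟩
        sumF (λ a → sumF λ b → sumV λ f → sumV λ g → (𝟙 (a ≟ b) * Ω m f g + Ω (suc m) f g) * Z a b f g)
          ≡⟨ PLF.ext (finP m₀) (λ a → sym (finP-fin m₀ (vecP m₀ d) λ b f → sumV λ g → (𝟙 (a ≟ b) * Ω m f g + Ω (suc m) f g) * Z a b f g)) ⟩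
        sumF (λ a → sumV λ f → sumF λ b → sumV λ g → Ω m (a ∷ f) (b ∷ g) * Y (sub T (a ∷ f)) (sub J (b ∷ g))) ∎
      where
      open ≡-Reasoning
      A : ℕ → Fin n → Fin n → ℚ
      A m i j = sumVV λ I I' → Y (i ∷ I) (j ∷ I') * Rw T J m I I'
      Z : Fin m₀ → Fin m₀ → Vec (Fin m₀) d → Vec (Fin m₀) d → ℚ
      Z a b f g = Y (lookup T a ∷ sub T f) (lookup J b ∷ sub J g)
      l : ∀ y a b c e → y * (a * b + c * e) ≡ a * (y * b) + c * (y * e)
      l = solve-∀ ringℚ
      l' : ∀ i a b z → (i * a + b) * z ≡ i * (a * z) + b * z
      l' = solve-∀ ringℚ
      rA : ∀ j → sumF (λ i → A (suc m) i j) ≡ 0ℚ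
      rA j = trans (sym (finP-fin n (KP d) λ { i (I , I') → Y (i ∷ I) (j ∷ I') * Rw T J (suc m) I I' })) (trans (PLF.ext (KP d) λ { (I , I') → trans (PLF.sclr (finP n) _ _) (mul0ˡ (r j I I')) }) (PLF.zer (KP d)))
      cA : ∀ i → sumF (λ j → A (suc m) i j) ≡ 0ℚ
      cA i = trans (sym (finP-fin n (KP d) λ { j (I , I') → Y (i ∷ I) (j ∷ I') * Rw T J (suc m) I I' })) (trans (PLF.ext (KP d) λ { (I , I') → trans (PLF.sclr (finP n) _ _) (mul0ˡ (c i I I')) }) (PLF.zer (KP d)))

    -- What is left of `Ω` after the diagonal term in which every pair was a match. At least one
    -- fresh pair occurred, so `p (suc m)` bounds it instead of `p m`: a gain of order 1/n.
    ω : ∀ {d} → ℕ → Vec (Fin m₀) d → Vec (Fin m₀) d → ℚ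
    ω m []      []      = 0ℚ
    ω m (a ∷ f) (b ∷ g) = 𝟙 (a ≟ b) * ω m f g + Ω (suc m) f g

    Ω-split : ∀ {d} m (f g : Vec (Fin m₀) d) → Ω m f g ≡ 𝟙 (f ≟V g) * p m + ω m f g
    Ω-split m []      []      = sym (trans (+-identityʳ _) (trans (cong (_* p m) (𝟙-yes (_≟V_ {m₀} [] []) refl)) (*-identityˡ (p m))))
    Ω-split m (a ∷ f) (b ∷ g) = trans (cong (λ z → 𝟙 (a ≟ b) * z + Ω (suc m) f g) (Ω-split m f g)) (trans (l (𝟙 (a ≟ b)) (𝟙 (f ≟V g)) (p m) (ω m f g) (Ω (suc m) f g)) (cong (λ z → z * p m + (𝟙 (a ≟ b) * ω m f g + Ω (suc m) f g)) (sym (𝟙-∷ a b f g))))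
      where
      l : ∀ i j p w o → i * (j * p + w) + o ≡ (i * j) * p + (i * w + o)
      l = solve-∀ ringℚ

    0≤Ω : ∀ {d} m (f g : Vec (Fin m₀) d) → 0ℚ ≤ Ω m f g
    0≤Ω m []      []      = 0≤p m
    0≤Ω m (a ∷ f) (b ∷ g) = 0≤+ (0≤* (0≤𝟙 (a ≟ b)) (0≤Ω m f g)) (0≤Ω (suc m) f g)

    𝟙*≤ : ∀ {P : Set} (q : Dec P) {x} → 0ℚ ≤ x → 𝟙 q * x ≤ x
    𝟙*≤ q {x} 0≤x = ≤-trans (*-monoˡ 0≤x (𝟙≤1 q)) (≤-reflexive (*-identityˡ x))

    Ω≤ : ∀ {d} m (f g : Vec (Fin m₀) d) → Ω m f g ≤ two^ d * p m
    Ω≤ m []      []      = ≤-reflexive (sym (*-identityˡ _))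
    Ω≤ {suc d} m (a ∷ f) (b ∷ g) = ≤-trans (+-mono-≤ (≤-trans (𝟙*≤ (a ≟ b) (0≤Ω m f g)) (Ω≤ m f g)) (≤-trans (Ω≤ (suc m) f g) (*-monoʳ (0≤two^ d) (p-dec m)))) (≤-reflexive (sym (*-distribʳ-+ (p m) (two^ d) (two^ d))))

    0≤ω : ∀ {d} m (f g : Vec (Fin m₀) d) → 0ℚ ≤ ω m f g
    0≤ω m []      []      = ≤-refl
    0≤ω m (a ∷ f) (b ∷ g) = 0≤+ (0≤* (0≤𝟙 (a ≟ b)) (0≤ω m f g)) (0≤Ω (suc m) f g)

    ω≤ : ∀ {d} m (f g : Vec (Fin m₀) d) → ω m f g ≤ two^ d * p (suc m)
    ω≤ m []      []      = 0≤* 0≤1 (0≤p (suc m))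
    ω≤ {suc d} m (a ∷ f) (b ∷ g) = ≤-trans (+-mono-≤ (≤-trans (𝟙*≤ (a ≟ b) (0≤ω m f g)) (ω≤ m f g)) (Ω≤ (suc m) f g)) (≤-reflexive (sym (*-distribʳ-+ (p (suc m)) (two^ d) (two^ d))))

module FrameInequalities (n : ℕ) where
  open Alternating n
  open TupleCalculus n
  open FrameBounds n
  open Context using (Rw)
  open Elimination using (sub; Ω; ω; eliminate; Ω-split; ω≤; 0≤ω)

  -- A repeated entry makes the last d values determine the first one, so the coefficient is a
  -- multiple of one for a d-tuple, to which z is orthogonal.
  ¬inj-row : ∀ d z (I J : Vec (Fin n) (suc d)) → Perp d z → ¬ InjV I → M z I J ≡ 0ℚ
  ¬inj-row d z (i ∷ I) (j ∷ J) q ni = go (any? (λ a → lookup I a ≟ i))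
    where
    rep : ∀ a → lookup I a ≡ i → M z (i ∷ I) (j ∷ J) ≡ 0ℚ
    rep a e = trans (PLF.ext 𝔾 pt) (trans (PLF.scl 𝔾 (𝟙 (lookup J a ≟ j)) _) (mul0ʳ {𝟙 (lookup J a ≟ j)} (q I J)))
      where
      by : ∀ σ (r : Dec (σ ∙ I ≡ J)) → z σ * (𝟙 (σ $ i ≟ j) * 𝟙 r) ≡ 𝟙 (lookup J a ≟ j) * (z σ * 𝟙 r)
      by σ (no _) = l (z σ) (𝟙 (σ $ i ≟ j)) (𝟙 (lookup J a ≟ j))
        where
        l : ∀ z a b → z * (a * 0ℚ) ≡ b * (z * 0ℚ)
        l = solve-∀ ringℚ
      by σ (yes r) = trans (l (z σ) (𝟙 (σ $ i ≟ j))) (cong (λ x → 𝟙 (x ≟ j) * (z σ * 1ℚ)) (trans (cong (σ $_) (sym e)) (trans (sym (lookup-∙ σ I a)) (cong (λ v → lookup v a) r))))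
        where
        l : ∀ z a → z * (a * 1ℚ) ≡ a * (z * 1ℚ)
        l = solve-∀ ringℚ
      pt : ∀ σ → z σ * 𝟙 (σ ∙ (i ∷ I) ≟V j ∷ J) ≡ 𝟙 (lookup J a ≟ j) * (z σ * 𝟙 (σ ∙ I ≟V J))
      pt σ = trans (cong (z σ *_) (Σ-col σ i j I J)) (by σ (σ ∙ I ≟V J))
    tail : ∀ d (I J : Vec (Fin n) d) → Perp d z → ¬ InjV I → M z (i ∷ I) (j ∷ J) ≡ 0ℚ
    tail zero    []  []  q ni = ⊥-elim (ni λ {a} → ⊥-elim (noFin a))
      where
      noFin : ¬ Fin 0
      noFin ()
    tail (suc d) I J q ni = trans (M-head z i j I J) (¬inj-row d (λ σ → z σ * 𝟙 (σ $ i ≟ j)) I J (Perp-head {z = z} q i j) ni)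
    go : Dec (∃ λ a → lookup I a ≡ i) → M z (i ∷ I) (j ∷ J) ≡ 0ℚ
    go (yes (a , e)) = rep a e
    go (no nI) = tail d I J q λ p → ni (InjV-∷ {v = I} (λ a e → nI (a , e)) p)

  ¬inj-col : ∀ d z (I J : Vec (Fin n) (suc d)) → Perp d z → ¬ InjV J → M z I J ≡ 0ℚ
  ¬inj-col d z I J q nj = go (decInj I)
    where
    go : Dec (InjV I) → M z I J ≡ 0ℚ
    go (no ni)  = ¬inj-row d z I J q ni
    go (yes iI) = trans (PLF.ext 𝔾 λ σ → mul0ʳ {z σ} (𝟙-no (σ ∙ I ≟V J) λ e → nj (subst InjV e (InjV-∙ σ I iI)))) (PLF.zer 𝔾)

  -- S z is the sum over all d-tuples T of rows of the unnormalised conditional expectation of z given σ on T.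
  S : ∀ d → (El → ℚ) → El → ℚ
  S d z σ = sumV {n} {d} λ I → M z I (σ ∙ I)

  -- As a weighted average of right translates of z, `S d z` inherits every orthogonality relation
  -- `Perp e`.
  S-avg : ∀ d z σ → S d z σ ≡ E λ g → sumV {n} {d} (λ I → 𝟙 (g ∙ I ≟V I)) * z (σ · g)
  S-avg d z σ = trans (PLF.ext (vecP n d) λ I → trans (sym (E-left σ λ τ → z τ * 𝟙 (τ ∙ I ≟V σ ∙ I)))
      (PLF.ext 𝔾 λ g → trans (cong (z (σ · g) *_) (𝟙-cong ((σ · g) ∙ I ≟V σ ∙ I) (g ∙ I ≟V I)
        (λ e → trans (sym (⁻¹-∙ σ (g ∙ I))) (trans (cong (σ ⁻¹ ∙_) (trans (sym (·-∙ σ g I)) e)) (⁻¹-∙ σ I))) (λ e → trans (·-∙ σ g I) (cong (σ ∙_) e)))) (*-comm (z (σ · g)) _)))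
    (trans (sym (vecP-fin n d 𝔾 λ I g → 𝟙 (g ∙ I ≟V I) * z (σ · g))) (PLF.ext 𝔾 λ g → PLF.sclr (vecP n d) (z (σ · g)) _))

  Perp-S : ∀ d {e z} → Perp e z → Perp e (S d z)
  Perp-S d {z = z} q T J = begin
      E (λ σ → S d z σ * 𝟙 (σ ∙ T ≟V J))
        ≡⟨ PLF.ext 𝔾 (λ σ → trans (cong (_* 𝟙 (σ ∙ T ≟V J)) (S-avg d z σ)) (trans (sym (PLF.sclr 𝔾 (𝟙 (σ ∙ T ≟V J)) _)) (PLF.ext 𝔾 λ g → *-assoc (K g) _ _))) ⟩
      E (λ σ → E λ g → K g * (z (σ · g) * 𝟙 (σ ∙ T ≟V J)))
        ≡⟨ 𝔾-fin 𝔾 (λ g σ → K g * (z (σ · g) * 𝟙 (σ ∙ T ≟V J))) ⟩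
      E (λ g → E λ σ → K g * (z (σ · g) * 𝟙 (σ ∙ T ≟V J)))
        ≡⟨ PLF.ext 𝔾 (λ g → trans (PLF.scl 𝔾 (K g) _) (mul0ʳ {K g} (Perp-R {z = z} g q T J))) ⟩
      E (λ g → 0ℚ)
        ≡⟨ PLF.zer 𝔾 ⟩
      0ℚ ∎
    where
    open ≡-Reasoning
    K : El → ℚ
    K g = sumV {n} {d} λ I → 𝟙 (g ∙ I ≟V I)

  N : ∀ d → (El → ℚ) → ℚ
  N d z = sumVV {d} λ T J → M z T J * M z T J

  0≤N : ∀ d z → 0ℚ ≤ N d z
  0≤N d z = PLF.sqs (KP d) λ { (T , J) → M z T J }

  -- `S` is `M` followed by its adjoint, that is, the frame operator of the indicators 1[σ ∙ I = J].
  S-sq : ∀ d z y → E (λ σ → S d z σ * y σ) ≡ sumVV {d} λ T J → M z T J * M y T J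
  S-sq d z y = E-kernel (M z {d}) y

  -- The value is d!. It is the number of equal diagonal terms in `main-formula`.
  injections : ℕ → ℚ
  injections d = sumV {d} {d} λ f → 𝟙 (decInj f)

  1≤injections : ∀ d → 1ℚ ≤ injections d
  1≤injections d = ≤-trans (≤-reflexive (sym (trans (PLF.ext (vecP d d) λ f → sym (*-identityʳ _)) (sumV-δ (allFin d) λ _ → 1ℚ)))) (PLF.mono (vecP d d) λ f → le f (f ≟V allFin d))
    where
    idInj : InjV (allFin d)
    idInj {i} {j} e = trans (sym (lookup-allFin i)) (trans e (lookup-allFin j))
    le : ∀ f (r : Dec (f ≡ allFin d)) → 𝟙 r ≤ 𝟙 (decInj f)
    le f (no _)     = 0≤𝟙 (decInj f)
    le f (yes refl) = ≤-reflexive (sym (𝟙-yes (decInj f) idInj))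

  tuples : ℕ → ℚ
  tuples d = sumV {d} {d} λ f → 1ℚ

  0≤tuples : ∀ d → 0ℚ ≤ tuples d
  0≤tuples d = PLF.nonneg (vecP d d) λ _ → 0≤1

  map-lookup : ∀ {d k} (T : Vec (Fin n) d) (f : Vec (Fin d) k) i → lookup (map (lookup T) f) i ≡ lookup T (lookup f i)
  map-lookup T f i = lookup-map i (lookup T) f

  ∙-sub : ∀ {d k} σ (T : Vec (Fin n) d) (f : Vec (Fin d) k) → σ ∙ map (lookup T) f ≡ map (lookup (σ ∙ T)) f
  ∙-sub σ T []      = refl
  ∙-sub σ T (a ∷ f) = cong₂ _∷_ (sym (lookup-∙ σ T a)) (∙-sub σ T f)

  ¬inj-sub : ∀ {d k} (T : Vec (Fin n) d) (f : Vec (Fin d) k) → ¬ InjV f → ¬ InjV (map (lookup T) f)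
  ¬inj-sub T f nf p = nf λ {i} {j} e → p (trans (map-lookup T f i) (trans (cong (lookup T) e) (sym (map-lookup T f j))))

  sub-cancel : ∀ {d} (T U : Vec (Fin n) d) (f : Vec (Fin d) d) → InjV f → map (lookup T) f ≡ map (lookup U) f → T ≡ U
  sub-cancel T U f p e = lookup-ext λ a → let (b , fb) = inj⇒surj p a in
    trans (cong (lookup T) (sym fb)) (trans (sym (map-lookup T f b)) (trans (cong (λ v → lookup v b) e) (trans (map-lookup U f b) (cong (lookup U) fb))))

  M-perm : ∀ {d} z (T J : Vec (Fin n) d) (f : Vec (Fin d) d) → InjV f → M z (map (lookup T) f) (map (lookup J) f) ≡ M z T J
  M-perm z T J f p = PLF.ext 𝔾 λ σ → cong (z σ *_) (𝟙-cong (σ ∙ map (lookup T) f ≟V map (lookup J) f) (σ ∙ T ≟V J)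
    (λ e → sub-cancel (σ ∙ T) J f p (trans (sym (∙-sub σ T f)) e)) (λ e → trans (∙-sub σ T f) (cong (λ v → map (lookup v) f) e)))

  sum-sub : ∀ {d} (f : Vec (Fin d) d) → InjV f → ∀ (F : Vec (Fin n) d → ℚ) → sumV (λ T → F (map (lookup T) f)) ≡ sumV F
  sum-sub {d} f p F = begin
      sumV (λ T → F (map (lookup T) f))
        ≡⟨ PLF.ext (vecP n d) (λ T → sym (sumV-δ (map (lookup T) f) F)) ⟩
      sumV (λ T → sumV λ U → 𝟙 (U ≟V map (lookup T) f) * F U)
        ≡⟨ vecP-fin n d (vecP n d) (λ U T → 𝟙 (U ≟V map (lookup T) f) * F U) ⟩
      sumV (λ U → sumV λ T → 𝟙 (U ≟V map (lookup T) f) * F U)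
        ≡⟨ PLF.ext (vecP n d) (λ U → PLF.ext (vecP n d) λ T → cong (_* F U) (𝟙-cong (U ≟V map (lookup T) f) (T ≟V g U)
             (λ e → sub-cancel T (g U) f p (trans (sym e) (sym (gf U)))) (λ e → trans (sym (gf U)) (cong (λ v → map (lookup v) f) (sym e))))) ⟩
      sumV (λ U → sumV λ T → 𝟙 (T ≟V g U) * F U)
        ≡⟨ PLF.ext (vecP n d) (λ U → sumV-δ (g U) λ _ → F U) ⟩
      sumV F ∎
    where
    open ≡-Reasoning
    g : Vec (Fin n) d → Vec (Fin n) d
    g U = Data.Vec.tabulate λ a → lookup U (proj₁ (inj⇒surj p a))
      where import Data.Vec
    gf : ∀ U → map (lookup (g U)) f ≡ U
    gf U = lookup-ext λ i → trans (map-lookup (g U) f i) (trans (Data.Vec.Properties.lookup∘tabulate _ (lookup f i)) (cong (lookup U) (p (proj₂ (inj⇒surj p (lookup f i))))))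
      where import Data.Vec.Properties

  -- k is kept abstract (rather than written suc d) so that sums over k-tuples do not unfold.
  module Main (d k : ℕ) (k≡ : k ≡ suc d) (2d≤n : suc (suc (k ℕ.+ k)) ℕ.≤ n) where

    row : ∀ z (I J : Vec (Fin n) k) → Perp d z → ¬ InjV I → M z I J ≡ 0ℚ
    row z = go k≡
      where
      go : ∀ {k} → k ≡ suc d → (I J : Vec (Fin n) k) → Perp d z → ¬ InjV I → M z I J ≡ 0ℚ
      go refl = ¬inj-row d z

    col : ∀ z (I J : Vec (Fin n) k) → Perp d z → ¬ InjV J → M z I J ≡ 0ℚ
    col z = go k≡
      where
      go : ∀ {k} → k ≡ suc d → (I J : Vec (Fin n) k) → Perp d z → ¬ InjV J → M z I J ≡ 0ℚ
      go refl = ¬inj-col d z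

    harm : ∀ z → Perp d z → Harm k (M z)
    harm z = go k≡
      where
      go : ∀ {k} → k ≡ suc d → Perp d z → Harm k (M z)
      go refl = Harm-M d z

    errK : (El → ℚ) → Kernel k
    errK z T J = sumV {k} {k} λ f → sumV {k} {k} λ g → ω T J k f g * M z (map (lookup T) f) (map (lookup J) g)

    κ = injections k

    -- By `joint` and `eliminate`, M (S z) T J combines entries of M z at rearrangements of T and J.
    -- The pairs f = g with f injective all give M z T J itself (`M-perm`), those with f not
    -- injective give 0, and `ω` collects the remainder. So S acts almost as the scalar p κ.
    main-formula : ∀ z → Perp d z → ∀ (T J : Vec (Fin n) k) → InjV T → InjV J → M (S k z) T J ≡ p k * κ * M z T J + errK z T J
    main-formula z q T J iT iJ = begin
        M (S k z) T J
          ≡⟨ E-kernel (M z {k}) (λ σ → 𝟙 (σ ∙ T ≟V J)) ⟩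
        sumVV {k} (λ I I' → M z I I' * E λ σ → 𝟙 (σ ∙ T ≟V J) * 𝟙 (σ ∙ I ≟V I'))
          ≡⟨ PLF.ext (KP k) (λ { (I , I') → pt I I' (decInj I) (decInj I') }) ⟩
        sumVV {k} (λ I I' → M z I I' * Rw T J k I I')
          ≡⟨ eliminate T J k k (M z) (harm z q) ⟩
        sumV {k} {k} (λ f → sumV {k} {k} λ g → Ω T J k f g * Y f g)
          ≡⟨ PLF.ext FP (λ { (f , g) → trans (cong (_* Y f g) (Ω-split T J k f g)) (l (𝟙 (f ≟V g)) (p k) (ω T J k f g) (Y f g)) }) ⟩
        sumV {k} {k} (λ f → sumV {k} {k} λ g → p k * (𝟙 (f ≟V g) * Y f g) + ω T J k f g * Y f g)
          ≡⟨ trans (PLF.add FP _ _) (cong (_+ errK z T J) (trans (PLF.scl FP (p k) _) (cong (p k *_) (trans (PLF.ext (vecP k k) λ f → sumV-δ' f (Y f)) (trans (PLF.ext (vecP k k) λ f → diag f (decInj f)) (PLF.sclr (vecP k k) (M z T J) _)))))) ⟩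
        p k * (κ * M z T J) + errK z T J
          ≡⟨ cong (_+ errK z T J) (sym (*-assoc (p k) κ (M z T J))) ⟩
        p k * κ * M z T J + errK z T J ∎
      where
      open ≡-Reasoning
      FP = vecP k k ⊗ vecP k k
      Y : Vec (Fin k) k → Vec (Fin k) k → ℚ
      Y f g = M z (map (lookup T) f) (map (lookup J) g)
      l : ∀ i p w y → (i * p + w) * y ≡ p * (i * y) + w * y
      l = solve-∀ ringℚ
      pt : ∀ I I' → Dec (InjV I) → Dec (InjV I') → M z I I' * E (λ σ → 𝟙 (σ ∙ T ≟V J) * 𝟙 (σ ∙ I ≟V I')) ≡ M z I I' * Rw T J k I I'
      pt I I' (no ni) _        = trans (mul0ˡ {M z I I'} (row z I I' q ni)) (sym (mul0ˡ {M z I I'} (row z I I' q ni)))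
      pt I I' (yes _) (no ni)  = trans (mul0ˡ {M z I I'} (col z I I' q ni)) (sym (mul0ˡ {M z I I'} (col z I I' q ni)))
      pt I I' (yes a) (yes b)  = cong (M z I I' *_) (trans (PLF.ext 𝔾 λ σ → *-comm (𝟙 (σ ∙ T ≟V J)) (𝟙 (σ ∙ I ≟V I'))) (joint T J I I' 2d≤n iT iJ a b))
      diag : ∀ f (r : Dec (InjV f)) → Y f f ≡ 𝟙 r * M z T J
      diag f (yes r) = trans (M-perm z T J f r) (sym (*-identityˡ _))
      diag f (no r)  = trans (row z (map (lookup T) f) (map (lookup J) f) q (¬inj-sub T f r)) (sym (*-zeroˡ (M z T J)))

    β = two^ k * p (suc k)

    0≤β : 0ℚ ≤ β
    0≤β = 0≤* (0≤two^ k) (0≤p (suc k))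

    -- Cauchy-Schwarz over the pairs f, g, whose number is free of n. An injective rearrangement of
    -- T and J permutes the entries of the matrix and keeps `N`; all other rearrangements contribute
    -- 0.
    err-norm : ∀ z → Perp d z → sumVV {k} (λ T J → errK z T J * errK z T J) ≤ (tuples k * tuples k * β) * (tuples k * tuples k * β) * N k z
    err-norm z q = begin
        sumVV {k} (λ T J → errK z T J * errK z T J)
          ≤⟨ PLF.mono (KP k) (λ { (T , J) → ≤-trans (PLF.cs FP (λ { (f , g) → ω T J k f g }) (λ { (f , g) → Y T J f g })) (*-monoˡ (PLF.sqs FP λ { (f , g) → Y T J f g }) (wsq T J)) }) ⟩
        sumVV {k} (λ T J → (c * c * (β * β)) * sumV {k} {k} λ f → sumV {k} {k} λ g → Y T J f g * Y T J f g)
          ≡⟨ PLF.scl (KP k) (c * c * (β * β)) _ ⟩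
        (c * c * (β * β)) * sumVV {k} (λ T J → sumV {k} {k} λ f → sumV {k} {k} λ g → Y T J f g * Y T J f g)
          ≡⟨ cong (c * c * (β * β) *_) (⊗-fin (vecP k k) (vecP k k) (vecP-fin k k) (vecP-fin k k) (KP k) λ { (f , g) (T , J) → Y T J f g * Y T J f g }) ⟩
        (c * c * (β * β)) * sumV {k} {k} (λ f → sumV {k} {k} λ g → sumVV {k} λ T J → Y T J f g * Y T J f g)
          ≤⟨ *-monoʳ (0≤* (0≤* (0≤tuples k) (0≤tuples k)) (0≤* 0≤β 0≤β)) (PLF.mono FP λ { (f , g) → each f g (decInj f) (decInj g) }) ⟩
        (c * c * (β * β)) * sumV {k} {k} (λ f → sumV {k} {k} λ g → N k z)
          ≡⟨ cong (c * c * (β * β) *_) (cN (N k z)) ⟩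
        (c * c * (β * β)) * (c * c * N k z)
          ≡⟨ l c β (N k z) ⟩
        (c * c * β) * (c * c * β) * N k z ∎
      where
      open ≤-Reasoning
      c = tuples k
      FP = vecP k k ⊗ vecP k k
      Y : Vec (Fin n) k → Vec (Fin n) k → Vec (Fin k) k → Vec (Fin k) k → ℚ
      Y T J f g = M z (map (lookup T) f) (map (lookup J) g)
      l : ∀ c b N → (c * c * (b * b)) * (c * c * N) ≡ (c * c * b) * (c * c * b) * N
      l = solve-∀ ringℚ
      cN : ∀ x → sumV {k} {k} (λ f → sumV {k} {k} λ g → x) ≡ c * c * x
      cN x = trans (PLF.ext FP λ _ → sym (*-identityʳ x)) (trans (PLF.scl FP x λ _ → 1ℚ) (trans (cong (x *_) (trans (PLF.ext (vecP k k) λ f → sym (*-identityʳ c)) (PLF.scl (vecP k k) c λ _ → 1ℚ))) (*-comm x (c * c))))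
      wsq : ∀ T J → PLF.ap FP (λ { (f , g) → ω T J k f g * ω T J k f g }) ≤ c * c * (β * β)
      wsq T J = ≤-trans (PLF.mono FP λ { (f , g) → *-mono (0≤ω T J k f g) 0≤β (ω≤ T J k f g) (ω≤ T J k f g) }) (≤-reflexive (cN (β * β)))
      each : ∀ f g → Dec (InjV f) → Dec (InjV g) → sumVV {k} (λ T J → Y T J f g * Y T J f g) ≤ N k z
      each f g (yes a) (yes b) = ≤-reflexive (trans (sum-sub f a λ T → sumV {n} {k} λ J → M z T (map (lookup J) g) * M z T (map (lookup J) g)) (PLF.ext (vecP n k) λ T → sum-sub g b λ J → M z T J * M z T J))
      each f g (no a) _ = ≤-trans (≤-reflexive (trans (PLF.ext (KP k) λ { (T , J) → mul0ˡ (row z (map (lookup T) f) (map (lookup J) g) q (¬inj-sub T f a)) }) (PLF.zer (KP k)))) (0≤N k z)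
      each f g (yes _) (no b) = ≤-trans (≤-reflexive (trans (PLF.ext (KP k) λ { (T , J) → mul0ˡ (col z (map (lookup T) f) (map (lookup J) g) q (¬inj-sub J g b)) }) (PLF.zer (KP k)))) (0≤N k z)

    resid : (El → ℚ) → El → ℚ
    resid z σ = S k z σ - p k * κ * z σ

    Perp-resid : ∀ {z} → Perp d z → Perp d (resid z)
    Perp-resid {z} q = Perp-- {z = S k z} (Perp-S k {z = z} q) (Perp-scl {z = z} (p k * κ) q)

    N-resid : ∀ z → Perp d z → N k (resid z) ≤ (tuples k * tuples k * β) * (tuples k * tuples k * β) * N k z
    N-resid z q = ≤-trans (PLF.mono (KP k) {f = λ q → M (resid z) (proj₁ q) (proj₂ q) * M (resid z) (proj₁ q) (proj₂ q)} {g = λ q → errK z (proj₁ q) (proj₂ q) * errK z (proj₁ q) (proj₂ q)} λ { (T , J) → by T J (decInj T) (decInj J) }) (err-norm z q)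
      where
      Mr : ∀ T J → M (resid z) T J ≡ M (S k z) T J - p k * κ * M z T J
      Mr T J = trans (M-- (S k z) (λ σ → p k * κ * z σ) T J) (cong (λ x → M (S k z) T J - x) (M-scl (p k * κ) z T J))
      l : ∀ a b → a + b - a ≡ b
      l = solve-∀ ringℚ
      by : ∀ T J → Dec (InjV T) → Dec (InjV J) → M (resid z) T J * M (resid z) T J ≤ errK z T J * errK z T J
      by T J (yes a) (yes b) = ≤-reflexive (cong (λ x → x * x) (trans (Mr T J) (trans (cong (λ x → x - p k * κ * M z T J) (main-formula z q T J a b)) (l (p k * κ * M z T J) (errK z T J)))))
      by T J (no a) _        = ≤-trans (≤-reflexive (mul0ˡ (row (resid z) T J (Perp-resid {z} q) a))) (0≤sq (errK z T J))
      by T J (yes _) (no b)  = ≤-trans (≤-reflexive (mul0ˡ (col (resid z) T J (Perp-resid {z} q) b))) (0≤sq (errK z T J))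

    module Large (0<p : 0ℚ < p k) (small : (tuples k * tuples k * β) ≤ ½ * p k) where

      N-small : ∀ z → Perp d z → N k (resid z) ≤ (½ * p k) * (½ * p k) * N k z
      N-small z q = ≤-trans (N-resid z q) (*-monoˡ (0≤N k z) (*-mono (0≤* (0≤* (0≤tuples k) (0≤tuples k)) 0≤β) (0≤* 0≤½ (<⇒≤ 0<p)) small small))

      ip = inv (p k) 0<p
      0≤ip = <⇒≤ (0<inv (p k) 0<p)

      -- N z is the inner product of S z with z, and the squared norm of S z is that of M z with M
      -- (S z), at most p (κ + 1) N z by the main formula. Cauchy-Schwarz then lets one factor N z
      -- cancel.
      upper-frame : ∀ z → Perp d z → N k z ≤ p k * (κ + 1ℚ) * nrm² z
      upper-frame z q = by (0ℚ <? N k z)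
        where
        open ≤-Reasoning
        Nz = N k z
        0≤pκ : 0ℚ ≤ p k * (κ + 1ℚ)
        0≤pκ = 0≤* (<⇒≤ 0<p) (0≤+ (≤-trans 0≤1 (1≤injections k)) 0≤1)
        quarter : ½ * ½ ≤ 1ℚ
        quarter = ≤-trans (*-mono 0≤½ 0≤1 ½≤1 ½≤1) (≤-reflexive (*-identityʳ 1ℚ))
          where
          ½≤1 : ½ ≤ 1ℚ
          ½≤1 = cert 0≤½ (sym (trans (cong₂ _+_ (sym (*-identityʳ ½)) (sym (*-identityʳ ½))) (½+½ 1ℚ)))
        cross : sumVV {k} (λ T J → M z T J * M (resid z) T J) ≤ p k * Nz
        cross = double (begin
          (1ℚ + 1ℚ) * sumVV {k} (λ T J → M z T J * M (resid z) T J)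
            ≡⟨ sym (PLF.scl (KP k) (1ℚ + 1ℚ) _) ⟩
          sumVV {k} (λ T J → (1ℚ + 1ℚ) * (M z T J * M (resid z) T J))
            ≤⟨ PLF.amgm (KP k) (p k) 0<p (λ { (T , J) → M z T J }) (λ { (T , J) → M (resid z) T J }) ⟩
          p k * Nz + ip * N k (resid z)
            ≤⟨ +-monoʳ-≤ (p k * Nz) (*-monoʳ 0≤ip (N-small z q)) ⟩
          p k * Nz + ip * ((½ * p k) * (½ * p k) * Nz)
            ≡⟨ cong (p k * Nz +_) (trans (l₁ ip ½ (p k) Nz) (mul1ˡ (inv-r (p k) 0<p))) ⟩
          p k * Nz + ½ * ½ * (p k * Nz)
            ≤⟨ +-monoʳ-≤ (p k * Nz) (≤-trans (*-monoˡ (0≤* (<⇒≤ 0<p) (0≤N k z)) quarter) (≤-reflexive (*-identityˡ _))) ⟩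
          p k * Nz + p k * Nz
            ≡⟨ l₂ (p k * Nz) ⟩
          (1ℚ + 1ℚ) * (p k * Nz) ∎)
          where
          l₁ : ∀ i h p N → i * ((h * p) * (h * p) * N) ≡ (p * i) * (h * h * (p * N))
          l₁ = solve-∀ ringℚ
          l₂ : ∀ x → x + x ≡ (1ℚ + 1ℚ) * x
          l₂ = solve-∀ ringℚ
        S≡ : ∀ σ → S k z σ ≡ p k * κ * z σ + resid z σ
        S≡ σ = l (S k z σ) (p k * κ * z σ)
          where
          l : ∀ a b → a ≡ b + (a - b)
          l = solve-∀ ringℚ
        SS : nrm² (S k z) ≤ p k * (κ + 1ℚ) * Nz
        SS = begin
          nrm² (S k z)
            ≡⟨ S-sq k z (S k z) ⟩
          sumVV {k} (λ T J → M z T J * M (S k z) T J)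
            ≡⟨ PLF.ext (KP k) (λ { (T , J) → trans (cong (M z T J *_) (trans (M-ext S≡ T J) (trans (M-+ (λ σ → p k * κ * z σ) (resid z) T J) (cong (_+ M (resid z) T J) (M-scl (p k * κ) z T J))))) (l (M z T J) (p k * κ) (M (resid z) T J)) }) ⟩
          sumVV {k} (λ T J → p k * κ * (M z T J * M z T J) + M z T J * M (resid z) T J)
            ≡⟨ trans (PLF.add (KP k) _ _) (cong (_+ sumVV {k} (λ T J → M z T J * M (resid z) T J)) (PLF.scl (KP k) (p k * κ) _)) ⟩
          p k * κ * Nz + sumVV {k} (λ T J → M z T J * M (resid z) T J)
            ≤⟨ +-monoʳ-≤ (p k * κ * Nz) cross ⟩
          p k * κ * Nz + p k * Nz
            ≡⟨ l' (p k) κ Nz ⟩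
          p k * (κ + 1ℚ) * Nz ∎
          where
          l : ∀ m a r → m * (a * m + r) ≡ a * (m * m) + m * r
          l = solve-∀ ringℚ
          l' : ∀ p c N → p * c * N + p * N ≡ p * (c + 1ℚ) * N
          l' = solve-∀ ringℚ
        by : Dec (0ℚ < Nz) → Nz ≤ p k * (κ + 1ℚ) * nrm² z
        by (no q) = ≤-trans (≮⇒≥ q) (0≤* 0≤pκ (0≤nrm² z))
        by (yes 0<N) = *-cancelˡ 0<N (begin
          Nz * Nz
            ≡⟨ cong₂ _*_ (sym (S-sq k z z)) (sym (S-sq k z z)) ⟩
          E (λ σ → S k z σ * z σ) * E (λ σ → S k z σ * z σ)
            ≤⟨ PLF.cs 𝔾 (S k z) z ⟩
          nrm² (S k z) * nrm² z
            ≤⟨ *-monoˡ (0≤nrm² z) SS ⟩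
          p k * (κ + 1ℚ) * Nz * nrm² z
            ≡⟨ l (p k * (κ + 1ℚ)) Nz (nrm² z) ⟩
          Nz * (p k * (κ + 1ℚ) * nrm² z) ∎)
          where
          l : ∀ a b c → a * b * c ≡ b * (a * c)
          l = solve-∀ ringℚ

      0<pκ : 0ℚ < p k * κ
      0<pκ = 0<* 0<p (<-≤-trans 0<1 (1≤injections k))

      a = inv (p k * κ) 0<pκ
      0≤a = <⇒≤ (0<inv (p k * κ) 0<pκ)

      -- Richardson iteration for inverting S: this is z - a S z with a = 1 / (p κ). Each round
      -- halves the norm of the matrix.
      next : (El → ℚ) → El → ℚ
      next z σ = (- a) * resid z σ

      next≡ : ∀ z σ → z σ ≡ next z σ + a * S k z σ
      next≡ z σ = sym (trans (l a (S k z σ) (p k * κ) (z σ)) (mul1ˡ (inv-r (p k * κ) 0<pκ)))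
        where
        l : ∀ a s c z → (- a) * (s - c * z) + a * s ≡ (c * a) * z
        l = solve-∀ ringℚ

      Perp-next : ∀ {z} → Perp d z → Perp d (next z)
      Perp-next {z} q = Perp-scl {z = resid z} (- a) (Perp-resid {z} q)

      a·p≤1 : a * p k ≤ 1ℚ
      a·p≤1 = ≤-trans (≤-trans (≤-reflexive (sym (*-identityʳ _))) (*-monoʳ (0≤* 0≤a (<⇒≤ 0<p)) (1≤injections k))) (≤-reflexive (trans (l a (p k) κ) (inv-r (p k * κ) 0<pκ)))
        where
        l : ∀ a p c → a * p * c ≡ (p * c) * a
        l = solve-∀ ringℚ

      N-next : ∀ z → Perp d z → N k (next z) ≤ ½ * ½ * N k z
      N-next z q = begin
          N k (next z)
            ≡⟨ trans (PLF.ext (KP k) λ { (T , J) → trans (cong (λ x → x * x) (M-scl (- a) (resid z) T J)) (l₁ a (M (resid z) T J)) }) (PLF.scl (KP k) (a * a) _) ⟩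
          a * a * N k (resid z)
            ≤⟨ *-monoʳ (0≤* 0≤a 0≤a) (N-small z q) ⟩
          a * a * ((½ * p k) * (½ * p k) * N k z)
            ≡⟨ l₂ a ½ (p k) (N k z) ⟩
          (a * p k) * (a * p k) * (½ * ½ * N k z)
            ≤⟨ *-monoˡ (0≤* (0≤* 0≤½ 0≤½) (0≤N k z)) (*-mono (0≤* 0≤a (<⇒≤ 0<p)) 0≤1 a·p≤1 a·p≤1) ⟩
          1ℚ * 1ℚ * (½ * ½ * N k z)
            ≡⟨ trans (cong (_* (½ * ½ * N k z)) (*-identityˡ 1ℚ)) (*-identityˡ _) ⟩
          ½ * ½ * N k z ∎
        where
        open ≤-Reasoning
        l₁ : ∀ a m → ((- a) * m) * ((- a) * m) ≡ a * a * (m * m)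
        l₁ = solve-∀ ringℚ
        l₂ : ∀ a h p N → a * a * ((h * p) * (h * p) * N) ≡ (a * p) * (a * p) * (h * h * N)
        l₂ = solve-∀ ringℚ

      iter : ℕ → (El → ℚ) → El → ℚ
      iter zero    z = z
      iter (suc j) z = next (iter j z)

      Perp-iter : ∀ j {z} → Perp d z → Perp d (iter j z)
      Perp-iter zero    q = q
      Perp-iter (suc j) {z} q = Perp-next {iter j z} (Perp-iter j {z} q)

      N-iter : ∀ j z → Perp d z → N k (iter j z) ≤ half j * half j * N k z
      N-iter zero    z q = ≤-reflexive (sym (trans (cong (_* N k z) (*-identityˡ 1ℚ)) (*-identityˡ _)))
      N-iter (suc j) z q = ≤-trans (N-next (iter j z) (Perp-iter j {z} q)) (≤-trans (*-monoʳ (0≤* 0≤½ 0≤½) (N-iter j z q)) (≤-reflexive (l ½ (half j) (N k z))))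
        where
        l : ∀ h j N → h * h * (j * j * N) ≡ (h * j) * (h * j) * N
        l = solve-∀ ringℚ

      kernel-pair : ∀ j z → Perp d z → (c : Kernel k) → sumVV {k} (λ T J → c T J * M (iter j z) T J) ≤ half j * (N k z + sumVV {k} (λ T J → c T J * c T J))
      kernel-pair j z q c = double (begin
          (1ℚ + 1ℚ) * sumVV {k} (λ T J → c T J * M (iter j z) T J)
            ≡⟨ sym (PLF.scl (KP k) (1ℚ + 1ℚ) _) ⟩
          sumVV {k} (λ T J → (1ℚ + 1ℚ) * (c T J * M (iter j z) T J))
            ≤⟨ PLF.amgm (KP k) (half j) (0<half j) (λ { (T , J) → c T J }) (λ { (T , J) → M (iter j z) T J }) ⟩
          half j * C + inv (half j) (0<half j) * N k (iter j z)
            ≤⟨ +-monoʳ-≤ (half j * C) (*-monoʳ (<⇒≤ (0<inv (half j) (0<half j))) (N-iter j z q)) ⟩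
          half j * C + inv (half j) (0<half j) * (half j * half j * N k z)
            ≡⟨ cong (half j * C +_) (trans (l₁ (inv (half j) (0<half j)) (half j) (N k z)) (mul1ˡ (inv-r (half j) (0<half j)))) ⟩
          half j * C + half j * N k z
            ≤⟨ cert (0≤+ (0≤* (0≤half j) 0≤C) (0≤* (0≤half j) (0≤N k z))) (l₂ (half j) C (N k z)) ⟩
          (1ℚ + 1ℚ) * (half j * (N k z + C)) ∎)
        where
        open ≤-Reasoning
        C = sumVV {k} (λ T J → c T J * c T J)
        0≤C : 0ℚ ≤ C
        0≤C = PLF.sqs (KP k) λ { (T , J) → c T J }
        0<half : ∀ j → 0ℚ < half j
        0<half zero    = 0<1
        0<half (suc j) = 0<* (0<inv (1ℚ + 1ℚ) (0<nat 1)) (0<half j)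
        l₁ : ∀ i h N → i * (h * h * N) ≡ (h * i) * (h * N)
        l₁ = solve-∀ ringℚ
        l₂ : ∀ h C N → (1ℚ + 1ℚ) * (h * (N + C)) ≡ (h * C + h * N) + (h * C + h * N)
        l₂ = solve-∀ ringℚ

      -- Consecutive iterates differ by a S of the earlier one, whose pairing with z is a pairing of
      -- matrices and decays like 2^(-j). The factor 4 is the sum of the terms 2 · 2^(-j).
      geometric : ∀ z → Perp d z → ∀ j → nrm² z ≤ (nat 4 * (1ℚ - half j)) * (a * N k z) + E (λ σ → iter j z σ * z σ)
      geometric z q zero    = ≤-reflexive (l (nrm² z) (a * N k z))
        where
        l : ∀ x y → x ≡ (nat 4 * (1ℚ - 1ℚ)) * y + x
        l = solve-∀ ringℚ
      geometric z q (suc j) = begin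
          nrm² z
            ≤⟨ geometric z q j ⟩
          (nat 4 * (1ℚ - half j)) * (a * N k z) + E (λ σ → iter j z σ * z σ)
            ≡⟨ cong ((nat 4 * (1ℚ - half j)) * (a * N k z) +_) step ⟩
          (nat 4 * (1ℚ - half j)) * (a * N k z) + (E (λ σ → iter (suc j) z σ * z σ) + a * sumVV {k} (λ T J → M z T J * M (iter j z) T J))
            ≤⟨ +-monoʳ-≤ ((nat 4 * (1ℚ - half j)) * (a * N k z)) (+-monoʳ-≤ (E (λ σ → iter (suc j) z σ * z σ)) (*-monoʳ 0≤a (kernel-pair j z q (M z)))) ⟩
          (nat 4 * (1ℚ - half j)) * (a * N k z) + (E (λ σ → iter (suc j) z σ * z σ) + a * (half j * (N k z + N k z)))
            ≡⟨ trans (cong (λ h → (nat 4 * (1ℚ - h)) * (a * N k z) + (E (λ σ → iter (suc j) z σ * z σ) + a * (h * (N k z + N k z)))) (sym (½+½ (half j)))) (l (half (suc j)) a (N k z) (E (λ σ → iter (suc j) z σ * z σ))) ⟩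
          (nat 4 * (1ℚ - half (suc j))) * (a * N k z) + E (λ σ → iter (suc j) z σ * z σ) ∎
        where
        open ≤-Reasoning
        step : E (λ σ → iter j z σ * z σ) ≡ E (λ σ → iter (suc j) z σ * z σ) + a * sumVV {k} (λ T J → M z T J * M (iter j z) T J)
        step = trans (PLF.ext 𝔾 λ σ → trans (cong (_* z σ) (next≡ (iter j z) σ)) (m (iter (suc j) z σ) a (S k (iter j z) σ) (z σ)))
          (trans (PLF.add 𝔾 _ _) (cong (E (λ σ → iter (suc j) z σ * z σ) +_) (trans (PLF.scl 𝔾 a _) (cong (a *_) (trans (S-sq k (iter j z) z) (PLF.ext (KP k) λ { (T , J) → *-comm (M (iter j z) T J) (M z T J) }))))))
          where
          m : ∀ x a s z → (x + a * s) * z ≡ x * z + a * (s * z)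
          m = solve-∀ ringℚ
        l : ∀ h a N e → (nat 4 * (1ℚ - (h + h))) * (a * N) + (e + a * ((h + h) * (N + N))) ≡ (nat 4 * (1ℚ - h)) * (a * N) + e
        l = solve-∀ ringℚ

      -- It remains to let j grow in `geometric`. Because z is built from a kernel c, its pairing
      -- with the iterate only sees the matrix of the iterate, which tends to 0. For general z the
      -- limit would contain the part of z invisible to k values.
      lower-frame : ∀ z → Perp d z → InV k z → p k * nrm² z ≤ nat 4 * N k z
      lower-frame z q (c , zc) = begin
          p k * nrm² z
            ≤⟨ *-monoʳ (<⇒≤ 0<p) (squeeze (nrm² z) (nat 4 * (a * N k z)) B 0≤B bound) ⟩
          p k * (nat 4 * (a * N k z))
            ≡⟨ l (p k) (nat 4) a (N k z) ⟩
          (a * p k) * (nat 4 * N k z)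
            ≤⟨ ≤-trans (*-monoˡ (0≤* (0≤nat 4) (0≤N k z)) a·p≤1) (≤-reflexive (*-identityˡ _)) ⟩
          nat 4 * N k z ∎
        where
        open ≤-Reasoning
        B = N k z + sumVV {k} (λ T J → c T J * c T J)
        0≤B : 0ℚ ≤ B
        0≤B = 0≤+ (0≤N k z) (PLF.sqs (KP k) λ { (T , J) → c T J })
        l : ∀ p f a N → p * (f * (a * N)) ≡ (a * p) * (f * N)
        l = solve-∀ ringℚ
        bound : ∀ j → nrm² z ≤ nat 4 * (a * N k z) + half j * B
        bound j = ≤-trans (geometric z q j) (+-mono-≤ (cert {(nat 4 * (1ℚ - half j)) * (a * N k z)} (0≤* (0≤* (0≤nat 4) (0≤half j)) (0≤* 0≤a (0≤N k z))) (m (half j) (a * N k z)))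
            (≤-trans (≤-reflexive (trans (PLF.ext 𝔾 λ σ → trans (*-comm (iter j z σ) (z σ)) (cong (_* iter j z σ) (zc σ))) (E-kernel {k} c (iter j z)))) (kernel-pair j z q c)))
          where
          m : ∀ h x → nat 4 * x ≡ (nat 4 * (1ℚ - h)) * x + nat 4 * h * x
          m = solve-∀ ringℚ

-- Level projections and convolution

module Projection {Ω : Set} (B : PLF Ω) where
  open PLF B

  data Span (us : List (Ω → ℚ)) : (Ω → ℚ) → Set where
    null : Span us (λ _ → 0ℚ)
    gen  : ∀ {u} → u ∈ us → Span us u
    lin  : ∀ a b {g h} → Span us g → Span us h → Span us (λ ω → a * g ω + b * h ω)

  weaken : ∀ {us u g} → Span us g → Span (u ∷ us) g
  weaken null          = null
  weaken (gen m)       = gen (there m)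
  weaken (lin a b p q) = lin a b (weaken p) (weaken q)

  lin-ap : ∀ (x : Ω → ℚ) a b (g h : Ω → ℚ) → ap (λ ω → x ω * (a * g ω + b * h ω)) ≡ a * ap (λ ω → x ω * g ω) + b * ap (λ ω → x ω * h ω)
  lin-ap x a b g h = trans (ext λ ω → l (x ω) a b (g ω) (h ω)) (trans (add _ _) (cong₂ _+_ (scl a _) (scl b _)))
    where
    l : ∀ x a b g h → x * (a * g + b * h) ≡ a * (x * g) + b * (x * h)
    l = solve-∀ ringℚ

  Orth : List (Ω → ℚ) → (Ω → ℚ) → Set
  Orth us x = ∀ u → u ∈ us → ap (λ ω → x ω * u ω) ≡ 0ℚ

  span-orth : ∀ {us g} (x : Ω → ℚ) → Orth us x → Span us g → ap (λ ω → x ω * g ω) ≡ 0ℚ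
  span-orth x o null = trans (ext λ ω → *-zeroʳ (x ω)) zer
  span-orth x o (gen m) = o _ m
  span-orth x o (lin a b {g} {h} p q) = trans (lin-ap x a b g h) (trans (cong₂ _+_ (mul0ʳ {a} (span-orth x o p)) (mul0ʳ {b} (span-orth x o q))) (+-identityʳ 0ℚ))

  -- Gram–Schmidt
  project : ∀ us f → Σ (Ω → ℚ) λ g → Span us g × Orth us (λ ω → f ω - g ω)
  project []       f = (λ _ → 0ℚ) , null , λ _ ()
  project (u ∷ us) f = by (0ℚ <? c)
    where
    u' = proj₁ (project us u)
    f' = proj₁ (project us f)
    x w : Ω → ℚ
    x ω = f ω - f' ω
    w ω = u ω - u' ω
    su = proj₁ (proj₂ (project us u)) ; ou = proj₂ (proj₂ (project us u))
    sf = proj₁ (proj₂ (project us f)) ; of = proj₂ (proj₂ (project us f))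
    c = ap (λ ω → w ω * w ω)
    xw = ap (λ ω → x ω * w ω)
    u≡ : ∀ (y : Ω → ℚ) → Orth us y → ap (λ ω → y ω * u ω) ≡ ap (λ ω → y ω * w ω)
    u≡ y o = trans (ext λ ω → l (y ω) (u ω) (u' ω)) (trans (add (λ ω → y ω * (u ω - u' ω)) (λ ω → y ω * u' ω)) (add0ʳ (span-orth y o su)))
      where
      l : ∀ y u u' → y * u ≡ y * (u - u') + y * u'
      l = solve-∀ ringℚ
    by : Dec (0ℚ < c) → Σ (Ω → ℚ) λ g → Span (u ∷ us) g × Orth (u ∷ us) (λ ω → f ω - g ω)
    -- The new generator differs from its projection by a function of norm 0. Then Cauchy-Schwarz
    -- already gives orthogonality to it, and the projection need not change.
    by (no q) = f' , weaken sf , λ { _ (here refl) → trans (u≡ x of) xw0 ; v (there m) → of v m }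
      where
      xw0 : xw ≡ 0ℚ
      xw0 = sq-zero xw (≤-trans (cs x w) (≤-trans (*-monoʳ (sqs x) (≮⇒≥ q)) (≤-reflexive (*-zeroʳ (ap (λ ω → x ω * x ω))))))
    by (yes p) = (λ ω → 1ℚ * f' ω + t * (1ℚ * u ω + (- 1ℚ) * u' ω)) , lin 1ℚ t (weaken sf) (lin 1ℚ (- 1ℚ) (gen (here refl)) (weaken su)) ,
        λ { _ (here refl) → trans (u≡ y oy) (trans (ext λ ω → l₀ (f ω) (f' ω) t (u ω) (u' ω) (w ω)) (trans (sub (λ ω → x ω * w ω) (λ ω → t * (w ω * w ω))) (trans (cong (λ z → xw - z) (trans (scl t (λ ω → w ω * w ω)) tc)) (+-inverseʳ xw)))) ; v (there m) → oy v m }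
      where
      t = xw * inv c p
      y : Ω → ℚ
      y ω = f ω - (1ℚ * f' ω + t * (1ℚ * u ω + (- 1ℚ) * u' ω))
      tc : t * c ≡ xw
      tc = trans (m xw (inv c p) c) (trans (cong (xw *_) (inv-r c p)) (*-identityʳ xw))
        where
        m : ∀ a i c → a * i * c ≡ a * (c * i)
        m = solve-∀ ringℚ
      l₀ : ∀ f f' t u u' w → (f - (1ℚ * f' + t * (1ℚ * u + (- 1ℚ) * u'))) * w ≡ (f - f') * w - t * ((u - u') * w)
      l₀ = solve-∀ ringℚ
      oy : Orth us y
      oy v m = trans (ext λ ω → l₀ (f ω) (f' ω) t (u ω) (u' ω) (v ω)) (trans (sub (λ ω → x ω * v ω) (λ ω → t * (w ω * v ω)))
        (trans (cong₂ _-_ (of v m) (trans (scl t (λ ω → w ω * v ω)) (mul0ʳ {t} (ou v m)))) (+-inverseʳ 0ℚ)))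

module LevelSpaces (n : ℕ) where
  open Alternating n
  open TupleCalculus n
  open Projection 𝔾

  ind : ∀ {d} → Vec (Fin n) d → Vec (Fin n) d → El → ℚ
  ind I J σ = 𝟙 (σ ∙ I ≟V J)

  gens : ℕ → List (El → ℚ)
  gens d = cartesianProductWith ind (allVecs d n) (allVecs d n)

  ∈-allVecs : ∀ {m} (v : Vec (Fin n) m) → v ∈ allVecs m n
  ∈-allVecs []      = here refl
  ∈-allVecs (i ∷ v) = ∈-cartesianProductWith⁺ _∷_ (∈-allFin i) (∈-allVecs v)

  InV-ind : ∀ {d} (I J : Vec (Fin n) d) → InV d (ind I J)
  InV-ind I J = (λ T L → 𝟙 (T ≟V I) * 𝟙 (L ≟V J)) , λ σ → sym (sumV-δ I λ T → 𝟙 (σ ∙ T ≟V J))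

  InV-ext : ∀ {d z y} → (∀ σ → z σ ≡ y σ) → InV d z → InV d y
  InV-ext e (c , p) = c , λ σ → trans (sym (e σ)) (p σ)

  InV-lin : ∀ {d} a b {z y} → InV d z → InV d y → InV d (λ σ → a * z σ + b * y σ)
  InV-lin {d} a b (c , p) (c' , p') = (λ I J → a * c I J + b * c' I J) , λ σ → trans (cong₂ (λ x y → a * x + b * y) (p σ) (p' σ))
    (sym (trans (PLF.add (vecP n d) _ _) (cong₂ _+_ (PLF.scl (vecP n d) a _) (PLF.scl (vecP n d) b _))))

  InV-span : ∀ {d z} → Span (gens d) z → InV d z
  InV-span {d} null = (λ _ _ → 0ℚ) , λ σ → sym (PLF.zer (vecP n d))
  InV-span {d} (gen m) with ∈-cartesianProductWith⁻ ind (allVecs d n) (allVecs d n) m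
  ... | I , J , _ , _ , refl = InV-ind I J
  InV-span (lin a b p q) = InV-lin a b (InV-span p) (InV-span q)

  P : ℕ → (El → ℚ) → El → ℚ
  P d f = proj₁ (project (gens d) f)

  P∈V : ∀ d f → InV d (P d f)
  P∈V d f = InV-span (proj₁ (proj₂ (project (gens d) f)))

  P-perp : ∀ d f → Perp d (λ σ → f σ - P d f σ)
  P-perp d f I J = proj₂ (proj₂ (project (gens d) f)) (ind I J) (∈-cartesianProductWith⁺ ind (∈-allVecs I) (∈-allVecs J))

  -- The kernel is spread evenly over the n possible additional entries.
  InV-up : ∀ {d z} → 0ℚ < nat n → InV d z → InV (suc d) z
  InV-up {d} {z} 0<n (c , p) = c' , λ σ → trans (p σ) (sym (trans (PLF.ext (finP n) λ i → trans (PLF.scl (vecP n d) v λ I → c I (σ ∙ I)) (*-comm v _)) (trans (PLF.scl (finP n) (sumV λ I → c I (σ ∙ I)) λ _ → v)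
      (trans (cong (sumV (λ I → c I (σ ∙ I)) *_) (trans (PLF.ext (finP n) λ _ → sym (*-identityʳ v)) (trans (PLF.scl (finP n) v λ _ → 1ℚ) (trans (cong (v *_) (sumF-const n)) (trans (*-comm v (nat n)) (inv-r (nat n) 0<n)))))) (*-identityʳ _)))))
    where
    v = inv (nat n) 0<n
    c' : Vec (Fin n) (suc d) → Vec (Fin n) (suc d) → ℚ
    c' (i ∷ I) (j ∷ J) = v * c I J

module Convolution (n : ℕ) where
  open Alternating n
  open TupleCalculus n
  open LevelSpaces n
  open FrameBounds n
  open FrameInequalities n

  conv : (El → ℚ) → (El → ℚ) → El → ℚ
  conv u v s = E λ x → u x * v (x ⁻¹ · s)

  conv-R : ∀ u v g s → conv u (R g v) s ≡ R g (conv u v) s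
  conv-R u v g s = PLF.ext 𝔾 λ x → cong (λ y → u x * v y) (assoc (x ⁻¹) s g)

  conv-ext : ∀ {u u' v v'} → (∀ σ → u σ ≡ u' σ) → (∀ σ → v σ ≡ v' σ) → ∀ s → conv u v s ≡ conv u' v' s
  conv-ext p q s = PLF.ext 𝔾 λ x → cong₂ _*_ (p x) (q (x ⁻¹ · s))

  conv-lin : ∀ u a b v w s → conv u (λ σ → a * v σ + b * w σ) s ≡ a * conv u v s + b * conv u w s
  conv-lin u a b v w s = Projection.lin-ap 𝔾 u a b (λ x → v (x ⁻¹ · s)) (λ x → w (x ⁻¹ · s))

  conv-+ˡ : ∀ u u' v s → conv (λ σ → u σ + u' σ) v s ≡ conv u v s + conv u' v s
  conv-+ˡ u u' v s = trans (PLF.ext 𝔾 λ x → *-distribʳ-+ (v (x ⁻¹ · s)) (u x) (u' x)) (PLF.add 𝔾 _ _)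

  ·-cancel : ∀ x y → x ⁻¹ · (x · y) ≡ y
  ·-cancel x y = trans (sym (assoc (x ⁻¹) x y)) (trans (cong (_· y) (invˡ x)) (idˡ y))

  ind-· : ∀ {d} x y (I J : Vec (Fin n) d) → ind I J (x · y) ≡ sumV λ L → ind I L y * ind L J x
  ind-· x y I J = trans (cong (λ v → 𝟙 (v ≟V J)) (·-∙ x y I)) (sym (sumV-δ' (y ∙ I) λ L → ind L J x))

  -- A product x y takes I to J through the intermediate tuple L = y ∙ I, so convolution becomes
  -- multiplication of matrices, in reverse order.
  M-conv : ∀ u v {d} (I J : Vec (Fin n) d) → M (conv u v) I J ≡ sumV λ L → M v I L * M u L J
  M-conv u v {d} I J = begin
      E (λ s → conv u v s * ind I J s)
        ≡⟨ PLF.ext 𝔾 (λ s → sym (PLF.sclr 𝔾 (ind I J s) _)) ⟩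
      E (λ s → E λ x → u x * v (x ⁻¹ · s) * ind I J s)
        ≡⟨ 𝔾-fin 𝔾 (λ x s → u x * v (x ⁻¹ · s) * ind I J s) ⟩
      E (λ x → E λ s → u x * v (x ⁻¹ · s) * ind I J s)
        ≡⟨ PLF.ext 𝔾 (λ x → trans (sym (E-left x λ s → u x * v (x ⁻¹ · s) * ind I J s)) (PLF.ext 𝔾 λ y → trans (cong₂ (λ a b → u x * v a * b) (·-cancel x y) (ind-· x y I J))
             (trans (sym (PLF.scl (vecP n d) (u x * v y) _)) (PLF.ext (vecP n d) λ L → l (u x) (v y) (ind I L y) (ind L J x))))) ⟩
      E (λ x → E λ y → sumV λ L → (u x * ind L J x) * (v y * ind I L y))
        ≡⟨ PLF.ext 𝔾 (λ x → trans (vecP-fin n d 𝔾 λ L y → (u x * ind L J x) * (v y * ind I L y)) (PLF.ext (vecP n d) λ L → trans (PLF.scl 𝔾 (u x * ind L J x) _) (*-comm (u x * ind L J x) (M v I L)))) ⟩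
      E (λ x → sumV λ L → M v I L * (u x * ind L J x))
        ≡⟨ trans (vecP-fin n d 𝔾 λ L x → M v I L * (u x * ind L J x)) (PLF.ext (vecP n d) λ L → PLF.scl 𝔾 (M v I L) _) ⟩
      sumV (λ L → M v I L * M u L J) ∎
    where
    open ≡-Reasoning
    l : ∀ a b c e → a * b * (c * e) ≡ (a * e) * (b * c)
    l = solve-∀ ringℚ

  Perp-conv : ∀ {d} u {v} → Perp d v → Perp d (conv u v)
  Perp-conv {d} u {v} q I J = trans (M-conv u v I J) (trans (PLF.ext (vecP n d) λ L → mul0ˡ (q I L)) (PLF.zer (vecP n d)))

  InV-conv : ∀ {d} u {v} → InV d v → InV d (conv u v)
  InV-conv {d} u {v} (c , p) = (λ I J → E λ x → u x * c I (x ⁻¹ ∙ J)) , λ s → trans (PLF.ext 𝔾 λ x → trans (cong (u x *_) (p (x ⁻¹ · s)))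
      (trans (sym (PLF.scl (vecP n d) (u x) _)) (PLF.ext (vecP n d) λ I → cong (λ w → u x * c I w) (·-∙ (x ⁻¹) s I))))
    (vecP-fin n d 𝔾 λ I x → u x * c I (x ⁻¹ ∙ (s ∙ I)))

  flip-𝟙 : ∀ {d} x (I J : Vec (Fin n) d) → 𝟙 (x ⁻¹ ∙ I ≟V J) ≡ 𝟙 (x ∙ J ≟V I)
  flip-𝟙 x I J = 𝟙-cong (x ⁻¹ ∙ I ≟V J) (x ∙ J ≟V I) (λ r → trans (cong (x ∙_) (sym r)) (∙-⁻¹ x I)) (λ r → trans (cong (x ⁻¹ ∙_) (sym r)) (⁻¹-∙ x J))

  refl-at : El → (El → ℚ) → El → ℚ
  refl-at s z x = z (x ⁻¹ · s)

  Perp-refl : ∀ {d z} s → Perp d z → Perp d (refl-at s z)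
  Perp-refl {d} {z} s q I J = trans (PLF.ext 𝔾 λ x → cong (z (x ⁻¹ · s) *_) (trans (cong (λ y → 𝟙 (y ∙ I ≟V J)) (sym (⁻¹⁻¹ x))) (flip-𝟙 (x ⁻¹) I J)))
    (trans (E-inv λ x → z (x · s) * 𝟙 (x ∙ J ≟V I)) (Perp-R {z = z} s q J I))

  InV-refl : ∀ {d z} s → InV d z → InV d (refl-at s z)
  InV-refl {d} {z} s (c , p) = (λ J L → sumV λ I → 𝟙 (L ≟V s ∙ I) * c I J) , λ x → trans (p (x ⁻¹ · s)) (trans (PLF.ext (vecP n d) λ I →
      trans (cong (c I) (·-∙ (x ⁻¹) s I)) (trans (sym (sumV-δ' (x ⁻¹ ∙ (s ∙ I)) (c I))) (PLF.ext (vecP n d) λ J → cong (_* c I J) (flip-𝟙 x (s ∙ I) J))))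
    (vecP-fin n d (vecP n d) λ J I → 𝟙 (x ∙ J ≟V s ∙ I) * c I J))

  conv-perp-inV : ∀ {d v z} → Perp d v → InV d z → ∀ s → conv v z s ≡ 0ℚ
  conv-perp-inV {d} {v} {z} q r s = trans (PLF.ext 𝔾 λ x → *-comm (v x) (z (x ⁻¹ · s))) (InV-⊥ {z = refl-at s z} (InV-refl {z = z} s r) q)

  conv-inV-perp : ∀ {d y z} → InV d y → Perp d z → ∀ s → conv y z s ≡ 0ℚ
  conv-inV-perp {d} {y} {z} r q s = InV-⊥ r (Perp-refl {z = z} s q)

  N-conv : ∀ d u v → N d (conv u v) ≤ N d v * N d u
  N-conv d u v = ≤-trans (PLF.mono (vecP n d) λ I → PLF.mono (vecP n d) λ J → ≤-trans (≤-reflexive (cong₂ _*_ (M-conv u v I J) (M-conv u v I J))) (PLF.cs (vecP n d) (λ L → M v I L) (λ L → M u L J)))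
    (≤-reflexive (trans (PLF.ext (vecP n d) λ I → PLF.scl (vecP n d) (sumV {n} {d} λ L → M v I L * M v I L) λ J → sumV λ L → M u L J * M u L J)
      (trans (PLF.sclr (vecP n d) (sumV {n} {d} λ J → sumV {n} {d} λ L → M u L J * M u L J) λ I → sumV {n} {d} λ L → M v I L * M v I L)
        (cong (N d v *_) (vecP-fin n d (vecP n d) λ L J → M u L J * M u L J)))))

  module Decomposition (0<n : 0ℚ < nat n) (f : El → ℚ) where
    α : ℚ
    α = E f

    -- The part of level d + 1: it depends on d + 1 values and is orthogonal to functions of d
    -- values.
    g : ℕ → El → ℚ
    g d σ = P (suc d) f σ - P d f σ

    g∈V : ∀ d → InV (suc d) (g d)
    g∈V d = InV-ext (λ σ → l (P (suc d) f σ) (P d f σ)) (InV-lin 1ℚ (- 1ℚ) (P∈V (suc d) f) (InV-up 0<n (P∈V d f)))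
      where
      l : ∀ a b → 1ℚ * a + (- 1ℚ) * b ≡ a - b
      l = solve-∀ ringℚ

    g-perp : ∀ d → Perp d (g d)
    g-perp d = Perp-ext {z = λ σ → (f σ - P d f σ) - (f σ - P (suc d) f σ)} (λ σ → l (f σ) (P d f σ) (P (suc d) f σ))
      (Perp-- {z = λ σ → f σ - P d f σ} {λ σ → f σ - P (suc d) f σ} (P-perp d f) (Perp-down {z = λ σ → f σ - P (suc d) f σ} (pt n 0<n) (P-perp (suc d) f)))
      where
      l : ∀ f a b → (f - a) - (f - b) ≡ b - a
      l = solve-∀ ringℚ
      pt : ∀ m → 0ℚ < nat m → Fin m
      pt zero    q = ⊥-elim (<-irrefl refl q)
      pt (suc m) q = zero

    inner : (El → ℚ) → (El → ℚ) → ℚ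
    inner y z = E λ σ → y σ * z σ

    nrm²-P-suc : ∀ d → nrm² (P (suc d) f) ≡ nrm² (P d f) + nrm² (g d)
    nrm²-P-suc d = trans (PLF.ext 𝔾 λ σ → l (P (suc d) f σ) (P d f σ)) (trans (PLF.add 𝔾 _ _) (cong₂ _+_ (PLF.add 𝔾 _ _ ⟨ trans ⟩ add0ʳ {nrm² (P d f)} (trans (PLF.scl 𝔾 (nat 2) _) (mul0ʳ {nat 2} (InV-⊥ (P∈V d f) (g-perp d))))) refl))
      where
      l : ∀ a b → a * a ≡ (b * b + nat 2 * (b * (a - b))) + (a - b) * (a - b)
      l = solve-∀ ringℚ

    nrm²-split : ∀ d → nrm² f ≡ nrm² (P d f) + nrm² (λ σ → f σ - P d f σ)
    nrm²-split d = trans (PLF.ext 𝔾 λ σ → l (f σ) (P d f σ)) (trans (PLF.add 𝔾 _ _) (cong₂ _+_ (PLF.add 𝔾 _ _ ⟨ trans ⟩ add0ʳ {nrm² (P d f)} (trans (PLF.scl 𝔾 (nat 2) _) (mul0ʳ {nat 2} (InV-⊥ (P∈V d f) (P-perp d f))))) refl))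
      where
      l : ∀ a b → a * a ≡ (b * b + nat 2 * (b * (a - b))) + (a - b) * (a - b)
      l = solve-∀ ringℚ

    nrm²-P≤ : ∀ d → nrm² (P d f) ≤ nrm² f
    nrm²-P≤ d = cert (0≤nrm² λ σ → f σ - P d f σ) (nrm²-split d)

    nrm²-rest≤ : ∀ d → nrm² (λ σ → f σ - P d f σ) ≤ nrm² f
    nrm²-rest≤ d = cert (0≤nrm² (P d f)) (trans (nrm²-split d) (+-comm (nrm² (P d f)) _))

    nrm²-g≤ : ∀ d → nrm² (g d) ≤ nrm² f
    nrm²-g≤ d = ≤-trans (cert (0≤nrm² (P d f)) (trans (nrm²-P-suc d) (+-comm (nrm² (P d f)) _))) (nrm²-P≤ (suc d))

    P₀ : ∀ σ → P 0 f σ ≡ α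
    P₀ σ = trans (proj₂ (P∈V 0 f) σ) (sym eq)
      where
      c = proj₁ (P∈V 0 f) [] []
      P₀≡ : ∀ σ → P 0 f σ ≡ c
      P₀≡ σ = proj₂ (P∈V 0 f) σ
      zero-mean : E (λ σ → f σ - P 0 f σ) ≡ 0ℚ
      zero-mean = trans (PLF.ext 𝔾 λ σ → sym (trans (cong ((f σ - P 0 f σ) *_) (𝟙-yes (σ ∙ [] ≟V []) refl)) (*-identityʳ _))) (P-perp 0 f [] [])
      eq : α ≡ c
      eq = trans (l α (E (P 0 f))) (trans (cong (_+ E (P 0 f)) (trans (sym (PLF.sub 𝔾 f (P 0 f))) zero-mean)) (trans (+-identityˡ _) (trans (PLF.ext 𝔾 P₀≡) (E-const c))))
        where
        l : ∀ a b → a ≡ (a - b) + b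
        l = solve-∀ ringℚ

    triple : (El → ℚ) → ℚ
    triple z = inner (conv f z) f

    triple-ext : ∀ {z y} → (∀ σ → z σ ≡ y σ) → triple z ≡ triple y
    triple-ext {z} {y} p = PLF.ext 𝔾 λ s → cong (_* f s) (conv-ext {f} {f} {z} {y} (λ _ → refl) p s)

    triple-+ : ∀ y z → triple (λ σ → y σ + z σ) ≡ triple y + triple z
    triple-+ y z = trans (PLF.ext 𝔾 λ s → trans (cong (_* f s) (trans (conv-ext {f} {f} {λ σ → y σ + z σ} {λ σ → 1ℚ * y σ + 1ℚ * z σ} (λ _ → refl) (λ σ → sym (cong₂ _+_ (*-identityˡ (y σ)) (*-identityˡ (z σ)))) s)
      (trans (conv-lin f 1ℚ 1ℚ y z s) (cong₂ _+_ (*-identityˡ (conv f y s)) (*-identityˡ (conv f z s)))))) (*-distribʳ-+ (f s) (conv f y s) (conv f z s))) (PLF.add 𝔾 _ _)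

    triple-const : triple (λ _ → α) ≡ α * α * α
    triple-const = trans (PLF.ext 𝔾 λ s → cong (_* f s) (PLF.sclr 𝔾 α f)) (PLF.scl 𝔾 (α * α) f)

    sumT : ℕ → ℚ
    sumT zero    = 0ℚ
    sumT (suc t) = sumT t + triple (g t)

    triple-P : ∀ t → triple (P t f) ≡ α * α * α + sumT t
    triple-P zero    = trans (triple-ext P₀) (trans triple-const (sym (+-identityʳ _)))
    triple-P (suc t) = trans (triple-ext {z = P (suc t) f} {λ σ → P t f σ + g t σ} λ σ → l (P (suc t) f σ) (P t f σ)) (trans (triple-+ (P t f) (g t)) (trans (cong (_+ triple (g t)) (triple-P t)) (+-assoc (α * α * α) _ _)))
      where
      l : ∀ a b → a ≡ b + (a - b)
      l = solve-∀ ringℚ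

    triple-f : ∀ t → triple f ≡ α * α * α + sumT t + triple (λ σ → f σ - P t f σ)
    triple-f t = trans (triple-ext {z = f} {λ σ → P t f σ + (f σ - P t f σ)} λ σ → l (f σ) (P t f σ)) (trans (triple-+ (P t f) (λ σ → f σ - P t f σ)) (cong (_+ triple (λ σ → f σ - P t f σ)) (triple-P t)))
      where
      l : ∀ a b → a ≡ b + (a - b)
      l = solve-∀ ringℚ

    f≡ : ∀ d σ → f σ ≡ (P d f σ + g d σ) + (f σ - P (suc d) f σ)
    f≡ d σ = l (f σ) (P d f σ) (P (suc d) f σ)
      where
      l : ∀ f a b → f ≡ (a + (b - a)) + (f - b)
      l = solve-∀ ringℚ

    -- The part of f below `g d` lies in V d, to which `g d` is orthogonal; the part above is
    -- orthogonal to V (d + 1), which contains `g d`. Reflection at s respects both, so their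
    -- convolutions with `g d` vanish.
    conv-f-g : ∀ d s → conv f (g d) s ≡ conv (g d) (g d) s
    conv-f-g d s = trans (conv-ext {v = g d} {g d} (f≡ d) (λ _ → refl) s) (trans (conv-+ˡ (λ σ → P d f σ + g d σ) (λ σ → f σ - P (suc d) f σ) (g d) s)
      (trans (add0ʳ {conv (λ σ → P d f σ + g d σ) (g d) s} (conv-perp-inV {v = λ σ → f σ - P (suc d) f σ} {g d} (P-perp (suc d) f) (g∈V d) s))
        (trans (conv-+ˡ (P d f) (g d) (g d) s) (add0ˡ (conv-inV-perp {y = P d f} {g d} (P∈V d f) (g-perp d) s)))))

    triple-g : ∀ d → triple (g d) ≡ inner (conv (g d) (g d)) (g d)
    triple-g d = trans (PLF.ext 𝔾 λ s → trans (cong₂ _*_ (conv-f-g d s) (f≡ d s)) (l (conv (g d) (g d) s) (P d f s) (g d s) (f s - P (suc d) f s)))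
      (trans (PLF.add 𝔾 _ _) (trans (add0ˡ (InV-⊥ (P∈V d f) (Perp-conv (g d) {g d} (g-perp d)))) (trans (PLF.add 𝔾 _ _) (add0ʳ {inner (conv (g d) (g d)) (g d)} (InV-⊥ (InV-conv (g d) {g d} (g∈V d)) (P-perp (suc d) f))))))
      where
      l : ∀ c a b e → c * ((a + b) + e) ≡ a * c + (c * b + c * e)
      l = solve-∀ ringℚ

    module _ (d k : ℕ) (k≡ : k ≡ suc d) (2d≤n : suc (suc (k ℕ.+ k)) ℕ.≤ n) where
      open Main d k k≡ 2d≤n
      module _ (0<p : 0ℚ < p k) (small : tuples k * tuples k * β ≤ ½ * p k) where
        open Large 0<p small

        K : ℚ
        K = κ + 1ℚ

        -- Passing to matrices by `upper-frame` gains p twice, once for each factor; passing back by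
        -- `lower-frame` loses it once. The net factor p is of order n^(-k).
        nrm²-conv : nrm² (conv (g d) (g d)) ≤ nat 4 * (p k * (K * K)) * (nrm² (g d) * nrm² (g d))
        nrm²-conv = *-cancelˡ 0<p (≤-trans (lower-frame (conv (g d) (g d)) (Perp-conv (g d) {g d} (g-perp d)) (subst (λ j → InV j (conv (g d) (g d))) (sym k≡) (InV-conv (g d) {g d} (g∈V d))))
          (≤-trans (*-monoʳ (0≤nat 4) (≤-trans (N-conv k (g d) (g d)) (*-mono (0≤N k (g d)) (≤-trans (0≤N k (g d)) up) up up))) (≤-reflexive (l (nat 4) (p k) K (nrm² (g d))))))
          where
          up : N k (g d) ≤ p k * K * nrm² (g d)
          up = upper-frame (g d) (g-perp d)
          l : ∀ f p k x → f * (p * k * x * (p * k * x)) ≡ p * (f * (p * (k * k)) * (x * x))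
          l = solve-∀ ringℚ

        triple-g² : triple (g d) * triple (g d) ≤ nat 4 * (p k * (K * K)) * (nrm² (g d) * nrm² (g d) * nrm² (g d))
        triple-g² = ≤-trans (≤-reflexive (cong₂ _*_ (triple-g d) (triple-g d))) (≤-trans (PLF.cs 𝔾 (conv (g d) (g d)) (g d)) (≤-trans (*-monoˡ (0≤nrm² (g d)) nrm²-conv) (≤-reflexive (*-assoc (nat 4 * (p k * (K * K))) (nrm² (g d) * nrm² (g d)) (nrm² (g d))))))

-- The spectral gap

swap-conj : ∀ {n} {f : Fin n → Fin n} → Inj f → ∀ a b x → f (swap a b x) ≡ swap (f a) (f b) (f x)
swap-conj {f = f} inj a b x = at-a (x ≟ a)
  where
  at-b : ¬ x ≡ a → Dec (x ≡ b) → f (swap a b x) ≡ swap (f a) (f b) (f x)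
  at-b ne (yes e) = trans (cong (λ y → f (swap a b y)) e) (trans (cong f (swap-r a b)) (sym (trans (cong (λ y → swap (f a) (f b) (f y)) e) (swap-r (f a) (f b)))))
  at-b ne (no nb) = trans (cong f (swap-o ne nb)) (sym (swap-o (λ e → ne (inj e)) (λ e → nb (inj e))))
  at-a : Dec (x ≡ a) → f (swap a b x) ≡ swap (f a) (f b) (f x)
  at-a (yes e) = trans (cong (λ y → f (swap a b y)) e) (trans (cong f (swap-l a b)) (sym (trans (cong (λ y → swap (f a) (f b) (f y)) e) (swap-l (f a) (f b)))))
  at-a (no ne) = at-b ne (x ≟ b)

record Quad (n : ℕ) : Set where
  constructor quad
  field
    a b c d : Fin n
    a≢b : ¬ a ≡ b
    c≢d : ¬ c ≡ d

module Quads (n : ℕ) where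
  open Alternating n
  open TupleCalculus n

  -- The product of the transpositions (a b) and (c d): a double transposition, or a 3-cycle when b = c.
  abstract
    dt : Quad n → El
    dt (quad a b c d p q) = mk (λ i → swap a b (swap c d i)) (λ e → swap-inj c d (swap-inj a b e))
      (trans (par-∘ (swap a b) (swap c d) (swap-inj a b) (swap-inj c d)) (cong₂ _xor_ (par-swap a b p) (par-swap c d q)))

    dt-$ : ∀ Q i → dt Q $ i ≡ swap (Quad.a Q) (Quad.b Q) (swap (Quad.c Q) (Quad.d Q) i)
    dt-$ (quad a b c d p q) i = mk-$ (λ i → swap a b (swap c d i)) (λ e → swap-inj c d (swap-inj a b e))
      (trans (par-∘ (swap a b) (swap c d) (swap-inj a b) (swap-inj c d)) (cong₂ _xor_ (par-swap a b p) (par-swap c d q))) i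

  act : El → Quad n → Quad n
  act g (quad a b c d p q) = quad (g $ a) (g $ b) (g $ c) (g $ d) (λ e → p ($-inj g e)) (λ e → q ($-inj g e))

  dt-conj : ∀ g Q → g · dt Q ≡ dt (act g Q) · g
  dt-conj g Q@(quad a b c d p q) = El-ext λ i → trans (·-$ g (dt Q) i) (trans (cong (g $_) (dt-$ Q i)) (trans (swap-conj {f = g $_} ($-inj g) a b (swap c d i))
    (trans (cong (swap (g $ a) (g $ b)) (swap-conj {f = g $_} ($-inj g) c d i)) (sym (trans (·-$ (dt (act g Q)) g i) (dt-$ (act g Q) (g $ i)))))))

  SamePts : Quad n → Quad n → Set
  SamePts Q Q' = (Quad.a Q ≡ Quad.a Q') × (Quad.b Q ≡ Quad.b Q') × (Quad.c Q ≡ Quad.c Q') × (Quad.d Q ≡ Quad.d Q')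

  dt-cong : ∀ {Q Q'} → SamePts Q Q' → dt Q ≡ dt Q'
  dt-cong {Q} {Q'} (refl , refl , refl , refl) = El-ext λ i → trans (dt-$ Q i) (sym (dt-$ Q' i))

  dt-move : ∀ g Q Q' → SamePts (act g Q) Q' → g · dt Q ≡ dt Q' · g
  dt-move g Q Q' e = trans (dt-conj g Q) (cong (_· g) (dt-cong {act g Q} {Q'} e))

  Off : ∀ {k} → Vec (Fin n) k → Fin n → Set
  Off K x = ∀ i → ¬ lookup K i ≡ x

  dt-fix : ∀ Q {k} (K : Vec (Fin n) k) → Off K (Quad.a Q) → Off K (Quad.b Q) → Off K (Quad.c Q) → Off K (Quad.d Q) → dt Q ∙ K ≡ K
  dt-fix Q K oa ob oc od = lookup-ext λ i → trans (lookup-∙ (dt Q) K i) (trans (dt-$ Q (lookup K i)) (trans (cong (swap (Quad.a Q) (Quad.b Q)) (swap-o (oc i) (od i))) (swap-o (oa i) (ob i))))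

  fixes : ∀ {k} g (K : Vec (Fin n) k) → g ∙ K ≡ K → ∀ i → g $ lookup K i ≡ lookup K i
  fixes g K e i = trans (sym (lookup-∙ g K i)) (cong (λ v → lookup v i) e)

  Off-fix : ∀ {k} g (K : Vec (Fin n) k) → g ∙ K ≡ K → ∀ {x} → Off K x → Off K (g $ x)
  Off-fix g K e {x} o i r = o i ($-inj g (trans (fixes g K e i) r))

  ⁻¹-fix : ∀ {k} g (K : Vec (Fin n) k) → g ∙ K ≡ K → g ⁻¹ ∙ K ≡ K
  ⁻¹-fix g K e = trans (cong (g ⁻¹ ∙_) (sym e)) (⁻¹-∙ g K)

  -- Two points are left, and exchanging them would be odd. This is where the chain of growing
  -- tuples in `telescope` may stop.
  fixes-all : ∀ {k} (I : Vec (Fin n) k) → InjV I → suc (suc k) ≡ n → ∀ h → h ∙ I ≡ I → h ≡ unit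
  fixes-all {k} I inj k≡ h e = El-ext λ i → trans (fixed i (any? λ a → lookup I a ≟ i)) (sym (unit-$ i))
    where
    k<n : suc k ℕ.≤ n
    k<n = ℕ.≤-trans (ℕ.n≤1+n (suc k)) (ℕ.≤-reflexive k≡)
    u = proj₁ (missing I k<n) ; u∉ = proj₂ (missing I k<n)
    v = proj₁ (missing (u ∷ I) (ℕ.≤-reflexive k≡)) ; v∉ = proj₂ (missing (u ∷ I) (ℕ.≤-reflexive k≡))
    u≢v : ¬ u ≡ v
    u≢v = v∉ zero
    only : ∀ x → Off I x → ¬ x ≡ u → ¬ x ≡ v → ∀ {A : Set} → A
    only x ox xu xv = ⊥-elim (ℕ.<-irrefl k≡ (Fin.injective⇒≤ {f = lookup (x ∷ v ∷ u ∷ I)} (InjV-∷ {v = v ∷ u ∷ I} (λ { zero r → xv (sym r) ; (suc zero) r → xu (sym r) ; (suc (suc a)) r → ox a r })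
      (InjV-∷ {v = u ∷ I} v∉ (InjV-∷ {v = I} u∉ inj)))))
    hu≢v : ¬ h $ u ≡ v
    hu≢v r = true≢false (trans (sym (par-swap u v u≢v)) (trans (par-cong λ i → sym (isSwap i (i ≟ u) (i ≟ v))) ($-par h)))
      where
      true≢false : ¬ true ≡ false
      true≢false ()
      hv : h $ v ≡ u
      hv = by (h $ v ≟ u) (h $ v ≟ v)
        where
        by : Dec (h $ v ≡ u) → Dec (h $ v ≡ v) → h $ v ≡ u
        by (yes p) _ = p
        by (no p) (yes q) = ⊥-elim (u≢v ($-inj h (trans r (sym q))))
        by (no p) (no q) = only (h $ v) (Off-fix h I e (λ i → v∉ (suc i))) p q
      isSwap : ∀ i → Dec (i ≡ u) → Dec (i ≡ v) → h $ i ≡ swap u v i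
      isSwap i (yes p) _ = trans (cong (h $_) p) (trans r (sym (trans (cong (swap u v) p) (swap-l u v))))
      isSwap i (no p) (yes q) = trans (cong (h $_) q) (trans hv (sym (trans (cong (swap u v) q) (swap-r u v))))
      isSwap i (no p) (no q) = trans (by (any? λ a → lookup I a ≟ i)) (sym (swap-o p q))
        where
        by : Dec (∃ λ a → lookup I a ≡ i) → h $ i ≡ i
        by (yes (a , s)) = trans (cong (h $_) (sym s)) (trans (fixes h I e a) s)
        by (no o) = only i (λ a s → o (a , s)) p q
    hu : h $ u ≡ u
    hu = by (h $ u ≟ u)
      where
      by : Dec (h $ u ≡ u) → h $ u ≡ u
      by (yes p) = p
      by (no p) = only (h $ u) (Off-fix h I e u∉) p hu≢v
    hv : h $ v ≡ v
    hv = by (h $ v ≟ v)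
      where
      by : Dec (h $ v ≡ v) → h $ v ≡ v
      by (yes p) = p
      by (no p) = only (h $ v) (Off-fix h I e (λ i → v∉ (suc i))) (λ q → u≢v ($-inj h (trans hu (sym q)))) p
    fixed : ∀ i → Dec (∃ λ a → lookup I a ≡ i) → h $ i ≡ i
    fixed i (yes (a , s)) = trans (cong (h $_) (sym s)) (trans (fixes h I e a) s)
    fixed i (no o) = by (i ≟ u) (i ≟ v)
      where
      by : Dec (i ≡ u) → Dec (i ≡ v) → h $ i ≡ i
      by (yes p) _ = trans (cong (h $_) p) (trans hu (sym p))
      by (no p) (yes q) = trans (cong (h $_) q) (trans hv (sym q))
      by (no p) (no q) = only i (λ a s → o (a , s)) p q

  module Stabiliser {m} (I : Vec (Fin n) m) (0<π : 0ℚ < Pr I I) where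
    π : ℚ
    π = inv (Pr I I) 0<π

    0≤π : 0ℚ ≤ π
    0≤π = <⇒≤ (0<inv (Pr I I) 0<π)

    fix : El → ℚ
    fix h = 𝟙 (h ∙ I ≟V I)

    𝔖 : PLF El
    𝔖 = record
      { ap = λ F → π * E (λ h → fix h * F h)
      ; add = λ f g → trans (cong (π *_) (trans (PLF.ext 𝔾 λ h → *-distribˡ-+ (fix h) (f h) (g h)) (PLF.add 𝔾 _ _))) (*-distribˡ-+ π _ _)
      ; scl = λ c f → trans (cong (π *_) (trans (PLF.ext 𝔾 λ h → l (fix h) c (f h)) (PLF.scl 𝔾 c _))) (l π c _)
      ; mono = λ p → *-monoʳ 0≤π (PLF.mono 𝔾 λ h → *-monoʳ (0≤𝟙 (h ∙ I ≟V I)) (p h)) }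
      where
      l : ∀ a c b → a * (c * b) ≡ c * (a * b)
      l = solve-∀ ringℚ

    S : (El → ℚ) → ℚ
    S = PLF.ap 𝔖

    S-ext : ∀ {F G : El → ℚ} → (∀ h → h ∙ I ≡ I → F h ≡ G h) → S F ≡ S G
    S-ext {F} {G} p = cong (π *_) (PLF.ext 𝔾 λ h → by h (h ∙ I ≟V I))
      where
      by : ∀ h (r : Dec (h ∙ I ≡ I)) → 𝟙 r * F h ≡ 𝟙 r * G h
      by h (yes e) = cong (1ℚ *_) (p h e)
      by h (no _)  = trans (*-zeroˡ (F h)) (sym (*-zeroˡ (G h)))

    S-one : S (λ _ → 1ℚ) ≡ 1ℚ
    S-one = trans (cong (π *_) (PLF.ext 𝔾 λ h → *-identityʳ (fix h))) (trans (*-comm π (Pr I I)) (inv-r (Pr I I) 0<π))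

    S-const : ∀ c → S (λ _ → c) ≡ c
    S-const c = trans (PLF.ext 𝔖 λ _ → sym (*-identityʳ c)) (trans (PLF.scl 𝔖 c (λ _ → 1ℚ)) (trans (cong (c *_) S-one) (*-identityʳ c)))

    S-bound : ∀ {F : El → ℚ} {c} → (∀ h → h ∙ I ≡ I → F h ≤ c) → S F ≤ c
    S-bound {F} {c} p = ≤-trans (*-monoʳ 0≤π (PLF.mono 𝔾 λ h → by h (h ∙ I ≟V I))) (≤-reflexive (S-const c))
      where
      by : ∀ h (r : Dec (h ∙ I ≡ I)) → 𝟙 r * F h ≤ 𝟙 r * c
      by h (yes e) = *-monoʳ 0≤1 (p h e)
      by h (no _)  = ≤-reflexive (trans (*-zeroˡ (F h)) (sym (*-zeroˡ c)))

    S-left : ∀ g → g ∙ I ≡ I → ∀ F → S (λ h → F (g · h)) ≡ S F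
    S-left g e F = cong (π *_) (trans (PLF.ext 𝔾 λ h → cong (_* F (g · h)) (𝟙-cong (h ∙ I ≟V I) ((g · h) ∙ I ≟V I)
      (λ r → trans (·-∙ g h I) (trans (cong (g ∙_) r) e)) (λ r → trans (sym (⁻¹-∙ g (h ∙ I))) (trans (cong (g ⁻¹ ∙_) (trans (sym (·-∙ g h I)) r)) (⁻¹-fix g I e))))) (E-left g λ h → fix h * F h))

    S-right : ∀ g → g ∙ I ≡ I → ∀ F → S (λ h → F (h · g)) ≡ S F
    S-right g e F = cong (π *_) (trans (PLF.ext 𝔾 λ h → cong (_* F (h · g)) (𝟙-cong (h ∙ I ≟V I) ((h · g) ∙ I ≟V I)
      (λ r → trans (·-∙ h g I) (trans (cong (h ∙_) e) r)) (λ r → trans (cong (h ∙_) (sym e)) (trans (sym (·-∙ h g I)) r)))) (E-right g λ h → fix h * F h))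

    S-inv : ∀ F → S (λ h → F (h ⁻¹)) ≡ S F
    S-inv F = cong (π *_) (trans (PLF.ext 𝔾 λ h → cong (_* F (h ⁻¹)) (𝟙-cong (h ∙ I ≟V I) (h ⁻¹ ∙ I ≟V I) (⁻¹-fix h I)
      (λ r → trans (cong (_∙ I) (sym (⁻¹⁻¹ h))) (⁻¹-fix (h ⁻¹) I r)))) (E-inv λ h → fix h * F h))

    S-fin : Finitary 𝔖
    S-fin B f = trans (PLF.scl B π _) (cong (π *_) (trans (𝔾-fin B λ h x → fix h * f h x) (PLF.ext 𝔾 λ h → PLF.scl B (fix h) (f h))))

    jensen : ∀ F → S F * S F ≤ S (λ h → F h * F h)
    jensen F = ≤-trans (≤-reflexive (cong (λ z → z * z) (PLF.ext 𝔖 λ h → sym (*-identityʳ (F h))))) (≤-trans (PLF.cs 𝔖 F (λ _ → 1ℚ))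
      (≤-reflexive (trans (cong (S (λ h → F h * F h) *_) (trans (PLF.ext 𝔖 λ _ → *-identityʳ 1ℚ) S-one)) (*-identityʳ _))))

  -- Families indexed by a translation parameter τ. Averaging over τ makes norms invariant under
  -- conjugation (`twist-conj`), which they need not be for a single function; all double
  -- transpositions then behave alike.
  Fam : Set
  Fam = El → El → ℚ

  ⟪_,_⟫ : Fam → Fam → ℚ
  ⟪ Y , Z ⟫ = E λ τ → E λ σ → Y τ σ * Z τ σ

  shift : El → Fam → Fam
  shift g Y τ σ = Y τ (σ · g)

  _⊝_ : Fam → Fam → Fam
  (Y ⊝ Z) τ σ = Y τ σ - Z τ σ

  𝔾₂ : PLF (El × El)
  𝔾₂ = 𝔾 ⊗ 𝔾

  0≤⟪⟫ : ∀ Y → 0ℚ ≤ ⟪ Y , Y ⟫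
  0≤⟪⟫ Y = PLF.sqs 𝔾₂ λ w → Y (proj₁ w) (proj₂ w)

  ⟪⟫-ext : ∀ {Y Y' Z Z' : Fam} → (∀ τ σ → Y τ σ ≡ Y' τ σ) → (∀ τ σ → Z τ σ ≡ Z' τ σ) → ⟪ Y , Z ⟫ ≡ ⟪ Y' , Z' ⟫
  ⟪⟫-ext p q = PLF.ext 𝔾 λ τ → PLF.ext 𝔾 λ σ → cong₂ _*_ (p τ σ) (q τ σ)

  shift-iso : ∀ g Y Z → ⟪ shift g Y , shift g Z ⟫ ≡ ⟪ Y , Z ⟫
  shift-iso g Y Z = PLF.ext 𝔾 λ τ → E-right g λ σ → Y τ σ * Z τ σ

  ⊝-sq : ∀ Y Z → ⟪ Y ⊝ Z , Y ⊝ Z ⟫ ≡ ⟪ Y , Y ⟫ - nat 2 * ⟪ Y , Z ⟫ + ⟪ Z , Z ⟫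
  ⊝-sq Y Z = trans (PLF.ext 𝔾₂ λ w → l (Y (proj₁ w) (proj₂ w)) (Z (proj₁ w) (proj₂ w))) (trans (PLF.add 𝔾₂ _ _) (cong (_+ ⟪ Z , Z ⟫) (trans (PLF.sub 𝔾₂ _ _) (cong (λ z → ⟪ Y , Y ⟫ - z) (PLF.scl 𝔾₂ (nat 2) λ w → Y (proj₁ w) (proj₂ w) * Z (proj₁ w) (proj₂ w))))))
    where
    l : ∀ a b → (a - b) * (a - b) ≡ (a * a - nat 2 * (a * b)) + b * b
    l = solve-∀ ringℚ

module Gaps (n : ℕ) where
  open Alternating n
  open TupleCalculus n
  open Quads n

  InjV-Off : ∀ {m} (I : Vec (Fin n) m) {p} → Off I p → InjV I → InjV (p ∷ I)
  InjV-Off I o q = InjV-∷ {v = I} o q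

  Pr-pos : ∀ {m} (I : Vec (Fin n) m) → 0ℚ < Pr I I
  Pr-pos I = <-≤-trans (0<inv card 0<card) (≤-trans (≤-reflexive (sym (trans (cong (inv card 0<card *_) (δ-sum unit)) (*-identityʳ _))))
    (PLF.mono 𝔾 λ h → by h (h ≟E unit)))
    where
    by : ∀ h (r : Dec (h ≡ unit)) → 𝟙 r ≤ 𝟙 (h ∙ I ≟V I)
    by h (no _)  = 0≤𝟙 (h ∙ I ≟V I)
    by h (yes e) = ≤-reflexive (sym (𝟙-yes (h ∙ I ≟V I) (trans (cong (_∙ I) e) (unit-∙ I))))

  -- The conditional expectation given the values of σ on I, since right multiplication by the
  -- stabiliser of I leaves σ ∙ I unchanged.
  A : ∀ {m} → Vec (Fin n) m → Fam → Fam
  A I Y τ σ = Stabiliser.S I (Pr-pos I) λ h → Y τ (σ · h)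

  A-sym : ∀ {m} (I : Vec (Fin n) m) Y Z → ⟪ A I Y , Z ⟫ ≡ ⟪ Y , A I Z ⟫
  A-sym I Y Z = PLF.ext 𝔾 λ τ → begin
      E (λ σ → S (λ h → Y τ (σ · h)) * Z τ σ)
        ≡⟨ PLF.ext 𝔾 (λ σ → sym (PLF.sclr 𝔖 (Z τ σ) λ h → Y τ (σ · h))) ⟩
      E (λ σ → S λ h → Y τ (σ · h) * Z τ σ)
        ≡⟨ 𝔾-fin 𝔖 (λ σ h → Y τ (σ · h) * Z τ σ) ⟨
      S (λ h → E λ σ → Y τ (σ · h) * Z τ σ)
        ≡⟨ PLF.ext 𝔖 (λ h → trans (sym (E-right (h ⁻¹) λ σ → Y τ (σ · h) * Z τ σ)) (PLF.ext 𝔾 λ σ → cong (λ g → Y τ g * Z τ (σ · h ⁻¹)) (trans (assoc σ (h ⁻¹) h) (trans (cong (σ ·_) (invˡ h)) (idʳ σ))))) ⟩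
      S (λ h → E λ σ → Y τ σ * Z τ (σ · h ⁻¹))
        ≡⟨ S-inv (λ h → E λ σ → Y τ σ * Z τ (σ · h)) ⟩
      S (λ h → E λ σ → Y τ σ * Z τ (σ · h))
        ≡⟨ 𝔾-fin 𝔖 (λ σ h → Y τ σ * Z τ (σ · h)) ⟩
      E (λ σ → S λ h → Y τ σ * Z τ (σ · h))
        ≡⟨ PLF.ext 𝔾 (λ σ → PLF.scl 𝔖 (Y τ σ) λ h → Z τ (σ · h)) ⟩
      E (λ σ → Y τ σ * S (λ h → Z τ (σ · h))) ∎
    where
    open ≡-Reasoning
    open Stabiliser I (Pr-pos I)

  A-below : ∀ {m k} (I : Vec (Fin n) m) (J : Vec (Fin n) k) → (∀ h → h ∙ J ≡ J → h ∙ I ≡ I) → ∀ Y τ σ → A J (A I Y) τ σ ≡ A I Y τ σ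
  A-below I J le Y τ σ = trans (SJ.S-ext λ h e → trans (PLF.ext SI.𝔖 λ k → cong (Y τ) (assoc σ h k)) (SI.S-left h (le h e) λ k → Y τ (σ · k))) (SJ.S-const _)
    where
    module SI = Stabiliser I (Pr-pos I)
    module SJ = Stabiliser J (Pr-pos J)

  A-above : ∀ {m k} (I : Vec (Fin n) m) (J : Vec (Fin n) k) → (∀ h → h ∙ J ≡ J → h ∙ I ≡ I) → ∀ Y τ σ → A I (A J Y) τ σ ≡ A I Y τ σ
  A-above I J le Y τ σ = trans (SJ.S-fin SI.𝔖 λ k h → Y τ (σ · h · k)) (trans (SJ.S-ext λ k e → trans (PLF.ext SI.𝔖 λ h → cong (Y τ) (assoc σ h k)) (SI.S-right k (le k e) λ h → Y τ (σ · h))) (SJ.S-const _))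
    where
    module SI = Stabiliser I (Pr-pos I)
    module SJ = Stabiliser J (Pr-pos J)

  ∙-tail : ∀ {m p} {I : Vec (Fin n) m} h → h ∙ (p ∷ I) ≡ p ∷ I → h ∙ I ≡ I
  ∙-tail h e = ∷-injectiveʳ e

  Δ : Fam → El → ℚ
  Δ Y g = ⟪ Y ⊝ shift g Y , Y ⊝ shift g Y ⟫

  module Telescope {k} (K : Vec (Fin n) k) (Y : Fam) (Φ : ℚ)
    (bound : ∀ Q → Off K (Quad.a Q) → Off K (Quad.b Q) → Off K (Quad.d Q) → Quad.b Q ≡ Quad.c Q → ¬ Quad.a Q ≡ Quad.d Q → Δ Y (dt Q) ≤ Φ) where

    Above : ∀ {m} → Vec (Fin n) m → Set
    Above I = ∀ x → Off I x → Off K x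

    nonneg : ∀ {m} {I : Vec (Fin n) m} → suc (suc (suc m)) ℕ.≤ n → InjV I → Above I → 0ℚ ≤ Φ
    nonneg {I = I} le inj ab = ≤-trans (0≤⟪⟫ (Y ⊝ shift (dt Q) Y)) (bound Q (ab x x∉) (ab y λ i → y∉ (suc i)) (ab z λ i → z∉ (suc (suc i))) refl (z∉ (suc zero)))
      where
      mx = missing I (ℕ.≤-trans (ℕ.≤-trans (ℕ.n≤1+n _) (ℕ.n≤1+n _)) le)
      x = proj₁ mx ; x∉ = proj₂ mx
      my = missing (x ∷ I) (ℕ.≤-trans (ℕ.n≤1+n _) le)
      y = proj₁ my ; y∉ = proj₂ my
      mz = missing (y ∷ x ∷ I) le
      z = proj₁ mz ; z∉ = proj₂ mz
      Q : Quad n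
      Q = quad x y y z (y∉ zero) (z∉ zero)

    module Step {m} (I : Vec (Fin n) m) (p : Fin n) (inj : InjV (p ∷ I)) (le : suc (suc (suc m)) ℕ.≤ n) (ab : Above I) where
      J = p ∷ I
      B = A J Y
      C = A I Y
      module SI = Stabiliser I (Pr-pos I)
      module SJ = Stabiliser J (Pr-pos J)

      up : ∀ h → h ∙ J ≡ J → h ∙ I ≡ I
      up h e = ∙-tail {p = p} {I} h e

      p∉ : Off I p
      p∉ = InjV-head {v = I} inj

      -- The bound for Y passes to its average over the stabiliser of J: moving a 3-cycle past an
      -- element k of the stabiliser conjugates it into another 3-cycle, which still avoids K
      -- because k fixes K.
      cycle : ∀ Q → Off K (Quad.a Q) → Off K (Quad.b Q) → Off K (Quad.d Q) → Quad.b Q ≡ Quad.c Q → ¬ Quad.a Q ≡ Quad.d Q → Δ B (dt Q) ≤ Φ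
      cycle Q oa ob od e ne = ≤-trans (PLF.mono 𝔾₂ λ w → ≤-trans (≤-reflexive (cong (λ z → z * z) (sym (PLF.sub SJ.𝔖 _ _)))) (SJ.jensen λ k → Y (proj₁ w) (proj₂ w · k) - Y (proj₁ w) (proj₂ w · dt Q · k)))
        (≤-trans (≤-reflexive (trans (PLF.ext 𝔾 λ τ → sym (𝔾-fin SJ.𝔖 λ σ k → D k τ σ)) (sym (𝔾-fin SJ.𝔖 λ τ k → E λ σ → D k τ σ)))) (SJ.S-bound each))
        where
        D : El → El → El → ℚ
        D k τ σ = (Y τ (σ · k) - Y τ (σ · dt Q · k)) * (Y τ (σ · k) - Y τ (σ · dt Q · k))
        each : ∀ k → k ∙ J ≡ J → E (λ τ → E λ σ → D k τ σ) ≤ Φ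
        each k f = ≤-trans (≤-reflexive (PLF.ext 𝔾 λ τ → trans (PLF.ext 𝔾 λ σ → cong (λ g → (Y τ (σ · k) - Y τ g) * (Y τ (σ · k) - Y τ g)) (eq σ)) (E-right k λ σ → (Y τ σ - Y τ (σ · dt Q')) * (Y τ σ - Y τ (σ · dt Q')))))
          (bound Q' (off oa) (off ob) (off od) (cong (k ⁻¹ $_) e) (λ r → ne ($-inj (k ⁻¹) r)))
          where
          Q' : Quad n
          Q' = act (k ⁻¹) Q
          off : ∀ {x} → Off K x → Off K (k ⁻¹ $ x)
          off = Off-fix (k ⁻¹) K (⁻¹-fix k K (lookup-ext λ i → trans (lookup-∙ k K i) (fixK i)))
            where
            inI : ∀ i → Dec (∃ λ a → lookup I a ≡ lookup K i) → ∃ λ a → lookup I a ≡ lookup K i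
            inI i (yes q) = q
            inI i (no q)  = ⊥-elim (ab (lookup K i) (λ a s → q (a , s)) i refl)
            fixK : ∀ i → k $ lookup K i ≡ lookup K i
            fixK i = let (a , s) = inI i (any? λ a → lookup I a ≟ lookup K i) in trans (cong (k $_) (sym s)) (trans (fixes k I (up k f) a) s)
          eq : ∀ σ → σ · dt Q · k ≡ σ · k · dt Q'
          eq σ = trans (assoc σ (dt Q) k) (trans (cong (σ ·_) (sym (dt-move k Q' Q ($-⁻¹ k _ , $-⁻¹ k _ , $-⁻¹ k _ , $-⁻¹ k _)))) (sym (assoc σ k (dt Q'))))

      -- B is invariant under the stabiliser of J = p ∷ I. Any h fixing I is a 3-cycle taking p to h
      -- p, times an element of that stabiliser, so displacing by h is the same as displacing by one
      -- 3-cycle.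
      move : ∀ h → h ∙ I ≡ I → Δ B h ≤ Φ
      move h f = by (h $ p ≟ p)
        where
        fixed : ∀ g → g ∙ J ≡ J → ∀ c τ σ → B τ (σ · (c · g)) ≡ B τ (σ · c)
        fixed g e c τ σ = trans (PLF.ext SJ.𝔖 λ k → cong (Y τ) (trans (cong (_· k) (sym (assoc σ c g))) (assoc (σ · c) g k))) (SJ.S-left g e λ k → Y τ (σ · c · k))
        by : Dec (h $ p ≡ p) → Δ B h ≤ Φ
        by (yes e) = ≤-trans (≤-reflexive (trans (PLF.ext 𝔾 λ τ → trans (PLF.ext 𝔾 λ σ → z (B τ σ) _ (trans (cong (λ g → B τ (σ · g)) (sym (idˡ h))) (trans (fixed h (cong₂ _∷_ e f) unit τ σ) (cong (B τ) (idʳ σ))))) (PLF.zer 𝔾)) (PLF.zer 𝔾))) (nonneg {I = I} le (InjV-tail {v = I} inj) ab)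
          where
          z : ∀ a b → b ≡ a → (a - b) * (a - b) ≡ 0ℚ
          z a b e = trans (cong (λ b → (a - b) * (a - b)) e) (l a)
            where
            l : ∀ a → (a - a) * (a - a) ≡ 0ℚ
            l = solve-∀ ringℚ
        by (no ne) = ≤-trans (≤-reflexive (⟪⟫-ext d d)) (cycle Q (ab p p∉) (ab (h $ p) hp∉) (ab s λ i → s∉ (suc (suc i))) refl (s∉ (suc zero)))
          where
          hp∉ : Off I (h $ p)
          hp∉ = Off-fix h I f p∉
          ms = missing ((h $ p) ∷ p ∷ I) le
          s = proj₁ ms ; s∉ = proj₂ ms
          Q : Quad n
          Q = quad p (h $ p) (h $ p) s (λ e → ne (sym e)) (s∉ zero)
          c = dt Q
          g = c ⁻¹ · h
          cp : c $ p ≡ h $ p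
          cp = trans (dt-$ Q p) (trans (cong (swap p (h $ p)) (swap-o (λ e → ne (sym e)) (s∉ (suc zero)))) (swap-l p (h $ p)))
          cI : c ∙ I ≡ I
          cI = dt-fix Q I p∉ hp∉ hp∉ (λ i → s∉ (suc (suc i)))
          gJ : g ∙ J ≡ J
          gJ = cong₂ _∷_ (trans (·-$ (c ⁻¹) h p) (trans (cong (c ⁻¹ $_) (sym cp)) (⁻¹-$' c p))) (trans (·-∙ (c ⁻¹) h I) (trans (cong (c ⁻¹ ∙_) f) (⁻¹-fix c I cI)))
          h≡ : h ≡ c · g
          h≡ = sym (trans (sym (assoc c (c ⁻¹) h)) (trans (cong (_· h) (invʳ c)) (idˡ h)))
          d : ∀ τ σ → B τ σ - B τ (σ · h) ≡ B τ σ - B τ (σ · c)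
          d τ σ = cong (λ z → B τ σ - z) (trans (cong (λ y → B τ (σ · y)) h≡) (fixed g gJ c τ σ))

      close : ⟪ B ⊝ C , B ⊝ C ⟫ ≤ Φ
      close = ≤-trans (PLF.mono 𝔾₂ λ w → ≤-trans (≤-reflexive (cong (λ z → z * z) (pt (proj₁ w) (proj₂ w)))) (SI.jensen λ h → B (proj₁ w) (proj₂ w) - B (proj₁ w) (proj₂ w · h)))
        (≤-trans (≤-reflexive (trans (PLF.ext 𝔾 λ τ → sym (𝔾-fin SI.𝔖 λ σ h → D h τ σ)) (sym (𝔾-fin SI.𝔖 λ τ h → E λ σ → D h τ σ)))) (SI.S-bound move))
        where
        D : El → El → El → ℚ
        D h τ σ = (B τ σ - B τ (σ · h)) * (B τ σ - B τ (σ · h))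
        pt : ∀ τ σ → B τ σ - C τ σ ≡ SI.S λ h → B τ σ - B τ (σ · h)
        pt τ σ = sym (trans (PLF.sub SI.𝔖 (λ _ → B τ σ) λ h → B τ (σ · h)) (cong₂ _-_ (SI.S-const (B τ σ)) (A-above I J up Y τ σ)))

      BC≡CC : ⟪ B , C ⟫ ≡ ⟪ C , C ⟫
      BC≡CC = trans (A-sym J Y C) (trans (⟪⟫-ext {Y} {Y} (λ _ _ → refl) (λ τ σ → trans (A-below I J up Y τ σ) (sym (A-below I I (λ _ e → e) Y τ σ)))) (sym (A-sym I Y C)))

      -- B and C are nested conditional expectations, hence C is the projection of B and Pythagoras
      -- applies.
      step : ⟪ B , B ⟫ ≤ ⟪ C , C ⟫ + Φ
      step = ≤-trans (≤-reflexive (l ⟪ B , B ⟫ ⟪ B , C ⟫ ⟪ C , C ⟫ BC≡CC)) (+-monoʳ-≤ ⟪ C , C ⟫ (≤-trans (≤-reflexive (sym (⊝-sq B C))) close))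
        where
        l₀ : ∀ b c → b ≡ c + ((b - nat 2 * c) + c)
        l₀ = solve-∀ ringℚ
        l : ∀ b x c → x ≡ c → b ≡ c + ((b - nat 2 * x) + c)
        l b x c e = trans (l₀ b c) (cong (λ y → c + ((b - nat 2 * y) + c)) (sym e))

    -- The averages A I Y for growing I form a martingale ending in Y; each of its increments is controlled by a single 3-cycle.
    telescope : ∀ j {m} (I : Vec (Fin n) m) → suc (suc (j ℕ.+ m)) ≡ n → InjV I → Above I → ⟪ Y , Y ⟫ ≤ ⟪ A I Y , A I Y ⟫ + nat j * Φ
    telescope zero    I e inj ab = ≤-reflexive (trans (⟪⟫-ext at at) (sym (add0ʳ {⟪ A I Y , A I Y ⟫} (mul0ˡ {nat 0} {Φ} refl))))
      where
      open Stabiliser I (Pr-pos I)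
      at : ∀ τ σ → Y τ σ ≡ A I Y τ σ
      at τ σ = sym (trans (S-ext λ h f → cong (Y τ) (trans (cong (σ ·_) (fixes-all I inj e h f)) (idʳ σ))) (S-const (Y τ σ)))
    telescope (suc j) {m} I e inj ab = ≤-trans (telescope j J (trans (cong (λ x → suc (suc x)) (ℕ.+-suc j m)) e) injJ (λ x o → ab x λ i → o (suc i)))
        (≤-trans (+-monoˡ-≤ (nat j * Φ) (Step.step I p injJ le ab)) (≤-reflexive (l ⟪ A I Y , A I Y ⟫ Φ (nat j))))
      where
      le : suc (suc (suc m)) ℕ.≤ n
      le = ℕ.≤-trans (s≤s (s≤s (s≤s (ℕ.m≤n+m m j)))) (ℕ.≤-reflexive e)
      mp = missing I (ℕ.≤-trans (ℕ.≤-trans (ℕ.n≤1+n _) (ℕ.n≤1+n _)) le)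
      p = proj₁ mp
      J = p ∷ I
      injJ : InjV J
      injJ = InjV-Off I (proj₂ mp) inj
      l : ∀ c f j → c + f + j * f ≡ c + (1ℚ + j) * f
      l = solve-∀ ringℚ

    -- The chain of averages starts at `A K Y`, which vanishes, and reaches Y in fewer than n steps,
    -- each costing at most Φ. This is the spectral gap of order 1/n.
    gap : suc (suc (suc k)) ℕ.≤ n → InjV K → (∀ τ σ → A K Y τ σ ≡ 0ℚ) → ⟪ Y , Y ⟫ ≤ nat n * Φ
    gap le inj z = ≤-trans (telescope j K j≡ inj (λ _ o → o)) (≤-trans (≤-reflexive (add0ˡ (trans (PLF.ext 𝔾₂ λ w → mul0ˡ {_} {A K Y (proj₁ w) (proj₂ w)} (z (proj₁ w) (proj₂ w))) (PLF.zer 𝔾₂))))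
        (*-monoˡ (nonneg {I = K} le inj (λ _ o → o)) (nat-mono (ℕ.≤-trans (ℕ.m≤m+n j k) (ℕ.≤-trans (ℕ.≤-trans (ℕ.n≤1+n _) (ℕ.n≤1+n _)) (ℕ.≤-reflexive j≡))))))
      where
      j = n ℕ.∸ suc (suc k)
      j≡ : suc (suc (j ℕ.+ k)) ≡ n
      j≡ = trans (sym (trans (ℕ.+-suc j (suc k)) (cong suc (ℕ.+-suc j k)))) (ℕ.m∸n+n≡m (ℕ.≤-trans (ℕ.n≤1+n _) le))

module DoubleTranspositions (n : ℕ) where
  open Alternating n
  open TupleCalculus n
  open Quads n
  open Gaps n

  -- Y τ is obtained from the translate R τ z by an operator that commutes with the stabiliser of K.
  Equivariant : ∀ {k} → Vec (Fin n) k → Fam → Set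
  Equivariant K Y = ∀ g → g ∙ K ≡ K → ∀ τ σ → Y τ (σ · g) ≡ Y (g · τ) σ

  twist : ℚ → El → Fam → Fam
  twist ε x Y τ σ = Y τ σ + ε * Y τ (σ · x)

  quadOf : ∀ {k} {K : Vec (Fin n) k} a b c d → InjV (a ∷ b ∷ c ∷ d ∷ K) → Quad n
  quadOf {K = K} a b c d i = quad a b c d (λ e → absurd (i {zero} {suc zero} e)) (λ e → absurd' (i {suc (suc zero)} {suc (suc (suc zero))} e))
    where
    absurd : ∀ {m} → ¬ _≡_ {A = Fin (suc (suc m))} zero (suc zero)
    absurd ()
    absurd' : ∀ {m} → ¬ _≡_ {A = Fin (suc (suc (suc (suc m))))} (suc (suc zero)) (suc (suc (suc zero)))
    absurd' ()

  off-∷ : ∀ {k} {K : Vec (Fin n) k} {x y} → ¬ y ≡ x → Off K x → Off (y ∷ K) x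
  off-∷ ne o zero    = ne
  off-∷ ne o (suc i) = o i

  -- Some g fixing K carries one quadruple to the other; this uses 4 points beyond K and the two
  -- spare points of `extend`. Equivariance trades right translation by g for a shift of τ, which
  -- the average over τ absorbs.
  twist-conj : ∀ {k} (K : Vec (Fin n) k) Y → Equivariant K Y → ∀ ε a b c d a' b' c' d' (i : InjV (a ∷ b ∷ c ∷ d ∷ K)) (i' : InjV (a' ∷ b' ∷ c' ∷ d' ∷ K)) →
    suc (suc (suc (suc (suc (suc k))))) ℕ.≤ n → let x = dt (quadOf {K = K} a b c d i) ; x' = dt (quadOf {K = K} a' b' c' d' i') in
    ⟪ twist ε x Y , twist ε x Y ⟫ ≡ ⟪ twist ε x' Y , twist ε x' Y ⟫
  twist-conj K Y eqv ε a b c d a' b' c' d' i i' le = begin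
      E (λ τ → E λ σ → sq (Y τ σ + ε * Y τ (σ · x)))
        ≡⟨ PLF.ext 𝔾 (λ τ → sym (E-right g λ σ → sq (Y τ σ + ε * Y τ (σ · x)))) ⟩
      E (λ τ → E λ σ → sq (Y τ (σ · g) + ε * Y τ (σ · g · x)))
        ≡⟨ PLF.ext 𝔾 (λ τ → PLF.ext 𝔾 λ σ → cong₂ (λ u v → sq (u + ε * v)) (eqv g gK τ σ) (trans (cong (Y τ) (comm σ)) (eqv g gK τ (σ · x')))) ⟩
      E (λ τ → E λ σ → sq (Y (g · τ) σ + ε * Y (g · τ) (σ · x')))
        ≡⟨ E-left g (λ τ → E λ σ → sq (Y τ σ + ε * Y τ (σ · x'))) ⟩
      E (λ τ → E λ σ → sq (Y τ σ + ε * Y τ (σ · x'))) ∎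
    where
    open ≡-Reasoning
    sq : ℚ → ℚ
    sq z = z * z
    x = dt (quadOf {K = K} a b c d i) ; x' = dt (quadOf {K = K} a' b' c' d' i')
    ex = extend (a ∷ b ∷ c ∷ d ∷ K) (a' ∷ b' ∷ c' ∷ d' ∷ K) le (Pat-inj (a ∷ b ∷ c ∷ d ∷ K) (a' ∷ b' ∷ c' ∷ d' ∷ K) i i')
    g = proj₁ ex
    ge = proj₂ ex
    gK : g ∙ K ≡ K
    gK = ∷-injectiveʳ (∷-injectiveʳ (∷-injectiveʳ (∷-injectiveʳ ge)))
    comm : ∀ σ → σ · g · x ≡ σ · x' · g
    comm σ = trans (assoc σ g x) (trans (cong (σ ·_) (dt-move g (quadOf {K = K} a b c d i) (quadOf {K = K} a' b' c' d' i')
      (∷-injectiveˡ ge , ∷-injectiveˡ (∷-injectiveʳ ge) , ∷-injectiveˡ (∷-injectiveʳ (∷-injectiveʳ ge)) , ∷-injectiveˡ (∷-injectiveʳ (∷-injectiveʳ (∷-injectiveʳ ge)))))) (sym (assoc σ x' g)))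

  inj4 : ∀ {k} {K : Vec (Fin n) k} {a b c d} → InjV K → Off K a → Off K b → Off K c → Off K d →
    ¬ b ≡ a → ¬ c ≡ a → ¬ d ≡ a → ¬ c ≡ b → ¬ d ≡ b → ¬ d ≡ c → InjV (a ∷ b ∷ c ∷ d ∷ K)
  inj4 {K = K} {a} {b} {c} {d} i oa ob oc od ba ca da cb db dc = InjV-∷ {v = b ∷ c ∷ d ∷ K} (off-∷ {K = c ∷ d ∷ K} ba (off-∷ {K = d ∷ K} ca (off-∷ {K = K} da oa)))
    (InjV-∷ {v = c ∷ d ∷ K} (off-∷ {K = d ∷ K} cb (off-∷ {K = K} db ob)) (InjV-∷ {v = d ∷ K} (off-∷ {K = K} dc oc) (InjV-∷ {v = K} od i)))

  module Step {k} (K : Vec (Fin n) k) (iK : InjV K) (Y : Fam) (eqv : Equivariant K Y) (a b c d : Fin n) (i : InjV (a ∷ b ∷ c ∷ d ∷ K))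
    (le : suc (suc (suc (suc (suc (suc k))))) ℕ.≤ n) where

    x : El
    x = dt (quadOf {K = K} a b c d i)

    le5 : suc (suc (suc (suc (suc k)))) ℕ.≤ n
    le5 = ℕ.≤-trans (ℕ.n≤1+n _) le

    -- The gap is stated for 3-cycles. A 3-cycle is a product of two double transpositions sharing
    -- an auxiliary transposition (s t), and by `twist-conj` both displace Y as much as x does; the
    -- triangle inequality for squares costs the factor 4.
    minus : (∀ τ σ → A K Y τ σ ≡ 0ℚ) → ⟪ Y , Y ⟫ ≤ nat n * (nat 4 * ⟪ twist (- 1ℚ) x Y , twist (- 1ℚ) x Y ⟫)
    minus z = Telescope.gap K Y (nat 4 * Φ) cyc (ℕ.≤-trans (ℕ.≤-trans (ℕ.n≤1+n _) (ℕ.n≤1+n _)) le5) iK z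
      where
      Φ = ⟪ twist (- 1ℚ) x Y , twist (- 1ℚ) x Y ⟫
      Δ≡ : ∀ g → Δ Y g ≡ ⟪ twist (- 1ℚ) g Y , twist (- 1ℚ) g Y ⟫
      Δ≡ g = ⟪⟫-ext pt pt
        where
        pt : ∀ τ σ → (Y ⊝ shift g Y) τ σ ≡ twist (- 1ℚ) g Y τ σ
        pt τ σ = l (Y τ σ) (Y τ (σ · g))
          where
          l : ∀ a b → a - b ≡ a + (- 1ℚ) * b
          l = solve-∀ ringℚ
      Δ-mul : ∀ g h → Δ Y (g · h) ≤ nat 2 * Δ Y g + nat 2 * Δ Y h
      Δ-mul g h = ≤-trans (PLF.mono 𝔾₂ λ w → ≤-trans (≤-reflexive (cong (λ y → (Y (proj₁ w) (proj₂ w) - y) * (Y (proj₁ w) (proj₂ w) - y)) (cong (Y (proj₁ w)) (sym (assoc (proj₂ w) g h)))))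
            (le₂ (Y (proj₁ w) (proj₂ w)) (Y (proj₁ w) (proj₂ w · g)) (Y (proj₁ w) (proj₂ w · g · h))))
          (≤-reflexive (trans (PLF.add 𝔾₂ _ _) (cong₂ _+_ (PLF.scl 𝔾₂ (nat 2) _) (trans (PLF.scl 𝔾₂ (nat 2) _) (cong (nat 2 *_) (shift-iso g (Y ⊝ shift h Y) (Y ⊝ shift h Y)))))))
        where
        le₂ : ∀ a b c → (a - c) * (a - c) ≤ nat 2 * ((a - b) * (a - b)) + nat 2 * ((b - c) * (b - c))
        le₂ a b c = cert (0≤sq (a - nat 2 * b + c)) (l a b c)
          where
          l : ∀ a b c → nat 2 * ((a - b) * (a - b)) + nat 2 * ((b - c) * (b - c)) ≡ (a - c) * (a - c) + (a - nat 2 * b + c) * (a - nat 2 * b + c)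
          l = solve-∀ ringℚ
      cyc : ∀ Q → Off K (Quad.a Q) → Off K (Quad.b Q) → Off K (Quad.d Q) → Quad.b Q ≡ Quad.c Q → ¬ Quad.a Q ≡ Quad.d Q → Δ Y (dt Q) ≤ nat 4 * Φ
      cyc Q@(quad u v .v y uv vy) ou ov oy refl uy = ≤-trans (≤-reflexive (cong (Δ Y) split)) (≤-trans (Δ-mul x₁ x₂) (≤-reflexive (trans (cong₂ (λ s t → nat 2 * s + nat 2 * t) e₁ e₂) (l Φ))))
          where
          ms = missing (u ∷ v ∷ y ∷ K) (ℕ.≤-trans (ℕ.n≤1+n _) le5)
          s = proj₁ ms ; s∉ = proj₂ ms
          mt = missing (s ∷ u ∷ v ∷ y ∷ K) le5
          t = proj₁ mt ; t∉ = proj₂ mt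
          os : Off K s
          os j = s∉ (suc (suc (suc j)))
          ot : Off K t
          ot j = t∉ (suc (suc (suc (suc j))))
          i₁ : InjV (u ∷ v ∷ s ∷ t ∷ K)
          i₁ = inj4 {K = K} iK ou ov os ot (λ e → uv (sym e)) (λ e → s∉ zero (sym e)) (λ e → t∉ (suc zero) (sym e)) (λ e → s∉ (suc zero) (sym e)) (λ e → t∉ (suc (suc zero)) (sym e)) (λ e → t∉ zero (sym e))
          i₂ : InjV (s ∷ t ∷ v ∷ y ∷ K)
          i₂ = inj4 {K = K} iK os ot ov oy (λ e → t∉ zero (sym e)) (s∉ (suc zero)) (s∉ (suc (suc zero))) (t∉ (suc (suc zero))) (t∉ (suc (suc (suc zero)))) (λ e → vy (sym e))
          x₁ = dt (quadOf {K = K} u v s t i₁)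
          x₂ = dt (quadOf {K = K} s t v y i₂)
          split : dt Q ≡ x₁ · x₂
          split = El-ext λ j → trans (dt-$ Q j) (sym (trans (·-$ x₁ x₂ j) (trans (cong (x₁ $_) (dt-$ (quadOf {K = K} s t v y i₂) j)) (trans (dt-$ (quadOf {K = K} u v s t i₁) _) (cong (swap u v) (swap-inv s t (swap v y j)))))))
          e₁ : Δ Y x₁ ≡ Φ
          e₁ = trans (Δ≡ x₁) (twist-conj K Y eqv (- 1ℚ) u v s t a b c d i₁ i le)
          e₂ : Δ Y x₂ ≡ Φ
          e₂ = trans (Δ≡ x₂) (twist-conj K Y eqv (- 1ℚ) s t v y a b c d i₂ i le)
          l : ∀ f → nat 2 * f + nat 2 * f ≡ nat 4 * f
          l = solve-∀ ringℚ

    -- If double transpositions nearly acted as -1, so would a product of three of them; but three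
    -- suitable ones multiply to the identity. Quantitatively, 2 Y is an alternating sum of three
    -- translates of the twisted family.
    plus : ⟪ Y , Y ⟫ ≤ nat 3 * ⟪ twist 1ℚ x Y , twist 1ℚ x Y ⟫
    plus = *-cancelˡ (0<nat 3) (≤-trans main (≤-trans (*-monoˡ (0≤⟪⟫ (twist 1ℚ x Y)) nine≤twelve) (≤-reflexive (*-assoc (nat 4) (nat 3) Φ))))
      where
      Φ = ⟪ twist 1ℚ x Y , twist 1ℚ x Y ⟫
      nine≤twelve : nat 9 ≤ nat 4 * nat 3
      nine≤twelve = cert (0≤nat 3) refl
      -- The product (a b)(c d) · (c d)(u v) · (u v)(a b) is the identity.
      mu = missing (a ∷ b ∷ c ∷ d ∷ K) le5
      u = proj₁ mu ; u∉ = proj₂ mu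
      mv = missing (u ∷ a ∷ b ∷ c ∷ d ∷ K) le
      v = proj₁ mv ; v∉ = proj₂ mv
      ia : Off (b ∷ c ∷ d ∷ K) a
      ia = InjV-head {v = b ∷ c ∷ d ∷ K} i
      ib : Off (c ∷ d ∷ K) b
      ib = InjV-head {v = c ∷ d ∷ K} (InjV-tail {v = b ∷ c ∷ d ∷ K} i)
      id' : InjV (c ∷ d ∷ K)
      id' = InjV-tail {v = c ∷ d ∷ K} (InjV-tail {v = b ∷ c ∷ d ∷ K} i)
      ic : Off (d ∷ K) c
      ic = InjV-head {v = d ∷ K} id'
      idd : Off K d
      idd = InjV-head {v = K} (InjV-tail {v = d ∷ K} id')
      ou : Off K u
      ou j = u∉ (suc (suc (suc (suc j))))
      ov : Off K v
      ov j = v∉ (suc (suc (suc (suc (suc j)))))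
      i₂ : InjV (c ∷ d ∷ u ∷ v ∷ K)
      i₂ = inj4 {K = K} iK (λ j → ic (suc j)) idd ou ov (ic zero) (λ e → u∉ (suc (suc zero)) (sym e)) (λ e → v∉ (suc (suc (suc zero))) (sym e)) (λ e → u∉ (suc (suc (suc zero))) (sym e)) (λ e → v∉ (suc (suc (suc (suc zero)))) (sym e)) (λ e → v∉ zero (sym e))
      i₃ : InjV (u ∷ v ∷ a ∷ b ∷ K)
      i₃ = inj4 {K = K} iK ou ov (λ j → ia (suc (suc (suc j)))) (λ j → ib (suc (suc j))) (λ e → v∉ zero (sym e)) (u∉ zero) (u∉ (suc zero)) (v∉ (suc zero)) (v∉ (suc (suc zero))) (ia zero)
      x₂ = dt (quadOf {K = K} c d u v i₂)
      x₃ = dt (quadOf {K = K} u v a b i₃)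
      e₂ : ⟪ twist 1ℚ x₂ Y , twist 1ℚ x₂ Y ⟫ ≡ Φ
      e₂ = twist-conj K Y eqv 1ℚ c d u v a b c d i₂ i le
      e₃ : ⟪ twist 1ℚ x₃ Y , twist 1ℚ x₃ Y ⟫ ≡ Φ
      e₃ = twist-conj K Y eqv 1ℚ u v a b a b c d i₃ i le
      one : x · x₂ · x₃ ≡ unit
      one = El-ext λ j → let y = swap u v (swap a b j) in trans (·-$ (x · x₂) x₃ j) (trans (cong ((x · x₂) $_) (dt-$ (quadOf {K = K} u v a b i₃) j)) (trans (·-$ x x₂ y) (trans (cong (x $_) (dt-$ (quadOf {K = K} c d u v i₂) y))
        (trans (dt-$ (quadOf {K = K} a b c d i) (swap c d (swap u v y))) (trans (cong (swap a b) (swap-inv c d (swap u v y))) (trans (cong (swap a b) (swap-inv u v (swap a b j))) (trans (swap-inv a b j) (sym (unit-$ j)))))))))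
      main : nat 4 * ⟪ Y , Y ⟫ ≤ nat 9 * Φ
      main = ≤-trans (≤-reflexive (sym (PLF.scl 𝔾₂ (nat 4) _))) (≤-trans (PLF.mono 𝔾₂ λ w → three (Y (proj₁ w) (proj₂ w)) (Y (proj₁ w) (proj₂ w · x)) (Y (proj₁ w) (proj₂ w · x · x₂)) (Y (proj₁ w) (proj₂ w · x · x₂ · x₃)) (cong (Y (proj₁ w)) (back (proj₂ w))))
        (≤-reflexive (trans (PLF.scl 𝔾₂ (nat 3) _) (trans (cong (nat 3 *_) (trans (PLF.add 𝔾₂ _ _) (cong₂ _+_ (trans (PLF.add 𝔾₂ _ _) (cong (Φ +_) (trans (shift-iso x (twist 1ℚ x₂ Y) (twist 1ℚ x₂ Y)) e₂)))
          (trans (⟪⟫-ext r r) (trans (shift-iso (x · x₂) (twist 1ℚ x₃ Y) (twist 1ℚ x₃ Y)) e₃))))) (l Φ)))))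
        where
        back : ∀ σ → σ · x · x₂ · x₃ ≡ σ
        back σ = trans (cong (_· x₃) (assoc σ x x₂)) (trans (assoc σ (x · x₂) x₃) (trans (cong (σ ·_) one) (idʳ σ)))
        r : ∀ τ σ → Y τ (σ · x · x₂) + 1ℚ * Y τ (σ · x · x₂ · x₃) ≡ shift (x · x₂) (twist 1ℚ x₃ Y) τ σ
        r τ σ = cong (λ g → Y τ g + 1ℚ * Y τ (g · x₃)) (assoc σ x x₂)
        l : ∀ f → nat 3 * (f + f + f) ≡ nat 9 * f
        l = solve-∀ ringℚ
        sq : ℚ → ℚ
        sq z = z * z
        three : ∀ p q s t → t ≡ p → nat 4 * (p * p) ≤ nat 3 * (sq (p + 1ℚ * q) + sq (q + 1ℚ * s) + sq (s + 1ℚ * t))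
        three p q s .p refl = cert (0≤+ (0≤+ (0≤sq (p + nat 2 * q + s)) (0≤sq (q - s))) (0≤sq (q + nat 2 * s + p)) ) (m p q s)
          where
          m : ∀ p q s → nat 3 * ((p + 1ℚ * q) * (p + 1ℚ * q) + (q + 1ℚ * s) * (q + 1ℚ * s) + (s + 1ℚ * p) * (s + 1ℚ * p))
            ≡ nat 4 * (p * p) + ((p + nat 2 * q + s) * (p + nat 2 * q + s) + (q - s) * (q - s) + (q + nat 2 * s + p) * (q + nat 2 * s + p))
          m = solve-∀ ringℚ

pw : ℕ → ℚ → ℚ
pw zero    x = 1ℚ
pw (suc k) x = x * pw k x

sg : Fin 2 → ℚ
sg zero       = - 1ℚ
sg (suc zero) = 1ℚ

four : ℕ → ℕ
four zero    = 0
four (suc m) = suc (suc (suc (suc (four m))))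

module Blocks (n L : ℕ) (pt : Fin L → Fin 4 → Fin n) (pt-inj : ∀ {b b' j j'} → pt b j ≡ pt b' j' → (b ≡ b') × (j ≡ j')) where
  open Alternating n
  open TupleCalculus n
  open Quads n
  open Gaps n
  open DoubleTranspositions n

  block : Fin L → Quad n
  block b = quad (pt b zero) (pt b (suc zero)) (pt b (suc (suc zero))) (pt b (suc (suc (suc zero)))) (λ e → a (proj₂ (pt-inj e))) (λ e → c (proj₂ (pt-inj e)))
    where
    a : ¬ _≡_ {A = Fin 4} zero (suc zero)
    a ()
    c : ¬ _≡_ {A = Fin 4} (suc (suc zero)) (suc (suc (suc zero)))
    c ()

  x : Fin L → El
  x b = dt (block b)

  _∷₄_ : ∀ {k} → Fin L → Vec (Fin n) k → Vec (Fin n) (suc (suc (suc (suc k))))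
  b ∷₄ K = pt b zero ∷ pt b (suc zero) ∷ pt b (suc (suc zero)) ∷ pt b (suc (suc (suc zero))) ∷ K

  pts : ∀ {m} → Vec (Fin 2 × Fin L) m → Vec (Fin n) (four m)
  pts []             = []
  pts ((_ , b) ∷ ps) = b ∷₄ pts ps

  -- The product of the operators 1 ± R (x b), which up to powers of 2 are the projections onto the
  -- eigenspaces of commuting involutions.
  T : ∀ {m} → Vec (Fin 2 × Fin L) m → (El → ℚ) → El → ℚ
  T []             z σ = z σ
  T ((s , b) ∷ ps) z σ = T ps z σ + sg s * T ps z (σ · x b)

  Fresh : ∀ {m} → Vec (Fin 2 × Fin L) m → Set
  Fresh []             = ⊤
  Fresh ((_ , b) ∷ ps) = (∀ i → ¬ proj₂ (lookup ps i) ≡ b) × Fresh ps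

  pts-off : ∀ {m} (ps : Vec (Fin 2 × Fin L) m) {b} → (∀ i → ¬ proj₂ (lookup ps i) ≡ b) → ∀ j → Off (pts ps) (pt b j)
  pts-off (p ∷ ps) o j zero e                       = o zero (proj₁ (pt-inj e))
  pts-off (p ∷ ps) o j (suc zero) e                 = o zero (proj₁ (pt-inj e))
  pts-off (p ∷ ps) o j (suc (suc zero)) e           = o zero (proj₁ (pt-inj e))
  pts-off (p ∷ ps) o j (suc (suc (suc zero))) e     = o zero (proj₁ (pt-inj e))
  pts-off (p ∷ ps) o j (suc (suc (suc (suc i)))) e  = pts-off ps (λ i → o (suc i)) j i e

  inj₄ : ∀ {m} (ps : Vec (Fin 2 × Fin L) m) {b} → InjV (pts ps) → (∀ i → ¬ proj₂ (lookup ps i) ≡ b) → InjV (b ∷₄ pts ps)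
  inj₄ ps {b} iK o = inj4 {K = pts ps} iK (pts-off ps o _) (pts-off ps o _) (pts-off ps o _) (pts-off ps o _)
    (λ e → d10 (proj₂ (pt-inj e))) (λ e → d20 (proj₂ (pt-inj e))) (λ e → d30 (proj₂ (pt-inj e))) (λ e → d21 (proj₂ (pt-inj e))) (λ e → d31 (proj₂ (pt-inj e))) (λ e → d32 (proj₂ (pt-inj e)))
    where
    d10 : ¬ _≡_ {A = Fin 4} (suc zero) zero
    d10 ()
    d20 : ¬ _≡_ {A = Fin 4} (suc (suc zero)) zero
    d20 ()
    d30 : ¬ _≡_ {A = Fin 4} (suc (suc (suc zero))) zero
    d30 ()
    d21 : ¬ _≡_ {A = Fin 4} (suc (suc zero)) (suc zero)
    d21 ()
    d31 : ¬ _≡_ {A = Fin 4} (suc (suc (suc zero))) (suc zero)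
    d31 ()
    d32 : ¬ _≡_ {A = Fin 4} (suc (suc (suc zero))) (suc (suc zero))
    d32 ()

  pts-inj : ∀ {m} (ps : Vec (Fin 2 × Fin L) m) → Fresh ps → InjV (pts ps)
  pts-inj []             _       {()}
  pts-inj ((_ , b) ∷ ps) (o , f) = inj₄ ps (pts-inj ps f) o

  T-ext : ∀ {m} (ps : Vec (Fin 2 × Fin L) m) {z y : El → ℚ} → (∀ σ → z σ ≡ y σ) → ∀ σ → T ps z σ ≡ T ps y σ
  T-ext []             e σ = e σ
  T-ext ((s , b) ∷ ps) e σ = cong₂ (λ u v → u + sg s * v) (T-ext ps e σ) (T-ext ps e (σ · x b))

  T-ap : ∀ {m} (ps : Vec (Fin 2 × Fin L) m) {Ω : Set} (B : PLF Ω) (z : Ω → El → ℚ) σ → PLF.ap B (λ ω → T ps (z ω) σ) ≡ T ps (λ σ → PLF.ap B λ ω → z ω σ) σ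
  T-ap []             B z σ = refl
  T-ap ((s , b) ∷ ps) B z σ = trans (PLF.add B _ _) (cong₂ _+_ (T-ap ps B z σ) (trans (PLF.scl B (sg s) _) (cong (sg s *_) (T-ap ps B z (σ · x b)))))

  T-zero : ∀ {m} (ps : Vec (Fin 2 × Fin L) m) {z : El → ℚ} → (∀ σ → z σ ≡ 0ℚ) → ∀ σ → T ps z σ ≡ 0ℚ
  T-zero []             e σ = e σ
  T-zero ((s , b) ∷ ps) e σ = trans (cong₂ _+_ (T-zero ps e σ) (mul0ʳ {sg s} (T-zero ps e (σ · x b)))) (+-identityʳ 0ℚ)

  fix₄ : ∀ {k} g b (K : Vec (Fin n) k) → g ∙ (b ∷₄ K) ≡ b ∷₄ K → (g · x b ≡ x b · g) × (g ∙ K ≡ K)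
  fix₄ g b K e = dt-move g (block b) (block b) (∷-injectiveˡ e , ∷-injectiveˡ (∷-injectiveʳ e) , ∷-injectiveˡ (∷-injectiveʳ (∷-injectiveʳ e)) , ∷-injectiveˡ (∷-injectiveʳ (∷-injectiveʳ (∷-injectiveʳ e)))) ,
    ∷-injectiveʳ (∷-injectiveʳ (∷-injectiveʳ (∷-injectiveʳ e)))

  T-R : ∀ {m} (ps : Vec (Fin 2 × Fin L) m) g → g ∙ pts ps ≡ pts ps → ∀ z σ → T ps z (σ · g) ≡ T ps (R g z) σ
  T-R []             g e z σ = refl
  T-R ((s , b) ∷ ps) g e z σ = let (c , e') = fix₄ g b (pts ps) e in cong₂ (λ u v → u + sg s * v) (T-R ps g e' z σ)
    (trans (cong (T ps z) (trans (assoc σ g (x b)) (trans (cong (σ ·_) c) (sym (assoc σ (x b) g))))) (T-R ps g e' z (σ · x b)))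

  Y : ∀ {m} → Vec (Fin 2 × Fin L) m → (El → ℚ) → Fam
  Y ps z τ σ = T ps (R τ z) σ

  Y-equivariant : ∀ {m} (ps : Vec (Fin 2 × Fin L) m) z → Equivariant (pts ps) (Y ps z)
  Y-equivariant ps z g e τ σ = trans (T-R ps g e (R τ z) σ) (T-ext ps (R-hom g τ z) σ)

  A-R : ∀ {k} (K : Vec (Fin n) k) z → Perp k z → ∀ τ σ → A K (λ τ → R τ z) τ σ ≡ 0ℚ
  A-R K z q τ σ = mul0ʳ {π} (trans (PLF.ext 𝔾 λ h → trans (cong (_* z (σ · h · τ)) (𝟙-cong (h ∙ K ≟V K) ((σ · h) ∙ K ≟V σ ∙ K) (λ e → trans (·-∙ σ h K) (cong (σ ∙_) e))
      (λ e → trans (sym (⁻¹-∙ σ (h ∙ K))) (trans (cong (σ ⁻¹ ∙_) (trans (sym (·-∙ σ h K)) e)) (⁻¹-∙ σ K))))) (*-comm _ (z (σ · h · τ))))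
    (trans (E-left σ λ h → R τ z h * 𝟙 (h ∙ K ≟V σ ∙ K)) (Perp-R {z = z} τ q K (σ ∙ K))))
    where open Stabiliser K (Pr-pos K)

  -- Elements fixing all used points commute with the involutions on them, so the average passes
  -- inside `T`, where it meets z and vanishes since z has no low levels.
  A-Y : ∀ {m} (ps : Vec (Fin 2 × Fin L) m) z → Perp (four m) z → ∀ τ σ → A (pts ps) (Y ps z) τ σ ≡ 0ℚ
  A-Y ps z q τ σ = trans (S-ext λ h e → T-R ps h e (R τ z) σ) (trans (T-ap ps 𝔖 (λ h → R h (R τ z)) σ) (T-zero ps (λ σ → A-R (pts ps) z q τ σ) σ))
    where open Stabiliser (pts ps) (Pr-pos (pts ps))

  loss : ∀ {m} → Vec (Fin 2 × Fin L) m → ℚ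
  loss []                     = 1ℚ
  loss ((zero , _) ∷ ps)      = loss ps * (nat n * nat 4)
  loss ((suc zero , _) ∷ ps)  = loss ps * nat 3

  0≤loss : ∀ {m} (ps : Vec (Fin 2 × Fin L) m) → 0ℚ ≤ loss ps
  0≤loss []                    = 0≤1
  0≤loss ((zero , _) ∷ ps)     = 0≤* (0≤loss ps) (0≤* (0≤nat n) (0≤nat 4))
  0≤loss ((suc zero , _) ∷ ps) = 0≤* (0≤loss ps) (0≤nat 3)

  -- One involution after the other, with K the points of the blocks already treated. The sign -1
  -- goes through `minus` and costs a factor of order n, the sign +1 through `plus` and costs only
  -- 3.
  descend : ∀ {m} (ps : Vec (Fin 2 × Fin L) m) z → Fresh ps → suc (suc (four m)) ℕ.≤ n → (∀ j → j ℕ.≤ four m → Perp j z) → nrm² z ≤ loss ps * ⟪ Y ps z , Y ps z ⟫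
  descend []             z f le q = ≤-reflexive (sym (trans (*-identityˡ _) (trans (PLF.ext 𝔾 λ τ → R-iso τ z z) (E-const (nrm² z)))))
  descend {suc m} ((s , b) ∷ ps) z (o , f) le q = ≤-trans (descend ps z f (ℕ.≤-trans (ℕ.≤-trans (ℕ.n≤1+n _) (ℕ.≤-trans (ℕ.n≤1+n _) (ℕ.≤-trans (ℕ.n≤1+n _) (ℕ.n≤1+n _)))) le) (λ j r → q j (ℕ.≤-trans r m≤))) (go s)
    where
    m≤ : four m ℕ.≤ four (suc m)
    m≤ = ℕ.≤-trans (ℕ.n≤1+n _) (ℕ.≤-trans (ℕ.n≤1+n _) (ℕ.≤-trans (ℕ.n≤1+n _) (ℕ.n≤1+n _)))
    iK = pts-inj ps f
    i₄ = inj₄ ps iK o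
    module St = Step (pts ps) iK (Y ps z) (Y-equivariant ps z) (pt b zero) (pt b (suc zero)) (pt b (suc (suc zero))) (pt b (suc (suc (suc zero)))) i₄ le
    x≡ : St.x ≡ x b
    x≡ = dt-cong {quadOf {K = pts ps} _ _ _ _ i₄} {block b} (refl , refl , refl , refl)
    at : ∀ ε → ⟪ twist ε St.x (Y ps z) , twist ε St.x (Y ps z) ⟫ ≡ ⟪ twist ε (x b) (Y ps z) , twist ε (x b) (Y ps z) ⟫
    at ε = cong (λ g → ⟪ twist ε g (Y ps z) , twist ε g (Y ps z) ⟫) x≡
    go : ∀ s → loss ps * ⟪ Y ps z , Y ps z ⟫ ≤ loss ((s , b) ∷ ps) * ⟪ Y ((s , b) ∷ ps) z , Y ((s , b) ∷ ps) z ⟫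
    go zero       = ≤-trans (*-monoʳ (0≤loss ps) (≤-trans (St.minus (A-Y ps z (q (four m) m≤))) (≤-reflexive (cong (λ t → nat n * (nat 4 * t)) (at (- 1ℚ)))))) (≤-reflexive (l (loss ps) (nat n) (nat 4) _))
      where
      l : ∀ a b c d → a * (b * (c * d)) ≡ (a * (b * c)) * d
      l = solve-∀ ringℚ
    go (suc zero) = ≤-trans (*-monoʳ (0≤loss ps) (≤-trans St.plus (≤-reflexive (cong (nat 3 *_) (at 1ℚ))))) (≤-reflexive (sym (*-assoc (loss ps) (nat 3) ⟪ twist 1ℚ (x b) (Y ps z) , twist 1ℚ (x b) (Y ps z) ⟫)))

-- Characters of commuting double transpositions

sg² : ∀ s → sg s * sg s ≡ 1ℚ
sg² zero       = refl
sg² (suc zero) = refl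

-- Bessel's inequality for orthogonal vectors of common squared norm N, where v is 0 or 1 and
-- selects the indices in use. Cauchy-Schwarz for U and the sum s of its components gives S² ≤ N S
-- ‖U‖².
bessel : ∀ {Ω M : Set} (B : PLF Ω) (C : PLF M) → Finitary C → (δ : M → M → ℚ) (v : M → ℚ) (N : ℚ) → 0ℚ ≤ N →
  (∀ m (F : M → ℚ) → PLF.ap C (λ m' → δ m m' * F m') ≡ F m) → (∀ m → v m * v m ≡ v m) →
  (e : M → Ω → ℚ) → (∀ m m' → v m * v m' * PLF.ap B (λ ω → e m ω * e m' ω) ≡ δ m m' * (v m * N)) → ∀ (U : Ω → ℚ) →
  PLF.ap C (λ m → v m * (PLF.ap B (λ ω → U ω * e m ω) * PLF.ap B (λ ω → U ω * e m ω))) ≤ N * PLF.ap B (λ ω → U ω * U ω)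
bessel {Ω} {M} B C finC δ v N 0≤N dl vv e or U = by (0ℚ <? S)
  where
  u c : M → ℚ
  u m = PLF.ap B λ ω → U ω * e m ω
  c m = v m * u m
  S = PLF.ap C λ m → v m * (u m * u m)
  s : Ω → ℚ
  s ω = PLF.ap C λ m → c m * e m ω
  nU = PLF.ap B λ ω → U ω * U ω
  Us : PLF.ap B (λ ω → U ω * s ω) ≡ S
  Us = trans (PLF.ext B λ ω → sym (PLF.scl C (U ω) λ m → c m * e m ω)) (trans (finC B λ m ω → U ω * (c m * e m ω))
    (PLF.ext C λ m → trans (PLF.ext B λ ω → l (U ω) (v m) (u m) (e m ω)) (trans (PLF.scl B (v m * u m) λ ω → U ω * e m ω) (*-assoc (v m) (u m) (u m)))))
    where
    l : ∀ U v u e → U * (v * u * e) ≡ v * u * (U * e)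
    l = solve-∀ ringℚ
  ss : PLF.ap B (λ ω → s ω * s ω) ≡ N * S
  ss = trans (PLF.ext B λ ω → trans (sym (PLF.sclr C (s ω) λ m → c m * e m ω)) (PLF.ext C λ m → trans (*-comm _ (s ω)) (sym (PLF.sclr C (c m * e m ω) λ m' → c m' * e m' ω))))
    (trans (finC B λ m ω → PLF.ap C λ m' → c m' * e m' ω * (c m * e m ω)) (trans (PLF.ext C λ m → trans (finC B λ m' ω → c m' * e m' ω * (c m * e m ω))
      (trans (PLF.ext C λ m' → trans (PLF.ext B λ ω → l (v m) (v m') (u m) (u m') (e m ω) (e m' ω)) (trans (PLF.scl B (u m * u m') λ ω → v m * v m' * (e m ω * e m' ω))
          (trans (cong (u m * u m' *_) (trans (PLF.scl B (v m * v m') λ ω → e m ω * e m' ω) (or m m'))) (l' (u m) (u m') (δ m m') (v m) N))))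
        (dl m λ m' → N * (v m * (u m * u m'))))) (PLF.scl C N λ m → v m * (u m * u m))))
    where
    l : ∀ v v' u u' e e' → v' * u' * e' * (v * u * e) ≡ u * u' * (v * v' * (e * e'))
    l = solve-∀ ringℚ
    l' : ∀ u u' δ v N → u * u' * (δ * (v * N)) ≡ δ * (N * (v * (u * u')))
    l' = solve-∀ ringℚ
  by : Dec (0ℚ < S) → S ≤ N * nU
  by (no ne) = ≤-trans (≮⇒≥ ne) (0≤* 0≤N (PLF.sqs B U))
  by (yes p) = *-cancelˡ p (≤-trans (≤-reflexive (sym (cong₂ _*_ Us Us))) (≤-trans (PLF.cs B U s) (≤-reflexive (trans (cong (nU *_) ss) (l nU N S)))))
    where
    l : ∀ a b c → a * (b * c) ≡ c * (b * a)
    l = solve-∀ ringℚ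

½+½≡1 : ½ + ½ ≡ 1ℚ
½+½≡1 = trans (sym (cong₂ _+_ (*-identityʳ ½) (*-identityʳ ½))) (½+½ 1ℚ)

module Characters (n : ℕ) where
  open Alternating n
  open TupleCalculus n
  open LevelSpaces n
  open Convolution n

  -- the component of z on which each involution of the list acts by the sign prescribed by χ
  comp : ∀ {j} → Vec El j → Vec (Fin 2) j → (El → ℚ) → El → ℚ
  comp []       []      z σ = z σ
  comp (x ∷ xs) (ε ∷ χ) z σ = ½ * (comp xs χ z σ + sg ε * comp xs χ z (σ · x))

  comp-lin : ∀ {j} (xs : Vec El j) χ c (z y : El → ℚ) σ → comp xs χ (λ σ → z σ + c * y σ) σ ≡ comp xs χ z σ + c * comp xs χ y σ
  comp-lin []       []      c z y σ = refl
  comp-lin (x ∷ xs) (ε ∷ χ) c z y σ = trans (cong₂ (λ u v → ½ * (u + sg ε * v)) (comp-lin xs χ c z y σ) (comp-lin xs χ c z y (σ · x)))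
    (l ½ (sg ε) c (comp xs χ z σ) (comp xs χ y σ) (comp xs χ z (σ · x)) (comp xs χ y (σ · x)))
    where
    l : ∀ h e c z y z' y' → h * (z + c * y + e * (z' + c * y')) ≡ h * (z + e * z') + c * (h * (y + e * y'))
    l = solve-∀ ringℚ

  parseval : ∀ {j} (xs : Vec El j) z → sumV (λ χ → nrm² (comp xs χ z)) ≡ nrm² z
  parseval []       z = refl
  parseval {suc j} (x ∷ xs) z = trans (cong₂ _+_ (PLF.ext (vecP 2 j) λ χ → at zero χ) (trans (+-identityʳ _) (PLF.ext (vecP 2 j) λ χ → at (suc zero) χ)))
      (trans (sym (PLF.add (vecP 2 j) _ _)) (trans (PLF.ext (vecP 2 j) λ χ → both (nrm² (comp xs χ z)) (E λ σ → comp xs χ z σ * comp xs χ z (σ · x))) (parseval xs z)))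
    where
    at : ∀ ε χ → nrm² (comp (x ∷ xs) (ε ∷ χ) z) ≡ ½ * (nrm² (comp xs χ z) + sg ε * E (λ σ → comp xs χ z σ * comp xs χ z (σ · x)))
    at ε χ = trans (PLF.ext 𝔾 λ σ → l₁ ε (comp xs χ z σ) (comp xs χ z (σ · x))) (trans (PLF.scl 𝔾 ½ _) (cong (½ *_) (trans (PLF.add 𝔾 _ _)
        (trans (cong₂ _+_ (trans (PLF.scl 𝔾 ½ _) (cong (½ *_) (trans (PLF.add 𝔾 _ _) (cong (nrm² (comp xs χ z) +_) (E-right x λ σ → comp xs χ z σ * comp xs χ z σ))))) (PLF.scl 𝔾 (sg ε) _)) (l₂ (nrm² (comp xs χ z)) _)))))
      where
      l₀ : ∀ e c d → ½ * (c + e * d) * (½ * (c + e * d)) ≡ ½ * (½ * (c * c + e * e * (d * d)) + (½ + ½) * (e * (c * d)))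
      l₀ e c d = l ½ e c d
        where
        l : ∀ h e c d → h * (c + e * d) * (h * (c + e * d)) ≡ h * (h * (c * c + e * e * (d * d)) + (h + h) * (e * (c * d)))
        l = solve-∀ ringℚ
      l₁ : ∀ ε c d → ½ * (c + sg ε * d) * (½ * (c + sg ε * d)) ≡ ½ * (½ * (c * c + d * d) + sg ε * (c * d))
      l₁ ε c d = trans (l₀ (sg ε) c d) (cong (½ *_) (cong₂ (λ u v → ½ * (c * c + u) + v) (trans (cong (_* (d * d)) (sg² ε)) (*-identityˡ (d * d))) (trans (cong (_* (sg ε * (c * d))) ½+½≡1) (*-identityˡ (sg ε * (c * d))))))
      l₂ : ∀ a b → ½ * (a + a) + b ≡ a + b
      l₂ a b = cong (_+ b) (trans (l ½ a) (trans (cong (_* a) ½+½≡1) (*-identityˡ a)))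
        where
        l : ∀ h a → h * (a + a) ≡ (h + h) * a
        l = solve-∀ ringℚ
    both : ∀ a b → ½ * (a + (- 1ℚ) * b) + ½ * (a + 1ℚ * b) ≡ a
    both a b = trans (l ½ a b) (trans (cong (_* a) ½+½≡1) (*-identityˡ a))
      where
      l : ∀ h a b → h * (a + (- 1ℚ) * b) + h * (a + 1ℚ * b) ≡ (h + h) * a
      l = solve-∀ ringℚ

  comp-conv : ∀ {j} (xs : Vec El j) χ u v s → comp xs χ (conv u v) s ≡ conv u (comp xs χ v) s
  comp-conv []       []      u v s = refl
  comp-conv (x ∷ xs) (ε ∷ χ) u v s = trans (cong₂ (λ a b → ½ * (a + sg ε * b)) (comp-conv xs χ u v s) (trans (comp-conv xs χ u v (s · x)) (sym (conv-R u (comp xs χ v) x s))))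
    (trans (l ½ (sg ε) (conv u (comp xs χ v) s) _) (trans (sym (conv-lin u ½ (½ * sg ε) (comp xs χ v) (R x (comp xs χ v)) s))
      (conv-ext {u} {u} {λ σ → ½ * comp xs χ v σ + ½ * sg ε * comp xs χ v (σ · x)} {comp (x ∷ xs) (ε ∷ χ) v} (λ _ → refl) (λ σ → sym (l ½ (sg ε) (comp xs χ v σ) (comp xs χ v (σ · x)))) s)))
    where
    l : ∀ h e a b → h * (a + e * b) ≡ h * a + h * e * b
    l = solve-∀ ringℚ

  comp-comm : ∀ {j} (xs : Vec El j) χ x' → (∀ i → x' · lookup xs i ≡ lookup xs i · x') → ∀ z σ → comp xs χ z (σ · x') ≡ comp xs χ (R x' z) σ
  comp-comm []       []      x' c z σ = refl
  comp-comm (x ∷ xs) (ε ∷ χ) x' c z σ = cong₂ (λ a b → ½ * (a + sg ε * b)) (comp-comm xs χ x' (λ i → c (suc i)) z σ)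
    (trans (cong (comp xs χ z) (trans (assoc σ x' x) (trans (cong (σ ·_) (c zero)) (sym (assoc σ x x'))))) (comp-comm xs χ x' (λ i → c (suc i)) z (σ · x)))

  eigen : ∀ {j} (xs : Vec El j) χ → (∀ i k → lookup xs i · lookup xs k ≡ lookup xs k · lookup xs i) → (∀ i → lookup xs i · lookup xs i ≡ unit) →
    ∀ i z σ → comp xs χ z (σ · lookup xs i) ≡ sg (lookup χ i) * comp xs χ z σ
  eigen (x ∷ xs) (ε ∷ χ) c q zero    z σ = trans (cong (λ b → ½ * (comp xs χ z (σ · x) + sg ε * b)) (cong (comp xs χ z) (trans (assoc σ x x) (trans (cong (σ ·_) (q zero)) (idʳ σ)))))
    (trans (cong (λ y → ½ * (y + sg ε * comp xs χ z σ)) (trans (sym (*-identityˡ (comp xs χ z (σ · x)))) (cong (_* comp xs χ z (σ · x)) (sym (sg² ε))))) (l ½ (sg ε) (comp xs χ z σ) (comp xs χ z (σ · x))))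
    where
    l : ∀ h e a b → h * (e * e * b + e * a) ≡ e * (h * (a + e * b))
    l = solve-∀ ringℚ
  eigen (x ∷ xs) (ε ∷ χ) c q (suc i) z σ = trans (cong₂ (λ a b → ½ * (a + sg ε * b)) (eigen xs χ (λ i k → c (suc i) (suc k)) (λ i → q (suc i)) i z σ)
      (trans (cong (comp xs χ z) (trans (assoc σ x' x) (trans (cong (σ ·_) (c (suc i) zero)) (sym (assoc σ x x'))))) (eigen xs χ (λ i k → c (suc i) (suc k)) (λ i → q (suc i)) i z (σ · x))))
    (l ½ (sg ε) (sg (lookup χ i)) (comp xs χ z σ) (comp xs χ z (σ · x)))
    where
    x' = lookup xs i
    l : ∀ h e s a b → h * (s * a + e * (s * b)) ≡ s * (h * (a + e * b))
    l = solve-∀ ringℚ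

dbl : ℕ → ℕ
dbl zero    = 0
dbl (suc j) = suc (suc (dbl j))

BInj : ∀ {j l L} → (Fin j → Fin l → Fin L) → Set
BInj B = ∀ {i a i' a'} → B i a ≡ B i' a' → (i ≡ i') × (a ≡ a')

BInj-suc : ∀ {j l L} {B : Fin (suc j) → Fin l → Fin L} → BInj B → BInj (λ i → B (suc i))
BInj-suc p e = Fin.suc-injective (proj₁ (p e)) , proj₂ (p e)

pw-* : ∀ k a b → pw k a * pw k b ≡ pw k (a * b)
pw-* zero    a b = *-identityˡ 1ℚ
pw-* (suc k) a b = trans (l a b (pw k a) (pw k b)) (cong (a * b *_) (pw-* k a b))
  where
  l : ∀ a b x y → a * x * (b * y) ≡ a * b * (x * y)
  l = solve-∀ ringℚ

0≤pw : ∀ k {a} → 0ℚ ≤ a → 0ℚ ≤ pw k a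
0≤pw zero    p = 0≤1
0≤pw (suc k) p = 0≤* p (0≤pw k p)

module Moves (n L : ℕ) (pt : Fin L → Fin 4 → Fin n) (pt-inj : ∀ {b b' j j'} → pt b j ≡ pt b' j' → (b ≡ b') × (j ≡ j'))
  (room : suc (suc (L ℕ.* 4)) ℕ.≤ n) (l : ℕ) where
  open Alternating n
  open TupleCalculus n
  open LevelSpaces n
  open Convolution n
  open Quads n
  open Gaps n
  open DoubleTranspositions n
  open Blocks n L pt pt-inj
  open Characters n

  xs : Vec El L
  xs = tabulate x

  x-comm : ∀ b b' → x b · x b' ≡ x b' · x b
  x-comm b b' = by (b ≟ b')
    where
    by : Dec (b ≡ b') → x b · x b' ≡ x b' · x b
    by (yes e) = cong₂ (λ c d → x c · x d) e (sym e)
    by (no ne) = proj₁ (fix₄ (x b) b' [] (dt-fix (block b) (b' ∷₄ []) (off zero) (off (suc zero)) (off (suc (suc zero))) (off (suc (suc (suc zero))))))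
      where
      off : ∀ j → Off (b' ∷₄ []) (pt b j)
      off j = pts-off ((zero , b') ∷ []) (λ { zero e → ne (sym e) }) j

  x-inv : ∀ b → x b · x b ≡ unit
  x-inv b = El-ext λ i → trans (·-$ (x b) (x b) i) (trans (cong (x b $_) (dt-$ (block b) i)) (trans (dt-$ (block b) (s₁ (s₂ i))) (trans (cong s₁ (swap-conj {f = s₂} (swap-inj _ _) (pt b zero) (pt b (suc zero)) (s₂ i)))
      (trans (cong₂ (λ u v → s₁ (swap u v (s₂ (s₂ i)))) (swap-o (λ e → d02 (proj₂ (pt-inj e))) (λ e → d03 (proj₂ (pt-inj e)))) (swap-o (λ e → d12 (proj₂ (pt-inj e))) (λ e → d13 (proj₂ (pt-inj e)))))
        (trans (swap-inv (pt b zero) (pt b (suc zero)) (s₂ (s₂ i))) (trans (swap-inv (pt b (suc (suc zero))) (pt b (suc (suc (suc zero)))) i) (sym (unit-$ i))))))))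
    where
    s₁ s₂ : Fin n → Fin n
    s₁ = swap (pt b zero) (pt b (suc zero))
    s₂ = swap (pt b (suc (suc zero))) (pt b (suc (suc (suc zero))))
    d02 : ¬ _≡_ {A = Fin 4} zero (suc (suc zero))
    d02 ()
    d03 : ¬ _≡_ {A = Fin 4} zero (suc (suc (suc zero)))
    d03 ()
    d12 : ¬ _≡_ {A = Fin 4} (suc zero) (suc (suc zero))
    d12 ()
    d13 : ¬ _≡_ {A = Fin 4} (suc zero) (suc (suc (suc zero)))
    d13 ()

  -- All points of all blocks are moved at once by `extend`; the two points kept free by `room`
  -- repair the parity.
  permute : (π : Fin L → Fin L) → Inj π → ∃ λ g → ∀ b j → g $ pt b j ≡ pt (π b) j
  permute π inj = g , λ b j → trans (cong (g $_) (sym (at (λ b → b) b j))) (trans (sym (lookup-∙ g (all λ b → b) _)) (trans (cong (λ v → lookup v (Fin.combine b j)) ge) (at π b j)))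
    where
    all : (Fin L → Fin L) → Vec (Fin n) (L ℕ.* 4)
    all π = tabulate λ q → pt (π (proj₁ (Fin.remQuot {L} 4 q))) (proj₂ (Fin.remQuot {L} 4 q))
    at : ∀ π b j → lookup (all π) (Fin.combine b j) ≡ pt (π b) j
    at π b j = trans (lookup∘tabulate _ (Fin.combine b j)) (cong₂ (λ c k → pt (π c) k) (cong proj₁ (Fin.remQuot-combine b j)) (cong proj₂ (Fin.remQuot-combine b j)))
    injAll : ∀ π → Inj π → InjV (all π)
    injAll π inj {i} {j} e = trans (sym (Fin.combine-remQuot {L} 4 i)) (trans (cong₂ Fin.combine (inj (proj₁ r)) (proj₂ r)) (Fin.combine-remQuot {L} 4 j))
      where
      r = pt-inj (trans (sym (lookup∘tabulate (λ q → pt (π (proj₁ (Fin.remQuot {L} 4 q))) (proj₂ (Fin.remQuot {L} 4 q))) i)) (trans e (lookup∘tabulate (λ q → pt (π (proj₁ (Fin.remQuot {L} 4 q))) (proj₂ (Fin.remQuot {L} 4 q))) j)))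
    ex = extend (all λ b → b) (all π) room (Pat-inj (all λ b → b) (all π) (injAll (λ b → b) (λ e → e)) (injAll π inj))
    g = proj₁ ex
    ge = proj₂ ex

  Ix : ℕ → Set
  Ix j = Vec (Fin l) j × Vec (Fin l) j

  IxP : ∀ j → PLF (Ix j)
  IxP j = vecP l j ⊗ vecP l j

  -- The blocks are arranged in groups of l. In each group one block a receives the sign -1 and
  -- another block p the sign +1: having one of each is what makes exchanging the two visible to the
  -- character.
  items : ∀ {j} → (Fin j → Fin l → Fin L) → Vec (Fin l) j → Vec (Fin l) j → Vec (Fin 2 × Fin L) (dbl j)
  items B []       []       = []
  items B (a ∷ as) (p ∷ ps) = (zero , B zero a) ∷ (suc zero , B zero p) ∷ items (λ i → B (suc i)) as ps

  Diff : ∀ {j} → Vec (Fin l) j → Vec (Fin l) j → Set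
  Diff []       []       = ⊤
  Diff (a ∷ as) (p ∷ ps) = (¬ a ≡ p) × Diff as ps

  items-block : ∀ {j} (B : Fin j → Fin l → Fin L) as ps i → ∃ λ k → ∃ λ c → proj₂ (lookup (items B as ps) i) ≡ B k c
  items-block B []       []       ()
  items-block B (a ∷ as) (p ∷ ps) zero          = zero , a , refl
  items-block B (a ∷ as) (p ∷ ps) (suc zero)    = zero , p , refl
  items-block B (a ∷ as) (p ∷ ps) (suc (suc i)) = let (k , c , e) = items-block (λ i → B (suc i)) as ps i in suc k , c , e

  items-fresh : ∀ {j} (B : Fin j → Fin l → Fin L) → BInj B → ∀ as ps → Diff as ps → Fresh (items B as ps)
  items-fresh B bi []       []       d = tt
  items-fresh {suc j} B bi (a ∷ as) (p ∷ ps) (ne , d) = (λ { zero e → ne (sym (proj₂ (bi e))) ; (suc i) e → later a i e }) , later p , items-fresh (λ i → B (suc i)) (BInj-suc {B = B} bi) as ps d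
    where
    later : ∀ c i → ¬ proj₂ (lookup (items (λ i → B (suc i)) as ps) i) ≡ B zero c
    later c i e = absurd (proj₁ (bi (trans (sym (proj₂ (proj₂ (items-block (λ i → B (suc i)) as ps i)))) e)))
      where
      absurd : ∀ {k : Fin j} → ¬ _≡_ {A = Fin (suc j)} (suc k) zero
      absurd ()

  items-loss : ∀ {j} (B : Fin j → Fin l → Fin L) as ps → loss (items B as ps) ≡ pw j (nat n * nat 4 * nat 3)
  items-loss B []       []       = refl
  items-loss {suc j} B (a ∷ as) (p ∷ ps) = trans (cong (λ y → y * nat 3 * (nat n * nat 4)) (items-loss (λ i → B (suc i)) as ps)) (m (pw j (nat n * nat 4 * nat 3)) (nat 3) (nat n * nat 4))
    where
    m : ∀ a b c → a * b * c ≡ c * b * a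
    m = solve-∀ ringℚ

  -- The scalar by which `T` acts on the component of character χ: a power of 2 if χ has the
  -- prescribed signs, and 0 otherwise. Hence the square computed in `coef²`.
  coef : ∀ {m} → Vec (Fin 2 × Fin L) m → Vec (Fin 2) L → ℚ
  coef []             χ = 1ℚ
  coef ((s , b) ∷ ps) χ = (1ℚ + sg s * sg (lookup χ b)) * coef ps χ

  xs-comm : ∀ i k → lookup xs i · lookup xs k ≡ lookup xs k · lookup xs i
  xs-comm i k = subst₂ (λ g h → g · h ≡ h · g) (sym (lookup∘tabulate x i)) (sym (lookup∘tabulate x k)) (x-comm i k)

  xs-inv : ∀ i → lookup xs i · lookup xs i ≡ unit
  xs-inv i = subst (λ g → g · g ≡ unit) (sym (lookup∘tabulate x i)) (x-inv i)

  eigen-x : ∀ χ b z σ → comp xs χ z (σ · x b) ≡ sg (lookup χ b) * comp xs χ z σ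
  eigen-x χ b z σ = trans (cong (λ g → comp xs χ z (σ · g)) (sym (lookup∘tabulate x b))) (eigen xs χ xs-comm xs-inv b z σ)

  comp-T : ∀ {m} (ps : Vec (Fin 2 × Fin L) m) χ z σ → comp xs χ (T ps z) σ ≡ coef ps χ * comp xs χ z σ
  comp-T []             χ z σ = sym (*-identityˡ _)
  comp-T ((s , b) ∷ ps) χ z σ = trans (comp-lin xs χ (sg s) (T ps z) (R (x b) (T ps z)) σ) (trans (cong (λ y → comp xs χ (T ps z) σ + sg s * y)
      (trans (sym (comp-comm xs χ (x b) (λ i → subst (λ g → x b · g ≡ g · x b) (sym (lookup∘tabulate x i)) (x-comm b i)) (T ps z) σ)) (eigen-x χ b (T ps z) σ)))
    (trans (cong (λ y → y + sg s * (sg (lookup χ b) * y)) (comp-T ps χ z σ)) (m (sg s) (sg (lookup χ b)) (coef ps χ) (comp xs χ z σ))))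
    where
    m : ∀ s e c y → c * y + s * (e * (c * y)) ≡ (1ℚ + s * e) * c * y
    m = solve-∀ ringℚ

  Valid : ∀ {j} → (Fin j → Fin l → Fin L) → Vec (Fin 2) L → Vec (Fin l) j → Vec (Fin l) j → Set
  Valid B χ []       []       = ⊤
  Valid B χ (a ∷ as) (p ∷ ps) = (lookup χ (B zero a) ≡ zero × lookup χ (B zero p) ≡ suc zero) × Valid (λ i → B (suc i)) χ as ps

  valid? : ∀ {j} B χ (as ps : Vec (Fin l) j) → Dec (Valid B χ as ps)
  valid? B χ []       []       = yes tt
  valid? B χ (a ∷ as) (p ∷ ps) = ((lookup χ (B zero a) ≟ zero) ×-dec (lookup χ (B zero p) ≟ suc zero)) ×-dec valid? (λ i → B (suc i)) χ as ps

  coef² : ∀ {j} (B : Fin j → Fin l → Fin L) χ as ps → coef (items B as ps) χ * coef (items B as ps) χ ≡ pw j (nat 16) * 𝟙 (valid? B χ as ps)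
  coef² B χ []       []       = refl
  coef² {suc j} B χ (a ∷ as) (p ∷ ps) = trans (m (1ℚ + sg zero * sg c) (1ℚ + sg (suc zero) * sg d) K) (trans (cong₂ _*_ (cong₂ _*_ (f₀ c) (f₁ d)) (coef² (λ i → B (suc i)) χ as ps))
      (trans (m' (nat 4) (𝟙 (c ≟ zero)) (𝟙 (d ≟ suc zero)) (pw j (nat 16)) V) (cong (nat 4 * nat 4 * pw j (nat 16) *_) (sym (trans (𝟙-× (valid? B χ (a ∷ as) (p ∷ ps)) ((c ≟ zero) ×-dec (d ≟ suc zero)) (valid? (λ i → B (suc i)) χ as ps) (λ v → v) _,_)
        (cong (_* V) (𝟙-× ((c ≟ zero) ×-dec (d ≟ suc zero)) (c ≟ zero) (d ≟ suc zero) (λ v → v) _,_)))))))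
    where
    c = lookup χ (B zero a) ; d = lookup χ (B zero p)
    K = coef (items (λ i → B (suc i)) as ps) χ
    V = 𝟙 (valid? (λ i → B (suc i)) χ as ps)
    m : ∀ x y k → (x * (y * k)) * (x * (y * k)) ≡ (x * x) * (y * y) * (k * k)
    m = solve-∀ ringℚ
    m' : ∀ f s t q v → (f * s) * (f * t) * (q * v) ≡ (f * f) * q * (s * t * v)
    m' = solve-∀ ringℚ
    f₀ : ∀ c → (1ℚ + sg zero * sg c) * (1ℚ + sg zero * sg c) ≡ nat 4 * 𝟙 (c ≟ zero)
    f₀ zero       = refl
    f₀ (suc zero) = refl
    f₁ : ∀ c → (1ℚ + sg (suc zero) * sg c) * (1ℚ + sg (suc zero) * sg c) ≡ nat 4 * 𝟙 (c ≟ suc zero)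
    f₁ zero       = refl
    f₁ (suc zero) = refl

  -- Exchanges, in every group, the chosen block of sign -1 with the chosen block of sign +1.
  mv : ∀ {j} → (Fin j → Fin l → Fin L) → Vec (Fin l) j → Vec (Fin l) j → Fin L → Fin L
  mv B []       []       b = b
  mv B (a ∷ as) (p ∷ ps) b = swap (B zero a) (B zero p) (mv (λ i → B (suc i)) as ps b)

  mv-inj : ∀ {j} (B : Fin j → Fin l → Fin L) as ps → Inj (mv B as ps)
  mv-inj B []       []       e = e
  mv-inj B (a ∷ as) (p ∷ ps) e = mv-inj (λ i → B (suc i)) as ps (swap-inj (B zero a) (B zero p) e)

  mv-other : ∀ {j} (B : Fin j → Fin l → Fin L) as ps {b} → (∀ i → ¬ b ≡ B i (lookup as i)) → (∀ i → ¬ b ≡ B i (lookup ps i)) → mv B as ps b ≡ b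
  mv-other B []       []       p q = refl
  mv-other B (a ∷ as) (p ∷ ps) f q = trans (cong (swap (B zero a) (B zero p)) (mv-other (λ i → B (suc i)) as ps (λ i → f (suc i)) (λ i → q (suc i)))) (swap-o (f zero) (q zero))

  0≢suc : ∀ {j} {k : Fin j} → ¬ _≡_ {A = Fin (suc j)} zero (suc k)
  0≢suc ()

  mv-a : ∀ {j} (B : Fin j → Fin l → Fin L) → BInj B → ∀ as ps i → mv B as ps (B i (lookup as i)) ≡ B i (lookup ps i)
  mv-a B bi (a ∷ as) (p ∷ ps) zero    = trans (cong (swap (B zero a) (B zero p)) (mv-other (λ i → B (suc i)) as ps (λ i e → 0≢suc (proj₁ (bi e))) (λ i e → 0≢suc (proj₁ (bi e))))) (swap-l (B zero a) (B zero p))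
  mv-a B bi (a ∷ as) (p ∷ ps) (suc i) = trans (cong (swap (B zero a) (B zero p)) (mv-a (λ i → B (suc i)) (BInj-suc {B = B} bi) as ps i)) (swap-o (λ e → 0≢suc (sym (proj₁ (bi e)))) (λ e → 0≢suc (sym (proj₁ (bi e)))))

  mv-p : ∀ {j} (B : Fin j → Fin l → Fin L) → BInj B → ∀ as ps i → mv B as ps (B i (lookup ps i)) ≡ B i (lookup as i)
  mv-p B bi (a ∷ as) (p ∷ ps) zero    = trans (cong (swap (B zero a) (B zero p)) (mv-other (λ i → B (suc i)) as ps (λ i e → 0≢suc (proj₁ (bi e))) (λ i e → 0≢suc (proj₁ (bi e))))) (swap-r (B zero a) (B zero p))
  mv-p B bi (a ∷ as) (p ∷ ps) (suc i) = trans (cong (swap (B zero a) (B zero p)) (mv-p (λ i → B (suc i)) (BInj-suc {B = B} bi) as ps i)) (swap-o (λ e → 0≢suc (sym (proj₁ (bi e)))) (λ e → 0≢suc (sym (proj₁ (bi e)))))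

  valid-a : ∀ {j} (B : Fin j → Fin l → Fin L) χ as ps → Valid B χ as ps → ∀ i → lookup χ (B i (lookup as i)) ≡ zero
  valid-a B χ (a ∷ as) (p ∷ ps) (v , vs) zero    = proj₁ v
  valid-a B χ (a ∷ as) (p ∷ ps) (v , vs) (suc i) = valid-a (λ i → B (suc i)) χ as ps vs i

  valid-p : ∀ {j} (B : Fin j → Fin l → Fin L) χ as ps → Valid B χ as ps → ∀ i → lookup χ (B i (lookup ps i)) ≡ suc zero
  valid-p B χ (a ∷ as) (p ∷ ps) (v , vs) zero    = proj₂ v
  valid-p B χ (a ∷ as) (p ∷ ps) (v , vs) (suc i) = valid-p (λ i → B (suc i)) χ as ps vs i

  module Orthogonality {w} (B : Fin w → Fin l → Fin L) (bi : BInj B) (χ : Vec (Fin 2) L) (v : El → ℚ) where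
    y : El → ℚ
    y = comp xs χ v

    g : Ix w → El
    g (as , ps) = proj₁ (permute (mv B as ps) (mv-inj B as ps))

    e : Ix w → El → ℚ
    e m = R (g m) y

    sign : ∀ as ps b b' → mv B as ps b' ≡ b → ∀ σ → e (as , ps) (σ · x b) ≡ sg (lookup χ b') * e (as , ps) σ
    sign as ps b b' eq σ = trans (cong y (trans (assoc σ (x b) h) (trans (cong (σ ·_) (sym (dt-move h (block b') (block b) (to zero , to (suc zero) , to (suc (suc zero)) , to (suc (suc (suc zero))))))) (sym (assoc σ h (x b')))))) (eigen-x χ b' v (σ · h))
      where
      h = g (as , ps)
      to : ∀ j → h $ pt b' j ≡ pt b j
      to j = trans (proj₂ (permute (mv B as ps) (mv-inj B as ps)) b' j) (cong (λ c → pt c j) eq)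

    opposite : ∀ (f h : El → ℚ) b c d → lookup χ c ≡ zero → lookup χ d ≡ suc zero → (∀ σ → f (σ · x b) ≡ sg (lookup χ c) * f σ) → (∀ σ → h (σ · x b) ≡ sg (lookup χ d) * h σ) → E (λ σ → f σ * h σ) ≡ 0ℚ
    opposite f h b c d c0 d1 p q = trans (l₁ I) (mul0ʳ {½} (trans (cong (I +_) (trans (sym (E-right (x b) λ σ → f σ * h σ)) (trans (PLF.ext 𝔾 λ σ → trans (cong₂ _*_ (trans (p σ) (cong (λ t → sg t * f σ) c0)) (trans (q σ) (cong (λ t → sg t * h σ) d1))) (l₂ (f σ) (h σ))) (PLF.scl 𝔾 (- 1ℚ) λ σ → f σ * h σ)))) (l₃ I)))
      where
      I = E λ σ → f σ * h σ
      l₁ : ∀ a → a ≡ ½ * (a + a)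
      l₁ a = sym (trans (*-distribˡ-+ ½ a a) (½+½ a))
      l₂ : ∀ a b → (- 1ℚ) * a * (1ℚ * b) ≡ (- 1ℚ) * (a * b)
      l₂ = solve-∀ ringℚ
      l₃ : ∀ a → a + (- 1ℚ) * a ≡ 0ℚ
      l₃ = solve-∀ ringℚ

    untouched : ∀ as ps → Valid B χ as ps → ∀ i c → (lookup χ (B i c) ≡ zero → ¬ c ≡ lookup as i) → (lookup χ (B i c) ≡ suc zero → ¬ c ≡ lookup ps i) → mv B as ps (B i c) ≡ B i c
    untouched as ps V i c na np = mv-other B as ps (λ k r → na (trans (cong (lookup χ) r) (valid-a B χ as ps V k)) (trans (proj₂ (bi r)) (cong (lookup as) (sym (proj₁ (bi r))))))
      (λ k r → np (trans (cong (lookup χ) r) (valid-p B χ as ps V k)) (trans (proj₂ (bi r)) (cong (lookup ps) (sym (proj₁ (bi r))))))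

    clash : ∀ {c : Fin 2} {A : Set} → c ≡ zero → c ≡ suc zero → A
    clash refl ()

    -- On the block b that only the first choice exchanges, the first translate has eigenvalue +1,
    -- taken over from its partner, while the second still has -1: b has sign -1, so it cannot be a
    -- `ps'` block either. Opposite eigenvalues of an involution give orthogonality.
    orth-a : ∀ as ps as' ps' → Valid B χ as ps → Valid B χ as' ps' → ∀ i → ¬ lookup as i ≡ lookup as' i → E (λ σ → e (as , ps) σ * e (as' , ps') σ) ≡ 0ℚ
    orth-a as ps as' ps' V V' i ne = trans (PLF.ext 𝔾 λ σ → *-comm (e (as , ps) σ) (e (as' , ps') σ)) (opposite (e (as' , ps')) (e (as , ps)) b b (B i (lookup ps i)) (valid-a B χ as ps V i) (valid-p B χ as ps V i)
        (sign as' ps' b b (untouched as' ps' V' i (lookup as i) (λ _ → ne) (λ z → clash (valid-a B χ as ps V i) z))) (sign as ps b (B i (lookup ps i)) (mv-p B bi as ps i)))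
      where b = B i (lookup as i)

    orth-p : ∀ as ps as' ps' → Valid B χ as ps → Valid B χ as' ps' → ∀ i → ¬ lookup ps i ≡ lookup ps' i → E (λ σ → e (as , ps) σ * e (as' , ps') σ) ≡ 0ℚ
    orth-p as ps as' ps' V V' i ne = opposite (e (as , ps)) (e (as' , ps')) b (B i (lookup as i)) b (valid-a B χ as ps V i) (valid-p B χ as ps V i)
        (sign as ps b (B i (lookup as i)) (mv-a B bi as ps i)) (sign as' ps' b b (untouched as' ps' V' i (lookup ps i) (λ z → clash z (valid-p B χ as ps V i)) (λ _ → ne)))
      where b = B i (lookup ps i)

    val : Ix w → ℚ
    val (as , ps) = 𝟙 (valid? B χ as ps)

    δ : Ix w → Ix w → ℚ
    δ (as , ps) (as' , ps') = 𝟙 (as ≟V as') * 𝟙 (ps ≟V ps')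

    δ-ap : ∀ m (F : Ix w → ℚ) → PLF.ap (IxP w) (λ m' → δ m m' * F m') ≡ F m
    δ-ap (as , ps) F = trans (PLF.ext (vecP l w) λ as' → trans (PLF.ext (vecP l w) λ ps' → *-assoc (𝟙 (as ≟V as')) (𝟙 (ps ≟V ps')) (F (as' , ps'))) (trans (PLF.scl (vecP l w) (𝟙 (as ≟V as')) _) (cong (𝟙 (as ≟V as') *_) (sumV-δ' ps λ ps' → F (as' , ps')))))
      (sumV-δ' as λ as' → F (as' , ps))

    differ : ∀ (u u' : Vec (Fin l) w) → ¬ u ≡ u' → ∃ λ i → ¬ lookup u i ≡ lookup u' i
    differ u u' ne = by (any? λ i → ¬? (lookup u i ≟ lookup u' i))
      where
      by : Dec (∃ λ i → ¬ lookup u i ≡ lookup u' i) → ∃ λ i → ¬ lookup u i ≡ lookup u' i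
      by (yes p) = p
      by (no q)  = ⊥-elim (ne (lookup-ext λ i → decidable-stable (lookup u i ≟ lookup u' i) λ r → q (i , r)))

    𝟙² : ∀ {P : Set} (p : Dec P) → 𝟙 p * 𝟙 p ≡ 𝟙 p
    𝟙² (yes _) = refl
    𝟙² (no _)  = refl

    gram : ∀ m m' → val m * val m' * E (λ σ → e m σ * e m' σ) ≡ δ m m' * (val m * nrm² y)
    gram (as , ps) (as' , ps') = by (as ≟V as') (ps ≟V ps')
      where
      I = E λ σ → e (as , ps) σ * e (as' , ps') σ
      off : (Valid B χ as ps → Valid B χ as' ps' → I ≡ 0ℚ) → (q : Dec (Valid B χ as ps)) (q' : Dec (Valid B χ as' ps')) → 𝟙 q * 𝟙 q' * I ≡ 0ℚ
      off z (yes V) (yes V') = mul0ʳ {1ℚ * 1ℚ} (z V V')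
      off z (yes V) (no _)   = trans (cong (_* I) (*-zeroʳ 1ℚ)) (*-zeroˡ I)
      off z (no _)  q'       = trans (cong (_* I) (*-zeroˡ (𝟙 q'))) (*-zeroˡ I)
      by : (r : Dec (as ≡ as')) (s : Dec (ps ≡ ps')) → 𝟙 (valid? B χ as ps) * 𝟙 (valid? B χ as' ps') * I ≡ 𝟙 r * 𝟙 s * (𝟙 (valid? B χ as ps) * nrm² y)
      by (yes refl) (yes refl) = trans (cong₂ _*_ (𝟙² (valid? B χ as ps)) (R-iso (g (as , ps)) y y)) (sym (trans (cong (_* (𝟙 (valid? B χ as ps) * nrm² y)) (*-identityˡ 1ℚ)) (*-identityˡ _)))
      by (no ne) s = trans (off (λ V V' → let (i , d) = differ as as' ne in orth-a as ps as' ps' V V' i d) (valid? B χ as ps) (valid? B χ as' ps')) (sym (trans (cong (_* (𝟙 (valid? B χ as ps) * nrm² y)) (*-zeroˡ (𝟙 s))) (*-zeroˡ (𝟙 (valid? B χ as ps) * nrm² y))))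
      by (yes _) (no ne) = trans (off (λ V V' → let (i , d) = differ ps ps' ne in orth-p as ps as' ps' V V' i d) (valid? B χ as ps) (valid? B χ as' ps')) (sym (trans (cong (_* (𝟙 (valid? B χ as ps) * nrm² y)) (*-zeroʳ 1ℚ)) (*-zeroˡ (𝟙 (valid? B χ as ps) * nrm² y))))

    -- Every valid choice gives a translate of y, and u convolved with it is a translate of
    -- `conv u y`, of the same norm. For fixed s these convolutions are the inner products of u with
    -- orthogonal vectors, so Bessel bounds their sum of squares; averaging over s shows that each
    -- valid choice counts in full.
    char-bound : ∀ u → PLF.ap (IxP w) (λ m → val m * nrm² (conv u y)) ≤ nrm² y * nrm² u
    char-bound u = ≤-trans (≤-reflexive (trans (PLF.ext (IxP w) λ m → trans (cong (val m *_) (sym (trans (PLF.ext 𝔾 λ s → cong₂ _*_ (conv-R u y (g m) s) (conv-R u y (g m) s)) (R-iso (g m) (conv u y) (conv u y)))))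
          (sym (PLF.scl 𝔾 (val m) λ s → conv u (e m) s * conv u (e m) s))) (sym (⊗-fin (vecP l w) (vecP l w) (vecP-fin l w) (vecP-fin l w) 𝔾 λ m s → val m * (conv u (e m) s * conv u (e m) s)))))
        (≤-trans (PLF.mono 𝔾 λ s → bessel 𝔾 (IxP w) (⊗-fin (vecP l w) (vecP l w) (vecP-fin l w) (vecP-fin l w)) δ val (nrm² y) (0≤nrm² y) δ-ap (λ { (as , ps) → 𝟙² (valid? B χ as ps) }) (λ m → refl-at s (e m))
            (λ m m' → trans (cong (val m * val m' *_) (trans (E-inv λ x → e m (x · s) * e m' (x · s)) (E-right s λ x → e m x * e m' x))) (gram m m')) u)
          (≤-reflexive (E-const (nrm² y * nrm² u))))

  module HighLevels {w} (B : Fin w → Fin l → Fin L) (bi : BInj B) (w≤ : suc (suc (four (dbl w))) ℕ.≤ n) where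
    open Orthogonality B bi using (char-bound)

    Tm : Ix w → (El → ℚ) → El → ℚ
    Tm m = T (items B (proj₁ m) (proj₂ m))

    IxP-fin : Finitary (IxP w)
    IxP-fin = ⊗-fin (vecP l w) (vecP l w) (vecP-fin l w) (vecP-fin l w)

    -- By Parseval the norms split over characters, and `T` keeps exactly the characters for which
    -- the choice is valid. The sum over choices therefore becomes the count in `char-bound`.
    total : ∀ u v → PLF.ap (IxP w) (λ m → nrm² (Tm m (conv u v))) ≤ pw w (nat 16) * (nrm² v * nrm² u)
    total u v = ≤-trans (≤-reflexive (begin
        PLF.ap (IxP w) (λ m → nrm² (Tm m (conv u v)))
          ≡⟨ PLF.ext (IxP w) (λ m → sym (parseval xs (Tm m (conv u v)))) ⟩
        PLF.ap (IxP w) (λ m → sumV λ χ → nrm² (comp xs χ (Tm m (conv u v))))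
          ≡⟨ PLF.ext (IxP w) (λ m → PLF.ext (vecP 2 L) λ χ → each m χ) ⟩
        PLF.ap (IxP w) (λ m → sumV λ χ → K * F χ m)
          ≡⟨ IxP-fin (vecP 2 L) (λ m χ → K * F χ m) ⟨
        sumV (λ χ → PLF.ap (IxP w) λ m → K * F χ m)
          ≡⟨ trans (PLF.ext (vecP 2 L) λ χ → PLF.scl (IxP w) K (F χ)) (PLF.scl (vecP 2 L) K _) ⟩
        K * sumV (λ χ → PLF.ap (IxP w) (F χ)) ∎))
      (*-monoʳ (0≤pw w (0≤nat 16)) (≤-trans (PLF.mono (vecP 2 L) λ χ → char-bound χ v u) (≤-reflexive (trans (PLF.sclr (vecP 2 L) (nrm² u) λ χ → nrm² (comp xs χ v)) (cong (_* nrm² u) (parseval xs v))))))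
      where
      open ≡-Reasoning
      K = pw w (nat 16)
      F : Vec (Fin 2) L → Ix w → ℚ
      F χ m = 𝟙 (valid? B χ (proj₁ m) (proj₂ m)) * nrm² (conv u (comp xs χ v))
      each : ∀ m χ → nrm² (comp xs χ (Tm m (conv u v))) ≡ K * F χ m
      each m χ = trans (PLF.ext 𝔾 λ σ → trans (cong (λ y → y * y) (trans (comp-T (items B (proj₁ m) (proj₂ m)) χ (conv u v) σ) (cong (c *_) (comp-conv xs χ u v σ)))) (q c (conv u (comp xs χ v) σ)))
          (trans (PLF.scl 𝔾 (c * c) λ σ → conv u (comp xs χ v) σ * conv u (comp xs χ v) σ) (trans (cong (_* nrm² (conv u (comp xs χ v))) (coef² B χ (proj₁ m) (proj₂ m))) (*-assoc K _ _)))
        where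
        c = coef (items B (proj₁ m) (proj₂ m)) χ
        q : ∀ c y → c * y * (c * y) ≡ c * c * (y * y)
        q = solve-∀ ringℚ

    apart : ∀ {j} → Vec (Fin l) j → Vec (Fin l) j → ℚ
    apart []       []       = 1ℚ
    apart (a ∷ as) (p ∷ ps) = (1ℚ - 𝟙 (a ≟ p)) * apart as ps

    apart-cases : ∀ {j} (as ps : Vec (Fin l) j) → (apart as ps ≡ 0ℚ) ⊎ (Diff as ps × apart as ps ≡ 1ℚ)
    apart-cases []       []       = inj₂ (tt , refl)
    apart-cases (a ∷ as) (p ∷ ps) = by (a ≟ p) (apart-cases as ps)
      where
      by : (r : Dec (a ≡ p)) → (apart as ps ≡ 0ℚ) ⊎ (Diff as ps × apart as ps ≡ 1ℚ) → ((1ℚ - 𝟙 r) * apart as ps ≡ 0ℚ) ⊎ (Diff (a ∷ as) (p ∷ ps) × (1ℚ - 𝟙 r) * apart as ps ≡ 1ℚ)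
      by (yes _) _              = inj₁ (mul0ˡ {1ℚ - 1ℚ} {apart as ps} refl)
      by (no ne) (inj₁ z)       = inj₁ (mul0ʳ {1ℚ - 0ℚ} z)
      by (no ne) (inj₂ (d , o)) = inj₂ ((ne , d) , trans (cong ((1ℚ - 0ℚ) *_) o) refl)

    apart-count : ∀ j → sumV {l} {j} (λ as → sumV {l} {j} λ ps → apart as ps) ≡ pw j (nat l * (nat l - 1ℚ))
    apart-count zero    = refl
    apart-count (suc j) = begin
        sumF {l} (λ a → sumV {l} {j} λ as → sumF {l} λ p → sumV {l} {j} λ ps → (1ℚ - 𝟙 (a ≟ p)) * apart as ps)
          ≡⟨ PLF.ext (finP l) (λ a → PLF.ext (vecP l j) λ as → trans (PLF.ext (finP l) λ p → PLF.scl (vecP l j) (1ℚ - 𝟙 (a ≟ p)) (apart as)) (trans (PLF.sclr (finP l) (sumV (apart as)) λ p → 1ℚ - 𝟙 (a ≟ p)) (cong (_* sumV (apart as)) (one a)))) ⟩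
        sumF {l} (λ a → sumV {l} {j} λ as → (nat l - 1ℚ) * sumV (apart as))
          ≡⟨ PLF.ext (finP l) (λ a → trans (PLF.scl (vecP l j) (nat l - 1ℚ) λ as → sumV (apart as)) (cong ((nat l - 1ℚ) *_) (apart-count j))) ⟩
        sumF {l} (λ a → c)
          ≡⟨ trans (PLF.ext (finP l) λ a → sym (*-identityʳ c)) (trans (PLF.scl (finP l) c λ _ → 1ℚ) (cong (c *_) (sumF-const l))) ⟩
        c * nat l
          ≡⟨ q (nat l - 1ℚ) (pw j (nat l * (nat l - 1ℚ))) (nat l) ⟩
        pw (suc j) (nat l * (nat l - 1ℚ)) ∎
      where
      open ≡-Reasoning
      c = (nat l - 1ℚ) * pw j (nat l * (nat l - 1ℚ))
      q : ∀ a b d → a * b * d ≡ d * a * b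
      q = solve-∀ ringℚ
      one : ∀ a → sumF (λ p → 1ℚ - 𝟙 (a ≟ p)) ≡ nat l - 1ℚ
      one a = trans (PLF.sub (finP l) (λ _ → 1ℚ) λ p → 𝟙 (a ≟ p)) (cong₂ _-_ (sumF-const l) (trans (PLF.ext (finP l) λ p → trans (𝟙-cong (a ≟ p) (p ≟ a) sym sym) (sym (*-identityʳ _))) (sumF-δ a λ _ → 1ℚ)))

    -- Each of the w steps loses a factor n to the gap, which is regained by the l (l - 1) choices of a pair of blocks.
    high-levels : ∀ u v → (∀ j → j ℕ.≤ four (dbl w) → Perp j v) →
      pw w (nat l * (nat l - 1ℚ)) * nrm² (conv u v) ≤ pw w (nat n * nat 4 * nat 3) * (pw w (nat 16) * (nrm² v * nrm² u))
    high-levels u v q = ≤-trans (≤-reflexive (sym (trans (PLF.sclr (IxP w) (nrm² z) λ m → apart (proj₁ m) (proj₂ m)) (cong (_* nrm² z) (apart-count w)))))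
      (≤-trans (PLF.mono (IxP w) λ m → each (proj₁ m) (proj₂ m) (apart-cases (proj₁ m) (proj₂ m))) (≤-trans (≤-reflexive (trans (PLF.scl (IxP w) K λ m → ⟪ Ym m , Ym m ⟫) (cong (K *_) (sym (IxP-fin 𝔾 λ m τ → nrm² (Tm m (R τ z)))))))
        (*-monoʳ 0≤K (≤-trans (PLF.mono 𝔾 λ τ → ≤-trans (≤-reflexive (PLF.ext (IxP w) λ m → PLF.ext 𝔾 λ σ → cong (λ y → y * y) (T-ext (items B (proj₁ m) (proj₂ m)) (λ s → sym (conv-R u v τ s)) σ)))
            (≤-trans (total u (R τ v)) (≤-reflexive (cong (λ y → pw w (nat 16) * (y * nrm² u)) (R-iso τ v v))))) (≤-reflexive (E-const _))))))
      where
      z = conv u v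
      K = pw w (nat n * nat 4 * nat 3)
      0≤K : 0ℚ ≤ K
      0≤K = 0≤pw w (0≤* (0≤* (0≤nat n) (0≤nat 4)) (0≤nat 3))
      Ym : Ix w → Fam
      Ym m = Y (items B (proj₁ m) (proj₂ m)) z
      each : ∀ as ps → (apart as ps ≡ 0ℚ) ⊎ (Diff as ps × apart as ps ≡ 1ℚ) → apart as ps * nrm² z ≤ K * ⟪ Ym (as , ps) , Ym (as , ps) ⟫
      each as ps (inj₁ e)       = ≤-trans (≤-reflexive (mul0ˡ {_} {nrm² z} e)) (0≤* 0≤K (0≤⟪⟫ (Ym (as , ps))))
      each as ps (inj₂ (d , e)) = ≤-trans (≤-reflexive (trans (cong (_* nrm² z) e) (*-identityˡ _))) (≤-trans (descend (items B as ps) z (items-fresh B bi as ps d) w≤ (λ j r → Perp-conv u {v} (q j r)))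
        (≤-reflexive (cong (_* ⟪ Ym (as , ps) , Ym (as , ps) ⟫) (items-loss B as ps))))

-- Coupling with a product space

-- Order-preserving choices of d of K coordinates
data Sel : ℕ → ℕ → Set where
  done : Sel 0 0
  skip : ∀ {K d} → Sel K d → Sel (suc K) d
  take : ∀ {K d} → Sel K d → Sel (suc K) (suc d)

pick : ∀ {X : Set} {K d} → Sel K d → Vec X K → Vec X d
pick done     []      = []
pick (skip s) (x ∷ v) = pick s v
pick (take s) (x ∷ v) = x ∷ pick s v

pick-map : ∀ {X Y : Set} {K d} (s : Sel K d) (h : X → Y) v → pick s (map h v) ≡ map h (pick s v)
pick-map done     h []      = refl
pick-map (skip s) h (x ∷ v) = pick-map s h v
pick-map (take s) h (x ∷ v) = cong (h x ∷_) (pick-map s h v)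

pick-∈ : ∀ {X : Set} {K d} (s : Sel K d) (v : Vec X K) a → ∃ λ i → lookup (pick s v) a ≡ lookup v i
pick-∈ done     []      ()
pick-∈ (skip s) (x ∷ v) a       = let (i , e) = pick-∈ s v a in suc i , e
pick-∈ (take s) (x ∷ v) zero    = zero , refl
pick-∈ (take s) (x ∷ v) (suc a) = let (i , e) = pick-∈ s v a in suc i , e

pick-inj : ∀ {n K d} (s : Sel K d) (v : Vec (Fin n) K) → InjV v → InjV (pick s v)
pick-inj done     []      p {()}
pick-inj (skip s) (x ∷ v) p = pick-inj s v (InjV-tail {v = v} p)
pick-inj (take s) (x ∷ v) p = InjV-∷ {v = pick s v} (λ a e → let (i , e') = pick-∈ s v a in InjV-head {v = v} p i (trans (sym e') e)) (pick-inj s v (InjV-tail {v = v} p))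

zeroP : ∀ {Ω : Set} → PLF Ω
zeroP = record { ap = λ _ → 0ℚ ; add = λ _ _ → refl ; scl = λ c _ → sym (*-zeroʳ c) ; mono = λ _ → ≤-refl }

selP : ∀ K d → PLF (Sel K d)
selP zero    zero    = record { ap = λ F → F done ; add = λ _ _ → refl ; scl = λ _ _ → refl ; mono = λ p → p done }
selP zero    (suc d) = zeroP
selP (suc K) zero    = record { ap = λ F → PLF.ap (selP K zero) λ s → F (skip s) ; add = λ _ _ → PLF.add (selP K zero) _ _ ; scl = λ c _ → PLF.scl (selP K zero) c _ ; mono = λ p → PLF.mono (selP K zero) λ s → p (skip s) }
selP (suc K) (suc d) = record
  { ap = λ F → PLF.ap (selP K (suc d)) (λ s → F (skip s)) + PLF.ap (selP K d) (λ s → F (take s))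
  ; add = λ f g → trans (cong₂ _+_ (PLF.add (selP K (suc d)) _ _) (PLF.add (selP K d) _ _)) (l (PLF.ap (selP K (suc d)) (λ s → f (skip s))) _ _ _)
  ; scl = λ c f → trans (cong₂ _+_ (PLF.scl (selP K (suc d)) c _) (PLF.scl (selP K d) c _)) (sym (*-distribˡ-+ c _ _))
  ; mono = λ p → +-mono-≤ (PLF.mono (selP K (suc d)) λ s → p (skip s)) (PLF.mono (selP K d) λ s → p (take s)) }
  where
  l : ∀ a b c d → a + b + (c + d) ≡ a + c + (b + d)
  l = solve-∀ ringℚ

selP-fin : ∀ K d → Finitary (selP K d)
selP-fin zero    zero    B f = refl
selP-fin zero    (suc d) B f = PLF.zer B
selP-fin (suc K) zero    B f = selP-fin K zero B λ s → f (skip s)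
selP-fin (suc K) (suc d) B f = trans (PLF.add B _ _) (cong₂ _+_ (selP-fin K (suc d) B λ s → f (skip s)) (selP-fin K d B λ s → f (take s)))

sels : ℕ → ℕ → ℚ
sels K d = PLF.ap (selP K d) λ _ → 1ℚ

0≤sels : ∀ K d → 0ℚ ≤ sels K d
0≤sels K d = PLF.nonneg (selP K d) λ _ → 0≤1

sels-mono : ∀ b K d → sels K d ≤ sels (b ℕ.+ K) d
sels-mono zero    K d       = ≤-refl
sels-mono (suc b) K zero    = sels-mono b K zero
sels-mono (suc b) K (suc d) = ≤-trans (sels-mono b K (suc d)) (cert (0≤sels (b ℕ.+ K) d) refl)

sels-grow : ∀ b K d → nat b * sels K d ≤ sels (b ℕ.+ K) (suc d)
sels-grow zero    K d = ≤-trans (≤-reflexive (mul0ˡ {nat 0} {sels K d} refl)) (0≤sels K (suc d))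
sels-grow (suc b) K d = ≤-trans (≤-reflexive (l (nat b) (sels K d))) (+-mono-≤ (sels-grow b K d) (sels-mono b K d))
  where
  l : ∀ b s → (1ℚ + b) * s ≡ b * s + s
  l = solve-∀ ringℚ

-- Among the choices of d out of d b coordinates are those with one from each of d groups of b.
pw≤sels : ∀ b d → pw d (nat b) ≤ sels (d ℕ.* b) d
pw≤sels b zero    = ≤-refl
pw≤sels b (suc d) = ≤-trans (*-monoʳ (0≤nat b) (pw≤sels b d)) (sels-grow b (d ℕ.* b) d)

module UniformProduct (n : ℕ) (0<n : 0ℚ < nat n) where
  open Alternating n
  open TupleCalculus n
  open FrameBounds n using (Perp-head)

  ν : ℚ
  ν = inv (nat n) 0<n

  nν : nat n * ν ≡ 1ℚ
  nν = inv-r (nat n) 0<n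

  uniform : Prob (Fin n)
  uniform = record
    { plf = scaleP ν (<⇒≤ (0<inv (nat n) 0<n)) (finP n)
    ; one = trans (cong (ν *_) (sumF-const n)) (trans (*-comm ν (nat n)) nν)
    ; fin = scaleP-fin ν (<⇒≤ (0<inv (nat n) 0<n)) (finP n) (finP-fin n) }

  open Prob uniform public using (avg; avg-const)
  open Product uniform public

  n-avg : ∀ F → nat n * avg F ≡ sumF F
  n-avg F = trans (sym (*-assoc (nat n) ν (sumF F))) (trans (cong (_* sumF F) nν) (*-identityˡ _))

  sumF-perm : ∀ g (F : Fin n → ℚ) → sumF (λ x → F (g $ x)) ≡ sumF F
  sumF-perm g F = begin
      sumF (λ x → F (g $ x))
        ≡⟨ PLF.ext (finP n) (λ x → sym (trans (PLF.ext (finP n) λ j → cong (_* F j) (𝟙-cong (g $ x ≟ j) (j ≟ g $ x) sym sym)) (sumF-δ (g $ x) F))) ⟩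
      sumF (λ x → sumF λ j → 𝟙 (g $ x ≟ j) * F j)
        ≡⟨ finP-fin n (finP n) (λ j x → 𝟙 (g $ x ≟ j) * F j) ⟩
      sumF (λ j → sumF λ x → 𝟙 (g $ x ≟ j) * F j)
        ≡⟨ PLF.ext (finP n) (λ j → trans (PLF.sclr (finP n) (F j) λ x → 𝟙 (g $ x ≟ j)) (trans (cong (_* F j) (sum-row g j)) (*-identityˡ (F j)))) ⟩
      sumF F ∎
    where open ≡-Reasoning

  𝔼-perm : ∀ g k (F : Vec (Fin n) k → ℚ) → 𝔼 (λ φ → F (g ∙ φ)) ≡ 𝔼 F
  𝔼-perm g zero    F = refl
  𝔼-perm g (suc k) F = trans (PLF.ext (Prob.plf uniform) λ x → 𝔼-perm g k λ φ → F ((g $ x) ∷ φ)) (cong (ν *_) (sumF-perm g λ x → 𝔼 λ φ → F (x ∷ φ)))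

  𝔼-δ : ∀ {k} u (F : Vec (Fin n) k → ℚ) → pw k (nat n) * 𝔼 (λ φ → 𝟙 (u ≟V φ) * F φ) ≡ F u
  𝔼-δ []      F = trans (*-identityˡ _) (trans (cong (_* F []) (𝟙-yes (_≟V_ {n} [] []) refl)) (*-identityˡ (F [])))
  𝔼-δ {suc k} (x ∷ u) F = begin
      nat n * pw k (nat n) * avg (λ y → 𝔼 λ φ → 𝟙 (x ∷ u ≟V y ∷ φ) * F (y ∷ φ))
        ≡⟨ l (nat n) (pw k (nat n)) _ ⟩
      pw k (nat n) * (nat n * avg (λ y → 𝔼 λ φ → 𝟙 (x ∷ u ≟V y ∷ φ) * F (y ∷ φ)))
        ≡⟨ cong (pw k (nat n) *_) (trans (n-avg _) (trans (PLF.ext (finP n) λ y → trans (PLF.ext (Er (free k)) λ φ → trans (cong (_* F (y ∷ φ)) (trans (𝟙-∷ x y u φ) (cong (_* 𝟙 (u ≟V φ)) (𝟙-cong (x ≟ y) (y ≟ x) sym sym)))) (*-assoc (𝟙 (y ≟ x)) _ _)) (PLF.scl (Er (free k)) (𝟙 (y ≟ x)) _)) (sumF-δ x λ y → 𝔼 λ φ → 𝟙 (u ≟V φ) * F (y ∷ φ)))) ⟩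
      pw k (nat n) * 𝔼 (λ φ → 𝟙 (u ≟V φ) * F (x ∷ φ))
        ≡⟨ 𝔼-δ u (λ φ → F (x ∷ φ)) ⟩
      F (x ∷ u) ∎
    where
    open ≡-Reasoning
    l : ∀ a b c → a * b * c ≡ b * (a * c)
    l = solve-∀ ringℚ

  fixed : ∀ {k} → (ρ : Vec (Maybe (Fin n)) k) → Vec (Fin n) k → Vec (Fin n) (cnt ρ)
  fixed []            []      = []
  fixed (nothing ∷ ρ) (x ∷ φ) = fixed ρ φ
  fixed (just _ ∷ ρ)  (x ∷ φ) = x ∷ fixed ρ φ

  fixed-∙ : ∀ {k} (ρ : Vec (Maybe (Fin n)) k) g φ → fixed ρ (g ∙ φ) ≡ g ∙ fixed ρ φ
  fixed-∙ []            g []      = refl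
  fixed-∙ (nothing ∷ ρ) g (x ∷ φ) = fixed-∙ ρ g φ
  fixed-∙ (just _ ∷ ρ)  g (x ∷ φ) = cong ((g $ x) ∷_) (fixed-∙ ρ g φ)

  values : ∀ {k} → (ρ : Vec (Maybe (Fin n)) k) → Vec (Fin n) (cnt ρ)
  values []            = []
  values (nothing ∷ ρ) = values ρ
  values (just y ∷ ρ)  = y ∷ values ρ

  Er-as : ∀ {k} (ρ : Vec (Maybe (Fin n)) k) F → pw (cnt ρ) (nat n) * 𝔼 (λ φ → 𝟙 (fixed ρ φ ≟V values ρ) * F φ) ≡ PLF.ap (Er ρ) F
  Er-as [] F = trans (*-identityˡ _) (trans (cong (_* F []) (𝟙-yes (_≟V_ {n} [] []) refl)) (*-identityˡ (F [])))
  Er-as (nothing ∷ ρ) F = trans (sym (PLF.scl (Prob.plf uniform) (pw (cnt ρ) (nat n)) _)) (PLF.ext (Prob.plf uniform) λ x → Er-as ρ λ φ → F (x ∷ φ))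
  Er-as {suc k} (just y ∷ ρ) F = begin
      nat n * pw (cnt ρ) (nat n) * avg (λ x → 𝔼 λ φ → 𝟙 (x ∷ fixed ρ φ ≟V y ∷ values ρ) * F (x ∷ φ))
        ≡⟨ l (nat n) (pw (cnt ρ) (nat n)) _ ⟩
      pw (cnt ρ) (nat n) * (nat n * avg (λ x → 𝔼 λ φ → 𝟙 (x ∷ fixed ρ φ ≟V y ∷ values ρ) * F (x ∷ φ)))
        ≡⟨ cong (pw (cnt ρ) (nat n) *_) (trans (n-avg _) (trans (PLF.ext (finP n) λ x → trans (PLF.ext (Er (free k)) λ φ → trans (cong (_* F (x ∷ φ)) (𝟙-∷ x y (fixed ρ φ) (values ρ))) (*-assoc (𝟙 (x ≟ y)) _ _)) (PLF.scl (Er (free k)) (𝟙 (x ≟ y)) _)) (sumF-δ y λ x → 𝔼 λ φ → 𝟙 (fixed ρ φ ≟V values ρ) * F (x ∷ φ)))) ⟩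
      pw (cnt ρ) (nat n) * 𝔼 (λ φ → 𝟙 (fixed ρ φ ≟V values ρ) * F (y ∷ φ))
        ≡⟨ Er-as ρ (λ φ → F (y ∷ φ)) ⟩
      PLF.ap (Er ρ) (λ φ → F (y ∷ φ)) ∎
    where
    open ≡-Reasoning
    l : ∀ a b c → a * b * c ≡ b * (a * c)
    l = solve-∀ ringℚ

  -- `Perp` shifted by one to agree with the level indices: for a function of level d, with no
  -- condition when d = 0.
  Perp' : ℕ → (El → ℚ) → Set
  Perp' zero    z = ⊤
  Perp' (suc d) z = Perp d z

  at : (El → ℚ) → Fin n → Fin n → El → ℚ
  at z i x σ = z σ * 𝟙 (σ $ i ≟ x)

  Perp'-at : ∀ d {z} → Perp d z → ∀ i x → Perp' d (at z i x)
  Perp'-at zero    q i x = tt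
  Perp'-at (suc d) {z} q i x = Perp-head {z = z} q i x

  -- The test function on the product space belonging to z and the rows ρ. Each selection
  -- contributes a function of d coordinates whose mean in any one of them is 0, which is why the
  -- sum is purely of level d.
  H : ∀ K d → (El → ℚ) → Vec (Fin n) K → Vec (Fin n) K → ℚ
  H K d z ρ φ = PLF.ap (selP K d) λ s → M z (pick s ρ) (pick s φ)

  H-∷ : ∀ K d z i ρ x φ → H (suc K) (suc d) z (i ∷ ρ) (x ∷ φ) ≡ H K (suc d) z ρ φ + H K d (at z i x) ρ φ
  H-∷ K d z i ρ x φ = cong (H K (suc d) z ρ φ +_) (PLF.ext (selP K d) λ s → M-head z i x (pick s ρ) (pick s φ))

  H-mean : ∀ K d z → Perp d z → ∀ i ρ φ → avg (λ x → H K d (at z i x) ρ φ) ≡ 0ℚ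
  H-mean K d z q i ρ φ = trans (selP-fin K d (Prob.plf uniform) λ s x → M (at z i x) (pick s ρ) (pick s φ)) (trans (PLF.ext (selP K d) λ s →
      mul0ʳ {ν} (trans (PLF.ext (finP n) λ x → sym (M-head z i x (pick s ρ) (pick s φ))) (trans (M-col z i (pick s ρ) (pick s φ)) (q (pick s ρ) (pick s φ))))) (PLF.zer (selP K d)))

  bar-H : ∀ K d z → Perp d z → ∀ i ρ φ → bar (H (suc K) (suc d) z (i ∷ ρ)) φ ≡ H K (suc d) z ρ φ
  bar-H K d z q i ρ φ = trans (PLF.ext (Prob.plf uniform) λ x → H-∷ K d z i ρ x φ) (trans (PLF.add (Prob.plf uniform) _ _) (trans (cong₂ _+_ (avg-const (H K (suc d) z ρ φ)) (H-mean K d z q i ρ φ)) (+-identityʳ _)))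

  H-pure : ∀ K d z → Perp' d z → ∀ ρ → Pure (suc d) (H K d z ρ)
  H-pure zero    zero    z q []      = tt
  H-pure zero    (suc d) z q []      = refl
  H-pure (suc K) zero    z q (i ∷ ρ) = Pure-ext 1 (λ φ → sym (avg-const (H K zero z ρ φ))) (H-pure K zero z q ρ) ,
    λ x φ → trans (cong (λ y → H K zero z ρ φ - y) (avg-const (H K zero z ρ φ))) (+-inverseʳ (H K zero z ρ φ))
  H-pure (suc K) (suc d) z q (i ∷ ρ) = Pure-ext (suc (suc d)) (λ φ → sym (bar-H K d z q i ρ φ)) (H-pure K (suc d) z q ρ) ,
    λ x → Pure-ext (suc d) (λ φ → sym (trans (cong₂ _-_ (H-∷ K d z i ρ x φ) (bar-H K d z q i ρ φ)) (l (H K (suc d) z ρ φ) (H K d (at z i x) ρ φ)))) (H-pure K d (at z i x) (Perp'-at d {z} q i x) ρ)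
    where
    l : ∀ a b → a + b - a ≡ b
    l = solve-∀ ringℚ

  rowsq : (El → ℚ) → ∀ {d} → Vec (Fin n) d → ℚ
  rowsq z {d} I = sumV {n} {d} λ J → M z I J * M z I J

  -- The contributions of different selections are orthogonal, because some coordinate occurs in
  -- only one of them and has mean 0. The factor n^d turns means over coordinates into sums over
  -- values.
  H-sq : ∀ K d z → Perp' d z → ∀ ρ → pw d (nat n) * 𝔼 (λ φ → H K d z ρ φ * H K d z ρ φ) ≡ PLF.ap (selP K d) λ s → rowsq z (pick s ρ)
  H-sq zero    zero    z q []      = *-identityˡ _
  H-sq zero    (suc d) z q []      = trans (cong (pw (suc d) (nat n) *_) (*-zeroʳ 0ℚ)) (*-zeroʳ (pw (suc d) (nat n)))
  H-sq (suc K) zero    z q (i ∷ ρ) = trans (cong (1ℚ *_) (avg-const (𝔼 λ φ → H K zero z ρ φ * H K zero z ρ φ))) (H-sq K zero z q ρ)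
  H-sq (suc K) (suc d) z q (i ∷ ρ) = begin
      nat n * pw d (nat n) * avg (λ x → 𝔼 λ φ → Hs x φ * Hs x φ)
        ≡⟨ cong (nat n * pw d (nat n) *_) expand ⟩
      nat n * pw d (nat n) * (𝔼 (λ φ → A φ * A φ) + avg (λ x → 𝔼 λ φ → B x φ * B x φ))
        ≡⟨ *-distribˡ-+ (nat n * pw d (nat n)) _ _ ⟩
      nat n * pw d (nat n) * 𝔼 (λ φ → A φ * A φ) + nat n * pw d (nat n) * avg (λ x → 𝔼 λ φ → B x φ * B x φ)
        ≡⟨ cong₂ _+_ (H-sq K (suc d) z q ρ) second ⟩
      PLF.ap (selP (suc K) (suc d)) (λ s → rowsq z (pick s (i ∷ ρ))) ∎
    where
    open ≡-Reasoning
    Hs : Fin n → Vec (Fin n) K → ℚ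
    Hs x φ = H (suc K) (suc d) z (i ∷ ρ) (x ∷ φ)
    A : Vec (Fin n) K → ℚ
    A φ = H K (suc d) z ρ φ
    B : Fin n → Vec (Fin n) K → ℚ
    B x φ = H K d (at z i x) ρ φ
    EK = Er (free K)
    av = Prob.plf uniform
    cross : avg (λ x → 𝔼 λ φ → A φ * B x φ) ≡ 0ℚ
    cross = trans (sym (Prob.fin uniform EK λ x φ → A φ * B x φ)) (trans (PLF.ext EK λ φ → trans (PLF.scl av (A φ) λ x → B x φ) (mul0ʳ {A φ} (H-mean K d z q i ρ φ))) (PLF.zer EK))
    expand : avg (λ x → 𝔼 λ φ → Hs x φ * Hs x φ) ≡ 𝔼 (λ φ → A φ * A φ) + avg (λ x → 𝔼 λ φ → B x φ * B x φ)
    expand = trans (PLF.ext av λ x → trans (PLF.ext EK λ φ → trans (cong (λ y → y * y) (H-∷ K d z i ρ x φ)) (l (A φ) (B x φ))) (trans (PLF.add EK _ _) (cong₂ _+_ (PLF.add EK (λ φ → A φ * A φ) (λ φ → B x φ * B x φ)) (PLF.scl EK (nat 2) λ φ → A φ * B x φ))))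
      (trans (PLF.add av _ _) (trans (cong₂ _+_ (trans (PLF.add av (λ _ → 𝔼 λ φ → A φ * A φ) (λ x → 𝔼 λ φ → B x φ * B x φ)) (cong (_+ avg (λ x → 𝔼 λ φ → B x φ * B x φ)) (avg-const (𝔼 λ φ → A φ * A φ)))) (trans (PLF.scl av (nat 2) λ x → 𝔼 λ φ → A φ * B x φ) (mul0ʳ {nat 2} cross))) (+-identityʳ _)))
      where
      l : ∀ a b → (a + b) * (a + b) ≡ (a * a + b * b) + nat 2 * (a * b)
      l = solve-∀ ringℚ
    second : nat n * pw d (nat n) * avg (λ x → 𝔼 λ φ → B x φ * B x φ) ≡ PLF.ap (selP K d) λ s → rowsq z (i ∷ pick s ρ)
    second = trans (l (nat n) (pw d (nat n)) _) (trans (cong (pw d (nat n) *_) (n-avg _)) (trans (sym (PLF.scl (finP n) (pw d (nat n)) _)) (trans (PLF.ext (finP n) λ x → H-sq K d (at z i x) (Perp'-at d {z} q i x) ρ)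
        (trans (selP-fin K d (finP n) λ s x → rowsq (at z i x) (pick s ρ)) (PLF.ext (selP K d) λ s → PLF.ext (finP n) λ x → PLF.ext (vecP n d) λ J → sym (cong (λ y → y * y) (M-head z i x (pick s ρ) J)))))))
      where
      l : ∀ a b c → a * b * c ≡ b * (a * c)
      l = solve-∀ ringℚ

  -- A vector with the same pattern of coincidences as ψ and with entries among those of r: every position takes the entry of r
  -- at the last position carrying the same letter of ψ.
  canon-head : ∀ {K} (r₀ ψ₀ : Fin n) (c ψ : Vec (Fin n) K) → Dec (∃ λ a → lookup ψ a ≡ ψ₀) → Fin n
  canon-head r₀ ψ₀ c ψ (yes (a , _)) = lookup c a
  canon-head r₀ ψ₀ c ψ (no _)        = r₀

  canon : ∀ {K} → Vec (Fin n) K → Vec (Fin n) K → Vec (Fin n) K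
  canon []       []       = []
  canon (r₀ ∷ r) (ψ₀ ∷ ψ) = canon-head r₀ ψ₀ (canon r ψ) ψ (any? λ a → lookup ψ a ≟ ψ₀) ∷ canon r ψ

  canon-∈ : ∀ {K} (r ψ : Vec (Fin n) K) a → ∃ λ i → lookup (canon r ψ) a ≡ lookup r i
  canon-∈ (r₀ ∷ r) (ψ₀ ∷ ψ) (suc a) = let (i , e) = canon-∈ r ψ a in suc i , e
  canon-∈ (r₀ ∷ r) (ψ₀ ∷ ψ) zero    = by (any? λ a → lookup ψ a ≟ ψ₀)
    where
    by : (q : Dec (∃ λ a → lookup ψ a ≡ ψ₀)) → ∃ λ i → canon-head r₀ ψ₀ (canon r ψ) ψ q ≡ lookup (r₀ ∷ r) i
    by (yes (a , _)) = let (i , e) = canon-∈ r ψ a in suc i , e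
    by (no _)        = zero , refl

  canon-pat : ∀ {K} (r ψ : Vec (Fin n) K) → InjV r → Pat (canon r ψ) ψ
  canon-pat (r₀ ∷ r) (ψ₀ ∷ ψ) inj = go (any? λ a → lookup ψ a ≟ ψ₀)
    where
    ih = canon-pat r ψ (InjV-tail {v = r} inj)
    go : (q : Dec (∃ λ a → lookup ψ a ≡ ψ₀)) → Pat (canon-head r₀ ψ₀ (canon r ψ) ψ q ∷ canon r ψ) (ψ₀ ∷ ψ)
    go q zero    zero    = (λ _ → refl) , (λ _ → refl)
    go q (suc i) (suc j) = ih i j
    go (yes (a , e)) zero    (suc j) = (λ r → trans (sym e) (proj₁ (ih a j) r)) , (λ r → proj₂ (ih a j) (trans e r))
    go (yes (a , e)) (suc i) zero    = (λ r → trans (proj₁ (ih i a) r) e) , (λ r → proj₂ (ih i a) (trans r (sym e)))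
    go (no ne) zero    (suc j) = (λ s → ⊥-elim (out j (sym s))) , (λ s → ⊥-elim (ne (j , sym s)))
      where
      out : ∀ j → ¬ lookup (canon r ψ) j ≡ r₀
      out j s = let (i , e) = canon-∈ r ψ j in InjV-head {v = r} inj i (trans (sym e) s)
    go (no ne) (suc i) zero    = (λ s → ⊥-elim (out i s)) , (λ s → ⊥-elim (ne (i , s)))
      where
      out : ∀ j → ¬ lookup (canon r ψ) j ≡ r₀
      out j s = let (i , e) = canon-∈ r ψ j in InjV-head {v = r} inj i (trans (sym e) s)

  -- Counts the coincidences of a selected letter with a later one. Without any, the selected
  -- entries of `canon r ψ` are those of r.
  repeats : ∀ {K d} → Sel K d → Vec (Fin n) K → ℚ
  repeats done     []      = 0ℚ
  repeats (skip s) (x ∷ ψ) = repeats s ψ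
  repeats (take s) (x ∷ ψ) = memb ψ x + repeats s ψ

  0≤memb : ∀ {k} (ψ : Vec (Fin n) k) x → 0ℚ ≤ memb ψ x
  0≤memb {k} ψ x = PLF.nonneg (finP k) λ b → 0≤𝟙 (lookup ψ b ≟ x)

  0≤repeats : ∀ {K d} (s : Sel K d) ψ → 0ℚ ≤ repeats s ψ
  0≤repeats done     []      = ≤-refl
  0≤repeats (skip s) (x ∷ ψ) = 0≤repeats s ψ
  0≤repeats (take s) (x ∷ ψ) = 0≤+ (0≤memb ψ x) (0≤repeats s ψ)

  1≤memb : ∀ {k} (ψ : Vec (Fin n) k) x a → lookup ψ a ≡ x → 1ℚ ≤ memb ψ x
  1≤memb {k} ψ x a e = ≤-trans (≤-reflexive (sym (trans (PLF.ext (finP k) λ b → sym (*-identityʳ (𝟙 (b ≟ a)))) (sumF-δ a λ _ → 1ℚ) )))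
      (PLF.mono (finP k) λ b → le b (b ≟ a))
    where
    le : ∀ b (q : Dec (b ≡ a)) → 𝟙 q ≤ 𝟙 (lookup ψ b ≟ x)
    le b (no _)  = 0≤𝟙 (lookup ψ b ≟ x)
    le b (yes r) = ≤-reflexive (sym (𝟙-yes (lookup ψ b ≟ x) (trans (cong (lookup ψ) r) e)))

  pick-canon : ∀ {K d} (s : Sel K d) (r ψ : Vec (Fin n) K) → (1ℚ ≤ repeats s ψ) ⊎ (pick s (canon r ψ) ≡ pick s r)
  pick-canon done     []       []       = inj₂ refl
  pick-canon (skip s) (r₀ ∷ r) (ψ₀ ∷ ψ) = pick-canon s r ψ
  pick-canon (take s) (r₀ ∷ r) (ψ₀ ∷ ψ) = by (any? λ a → lookup ψ a ≟ ψ₀) (pick-canon s r ψ)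
    where
    by : (q : Dec (∃ λ a → lookup ψ a ≡ ψ₀)) → (1ℚ ≤ repeats s ψ) ⊎ (pick s (canon r ψ) ≡ pick s r) →
      (1ℚ ≤ memb ψ ψ₀ + repeats s ψ) ⊎ (canon-head r₀ ψ₀ (canon r ψ) ψ q ∷ pick s (canon r ψ) ≡ r₀ ∷ pick s r)
    by (yes (a , e)) _        = inj₁ (≤-trans (1≤memb ψ ψ₀ a e) (cert (0≤repeats s ψ) refl))
    by (no _) (inj₁ p)        = inj₁ (≤-trans p (cert (0≤memb ψ ψ₀) (+-comm (memb ψ ψ₀) (repeats s ψ))))
    by (no _) (inj₂ e)        = inj₂ (cong (r₀ ∷_) e)

  𝔼-repeats : ∀ {K d} (s : Sel K d) m → K ℕ.≤ m → 𝔼 (repeats s) ≤ nat d * (nat m * ν)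
  𝔼-repeats done m le = ≤-reflexive (sym (mul0ˡ {nat 0} {nat m * ν} refl))
  𝔼-repeats (skip s) m le = ≤-trans (≤-reflexive (avg-const (𝔼 (repeats s)))) (𝔼-repeats s m (ℕ.≤-trans (ℕ.n≤1+n _) le))
  𝔼-repeats {suc K} {suc d} (take s) m le = ≤-trans (≤-reflexive (trans (PLF.ext av λ x → PLF.add EK (λ ψ → memb ψ x) (repeats s)) (trans (PLF.add av (λ x → 𝔼 {K} λ ψ → memb ψ x) (λ _ → 𝔼 {K} (repeats s))) (cong₂ _+_ first (avg-const (𝔼 {K} (repeats s)))))))
      (≤-trans (+-mono-≤ (*-monoˡ (<⇒≤ (0<inv (nat n) 0<n)) (nat-mono (ℕ.≤-trans (ℕ.n≤1+n _) le))) (𝔼-repeats s m (ℕ.≤-trans (ℕ.n≤1+n _) le))) (≤-reflexive (l (nat m * ν) (nat d))))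
    where
    EK = Er (free K)
    av = Prob.plf uniform
    l : ∀ a d → a + d * a ≡ (1ℚ + d) * a
    l = solve-∀ ringℚ
    first : avg (λ x → 𝔼 {K} λ ψ → memb ψ x) ≡ nat K * ν
    first = trans (sym (Prob.fin uniform EK λ x ψ → memb ψ x)) (trans (PLF.ext EK λ ψ → trans (cong (ν *_) (trans (PLF.ext (finP n) λ x → sym (*-identityʳ (memb ψ x))) (trans (sumF-memb ψ λ _ → 1ℚ) (sumF-const K)))) (*-comm ν (nat K))) (Er-const (free K) (nat K * ν)))

module Coupling (n : ℕ) (0<n : 0ℚ < nat n) where
  open Alternating n
  open TupleCalculus n
  open FrameBounds n
  open FrameInequalities n
  open UniformProduct n 0<n
  open LevelInequality uniform using (Restr; weight; 0≤weight)

  sumV-perm : ∀ g k (F : Vec (Fin n) k → ℚ) → sumV (λ I → F (g ∙ I)) ≡ sumV F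
  sumV-perm g zero    F = refl
  sumV-perm g (suc k) F = trans (PLF.ext (finP n) λ i → sumV-perm g k λ I → F ((g $ i) ∷ I)) (sumF-perm g λ i → sumV λ I → F (i ∷ I))

  sumV-const : ∀ k c → sumV {n} {k} (λ _ → c) ≡ pw k (nat n) * c
  sumV-const zero    c = sym (*-identityˡ c)
  sumV-const (suc k) c = trans (PLF.ext (finP n) λ i → trans (sumV-const k c) (sym (*-identityʳ _))) (trans (PLF.scl (finP n) (pw k (nat n) * c) λ _ → 1ℚ) (trans (cong (pw k (nat n) * c *_) (sumF-const n)) (l (pw k (nat n)) c (nat n))))
    where
    l : ∀ p c n → p * c * n ≡ n * p * c
    l = solve-∀ ringℚ

  pair : ∀ {k} (u g : El → ℚ) (I I' : Vec (Fin n) k) → E (λ σ → u σ * M g I (σ ∙ I')) ≡ sumV λ J → M u I' J * M g I J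
  pair {k} u g I I' = trans (PLF.ext 𝔾 λ σ → trans (cong (u σ *_) (sym (sumV-δ' (σ ∙ I') (M g I)))) (trans (sym (PLF.scl (vecP n k) (u σ) _)) (PLF.ext (vecP n k) λ J → l (u σ) (𝟙 (σ ∙ I' ≟V J)) (M g I J))))
      (trans (vecP-fin n k 𝔾 λ J σ → M g I J * (u σ * 𝟙 (σ ∙ I' ≟V J))) (PLF.ext (vecP n k) λ J → trans (PLF.scl 𝔾 (M g I J) _) (*-comm (M g I J) (M u I' J))))
    where
    l : ∀ a b c → a * (b * c) ≡ c * (a * b)
    l = solve-∀ ringℚ

  module Rows {K} (r : Vec (Fin n) K) (injR : InjV r) (room : suc (suc K) ℕ.≤ n) where

    -- The reason for `canon`: it has the coincidences of ψ, so some group element carries it to ψ,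
    -- and for uniform σ the readings have the law of σ ∙ ψ. That is uniform on the product space
    -- since ψ is. Reading distinct rows directly would only give distinct values.
    E-canon : ∀ τ F → 𝔼 (λ ψ → E λ σ → F (σ ∙ (τ ∙ canon r ψ))) ≡ 𝔼 F
    E-canon τ F = trans (PLF.ext (Er (free K)) at-ψ) (trans (𝔾-fin (Er (free K)) λ σ ψ → F (σ ∙ ψ)) (trans (PLF.ext 𝔾 λ σ → 𝔼-perm σ K F) (E-const (𝔼 F))))
      where
      at-ψ : ∀ ψ → E (λ σ → F (σ ∙ (τ ∙ canon r ψ))) ≡ E λ σ → F (σ ∙ ψ)
      at-ψ ψ = trans (PLF.ext 𝔾 λ σ → cong F (trans (cong (λ v → σ ∙ (τ ∙ v)) c≡) (trans (cong (σ ∙_) (sym (·-∙ τ (h ⁻¹) ψ))) (sym (·-∙ σ (τ · h ⁻¹) ψ))))) (E-right (τ · h ⁻¹) λ σ → F (σ ∙ ψ))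
        where
        ex = extend (canon r ψ) ψ room (canon-pat r ψ injR)
        h = proj₁ ex
        c≡ : canon r ψ ≡ h ⁻¹ ∙ ψ
        c≡ = trans (sym (⁻¹-∙ h (canon r ψ))) (cong (h ⁻¹ ∙_) (proj₂ ex))

    -- the density, with respect to the uniform measure, of the image of f under ψ, σ ↦ σ ∙ (τ ∙ canon r ψ)
    lift : (El → ℚ) → El → Vec (Fin n) K → ℚ
    lift f τ φ = pw K (nat n) * 𝔼 λ ψ → E λ σ → f σ * 𝟙 (σ ∙ (τ ∙ canon r ψ) ≟V φ)

    𝔼-lift : ∀ f τ h → 𝔼 (λ φ → lift f τ φ * h φ) ≡ 𝔼 λ ψ → E λ σ → f σ * h (σ ∙ (τ ∙ canon r ψ))
    𝔼-lift f τ h = begin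
        𝔼 (λ φ → lift f τ φ * h φ)
          ≡⟨ PLF.ext EK (λ φ → trans (l n^ _ (h φ)) (cong (n^ *_) (trans (sym (PLF.sclr EK (h φ) _)) (PLF.ext EK λ ψ → trans (sym (PLF.sclr 𝔾 (h φ) _)) (PLF.ext 𝔾 λ σ → *-assoc (f σ) _ (h φ)))))) ⟩
        𝔼 (λ φ → n^ * 𝔼 λ ψ → E λ σ → f σ * (𝟙 (u ψ σ ≟V φ) * h φ))
          ≡⟨ PLF.scl EK n^ _ ⟩
        n^ * 𝔼 (λ φ → 𝔼 λ ψ → E λ σ → f σ * (𝟙 (u ψ σ ≟V φ) * h φ))
          ≡⟨ cong (n^ *_) (trans (Er-fin (free K) EK λ ψ φ → E λ σ → f σ * (𝟙 (u ψ σ ≟V φ) * h φ)) (PLF.ext EK λ ψ → 𝔾-fin EK λ σ φ → f σ * (𝟙 (u ψ σ ≟V φ) * h φ))) ⟩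
        n^ * 𝔼 (λ ψ → E λ σ → 𝔼 λ φ → f σ * (𝟙 (u ψ σ ≟V φ) * h φ))
          ≡⟨ trans (sym (PLF.scl EK n^ _)) (PLF.ext EK λ ψ → trans (sym (PLF.scl 𝔾 n^ _)) (PLF.ext 𝔾 λ σ → trans (cong (n^ *_) (PLF.scl EK (f σ) _)) (trans (l' n^ (f σ) _) (cong (f σ *_) (𝔼-δ (u ψ σ) h))))) ⟩
        𝔼 (λ ψ → E λ σ → f σ * h (u ψ σ)) ∎
      where
      open ≡-Reasoning
      n^ = pw K (nat n)
      EK = Er (free K)
      u : Vec (Fin n) K → El → Vec (Fin n) K
      u ψ σ = σ ∙ (τ ∙ canon r ψ)
      l : ∀ a b c → a * b * c ≡ a * (b * c)
      l = solve-∀ ringℚ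
      l' : ∀ a b c → a * (b * c) ≡ b * (a * c)
      l' = solve-∀ ringℚ

    0≤pwn : ∀ k → 0ℚ ≤ pw k (nat n)
    0≤pwn zero    = 0≤1
    0≤pwn (suc k) = 0≤* (0≤nat n) (0≤pwn k)

    lift-mean : ∀ f τ → 𝔼 (lift f τ) ≡ E f
    lift-mean f τ = trans (PLF.ext EK λ φ → sym (*-identityʳ (lift f τ φ))) (trans (𝔼-lift f τ λ _ → 1ℚ) (trans (PLF.ext EK λ ψ → PLF.ext 𝔾 λ σ → *-identityʳ (f σ)) (Er-const (free K) (E f))))
      where EK = Er (free K)

    lift-nonneg : ∀ f τ → (∀ σ → 0ℚ ≤ f σ) → ∀ φ → 0ℚ ≤ lift f τ φ
    lift-nonneg f τ p φ = 0≤* (0≤pwn K) (PLF.nonneg (Er (free K)) λ ψ → PLF.nonneg 𝔾 λ σ → 0≤* (p σ) (0≤𝟙 (σ ∙ (τ ∙ canon r ψ) ≟V φ)))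

    lift-≤1 : ∀ f τ → (∀ σ → f σ ≤ 1ℚ) → ∀ φ → lift f τ φ ≤ 1ℚ
    lift-≤1 f τ p φ = ≤-trans (*-monoʳ (0≤pwn K) (PLF.mono EK λ ψ → PLF.mono 𝔾 λ σ → ≤-trans (*-monoˡ (0≤𝟙 (σ ∙ (τ ∙ canon r ψ) ≟V φ)) (p σ)) (≤-reflexive (*-identityˡ (𝟙 (σ ∙ (τ ∙ canon r ψ) ≟V φ))))))
        (≤-reflexive (trans (cong (pw K (nat n) *_) (trans (E-canon τ λ v → 𝟙 (v ≟V φ)) (PLF.ext EK λ v → trans (𝟙-cong (v ≟V φ) (φ ≟V v) sym sym) (sym (*-identityʳ _))))) (𝔼-δ φ λ _ → 1ℚ)))
      where EK = Er (free K)

    -- Freezing coordinates of the lift prescribes the values of σ on the corresponding rows. So the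
    -- hypothesis on coefficients of f bounds the conditional means, and the probabilities recombine
    -- by `E-canon`.
    lift-restr : ∀ f τ k γ → (∀ {j} → j ℕ.≤ k → ∀ (T J : Vec (Fin n) j) → M f T J ≤ γ * Pr T J) → Restr k γ (lift f τ)
    lift-restr f τ k γ glob ρ c≤ = ≤-trans (≤-reflexive (trans (sym (Er-as ρ (lift f τ))) (cong (n^ *_) (trans (PLF.ext EK λ φ → *-comm (𝟙 (fixed ρ φ ≟V values ρ)) (lift f τ φ)) (𝔼-lift f τ λ φ → 𝟙 (fixed ρ φ ≟V values ρ))))))
      (≤-trans (*-monoʳ (0≤pwn (cnt ρ)) (PLF.mono EK λ ψ → ≤-trans (≤-reflexive (PLF.ext 𝔾 λ σ → cong (λ v → f σ * 𝟙 (v ≟V values ρ)) (fixed-∙ ρ σ (τ ∙ canon r ψ)))) (glob c≤ (fixed ρ (τ ∙ canon r ψ)) (values ρ))))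
        (≤-reflexive (begin
          n^ * 𝔼 (λ ψ → γ * Pr (fixed ρ (τ ∙ canon r ψ)) (values ρ))
            ≡⟨ cong (n^ *_) (PLF.scl EK γ _) ⟩
          n^ * (γ * 𝔼 (λ ψ → E λ σ → 𝟙 (σ ∙ fixed ρ (τ ∙ canon r ψ) ≟V values ρ)))
            ≡⟨ cong (λ y → n^ * (γ * y)) (trans (PLF.ext EK λ ψ → PLF.ext 𝔾 λ σ → cong (λ v → 𝟙 (v ≟V values ρ)) (sym (fixed-∙ ρ σ (τ ∙ canon r ψ)))) (E-canon τ λ φ → 𝟙 (fixed ρ φ ≟V values ρ))) ⟩
          n^ * (γ * 𝔼 (λ φ → 𝟙 (fixed ρ φ ≟V values ρ)))
            ≡⟨ l n^ γ _ ⟩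
          γ * (n^ * 𝔼 (λ φ → 𝟙 (fixed ρ φ ≟V values ρ)))
            ≡⟨ cong (γ *_) (trans (cong (n^ *_) (PLF.ext EK λ φ → sym (*-identityʳ (𝟙 (fixed ρ φ ≟V values ρ))))) (trans (Er-as ρ λ _ → 1ℚ) (Er-const ρ 1ℚ))) ⟩
          γ * 1ℚ
            ≡⟨ *-identityʳ γ ⟩
          γ ∎)))
      where
      open ≡-Reasoning
      n^ = pw (cnt ρ) (nat n)
      EK = Er (free K)
      l : ∀ a b c → a * (b * c) ≡ b * (a * c)
      l = solve-∀ ringℚ

    module AtLevel (e k : ℕ) (k≡ : k ≡ suc e) (f P g rest : El → ℚ) (f≡ : ∀ σ → f σ ≡ (P σ + g σ) + rest σ) (P∈ : InV e P) (g⊥ : Perp e g) (rest⊥ : Perp k rest) where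

      g⊥' : Perp' k g
      g⊥' = subst (λ j → Perp' j g) (sym k≡) g⊥

      row0 : ∀ (I J : Vec (Fin n) k) → ¬ InjV I → M g I J ≡ 0ℚ
      row0 = by k≡
        where
        by : ∀ {k} → k ≡ suc e → ∀ (I J : Vec (Fin n) k) → ¬ InjV I → M g I J ≡ 0ℚ
        by refl I J = ¬inj-row e g I J g⊥

      -- Correlation of u, read at the rows T', with the coefficients of g at the rows T. The lift
      -- reads T' from `canon`, while the test function uses the true rows T.
      Q : (El → ℚ) → Vec (Fin n) k → Vec (Fin n) k → ℚ
      Q u T T' = E λ τ → E λ σ → u σ * M g (τ ∙ T) (σ ∙ (τ ∙ T'))

      Q-pair : ∀ u T T' → Q u T T' ≡ E λ τ → sumV λ J → M u (τ ∙ T') J * M g (τ ∙ T) J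
      Q-pair u T T' = PLF.ext 𝔾 λ τ → pair u g (τ ∙ T) (τ ∙ T')

      Q-rest : ∀ T T' → Q rest T T' ≡ 0ℚ
      Q-rest T T' = trans (Q-pair rest T T') (trans (PLF.ext 𝔾 λ τ → trans (PLF.ext (vecP n k) λ J → mul0ˡ (rest⊥ (τ ∙ T') J)) (PLF.zer (vecP n k))) (PLF.zer 𝔾))

      -- Averaged over τ, the kernel is a right convolution of g, hence orthogonal to V e as g is.
      Q-P : ∀ T T' → Q P T T' ≡ 0ℚ
      Q-P T T' = trans (𝔾-fin 𝔾 λ σ τ → P σ * M g (τ ∙ T) (σ ∙ (τ ∙ T'))) (trans (PLF.ext 𝔾 λ σ → PLF.scl 𝔾 (P σ) λ τ → M g (τ ∙ T) (σ ∙ (τ ∙ T'))) (InV-⊥ P∈ w⊥))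
        where
        κ : El → ℚ
        κ h = E λ τ → 𝟙 (h ∙ (τ ∙ T) ≟V τ ∙ T')
        w : El → ℚ
        w σ = E λ τ → M g (τ ∙ T) (σ ∙ (τ ∙ T'))
        w≡ : ∀ σ → w σ ≡ E λ h → κ h * g (σ · h)
        w≡ σ = trans (PLF.ext 𝔾 λ τ → trans (sym (E-left σ λ ν → g ν * 𝟙 (ν ∙ (τ ∙ T) ≟V σ ∙ (τ ∙ T')))) (PLF.ext 𝔾 λ h → trans (cong (g (σ · h) *_) (𝟙-cong ((σ · h) ∙ (τ ∙ T) ≟V σ ∙ (τ ∙ T')) (h ∙ (τ ∙ T) ≟V τ ∙ T')
              (λ q → trans (sym (⁻¹-∙ σ (h ∙ (τ ∙ T)))) (trans (cong (σ ⁻¹ ∙_) (trans (sym (·-∙ σ h (τ ∙ T))) q)) (⁻¹-∙ σ (τ ∙ T')))) (λ q → trans (·-∙ σ h (τ ∙ T)) (cong (σ ∙_) q)))) (*-comm (g (σ · h)) _)))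
          (trans (𝔾-fin 𝔾 λ h τ → 𝟙 (h ∙ (τ ∙ T) ≟V τ ∙ T') * g (σ · h)) (PLF.ext 𝔾 λ h → PLF.sclr 𝔾 (g (σ · h)) λ τ → 𝟙 (h ∙ (τ ∙ T) ≟V τ ∙ T')))
        w⊥ : Perp e w
        w⊥ A B = trans (PLF.ext 𝔾 λ σ → trans (cong (_* 𝟙 (σ ∙ A ≟V B)) (w≡ σ)) (trans (sym (PLF.sclr 𝔾 (𝟙 (σ ∙ A ≟V B)) λ h → κ h * g (σ · h))) (PLF.ext 𝔾 λ h → *-assoc (κ h) (g (σ · h)) _)))
          (trans (𝔾-fin 𝔾 λ h σ → κ h * (g (σ · h) * 𝟙 (σ ∙ A ≟V B))) (trans (PLF.ext 𝔾 λ h → trans (PLF.scl 𝔾 (κ h) _) (mul0ʳ {κ h} (Perp-R {z = g} h g⊥ A B))) (PLF.zer 𝔾)))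

      Q-f : ∀ T T' → Q f T T' ≡ Q g T T'
      Q-f T T' = trans (PLF.ext 𝔾 λ τ → trans (PLF.ext 𝔾 λ σ → trans (cong (_* m τ σ) (f≡ σ)) (l (P σ) (g σ) (rest σ) (m τ σ))) (trans (PLF.add 𝔾 _ _) (cong₂ _+_ (PLF.add 𝔾 (λ σ → P σ * m τ σ) (λ σ → g σ * m τ σ)) refl)))
          (trans (PLF.add 𝔾 _ _) (trans (cong₂ _+_ (trans (PLF.add 𝔾 _ _) (cong₂ _+_ (Q-P T T') refl)) (Q-rest T T')) (trans (+-identityʳ _) (+-identityˡ _))))
        where
        m : El → El → ℚ
        m τ σ = M g (τ ∙ T) (σ ∙ (τ ∙ T'))
        l : ∀ p g r m → (p + g + r) * m ≡ (p * m + g * m) + r * m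
        l = solve-∀ ringℚ

      avgsq : Vec (Fin n) k → ℚ
      avgsq T = E λ τ → rowsq g (τ ∙ T)

      0≤rowsq : ∀ (T : Vec (Fin n) k) → 0ℚ ≤ rowsq g T
      0≤rowsq T = PLF.sqs (vecP n k) (M g T)

      avgsq-const : suc (suc k) ℕ.≤ n → ∀ T T' → InjV T → InjV T' → avgsq T ≡ avgsq T'
      avgsq-const le T T' i i' = sym (trans (PLF.ext 𝔾 λ τ → cong (rowsq g) (trans (cong (τ ∙_) (sym (proj₂ ex))) (sym (·-∙ τ (proj₁ ex) T)))) (E-right (proj₁ ex) λ τ → rowsq g (τ ∙ T)))
        where
        ex = extend T T' le (Pat-inj T T' i i')

      rowsq0 : ∀ (I : Vec (Fin n) k) → ¬ InjV I → rowsq g I ≡ 0ℚ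
      rowsq0 I ni = trans (PLF.ext (vecP n k) λ J → mul0ˡ (row0 I J ni)) (PLF.zer (vecP n k))

      ¬inj-∙ : ∀ τ (I : Vec (Fin n) k) → ¬ InjV I → ¬ InjV (τ ∙ I)
      ¬inj-∙ τ I ni p = ni (subst InjV (⁻¹-∙ τ I) (InjV-∙ (τ ⁻¹) (τ ∙ I) p))

      avgsq≤ : suc (suc k) ℕ.≤ n → ∀ T T' → InjV T → avgsq T' ≤ avgsq T
      avgsq≤ le T T' i = by (decInj T')
        where
        by : Dec (InjV T') → avgsq T' ≤ avgsq T
        by (yes i') = ≤-reflexive (avgsq-const le T' T i' i)
        by (no ni)  = ≤-trans (≤-reflexive (trans (PLF.ext 𝔾 λ τ → rowsq0 (τ ∙ T') (¬inj-∙ τ T' ni)) (PLF.zer 𝔾))) (PLF.nonneg 𝔾 λ τ → 0≤rowsq (τ ∙ T))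

      Q-diag : ∀ T → Q g T T ≡ avgsq T
      Q-diag T = Q-pair g T T

      -- Rows altered by a repetition may correlate negatively with the intended ones, but by 2 x y
      -- ≥ - x² - y² never below the negative of the diagonal value. Repeated rows only make the
      -- second square vanish.
      Q-lower : suc (suc k) ℕ.≤ n → ∀ T T' → InjV T → - avgsq T ≤ Q g T T'
      Q-lower le T T' i = ≤-trans below (≤-reflexive (sym (Q-pair g T T')))
        where
        half² : ∀ x y → - (½ * (x * x)) + - (½ * (y * y)) ≤ y * x
        half² x y = cert (0≤* 0≤½ (0≤sq (x + y))) (trans (sym (*-identityˡ (y * x))) (trans (cong (_* (y * x)) (sym (½+½ 1ℚ))) (l ½ x y)))
          where
          l : ∀ h x y → (h * 1ℚ + h * 1ℚ) * (y * x) ≡ (- (h * (x * x)) + - (h * (y * y))) + h * ((x + y) * (x + y))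
          l = solve-∀ ringℚ
        below : - avgsq T ≤ E λ τ → sumV λ J → M g (τ ∙ T') J * M g (τ ∙ T) J
        below = ≤-trans (≤-trans (≤-reflexive (trans (cong -_ (sym (½+½ (avgsq T)))) (l (½ * avgsq T) (½ * avgsq T)))) (+-monoʳ-≤ (- (½ * avgsq T)) (neg-antimono-≤ (*-monoʳ 0≤½ (avgsq≤ le T T' i)))))
          (≤-trans (≤-reflexive (sym expand)) (PLF.mono 𝔾 λ τ → PLF.mono (vecP n k) λ J → half² (M g (τ ∙ T) J) (M g (τ ∙ T') J)))
          where
          l : ∀ a b → - (a + b) ≡ - a + - b
          l = solve-∀ ringℚ
          expand : E (λ τ → sumV λ J → - (½ * (M g (τ ∙ T) J * M g (τ ∙ T) J)) + - (½ * (M g (τ ∙ T') J * M g (τ ∙ T') J))) ≡ - (½ * avgsq T) + - (½ * avgsq T')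
          expand = trans (PLF.ext 𝔾 λ τ → trans (PLF.add (vecP n k) _ _) (cong₂ _+_ (trans (PLF.neg (vecP n k) _) (cong -_ (PLF.scl (vecP n k) ½ _))) (trans (PLF.neg (vecP n k) _) (cong -_ (PLF.scl (vecP n k) ½ _)))))
            (trans (PLF.add 𝔾 _ _) (cong₂ _+_ (trans (PLF.neg 𝔾 _) (cong -_ (PLF.scl 𝔾 ½ λ τ → rowsq g (τ ∙ T)))) (trans (PLF.neg 𝔾 _) (cong -_ (PLF.scl 𝔾 ½ λ τ → rowsq g (τ ∙ T'))))))

      total : suc (suc k) ℕ.≤ n → ∀ T → InjV T → N k g ≤ pw k (nat n) * avgsq T
      total le T i = ≤-trans (≤-reflexive (trans (sym (E-const (N k g))) (trans (PLF.ext 𝔾 λ τ → sym (sumV-perm τ k (rowsq g))) (vecP-fin n k 𝔾 λ I τ → rowsq g (τ ∙ I)))))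
        (≤-trans (PLF.mono (vecP n k) λ I → avgsq≤ le T I i) (≤-reflexive (sumV-const k (avgsq T))))

      Ht : El → Vec (Fin n) K → ℚ
      Ht τ φ = H K k g (τ ∙ r) φ

      correlation : E (λ τ → 𝔼 λ φ → lift f τ φ * Ht τ φ) ≡ 𝔼 λ ψ → PLF.ap (selP K k) λ s → Q f (pick s r) (pick s (canon r ψ))
      correlation = begin
          E (λ τ → 𝔼 λ φ → lift f τ φ * Ht τ φ)
            ≡⟨ PLF.ext 𝔾 (λ τ → 𝔼-lift f τ (Ht τ)) ⟩
          E (λ τ → 𝔼 λ ψ → E λ σ → f σ * Ht τ (σ ∙ (τ ∙ canon r ψ)))
            ≡⟨ Er-fin (free K) 𝔾 (λ ψ τ → E λ σ → f σ * Ht τ (σ ∙ (τ ∙ canon r ψ))) ⟩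
          𝔼 (λ ψ → E λ τ → E λ σ → f σ * Ht τ (σ ∙ (τ ∙ canon r ψ)))
            ≡⟨ PLF.ext (Er (free K)) (λ ψ → trans (PLF.ext 𝔾 λ τ → trans (PLF.ext 𝔾 λ σ → trans (sym (PLF.scl (selP K k) (f σ) _)) (PLF.ext (selP K k) λ s → cong₂ (λ u v → f σ * M g u v) (pick-map s (τ $_) r)
                   (trans (pick-map s (σ $_) (τ ∙ canon r ψ)) (cong (σ ∙_) (pick-map s (τ $_) (canon r ψ))))))
                 (selP-fin K k 𝔾 λ s σ → f σ * M g (τ ∙ pick s r) (σ ∙ (τ ∙ pick s (canon r ψ))))) (selP-fin K k 𝔾 λ s τ → E λ σ → f σ * M g (τ ∙ pick s r) (σ ∙ (τ ∙ pick s (canon r ψ))))) ⟩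
          𝔼 (λ ψ → PLF.ap (selP K k) λ s → Q f (pick s r) (pick s (canon r ψ))) ∎
        where open ≡-Reasoning

      module _ (le : suc (suc k) ℕ.≤ n) (T₀ : Vec (Fin n) k) (i₀ : InjV T₀) where
        a Σ₁ : ℚ
        a = avgsq T₀
        Σ₁ = sels K k

        0≤a : 0ℚ ≤ a
        0≤a = PLF.nonneg 𝔾 λ τ → 0≤rowsq (τ ∙ T₀)

        H-norm : pw k (nat n) * E (λ τ → 𝔼 λ φ → Ht τ φ * Ht τ φ) ≡ Σ₁ * a
        H-norm = trans (sym (PLF.scl 𝔾 (pw k (nat n)) _)) (trans (PLF.ext 𝔾 λ τ → trans (H-sq K k g g⊥' (τ ∙ r)) (PLF.ext (selP K k) λ s → cong (rowsq g) (pick-map s (τ $_) r)))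
          (trans (selP-fin K k 𝔾 λ s τ → rowsq g (τ ∙ pick s r)) (trans (PLF.ext (selP K k) λ s → trans (avgsq-const le (pick s r) T₀ (pick-inj s r injR) i₀) (sym (*-identityˡ a))) (PLF.sclr (selP K k) a λ _ → 1ℚ))))

        module _ (W : ℚ) (w≤ : ∀ τ → weight (suc k) (lift f τ) ≤ W) (few : nat 4 * (nat k * (nat K * ν)) ≤ 1ℚ) where
          C = E λ τ → 𝔼 λ φ → lift f τ φ * Ht τ φ
          X = E λ τ → 𝔼 λ φ → Ht τ φ * Ht τ φ

          -- If ψ has no repeat at the selected positions, the rows are the intended ones and Q is
          -- the full diagonal value a. Otherwise `repeats` is at least 1 and a lower bound of - a
          -- is enough.
          term : ∀ s ψ → a * (1ℚ - nat 2 * repeats s ψ) ≤ Q f (pick s r) (pick s (canon r ψ))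
          term s ψ = ≤-trans (by (pick-canon s r ψ)) (≤-reflexive (sym (Q-f (pick s r) (pick s (canon r ψ)))))
            where
            T = pick s r
            a≡ : avgsq T ≡ a
            a≡ = avgsq-const le T T₀ (pick-inj s r injR) i₀
            by : (1ℚ ≤ repeats s ψ) ⊎ (pick s (canon r ψ) ≡ T) → a * (1ℚ - nat 2 * repeats s ψ) ≤ Q g T (pick s (canon r ψ))
            by (inj₁ p) = ≤-trans (≤-trans (*-monoʳ 0≤a (+-monoʳ-≤ 1ℚ (neg-antimono-≤ (*-monoʳ (0≤nat 2) p)))) (≤-reflexive (l a))) (≤-trans (≤-reflexive (cong -_ (sym a≡))) (Q-lower le T (pick s (canon r ψ)) (pick-inj s r injR)))
              where
              l : ∀ a → a * (1ℚ - nat 2 * 1ℚ) ≡ - a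
              l = solve-∀ ringℚ
            by (inj₂ e) = ≤-trans (≤-trans (*-monoʳ 0≤a (+-monoʳ-≤ 1ℚ (neg-antimono-≤ (0≤* (0≤nat 2) (0≤repeats s ψ))))) (≤-reflexive (l a))) (≤-reflexive (trans (sym a≡) (trans (sym (Q-diag T)) (cong (Q g T) (sym e)))))
              where
              l : ∀ a → a * (1ℚ - 0ℚ) ≡ a
              l = solve-∀ ringℚ

          -- By `few` the expected number of repeats is at most 1/4 for every selection, so at least
          -- half of the diagonal value survives on average.
          lower : ½ * (Σ₁ * a) ≤ C
          lower = ≤-trans (≤-reflexive (trans (l₁ ½ Σ₁ a) (sym (PLF.scl (selP K k) (½ * a) λ _ → 1ℚ)))) (≤-trans (PLF.mono (selP K k) λ s → ≤-trans (half-left s) (≤-reflexive (sym (mean s))))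
              (≤-trans (≤-reflexive (sym (selP-fin K k EK λ s ψ → a * (1ℚ - nat 2 * repeats s ψ)))) (≤-trans (PLF.mono EK λ ψ → PLF.mono (selP K k) λ s → term s ψ) (≤-reflexive (sym correlation)))))
            where
            EK = Er (free K)
            l₁ : ∀ h s a → h * (s * a) ≡ h * a * s
            l₁ = solve-∀ ringℚ
            mean : ∀ s → 𝔼 (λ ψ → a * (1ℚ - nat 2 * repeats s ψ)) ≡ a * (1ℚ - nat 2 * 𝔼 (repeats s))
            mean s = trans (PLF.scl EK a _) (cong (a *_) (trans (PLF.sub EK (λ _ → 1ℚ) λ ψ → nat 2 * repeats s ψ) (cong₂ _-_ (Er-const (free K) 1ℚ) (PLF.scl EK (nat 2) (repeats s)))))
            half-left : ∀ s → ½ * a * 1ℚ ≤ a * (1ℚ - nat 2 * 𝔼 (repeats s))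
            half-left s = ≤-trans (≤-reflexive (l₂ ½ a)) (*-monoʳ 0≤a (undiff (≤-trans (≤-reflexive (sym (mul0ʳ {½} refl))) (≤-trans (*-monoʳ 0≤½ (diff (≤-trans (*-monoʳ (0≤nat 4) (𝔼-repeats s K ℕ.≤-refl)) few))) (≤-reflexive (trans (l₃ ½ (𝔼 (repeats s))) (cong₂ (λ u v → u - ½ - nat 2 * (v * 𝔼 (repeats s))) h1 h1)) ) ⟨ ≤-trans ⟩ ≤-reflexive (l₄ ½ (𝔼 (repeats s)))))))
              where
              h1 : ½ + ½ ≡ 1ℚ
              h1 = trans (sym (cong₂ _+_ (*-identityʳ ½) (*-identityʳ ½))) (½+½ 1ℚ)
              l₂ : ∀ h a → h * a * 1ℚ ≡ a * h
              l₂ = solve-∀ ringℚ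
              l₃ : ∀ h r → h * (1ℚ - nat 4 * r) ≡ (h + h) - h - nat 2 * ((h + h) * r)
              l₃ = solve-∀ ringℚ
              l₄ : ∀ h r → 1ℚ - h - nat 2 * (1ℚ * r) ≡ 1ℚ - nat 2 * r - h
              l₄ = solve-∀ ringℚ

          -- The test function is pure, so in the pairing the lift may be replaced by its level-k
          -- part, whose norm is the weight.
          upper : C * C ≤ W * X
          upper = ≤-trans (≤-reflexive (cong₂ _*_ C≡ C≡)) (≤-trans (PLF.cs B (λ w → Lv (suc k) (lift f (proj₁ w)) (proj₂ w)) λ w → Ht (proj₁ w) (proj₂ w)) (*-monoˡ (PLF.sqs B λ w → Ht (proj₁ w) (proj₂ w)) (≤-trans (PLF.mono 𝔾 w≤) (≤-reflexive (E-const W)))))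
            where
            B = 𝔾 ⊗ Er (free K)
            C≡ : C ≡ E λ τ → 𝔼 λ φ → Lv (suc k) (lift f τ) φ * Ht τ φ
            C≡ = PLF.ext 𝔾 λ τ → Lv-adj (suc k) (lift f τ) (Ht τ) (H-pure K k g g⊥' (τ ∙ r))

          0≤W : 0ℚ ≤ W
          0≤W = ≤-trans (0≤weight (suc k) (lift f unit)) (w≤ unit)

          bound : pw k (nat n) * (Σ₁ * a) ≤ nat 4 * W
          bound = by (0ℚ <? Σ₁ * a)
            where
            n^k = pw k (nat n)
            by : Dec (0ℚ < Σ₁ * a) → n^k * (Σ₁ * a) ≤ nat 4 * W
            by (no q) = ≤-trans (*-monoʳ (0≤pwn k) (≮⇒≥ q)) (≤-trans (≤-reflexive (*-zeroʳ n^k)) (0≤* (0≤nat 4) 0≤W))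
            by (yes p) = *-cancelˡ p (≤-trans (≤-reflexive (trans (sym (*-identityˡ _)) (trans (cong₂ (λ u v → u * v * (Σ₁ * a * (n^k * (Σ₁ * a)))) (sym h1) (sym h1)) (l₁ ½ n^k (Σ₁ * a)))))
                (≤-trans (*-monoʳ (0≤* (0≤nat 4) (0≤pwn k)) (≤-trans (*-mono (0≤* 0≤½ (<⇒≤ p)) (≤-trans (0≤* 0≤½ (<⇒≤ p)) lower) lower lower) upper))
                  (≤-reflexive (trans (l₂ (nat 4) n^k W X) (trans (cong (nat 4 * W *_) H-norm) (*-comm (nat 4 * W) (Σ₁ * a)))))))
              where
              h1 : ½ + ½ ≡ 1ℚ
              h1 = trans (sym (cong₂ _+_ (*-identityʳ ½) (*-identityʳ ½))) (½+½ 1ℚ)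
              l₁ : ∀ h p s → (h + h) * (h + h) * (s * (p * s)) ≡ nat 4 * p * (h * s * (h * s))
              l₁ = solve-∀ ringℚ
              l₂ : ∀ f p w x → f * p * (w * x) ≡ f * w * (p * x)
              l₂ = solve-∀ ringℚ

          -- Comparing `lower` with `upper` leaves one factor Σ₁ a. As `sels K k` is of order n^k
          -- when K is proportional to n, the matrix norm of the level part is about n^(-k) times
          -- the weight on the product space.
          coupling-bound : Σ₁ * N k g ≤ nat 4 * W
          coupling-bound = ≤-trans (*-monoʳ (0≤sels K k) (total le T₀ i₀)) (≤-trans (≤-reflexive (l Σ₁ (pw k (nat n)) a)) bound)
            where
            l : ∀ s p a → s * (p * a) ≡ p * (s * a)
            l = solve-∀ ringℚ

-- Comparison of the error terms

pw-+ : ∀ a b x → pw (a ℕ.+ b) x ≡ pw a x * pw b x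
pw-+ zero    b x = sym (*-identityˡ (pw b x))
pw-+ (suc a) b x = trans (cong (x *_) (pw-+ a b x)) (sym (*-assoc x (pw a x) (pw b x)))

0<pw : ∀ k {x} → 0ℚ < x → 0ℚ < pw k x
0<pw zero    p = 0<1
0<pw (suc k) p = 0<* p (0<pw k p)

pw-mono : ∀ k {x y} → 0ℚ ≤ x → x ≤ y → pw k x ≤ pw k y
pw-mono zero    p q = ≤-refl
pw-mono (suc k) p q = *-mono p (0≤pw k (≤-trans p q)) q (pw-mono k p q)

pw-mono< : ∀ k {x y} → 0ℚ ≤ x → x < y → pw (suc k) x < pw (suc k) y
pw-mono< k {x} {y} p q = ≤-<-trans (*-monoʳ p (pw-mono k p (<⇒≤ q)))
  (*-monoˡ-<-pos (pw k y) {{positive (0<pw k (≤-<-trans p q))}} q)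

1≤pw : ∀ k {x} → 1ℚ ≤ x → 1ℚ ≤ pw k x
1≤pw zero    p = ≤-refl
1≤pw (suc k) {x} p = ≤-trans (≤-reflexive (sym (*-identityˡ 1ℚ))) (*-mono 0≤1 (0≤pw k (≤-trans 0≤1 p)) p (1≤pw k p))

pw-exp : ∀ {a b x} → 1ℚ ≤ x → a ℕ.≤ b → pw a x ≤ pw b x
pw-exp {b = b} p z≤n     = 1≤pw b p
pw-exp {x = x} p (s≤s q) = *-monoʳ (≤-trans 0≤1 p) (pw-exp p q)

-- mers s = 2ˢ - 1
mers : ℕ → ℕ
mers zero    = 0
mers (suc s) = suc (mers s ℕ.+ mers s)

s≤mers : ∀ s → s ℕ.≤ mers s
s≤mers zero    = z≤n
s≤mers (suc s) = s≤s (ℕ.≤-trans (s≤mers s) (ℕ.m≤m+n (mers s) (mers s)))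

Gp≡pw : ∀ s x → Gp s x ≡ pw (mers s) x
Gp≡pw zero    x = refl
Gp≡pw (suc s) x = cong (x *_) (trans (Gp≡pw s (x * x)) (trans (sym (pw-* (mers s) x x)) (sym (pw-+ (mers s) (mers s) x))))

pow2≡pw : ∀ s x → pow2 s x ≡ pw (suc (mers s)) x
pow2≡pw s x = trans (sym (x*Gp s x)) (cong (x *_) (Gp≡pw s x))

module WeightBound {X : Set} (𝒫 : Prob X) (s d i : ℕ) (i≤ : i ℕ.≤ mers s) (α B q : ℚ) (0<α : 0ℚ < α) (1≤B : 1ℚ ≤ B) (1≤q : 1ℚ ≤ q) (large : 1ℚ ≤ pw i q * α) where
  open Product 𝒫
  open LevelInequality 𝒫

  -- γ bounds the means of restrictions, Γ is the crude bound for weights that the bootstrap needs,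
  -- and Ω = α² B q is the final one: it has B to the first power only, where Γ has B².
  γ Γ Ω : ℚ
  γ = B * α
  Γ = γ * γ * q
  Ω = α * α * (B * q)

  0≤α = <⇒≤ 0<α
  0≤B = ≤-trans 0≤1 1≤B
  0≤q = ≤-trans 0≤1 1≤q
  0≤γ = 0≤* 0≤B 0≤α
  0≤Γ = 0≤* (0≤* 0≤γ 0≤γ) 0≤q

  m : ℕ
  m = mers s

  Q = pw m q
  1≤Qα : 1ℚ ≤ Q * α
  1≤Qα = ≤-trans large (*-monoˡ 0≤α (pw-exp 1≤q i≤))

  α≤γ : α ≤ γ
  α≤γ = ≤-trans (≤-reflexive (sym (*-identityˡ α))) (*-monoˡ 0≤α 1≤B)

  -- With finite exponents the level inequality misses one factor α. As α ≥ 1 / Q with Q = q^(2ˢ -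
  -- 1), after taking roots this costs no more than a single q.
  q≤ : q ≤ γ * (q * Q)
  q≤ = ≤-trans (≤-reflexive (sym (*-identityˡ q))) (≤-trans (*-monoˡ 0≤q (≤-trans 1≤Qα (*-monoʳ (0≤pw m 0≤q) α≤γ))) (≤-reflexive (l Q γ q)))
    where
    l : ∀ Q g q → Q * g * q ≡ g * (q * Q)
    l = solve-∀ ringℚ

  cond : sumC s d ≤ q → sumC s d * Gp (suc s) γ ≤ pow2 s Γ
  cond c = ≤-trans (≤-reflexive (cong (λ z → sumC s d * (γ * z)) (Gp≡pw s (γ * γ)))) (≤-trans (≤-reflexive (l₁ (sumC s d) γ Z)) (≤-trans (*-monoʳ (0≤* 0≤γ (0≤pw m (0≤* 0≤γ 0≤γ))) (≤-trans c q≤))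
      (≤-reflexive (sym (trans (pow2≡pw s Γ) (trans (cong (Γ *_) (sym (pw-* m (γ * γ) q))) (l₂ γ q Z Q)))))))
    where
    Z = pw m (γ * γ)
    l₁ : ∀ c g z → c * (g * z) ≡ g * z * c
    l₁ = solve-∀ ringℚ
    l₂ : ∀ g q z p → g * g * q * (z * p) ≡ g * z * (g * (q * p))
    l₂ = solve-∀ ringℚ

  -- Stated after cancelling one factor w: `level-inequality` bounds w^(2^(s+1) - 1), and collecting
  -- the powers of α, B and q on its right side gives at most Ω to the same exponent.
  weight-bound : sumC s d ≤ q → ∀ {k} (F : Vec X k → ℚ) → (∀ φ → 0ℚ ≤ F φ) → (∀ φ → F φ ≤ 1ℚ) → Restr d γ F → 𝔼 F ≡ α → weight (suc d) F ≤ Ω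
  weight-bound c F 0≤F F≤1 re mean = ≮⇒≥ λ Ω<w →
    let 0<w = ≤-<-trans 0≤Ω Ω<w
        le : Gp (suc s) w ≤ Gp (suc s) Ω
        le = *-cancelˡ 0<w (≤-trans (≤-reflexive (x*Gp (suc s) w)) (≤-trans main (≤-reflexive refl)))
        lt : Gp (suc s) Ω < Gp (suc s) w
        lt = ≤-<-trans (≤-reflexive (Gp≡pw (suc s) Ω)) (<-≤-trans (pw-mono< (m ℕ.+ m) 0≤Ω Ω<w) (≤-reflexive (sym (Gp≡pw (suc s) w))))
    in <⇒≱ lt le
    where
    w = weight (suc d) F
    0≤w = 0≤weight (suc d) F
    0≤Ω : 0ℚ ≤ Ω
    0≤Ω = 0≤* (0≤* 0≤α 0≤α) (0≤* 0≤B 0≤q)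
    A = pw m (α * α) ; Bm = pw m (B * B)
    0≤A = 0≤pw m (0≤* 0≤α 0≤α) ; 0≤Bm = 0≤pw m (0≤* 0≤B 0≤B) ; 0≤Q = 0≤pw m 0≤q
    GΓ : Gp s Γ ≡ Bm * A * Q
    GΓ = trans (Gp≡pw s Γ) (trans (sym (pw-* m (γ * γ) q)) (cong (_* Q) (trans (cong (pw m) (l B α)) (sym (pw-* m (B * B) (α * α))))))
      where
      l : ∀ b a → b * a * (b * a) ≡ b * b * (a * a)
      l = solve-∀ ringℚ
    GΩ : Gp (suc s) Ω ≡ Ω * (A * A * Bm * (Q * Q))
    GΩ = cong (Ω *_) (trans (Gp≡pw s (Ω * Ω)) (trans (cong (pw m) (l α B q)) (trans (sym (pw-* m _ (q * q))) (cong₂ _*_ (trans (sym (pw-* m _ (B * B))) (cong (_* Bm) (sym (pw-* m (α * α) (α * α))))) (sym (pw-* m q q))))))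
      where
      l : ∀ a b q → a * a * (b * q) * (a * a * (b * q)) ≡ a * a * (a * a) * (b * b) * (q * q)
      l = solve-∀ ringℚ
    lv≤ : lvConst s d ≤ B * α * (q * Q)
    lv≤ = ≤-trans (lv≤sumC s d) (≤-trans c q≤)
    main : pow2 (suc s) w ≤ w * Gp (suc s) Ω
    main = ≤-trans (level-inequality s γ Γ 0≤Γ d (cond c) F 0≤F F≤1 re) (≤-trans (≤-reflexive (cong₂ (λ x y → x * (lvConst s d * (w * y))) (trans (cong (Gp (suc s)) mean) (cong (α *_) (Gp≡pw s (α * α)))) GΓ))
        (≤-trans (≤-reflexive (l₁ α A (lvConst s d) w Bm Q)) (≤-trans (*-monoʳ (0≤* (0≤* 0≤w 0≤α) (0≤* (0≤* (0≤* 0≤A 0≤A) 0≤Bm) 0≤Q)) lv≤) (≤-reflexive (trans (l₂ w α A Bm Q B q) (cong (w *_) (sym GΩ)))))))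
      where
      l₁ : ∀ a A c w b Q → a * A * (c * (w * (b * A * Q))) ≡ w * a * (A * A * b * Q) * c
      l₁ = solve-∀ ringℚ
      l₂ : ∀ w a A b Q B q → w * a * (A * A * b * Q) * (B * a * (q * Q)) ≡ w * (a * a * (B * q) * (A * A * b * (Q * Q)))
      l₂ = solve-∀ ringℚ

six : ℚ → ℚ
six a = a * a * a * (a * a * a)

norm-arith : ∀ {S NN Ω p nr Nk c} → 0ℚ ≤ nr → 0ℚ ≤ Nk → 0ℚ ≤ NN → 0ℚ ≤ c → S * NN ≤ nat 4 * Ω → p * nr ≤ nat 4 * NN → 1ℚ ≤ p * Nk → Nk ≤ c * S → nr ≤ nat 16 * c * Ω
norm-arith {S} {NN} {Ω} {p} {nr} {Nk} {c} 0≤nr 0≤Nk 0≤NN 0≤c a b e g = ≤-trans (≤-reflexive (sym (*-identityˡ nr))) (≤-trans (*-monoˡ 0≤nr e) (≤-trans (≤-reflexive (l₁ p Nk nr)) (≤-trans (*-monoʳ 0≤Nk b)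
    (≤-trans (*-monoˡ (0≤* (0≤nat 4) 0≤NN) g) (≤-trans (≤-reflexive (l₂ c S (nat 4) NN)) (≤-trans (*-monoʳ (0≤* (0≤nat 4) 0≤c) a) (≤-reflexive (l₃ (nat 4) c Ω))))))))
  where
  l₁ : ∀ p N n → p * N * n ≡ N * (p * n)
  l₁ = solve-∀ ringℚ
  l₂ : ∀ c s f n → c * s * (f * n) ≡ f * c * (s * n)
  l₂ = solve-∀ ringℚ
  l₃ : ∀ f c o → f * c * (f * o) ≡ f * f * c * o
  l₃ = solve-∀ ringℚ

triple-arith : ∀ {T p K nr Nk D y} → 0ℚ ≤ p → 0ℚ ≤ Nk → 0ℚ ≤ nr → 0ℚ ≤ K → 0ℚ ≤ D → T ≤ nat 4 * (p * K) * (nr * nr * nr) → p * Nk ≤ D → nr ≤ y → Nk * T ≤ nat 4 * D * K * (y * y * y)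
triple-arith {T} {p} {K} {nr} {Nk} {D} {y} 0≤p 0≤Nk 0≤nr 0≤K 0≤D t d n≤ = ≤-trans (*-monoʳ 0≤Nk t) (≤-trans (≤-reflexive (l Nk (nat 4) p K (nr * nr * nr)))
    (*-mono (0≤* (0≤* (0≤nat 4) (0≤* 0≤p 0≤Nk)) 0≤K) (0≤* (0≤* 0≤y 0≤y) 0≤y) (*-monoˡ 0≤K (*-monoʳ (0≤nat 4) d)) (*-mono (0≤* 0≤nr 0≤nr) 0≤y (*-mono 0≤nr 0≤y n≤ n≤) n≤)))
  where
  0≤y = ≤-trans 0≤nr n≤
  l : ∀ N f p k z → N * (f * (p * k) * z) ≡ f * (p * N) * k * z
  l = solve-∀ ringℚ

-- Here n^k is at least B⁴ up to a constant, while the cube of the norm bound contains B³ q³. Of the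
-- B that remains, q³ pays for the cube and one more q is left as the gain.
low-arith : ∀ {T B q α Nk E C c} → 0ℚ < B → 0ℚ < q → 0ℚ ≤ T → 0ℚ ≤ E → Nk * T ≤ C * (c * (α * α * (B * q)) * (c * (α * α * (B * q))) * (c * (α * α * (B * q)))) → B * B * (B * B) ≤ E * Nk → q * q * q * q ≤ B →
  q * T ≤ E * C * (c * c * c) * six α
low-arith {T} {B} {q} {α} {Nk} {E} {C} {c} 0<B 0<q 0≤T 0≤E a b e = *-cancelˡ (0<* (0<* 0<q 0<q) 0<q) (≤-trans (≤-trans (≤-reflexive (l₁ q T)) (*-monoˡ 0≤T e)) BT)
  where
  BBB = B * B * B
  0<BBB : 0ℚ < BBB
  0<BBB = 0<* (0<* 0<B 0<B) 0<B
  BT : B * T ≤ q * q * q * (E * C * (c * c * c) * six α)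
  BT = *-cancelˡ 0<BBB (≤-trans (≤-reflexive (l₂ B T)) (≤-trans (*-monoˡ 0≤T b) (≤-trans (≤-reflexive (*-assoc E Nk T)) (≤-trans (*-monoʳ 0≤E a) (≤-reflexive (l₃ E C c α B q))))))
    where
    l₂ : ∀ b t → b * b * b * (b * t) ≡ b * b * (b * b) * t
    l₂ = solve-∀ ringℚ
    l₃ : ∀ E C c a B q → E * (C * (c * (a * a * (B * q)) * (c * (a * a * (B * q))) * (c * (a * a * (B * q))))) ≡ B * B * B * (q * q * q * (E * C * (c * c * c) * (a * a * a * (a * a * a))))
    l₃ = solve-∀ ringℚ
  l₁ : ∀ q t → q * q * q * (q * t) ≡ q * q * q * q * t
  l₁ = solve-∀ ringℚ

-- Nr is n^(3 r), so Nr α³ ≥ 1 turns α³ into α⁶; the additional factor n is the gain, far more than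
-- q.
high-arith : ∀ {T q α Nr C n} → 0ℚ < Nr → 0ℚ ≤ T → 0ℚ ≤ C → 0ℚ ≤ α → n * Nr * T ≤ C * (α * α * α) → 1ℚ ≤ Nr * (α * α * α) → q ≤ n → q * T ≤ C * six α
high-arith {T} {q} {α} {Nr} {C} {n} 0<Nr 0≤T 0≤C 0≤α a b e = *-cancelˡ 0<Nr (≤-trans (≤-reflexive (l₁ Nr q T)) (≤-trans (*-monoˡ (0≤* (<⇒≤ 0<Nr) 0≤T) e) (≤-trans (≤-reflexive (l₂ n Nr T)) (≤-trans a
    (≤-trans (≤-reflexive (sym (*-identityˡ _))) (≤-trans (*-monoˡ (0≤* 0≤C (0≤* (0≤* 0≤α 0≤α) 0≤α)) b) (≤-reflexive (l₃ Nr (α * α * α) C))))))))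
  where
  l₁ : ∀ N q t → N * (q * t) ≡ q * (N * t)
  l₁ = solve-∀ ringℚ
  l₂ : ∀ n N t → n * (N * t) ≡ n * N * t
  l₂ = solve-∀ ringℚ
  l₃ : ∀ N a c → N * a * (c * a) ≡ N * (c * (a * a))
  l₃ = solve-∀ ringℚ

-- The same sums as `injections` and `tuples`, repeated outside the modules over n so that constants
-- visibly do not depend on n and n may be chosen after them.
injections# tuples# levelC : ℕ → ℚ
injections# k = sumV {k} {k} λ f → 𝟙 (decInj f)
tuples# k = sumV {k} {k} λ f → 1ℚ
levelC k = nat 4 * pw k (nat 2) * ((injections# k + 1ℚ) * (injections# k + 1ℚ))

rows : ∀ {n} m → m ℕ.≤ n → ∃ λ (v : Vec (Fin n) m) → InjV v
rows m le = tabulate (λ i → Fin.inject≤ i le) , λ {i} {j} e →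
  Fin.inject≤-injective le le i j (trans (sym (lookup∘tabulate (λ i → Fin.inject≤ i le) i)) (trans e (lookup∘tabulate (λ i → Fin.inject≤ i le) j)))

module PBounds (n : ℕ) where
  open Alternating n
  open TupleCalculus n
  open FrameBounds n

  fall≤ : ∀ k → k ℕ.≤ n → (0ℚ ≤ fall k) × (fall k ≤ pw k (nat n))
  fall≤ zero    le = 0≤1 , ≤-refl
  fall≤ (suc k) le = let (a , b) = fall≤ k (ℕ.≤-trans (ℕ.n≤1+n k) le) in
    0≤* a (≤-trans 0≤1 (1≤nat-diff le)) , ≤-trans (*-mono a (0≤nat n) b n-k≤) (≤-reflexive (*-comm (pw k (nat n)) (nat n)))
    where
    n-k≤ : nat n - nat k ≤ nat n
    n-k≤ = cert (0≤nat k) (l (nat n) (nat k))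
      where
      l : ∀ a b → a ≡ a - b + b
      l = solve-∀ ringℚ

  0<p : ∀ k → k ℕ.≤ n → 0ℚ < p k
  0<p k le = by (0ℚ <? p k)
    where
    by : Dec (0ℚ < p k) → 0ℚ < p k
    by (yes q) = q
    by (no q)  = ⊥-elim (<⇒≱ 0<1 (≤-trans (≤-reflexive (sym (p-fall k le))) (≤-trans (*-monoˡ (proj₁ (fall≤ k le)) (≮⇒≥ q)) (≤-reflexive (*-zeroˡ (fall k))))))

  1≤p*n^k : ∀ k → k ℕ.≤ n → 1ℚ ≤ p k * pw k (nat n)
  1≤p*n^k k le = ≤-trans (≤-reflexive (sym (p-fall k le))) (*-monoʳ (0≤p k) (proj₂ (fall≤ k le)))

  p*n^k≤ : ∀ k → k ℕ.+ k ℕ.≤ n → p k * pw k (nat n) ≤ pw k (nat 2)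
  p*n^k≤ zero    le = ≤-refl
  p*n^k≤ (suc k) le = ≤-trans (≤-reflexive (l (p k) v (nat n) (pw k (nat n)))) (*-mono (0≤* (0≤nat n) (0≤invd (nat n - nat k))) (0≤pw k (0≤nat 2)) nv≤ (p*n^k≤ k le'))
    where
    v = invd (nat n - nat k)
    l : ∀ p v n w → p * v * (n * w) ≡ n * v * (p * w)
    l = solve-∀ ringℚ
    le' : k ℕ.+ k ℕ.≤ n
    le' = ℕ.≤-trans (ℕ.+-mono-≤ (ℕ.n≤1+n k) (ℕ.n≤1+n k)) le
    k<n : k ℕ.< n
    k<n = ℕ.≤-trans (ℕ.m≤m+n (suc k) (suc k)) le
    nv≤ : nat n * v ≤ nat 2
    nv≤ = ≤-trans (*-monoˡ (0≤invd (nat n - nat k)) n≤) (≤-reflexive (trans (*-assoc (nat 2) (nat n - nat k) v) (trans (cong (nat 2 *_) (invd-r (nat n - nat k) (<-≤-trans 0<1 (1≤nat-diff k<n)))) (*-identityʳ (nat 2)))))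
      where
      n≤ : nat n ≤ nat 2 * (nat n - nat k)
      n≤ = cert (diff (nat-mono le')) (trans (m (nat n) (nat k)) (cong (λ z → nat n + (nat n - z)) (sym (nat-+ k k))))
        where
        m : ∀ n k → nat 2 * (n - k) ≡ n + (n - (k + k))
        m = solve-∀ ringℚ

  -- The ratio of p (k + 1) to p k is 1 / (n - k), so the error of the main formula is below half of
  -- p k once n - k exceeds a constant.
  smallness : ∀ k → k ℕ.< n → ∀ Z → nat 2 * Z ≤ nat n - nat k → Z * p (suc k) ≤ ½ * p k
  smallness k lt Z h = ≤-trans (≤-reflexive (l Z (p k) v)) (*-monoˡ (0≤p k) (double {Z * v} {½} (≤-trans (≤-reflexive (sym (*-assoc (nat 2) Z v))) (≤-trans (*-monoˡ (0≤invd (nat n - nat k)) h) (≤-reflexive (trans (invd-r (nat n - nat k) (<-≤-trans 0<1 (1≤nat-diff lt))) (sym (trans (m ½) (½+½ 1ℚ)))))))))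
    where
    v = invd (nat n - nat k)
    l : ∀ z p v → z * (p * v) ≡ z * v * p
    l = solve-∀ ringℚ
    m : ∀ h → (1ℚ + 1ℚ) * h ≡ h * 1ℚ + h * 1ℚ
    m = solve-∀ ringℚ

module LevelBounds (n : ℕ) (0<n : 0ℚ < nat n) (f : Alternating.El n → ℚ) (f-idem : ∀ σ → f σ * f σ ≡ f σ) (0≤f : ∀ σ → 0ℚ ≤ f σ) (f≤1 : ∀ σ → f σ ≤ 1ℚ) where
  open Alternating n
  open TupleCalculus n
  open FrameBounds n
  open FrameInequalities n
  open LevelSpaces n
  open Convolution n
  open Decomposition 0<n f public
  open PBounds n
  open UniformProduct n 0<n using (ν; nν; uniform)

  nrm²f : nrm² f ≡ α
  nrm²f = PLF.ext 𝔾 f-idem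

  0≤α : 0ℚ ≤ α
  0≤α = PLF.nonneg 𝔾 0≤f

  module At (d k : ℕ) (k≡ : k ≡ suc d) (2k≤n : suc (suc (k ℕ.+ k)) ℕ.≤ n) (big : nat 2 * (tuples# k * tuples# k * two^ k) ≤ nat n - nat k) where
    2k : k ℕ.+ k ℕ.≤ n
    2k = ℕ.≤-trans (ℕ.≤-trans (ℕ.n≤1+n _) (ℕ.n≤1+n _)) 2k≤n

    k+2≤n : suc (suc k) ℕ.≤ n
    k+2≤n = ℕ.≤-trans (s≤s (s≤s (ℕ.m≤m+n k k))) 2k≤n

    k≤n : k ℕ.≤ n
    k≤n = ℕ.≤-trans (ℕ.≤-trans (ℕ.n≤1+n _) (ℕ.n≤1+n _)) k+2≤n

    open Main d k k≡ 2k≤n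
    small : tuples k * tuples k * β ≤ ½ * p k
    small = ≤-trans (≤-reflexive (sym (*-assoc (tuples k * tuples k) (two^ k) (p (suc k))))) (smallness k (ℕ.≤-trans (ℕ.n≤1+n _) k+2≤n) (tuples k * tuples k * two^ k) big)
    open Large (0<p k k≤n) small

    T = triple (g d) * triple (g d)

    cubic : ∀ {y} → nrm² (g d) ≤ y → pw k (nat n) * T ≤ levelC k * (y * y * y)
    cubic le = triple-arith (0≤p k) (0≤pw k (0≤nat n)) (0≤nrm² (g d)) (0≤sq (κ + 1ℚ)) (0≤pw k (0≤nat 2)) (triple-g² d k k≡ 2k≤n (0<p k k≤n) small) (p*n^k≤ k 2k) le

    trivial : pw k (nat n) * T ≤ levelC k * (α * α * α)
    trivial = cubic (≤-trans (nrm²-g≤ d) (≤-reflexive nrm²f))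

    module Low (s i b : ℕ) (B q c : ℚ) (i≤ : i ℕ.≤ mers s) (0<α : 0ℚ < α) (1≤B : 1ℚ ≤ B) (1≤q : 1ℚ ≤ q) (large : 1ℚ ≤ pw i q * α)
      (sumC≤q : sumC s k ≤ q) (room : suc (suc (k ℕ.* b)) ℕ.≤ n) (few : nat 4 * (nat k * (nat (k ℕ.* b) * ν)) ≤ 1ℚ) (0≤c : 0ℚ ≤ c) (n≤cb : nat n ≤ c * nat b)
      (glob : ∀ {j} → j ℕ.≤ k → ∀ (T J : Vec (Fin n) j) → M f T J ≤ B * α * Pr T J) where
      open WeightBound uniform s k i i≤ α B q 0<α 1≤B 1≤q large using (Ω; weight-bound)

      norm-low : nrm² (g d) ≤ nat 16 * pw k c * Ω
      norm-low = norm-arith {p = p k} (0≤nrm² (g d)) (0≤pw k (0≤nat n)) (0≤N k (g d)) (0≤pw k 0≤c) coupled (lower-frame (g d) (g-perp d) (subst (λ j → InV j (g d)) (sym k≡) (g∈V d))) (1≤p*n^k k k≤n)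
        (≤-trans (pw-mono k (0≤nat n) n≤cb) (≤-trans (≤-reflexive (sym (pw-* k c (nat b)))) (*-monoʳ (0≤pw k 0≤c) (pw≤sels b k))))
        where
        R₀ = rows {n} (k ℕ.* b) (ℕ.≤-trans (ℕ.≤-trans (ℕ.n≤1+n _) (ℕ.n≤1+n _)) room)
        T₀ = rows {n} k k≤n
        open Coupling n 0<n
        open Rows (proj₁ R₀) (proj₂ R₀) room
        open AtLevel d k k≡ f (P d f) (g d) (λ σ → f σ - P (suc d) f σ) (f≡ d) (P∈V d f) (g-perp d) (subst (λ j → Perp j (λ σ → f σ - P (suc d) f σ)) (sym k≡) (P-perp (suc d) f))
        coupled : sels (k ℕ.* b) k * N k (g d) ≤ nat 4 * Ω
        coupled = coupling-bound k+2≤n (proj₁ T₀) (proj₂ T₀) Ω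
          (λ τ → weight-bound sumC≤q (lift f τ) (lift-nonneg f τ 0≤f) (lift-≤1 f τ f≤1) (lift-restr f τ k (B * α) glob) (lift-mean f τ)) few

      low-level : ∀ {E} → 0ℚ ≤ E → B * B * (B * B) ≤ E * pw k (nat n) → q * q * q * q ≤ B → q * T ≤ E * levelC k * (nat 16 * pw k c * (nat 16 * pw k c) * (nat 16 * pw k c)) * six α
      low-level 0≤E b e = low-arith {α = α} {C = levelC k} {c = nat 16 * pw k c} (<-≤-trans 0<1 1≤B) (<-≤-trans 0<1 1≤q) (0≤sq (triple (g d))) 0≤E (cubic norm-low) b e

  module HighPart (w l : ℕ) (room : suc (suc (w ℕ.* l ℕ.* 4)) ℕ.≤ n) (w≤ : suc (suc (four (dbl w))) ℕ.≤ n) (c : ℚ) (0≤c : 0ℚ ≤ c) (nn≤ : nat n * nat n ≤ c * (nat l * (nat l - 1ℚ))) where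
    t = four (dbl w)

    v : El → ℚ
    v σ = f σ - P t f σ

    L4≤n : w ℕ.* l ℕ.* 4 ℕ.≤ n
    L4≤n = ℕ.≤-trans (ℕ.≤-trans (ℕ.n≤1+n _) (ℕ.n≤1+n _)) room

    pt : Fin (w ℕ.* l) → Fin 4 → Fin n
    pt b j = Fin.inject≤ (Fin.combine b j) L4≤n

    pt-inj : ∀ {b b' j j'} → pt b j ≡ pt b' j' → (b ≡ b') × (j ≡ j')
    pt-inj {b} {b'} {j} {j'} e = Fin.combine-injective b j b' j' (Fin.inject≤-injective L4≤n L4≤n (Fin.combine b j) (Fin.combine b' j') e)

    perp-below : ∀ j {z} → Fin n → Perp j z → ∀ i → i ℕ.≤ j → Perp i z
    perp-below j {z} x q i le = go (ℕ.≤⇒≤′ le) q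
      where
      go : ∀ {j} → i ℕ.≤′ j → Perp j z → Perp i z
      go (ℕ.≤′-reflexive refl) q = q
      go (ℕ.≤′-step p) q = go p (Perp-down {z = z} x q)

    highC : ℚ
    highC = pw w c * (pw w (nat 4 * nat 3) * pw w (nat 16))

    -- Two factors n^w are gained from the choices of pairs of blocks and one is lost to the gap.
    -- Cauchy-Schwarz against f supplies the third α.
    high-part : pw w (nat n) * (triple v * triple v) ≤ highC * (α * α * α)
    high-part = ≤-trans (*-monoʳ 0≤W (≤-trans (PLF.cs 𝔾 (conv f v) f) (≤-reflexive (cong (X *_) nrm²f)))) (≤-trans (≤-reflexive (sym (*-assoc W X α))) (≤-trans (*-monoˡ 0≤α Xbound) (≤-reflexive (m₄ highC α))))
      where
      open Moves n (w ℕ.* l) pt pt-inj room l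
      open HighLevels {w} Fin.combine (λ {i} {a} {i'} {a'} → Fin.combine-injective i a i' a') w≤
      W = pw w (nat n)
      0≤W = 0≤pw w (0≤nat n)
      0<W = 0<pw w 0<n
      X = nrm² (conv f v)
      0≤X = 0≤nrm² (conv f v)
      Lw = pw w (nat l * (nat l - 1ℚ))
      pn : ∀ m → 0ℚ < nat m → Fin m
      pn zero    q = ⊥-elim (<-irrefl refl q)
      pn (suc m) q = zero
      hl : Lw * X ≤ pw w (nat n * nat 4 * nat 3) * (pw w (nat 16) * (nrm² v * nrm² f))
      hl = high-levels f v (λ j le → perp-below t {v} (pn n 0<n) (P-perp t f) j le)
      nv : nrm² v * nrm² f ≤ α * α
      nv = *-mono (0≤nrm² v) 0≤α (≤-trans (nrm²-rest≤ t) (≤-reflexive nrm²f)) (≤-reflexive nrm²f)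
      Xbound : W * X ≤ highC * (α * α)
      Xbound = *-cancelˡ 0<W (≤-trans (≤-reflexive (trans (sym (*-assoc W W X)) (cong (_* X) (pw-* w (nat n) (nat n))))) (≤-trans (*-monoˡ 0≤X (pw-mono w (0≤* (0≤nat n) (0≤nat n)) nn≤))
          (≤-trans (≤-reflexive (trans (cong (_* X) (sym (pw-* w c _))) (*-assoc (pw w c) Lw X))) (≤-trans (*-monoʳ (0≤pw w 0≤c) (≤-trans hl (*-monoʳ (0≤pw w (0≤* (0≤* (0≤nat n) (0≤nat 4)) (0≤nat 3))) (*-monoʳ (0≤pw w (0≤nat 16)) nv))))
            (≤-reflexive (trans (cong (λ z → pw w c * (z * (pw w (nat 16) * (α * α)))) (trans (cong (pw w) (*-assoc (nat n) (nat 4) (nat 3))) (sym (pw-* w (nat n) (nat 4 * nat 3))))) (m₃ (pw w c) W (pw w (nat 4 * nat 3)) (pw w (nat 16)) (α * α))))))))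
        where
        m₃ : ∀ c w a b x → c * (w * a * (b * x)) ≡ w * (c * (a * b) * x)
        m₃ = solve-∀ ringℚ
      m₄ : ∀ c a → c * (a * a) * a ≡ c * (a * a * a)
      m₄ = solve-∀ ringℚ

  -- The signs of the error terms are unknown and Cauchy-Schwarz bounds only their squares, so α³ =
  -- - (sum of errors) is squared. Splitting off one term at a time with (x + y)² ≤ 2 x² + 2 y²
  -- costs at most 4 per level.
  no-cancellation : ∀ t q C → 0ℚ ≤ C → 0ℚ < α → triple f ≡ 0ℚ → (∀ d → d ℕ.< t → q * (triple (g d) * triple (g d)) ≤ C * six α) →
    q * (triple (λ σ → f σ - P t f σ) * triple (λ σ → f σ - P t f σ)) ≤ C * six α → 0ℚ ≤ q → pw (suc t) (nat 4) * C < q → ⊥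
  no-cancellation t q C 0≤C 0<α zero-triple each last 0≤q big = <⇒≱ big (*-cancelˡ 0<six (≤-trans (≤-trans (≤-reflexive (*-comm (six α) q)) (≤-trans (*-monoʳ 0≤q cube) (≤-trans (≤-reflexive (l₁ q (sumT t * sumT t) (y * y))) (+-mono-≤ (*-monoʳ (0≤nat 2) (sums t ℕ.≤-refl)) (*-monoʳ (0≤nat 2) last)))))
      (≤-trans (≤-reflexive (l₂ (pw t (nat 4)) (C * six α))) (≤-trans (+-monoʳ-≤ (nat 2 * pw t (nat 4) * (C * six α)) (≤-trans (≤-reflexive (sym (*-identityˡ _))) (*-monoˡ (0≤* (0≤nat 2) 0≤D) (1≤pw t 1≤4)))) (≤-reflexive (l₃ (pw t (nat 4)) C (six α)))))))
    where
    y = triple (λ σ → f σ - P t f σ)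
    0<six : 0ℚ < six α
    0<six = 0<* (0<* (0<* 0<α 0<α) 0<α) (0<* (0<* 0<α 0<α) 0<α)
    0≤D : 0ℚ ≤ C * six α
    0≤D = 0≤* 0≤C (<⇒≤ 0<six)
    1≤4 : 1ℚ ≤ nat 4
    1≤4 = cert (0≤nat 3) refl
    two-sq : ∀ a b → (a + b) * (a + b) ≤ nat 2 * (a * a) + nat 2 * (b * b)
    two-sq a b = cert (0≤sq (a - b)) (l a b)
      where
      l : ∀ a b → nat 2 * (a * a) + nat 2 * (b * b) ≡ (a + b) * (a + b) + (a - b) * (a - b)
      l = solve-∀ ringℚ
    l₁ : ∀ q s y → q * (nat 2 * s + nat 2 * y) ≡ nat 2 * (q * s) + nat 2 * (q * y)
    l₁ = solve-∀ ringℚ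
    l₂ : ∀ p d → nat 2 * (p * d) + nat 2 * d ≡ nat 2 * p * d + nat 2 * d
    l₂ = solve-∀ ringℚ
    l₃ : ∀ p c s → nat 2 * p * (c * s) + p * (nat 2 * (c * s)) ≡ s * (nat 4 * p * c)
    l₃ = solve-∀ ringℚ
    cube : six α ≤ nat 2 * (sumT t * sumT t) + nat 2 * (y * y)
    cube = ≤-trans (≤-reflexive (trans (l (α * α * α) (sumT t) y) (cong (λ z → (z - (sumT t + y)) * (z - (sumT t + y))) (trans (sym (triple-f t)) zero-triple)))) (≤-trans (≤-reflexive (l' (sumT t + y))) (two-sq (sumT t) y))
      where
      l : ∀ a s y → a * a ≡ ((a + s + y) - (s + y)) * ((a + s + y) - (s + y))
      l = solve-∀ ringℚ
      l' : ∀ z → (0ℚ - z) * (0ℚ - z) ≡ z * z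
      l' = solve-∀ ringℚ
    sums : ∀ j → j ℕ.≤ t → q * (sumT j * sumT j) ≤ pw j (nat 4) * (C * six α)
    sums zero    le = ≤-trans (≤-reflexive (trans (cong (q *_) (*-zeroʳ 0ℚ)) (*-zeroʳ q))) (0≤* 0≤1 0≤D)
    sums (suc j) le = ≤-trans (*-monoʳ 0≤q (two-sq (sumT j) (triple (g j)))) (≤-trans (≤-reflexive (l₁ q (sumT j * sumT j) (triple (g j) * triple (g j)))) (≤-trans (+-mono-≤ (*-monoʳ (0≤nat 2) (sums j (ℕ.≤-trans (ℕ.n≤1+n j) le))) (*-monoʳ (0≤nat 2) (each j le)))
      (≤-trans (+-monoʳ-≤ (nat 2 * (pw j (nat 4) * (C * six α))) (≤-trans (≤-reflexive (sym (*-identityˡ _))) (*-monoˡ (0≤* (0≤nat 2) 0≤D) (1≤pw j 1≤4)))) (≤-reflexive (m (pw j (nat 4)) (C * six α))))))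
      where
      m : ∀ p d → nat 2 * (p * d) + p * (nat 2 * d) ≡ nat 4 * p * d
      m = solve-∀ ringℚ

-- Large n: integer roots, block sizes and constants

Eventually : (ℕ → Set) → Set
Eventually P = ∃ λ N → ∀ n → N ℕ.≤ n → P n

ev-map : ∀ {P Q : ℕ → Set} → (∀ n → P n → Q n) → Eventually P → Eventually Q
ev-map h (N , p) = N , λ n le → h n (p n le)

ev-× : ∀ {P Q : ℕ → Set} → Eventually P → Eventually Q → Eventually λ n → P n × Q n
ev-× (N , p) (N' , q) = N ℕ.+ N' , λ n le → p n (ℕ.≤-trans (ℕ.m≤m+n N N') le) , q n (ℕ.≤-trans (ℕ.m≤n+m N' N) le)

ev-all : ∀ t {P : ℕ → ℕ → Set} → (∀ d → Eventually (P d)) → Eventually λ n → ∀ d → d ℕ.< t → P d n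
ev-all zero    e = 0 , λ n _ d ()
ev-all (suc t) {P} e = ev-map (λ n h d le → by (proj₁ h) (proj₂ h) d (ℕ.m<1+n⇒m<n∨m≡n le)) (ev-× (e t) (ev-all t e))
  where
  by : ∀ {n} → P t n → (∀ d → d ℕ.< t → P d n) → ∀ d → (d ℕ.< t) ⊎ (d ≡ t) → P d n
  by p h d (inj₁ lt)   = h d lt
  by p h d (inj₂ refl) = p

ev-≥ : ∀ m → Eventually (m ℕ.≤_)
ev-≥ m = m , λ n le → le

ev-nat : ∀ c → Eventually λ n → c ≤ nat n
ev-nat c = let (N , h) = archimedes c in N , λ n le → ≤-trans h (nat-mono le)

nat-* : ∀ a b → nat (a ℕ.* b) ≡ nat a * nat b
nat-* zero    b = sym (*-zeroˡ (nat b))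
nat-* (suc a) b = trans (nat-+ b (a ℕ.* b)) (trans (cong (nat b +_) (nat-* a b)) (l (nat a) (nat b)))
  where
  l : ∀ a b → b + a * b ≡ (1ℚ + a) * b
  l = solve-∀ ringℚ

pw-pw : ∀ a b x → pw a (pw b x) ≡ pw (a ℕ.* b) x
pw-pw zero    b x = refl
pw-pw (suc a) b x = trans (cong (pw b x *_) (pw-pw a b x)) (sym (pw-+ b (a ℕ.* b) x))

next : (ν n : ℕ) → Dec (pw 24 (nat (suc ν)) ≤ nat (suc n)) → ℕ
next ν n (yes _) = suc ν
next ν n (no _)  = ν

-- As 24 = 4 · 6, a gain of n^(t/4) in a t-umvirate is at most (1 + root n)^(6 t).
root : ℕ → ℕ
root zero    = 0
root (suc n) = next (root n) n (pw 24 (nat (suc (root n))) ≤? nat (suc n))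

-- Raising the root by at most one per step suffices because 1 + x^24 ≤ (1 + x)^24.
root-spec : ∀ n → (pw 24 (nat (root n)) ≤ nat n) × (nat n < pw 24 (nat (suc (root n))))
root-spec zero    = ≤-reflexive (*-zeroˡ (pw 23 0ℚ)) , 0<pw 24 (0<nat 0)
root-spec (suc n) = by (pw 24 (nat (suc (root n))) ≤? nat (suc n))
  where
  ν = root n
  ih = root-spec n
  by : (q : Dec (pw 24 (nat (suc ν)) ≤ nat (suc n))) → (pw 24 (nat (next ν n q)) ≤ nat (suc n)) × (nat (suc n) < pw 24 (nat (suc (next ν n q))))
  by (no q)  = ≤-trans (proj₁ ih) (cert 0≤1 (+-comm 1ℚ (nat n))) , ≰⇒> q
  by (yes q) = q , <-≤-trans (+-monoʳ-< 1ℚ (proj₂ ih)) (grow (nat (suc ν)) (cert (0≤nat ν) refl))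
    where
    grow : ∀ x → 1ℚ ≤ x → 1ℚ + pw 24 x ≤ pw 24 (1ℚ + x)
    grow x 1≤x = ≤-trans (+-monoˡ-≤ (pw 24 x) (1≤pw 23 1≤x)) (≤-trans (≤-reflexive (l x (pw 23 x))) (*-monoʳ (0≤+ 0≤1 0≤x) (pw-mono 23 0≤x (cert 0≤1 (+-comm 1ℚ x)))))
      where
      0≤x = ≤-trans 0≤1 1≤x
      l : ∀ x y → y + x * y ≡ (1ℚ + x) * y
      l = solve-∀ ringℚ

ev-root : ∀ m → Eventually λ n → m ℕ.≤ root n
ev-root m = ev-map (λ n h → ℕ.≮⇒≥ λ lt → <⇒≱ (proj₂ (root-spec n)) (≤-trans (pw-mono 24 (0≤nat (suc (root n))) (nat-mono lt)) h)) (ev-nat (pw 24 (nat m)))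

scale : ℕ → ℚ
scale n = nat (suc (root n))

ev-scale : ∀ c → Eventually λ n → c < scale n
ev-scale c = let (m , h) = archimedes c in ev-map (λ n le → ≤-<-trans (≤-trans h (nat-mono le)) (<-≤-trans (≤-<-trans (≤-reflexive (sym (+-identityˡ _))) (+-monoˡ-< (nat (root n)) 0<1)) ≤-refl)) (ev-root m)

m<[1+m/n]*n : ∀ m n .{{_ : ℕ.NonZero n}} → m ℕ.< suc (m / n) ℕ.* n
m<[1+m/n]*n m n = ℕ.≤-<-trans (ℕ.≤-reflexive (m≡m%n+[m/n]*n m n)) (ℕ.+-monoˡ-< (m / n ℕ.* n) (m%n<n m n))

-- The divisor 4 K² is what `few` asks for: among K b random letters, K selected ones are then
-- expected to have at most 1/4 repeats. Rounding down costs the factor 2 between 4 and 8.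
block-size : ∀ k n → 4 ℕ.* (suc k ℕ.* suc k) ℕ.≤ n → (0<n : 0ℚ < nat n) → ∃ λ b → (suc (suc (suc k ℕ.* b)) ℕ.≤ n) ×
  (nat 4 * (nat (suc k) * (nat (suc k ℕ.* b) * inv (nat n) 0<n)) ≤ 1ℚ) × (nat n ≤ nat (8 ℕ.* (suc k ℕ.* suc k)) * nat b)
block-size k n large 0<n = b , room , few , n≤
  where
  K = suc k
  D = 4 ℕ.* (K ℕ.* K)
  b = n / D
  bD : b ℕ.* D ℕ.≤ n
  bD = m/n*n≤m n D
  1≤b : 1 ℕ.≤ b
  1≤b = ℕ.≮⇒≥ λ lt → ℕ.<-irrefl refl (ℕ.<-≤-trans (subst (λ c → n ℕ.< suc c ℕ.* D) (ℕ.n<1⇒n≡0 lt) (m<[1+m/n]*n n D)) (ℕ.≤-trans (ℕ.≤-reflexive (ℕ.*-identityˡ D)) large))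
  4Kb≤ : 4 ℕ.* (K ℕ.* b) ℕ.≤ n
  4Kb≤ = ℕ.≤-trans (ℕ.*-monoʳ-≤ 4 (ℕ.*-monoˡ-≤ b (ℕ.m≤m*n K K))) (ℕ.≤-trans (ℕ.≤-reflexive (trans (sym (ℕ.*-assoc 4 (K ℕ.* K) b)) (ℕ.*-comm D b))) bD)
  1≤Kb : 1 ℕ.≤ K ℕ.* b
  1≤Kb = ℕ.*-mono-≤ {1} {K} {1} {b} (s≤s z≤n) 1≤b
  room : suc (suc (K ℕ.* b)) ℕ.≤ n
  room = ℕ.≤-trans (ℕ.≤-trans (ℕ.+-mono-≤ {2} {2 ℕ.* (K ℕ.* b)} (ℕ.*-monoʳ-≤ 2 1≤Kb) (ℕ.≤-refl {K ℕ.* b})) (ℕ.≤-trans (ℕ.≤-reflexive (ℕ.+-comm (2 ℕ.* (K ℕ.* b)) (K ℕ.* b))) (ℕ.*-monoˡ-≤ (K ℕ.* b) {3} {4} (s≤s (s≤s (s≤s z≤n)))))) 4Kb≤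
  few : nat 4 * (nat K * (nat (K ℕ.* b) * inv (nat n) 0<n)) ≤ 1ℚ
  few = ≤-trans (≤-reflexive (trans (l (nat 4) (nat K) (nat (K ℕ.* b)) (inv (nat n) 0<n)) (cong (_* inv (nat n) 0<n) (sym (trans (nat-* 4 (K ℕ.* (K ℕ.* b))) (cong (nat 4 *_) (nat-* K (K ℕ.* b))))))))
      (≤-trans (*-monoˡ (<⇒≤ (0<inv (nat n) 0<n)) (nat-mono le)) (≤-reflexive (inv-r (nat n) 0<n)))
    where
    l : ∀ a b c d → a * (b * (c * d)) ≡ a * (b * c) * d
    l = solve-∀ ringℚ
    le : 4 ℕ.* (K ℕ.* (K ℕ.* b)) ℕ.≤ n
    le = ℕ.≤-trans (ℕ.≤-reflexive (trans (cong (4 ℕ.*_) (sym (ℕ.*-assoc K K b))) (trans (sym (ℕ.*-assoc 4 (K ℕ.* K) b)) (ℕ.*-comm D b)))) bD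
  n≤ : nat n ≤ nat (8 ℕ.* (K ℕ.* K)) * nat b
  n≤ = ≤-trans (nat-mono le) (≤-reflexive (nat-* (8 ℕ.* (K ℕ.* K)) b))
    where
    le : n ℕ.≤ 8 ℕ.* (K ℕ.* K) ℕ.* b
    le = ℕ.≤-trans (ℕ.<⇒≤ (m<[1+m/n]*n n D)) (ℕ.≤-trans (ℕ.+-monoˡ-≤ (b ℕ.* D) (ℕ.≤-trans (ℕ.≤-reflexive (sym (ℕ.*-identityˡ D))) (ℕ.*-monoˡ-≤ D 1≤b))) (ℕ.≤-reflexive (trans (cong₂ ℕ._+_ (ℕ.*-comm b D) (ℕ.*-comm b D)) (trans (sym (ℕ.*-distribʳ-+ b D D)) (cong (ℕ._* b) (sym (ℕ.*-distribʳ-+ (K ℕ.* K) 4 4)))))))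

-- Half of the points are spent on blocks. The hypothesis guarantees l ≥ 2, the range in which (l +
-- 1)² ≤ 6 l (l - 1); for smaller l there would be no pair of distinct blocks.
high-size : ∀ w n → 16 ℕ.* suc w ℕ.≤ n → ∃ λ l → (suc (suc (suc w ℕ.* l ℕ.* 4)) ℕ.≤ n) × (nat n * nat n ≤ nat (8 ℕ.* suc w) * nat (8 ℕ.* suc w) * nat 6 * (nat l * (nat l - 1ℚ)))
high-size w₀ n large = by l refl
  where
  w = suc w₀
  D = 8 ℕ.* w
  l = n / D
  lD : l ℕ.* D ℕ.≤ n
  lD = m/n*n≤m n D
  n< : n ℕ.< suc l ℕ.* D
  n< = m<[1+m/n]*n n D
  16w≡ : 2 ℕ.* D ≡ 16 ℕ.* w
  16w≡ = sym (ℕ.*-assoc 2 8 w)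
  too-small : ∀ {A : Set} m → l ≡ m → suc m ℕ.≤ 2 → A
  too-small m e le = ⊥-elim (ℕ.<-irrefl refl (ℕ.<-≤-trans n< (ℕ.≤-trans (ℕ.*-monoˡ-≤ D (subst (λ z → suc z ℕ.≤ 2) (sym e) le)) (ℕ.≤-trans (ℕ.≤-reflexive 16w≡) large))))
  by : ∀ m → l ≡ m → ∃ λ l → (suc (suc (w ℕ.* l ℕ.* 4)) ℕ.≤ n) × (nat n * nat n ≤ nat (8 ℕ.* w) * nat (8 ℕ.* w) * nat 6 * (nat l * (nat l - 1ℚ)))
  by zero          e = too-small 0 e (s≤s z≤n)
  by (suc zero)    e = too-small 1 e (s≤s (s≤s z≤n))
  by (suc (suc m)) e = l , room , ≤-trans (*-mono (0≤nat n) (0≤* (0≤nat (suc l)) (0≤nat D)) n≤ n≤) (≤-trans (≤-reflexive (l₁ (nat (suc l)) (nat D))) (≤-trans (*-monoʳ (0≤* (0≤nat D) (0≤nat D)) sq≤) (≤-reflexive (sym (*-assoc (nat D * nat D) (nat 6) _)))))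
    where
    n≤ : nat n ≤ nat (suc l) * nat D
    n≤ = ≤-trans (nat-mono (ℕ.<⇒≤ n<)) (≤-reflexive (nat-* (suc l) D))
    l₁ : ∀ a b → a * b * (a * b) ≡ b * b * (a * a)
    l₁ = solve-∀ ringℚ
    sq≤ : nat (suc l) * nat (suc l) ≤ nat 6 * (nat l * (nat l - 1ℚ))
    sq≤ = subst (λ z → nat (suc z) * nat (suc z) ≤ nat 6 * (nat z * (nat z - 1ℚ))) (sym e) (cert (0≤+ (0≤* (0≤nat 5) (0≤sq (nat m))) (0≤+ (0≤* (0≤nat 12) (0≤nat m)) (0≤nat 3))) (q (nat m)))
      where
      q : ∀ m → nat 6 * ((1ℚ + (1ℚ + m)) * ((1ℚ + (1ℚ + m)) - 1ℚ)) ≡ (1ℚ + (1ℚ + (1ℚ + m))) * (1ℚ + (1ℚ + (1ℚ + m))) + (nat 5 * (m * m) + (nat 12 * m + nat 3))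
      q = solve-∀ ringℚ
    room : suc (suc (w ℕ.* l ℕ.* 4)) ℕ.≤ n
    room = ℕ.≤-trans (ℕ.+-monoˡ-≤ (w ℕ.* l ℕ.* 4) 2≤) (ℕ.≤-trans (ℕ.≤-reflexive twice) lD)
      where
      X = w ℕ.* l ℕ.* 4
      1≤l : 1 ℕ.≤ l
      1≤l = subst (1 ℕ.≤_) (sym e) (s≤s z≤n)
      2≤ : 2 ℕ.≤ X
      2≤ = ℕ.≤-trans (s≤s (s≤s z≤n)) (ℕ.*-monoˡ-≤ 4 {1} {w ℕ.* l} (ℕ.*-mono-≤ {1} {w} (s≤s z≤n) 1≤l))
      twice : X ℕ.+ X ≡ l ℕ.* D
      twice = trans (sym (ℕ.*-distribˡ-+ (w ℕ.* l) 4 4)) (trans (cong (ℕ._* 8) (ℕ.*-comm w l)) (trans (ℕ.*-assoc l w 8) (cong (l ℕ.*_) (ℕ.*-comm w 8))))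

module Reduce (n : ℕ) where
  open Alternating n
  open TupleCalculus n

  -- The absence of bumps concerns injective tuples only, but restrictions of the lift lead to
  -- arbitrary ones, since `canon` repeats rows. A repeated row is dropped, with a 0-1 factor in c
  -- for consistency; a value claimed by two different rows makes c = 0.
  reduce : ∀ {m} (T J : Vec (Fin n) m) → ∃ λ m' → (m' ℕ.≤ m) × Σ (Vec (Fin n) m' × Vec (Fin n) m') λ TJ → Σ ℚ λ c → (0ℚ ≤ c) × InjV (proj₁ TJ) × InjV (proj₂ TJ) ×
    (∀ σ → 𝟙 (σ ∙ T ≟V J) ≡ c * 𝟙 (σ ∙ proj₁ TJ ≟V proj₂ TJ))
  reduce []      []      = 0 , z≤n , ([] , []) , 1ℚ , 0≤1 , (λ { {()} }) , (λ { {()} }) , λ σ → sym (*-identityˡ _)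
  reduce {suc m} (i ∷ T) (j ∷ J) = let (m' , le , (T' , J') , c , 0≤c , iT , iJ , e) = reduce T J in
    go T' J' c le 0≤c iT iJ (λ σ → trans (Σ-col σ i j T J) (cong (𝟙 (σ $ i ≟ j) *_) (e σ))) (any? λ a → lookup T' a ≟ i) (any? λ a → lookup J' a ≟ j)
    where
    Out = ∃ λ m' → (m' ℕ.≤ suc m) × Σ (Vec (Fin n) m' × Vec (Fin n) m') λ TJ → Σ ℚ λ c → (0ℚ ≤ c) × InjV (proj₁ TJ) × InjV (proj₂ TJ) ×
      (∀ σ → 𝟙 (σ ∙ (i ∷ T) ≟V j ∷ J) ≡ c * 𝟙 (σ ∙ proj₁ TJ ≟V proj₂ TJ))
    go : ∀ {m'} (T' J' : Vec (Fin n) m') c → m' ℕ.≤ m → 0ℚ ≤ c → InjV T' → InjV J' → (∀ σ → 𝟙 (σ ∙ (i ∷ T) ≟V j ∷ J) ≡ 𝟙 (σ $ i ≟ j) * (c * 𝟙 (σ ∙ T' ≟V J'))) →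
      Dec (∃ λ a → lookup T' a ≡ i) → Dec (∃ λ a → lookup J' a ≡ j) → Out
    go {m'} T' J' c le 0≤c iT iJ e (yes (a , s)) _ = m' , ℕ.≤-trans le (ℕ.n≤1+n m) , (T' , J') , c * 𝟙 (lookup J' a ≟ j) , 0≤* 0≤c (0≤𝟙 (lookup J' a ≟ j)) , iT , iJ , λ σ → trans (e σ) (at σ (σ ∙ T' ≟V J'))
      where
      at : ∀ σ (r : Dec (σ ∙ T' ≡ J')) → 𝟙 (σ $ i ≟ j) * (c * 𝟙 r) ≡ c * 𝟙 (lookup J' a ≟ j) * 𝟙 r
      at σ (no _)  = l (𝟙 (σ $ i ≟ j)) c (𝟙 (lookup J' a ≟ j))
        where
        l : ∀ a c b → a * (c * 0ℚ) ≡ c * b * 0ℚ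
        l = solve-∀ ringℚ
      at σ (yes r) = trans (l (𝟙 (σ $ i ≟ j)) c) (cong (λ x → c * 𝟙 (x ≟ j) * 1ℚ) (trans (cong (σ $_) (sym s)) (trans (sym (lookup-∙ σ T' a)) (cong (λ v → lookup v a) r))))
        where
        l : ∀ a c → a * (c * 1ℚ) ≡ c * a * 1ℚ
        l = solve-∀ ringℚ
    go {m'} T' J' c le 0≤c iT iJ e (no nT) (yes (a , s)) = m' , ℕ.≤-trans le (ℕ.n≤1+n m) , (T' , J') , 0ℚ , ≤-refl , iT , iJ , λ σ → trans (e σ) (trans (at σ (σ $ i ≟ j) (σ ∙ T' ≟V J')) (sym (*-zeroˡ (𝟙 (σ ∙ T' ≟V J')))))
      where
      at : ∀ σ (q : Dec (σ $ i ≡ j)) (r : Dec (σ ∙ T' ≡ J')) → 𝟙 q * (c * 𝟙 r) ≡ 0ℚ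
      at σ (no _)  r       = *-zeroˡ (c * 𝟙 r)
      at σ (yes _) (no _)  = trans (cong (1ℚ *_) (*-zeroʳ c)) (*-zeroʳ 1ℚ)
      at σ (yes q) (yes r) = ⊥-elim (nT (a , $-inj σ (trans (sym (lookup-∙ σ T' a)) (trans (cong (λ v → lookup v a) r) (trans s (sym q))))))
    go {m'} T' J' c le 0≤c iT iJ e (no nT) (no nJ) = suc m' , s≤s le , (i ∷ T' , j ∷ J') , c , 0≤c , InjV-∷ {v = T'} (λ a s → nT (a , s)) iT , InjV-∷ {v = J'} (λ a s → nJ (a , s)) iJ ,
        λ σ → trans (e σ) (trans (l (𝟙 (σ $ i ≟ j)) c (𝟙 (σ ∙ T' ≟V J'))) (cong (c *_) (sym (Σ-col σ i j T' J'))))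
      where
      l : ∀ a c b → a * (c * b) ≡ c * (a * b)
      l = solve-∀ ringℚ

  global : ∀ f γ k → (∀ {j} → j ℕ.≤ k → ∀ (T J : Vec (Fin n) j) → InjV T → InjV J → M f T J ≤ γ * Pr T J) → ∀ {j} → j ℕ.≤ k → ∀ (T J : Vec (Fin n) j) → M f T J ≤ γ * Pr T J
  global f γ k h {j} le T J = let (m' , le' , (T' , J') , c , 0≤c , iT , iJ , e) = reduce T J in
    ≤-trans (≤-reflexive (trans (PLF.ext 𝔾 λ σ → trans (cong (f σ *_) (e σ)) (l (f σ) c _)) (PLF.scl 𝔾 c λ σ → f σ * 𝟙 (σ ∙ T' ≟V J'))))
      (≤-trans (*-monoʳ 0≤c (h (ℕ.≤-trans le' le) T' J' iT iJ)) (≤-reflexive (trans (l c γ (Pr T' J')) (cong (γ *_) (trans (sym (PLF.scl 𝔾 c λ σ → 𝟙 (σ ∙ T' ≟V J'))) (PLF.ext 𝔾 λ σ → sym (e σ)))))))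
    where
    l : ∀ a b c → a * (b * c) ≡ b * (a * c)
    l = solve-∀ ringℚ

module Constants (r : ℕ) where
  -- As α³ > n^(-3 r), w = 3 r + 1 leaves a factor 1/n. The gap argument uses two blocks of four
  -- points in each of w groups, hence t = 8 w. With s = 24 r, q^s α ≥ 1 because q^24 > n; the same
  -- s serves as the number of squarings, since s ≤ 2ˢ - 1.
  three-r w t s : ℕ
  three-r = r ℕ.+ r ℕ.+ r
  w = suc three-r
  t = four (dbl w)
  s = r ℕ.* 24

  blockC : ℕ → ℚ
  blockC k = nat (8 ℕ.* (k ℕ.* k))

  -- Rounding: q is at most twice `root n`, so q^24 exceeds n by at most 2^24.
  rootC : ℕ → ℚ
  rootC k = pw k (pw 24 (nat 2))

  sizeC lowC : ℕ → ℚ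
  sizeC k = nat 16 * pw k (blockC k)
  lowC k = rootC k * levelC k * (sizeC k * sizeC k * sizeC k)

  pairC highC : ℚ
  pairC = nat (8 ℕ.* w) * nat (8 ℕ.* w) * nat 6
  highC = pw w pairC * (pw w (nat 4 * nat 3) * pw w (nat 16))

  -- Adding up the constants of all levels gives a single one that works for each of them.
  sumUp : ℕ → ℚ
  sumUp zero    = highC
  sumUp (suc d) = (lowC (suc d) + levelC (suc d)) + sumUp d

  totalC : ℚ
  totalC = sumUp t

  0≤levelC : ∀ k → 0ℚ ≤ levelC k
  0≤levelC k = 0≤* (0≤* (0≤nat 4) (0≤pw k (0≤nat 2))) (0≤sq (injections# k + 1ℚ))

  0≤rootC : ∀ k → 0ℚ ≤ rootC k
  0≤rootC k = 0≤pw k (0≤pw 24 (0≤nat 2))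

  0≤lowC : ∀ k → 0ℚ ≤ lowC k
  0≤lowC k = 0≤* (0≤* (0≤rootC k) (0≤levelC k)) (0≤* (0≤* 0≤z 0≤z) 0≤z)
    where
    0≤z : 0ℚ ≤ sizeC k
    0≤z = 0≤* (0≤nat 16) (0≤pw k (0≤nat (8 ℕ.* (k ℕ.* k))))

  0≤pairC : 0ℚ ≤ pairC
  0≤pairC = 0≤* (0≤* (0≤nat (8 ℕ.* w)) (0≤nat (8 ℕ.* w))) (0≤nat 6)

  0≤highC : 0ℚ ≤ highC
  0≤highC = 0≤* (0≤pw w 0≤pairC) (0≤* (0≤pw w (0≤* (0≤nat 4) (0≤nat 3))) (0≤pw w (0≤nat 16)))

  0≤sumUp : ∀ d → 0ℚ ≤ sumUp d
  0≤sumUp zero    = 0≤highC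
  0≤sumUp (suc d) = 0≤+ (0≤+ (0≤lowC (suc d)) (0≤levelC (suc d))) (0≤sumUp d)

  sumUp-mono : ∀ {i j} → i ℕ.≤ j → sumUp i ≤ sumUp j
  sumUp-mono {i} le = go (ℕ.≤⇒≤′ le)
    where
    go : ∀ {j} → i ℕ.≤′ j → sumUp i ≤ sumUp j
    go (ℕ.≤′-reflexive refl) = ≤-refl
    go (ℕ.≤′-step {n = d} p) = ≤-trans (go p) (cert (0≤+ (0≤lowC (suc d)) (0≤levelC (suc d))) (+-comm _ (sumUp d)))

  high≤ : highC ≤ totalC
  high≤ = sumUp-mono {0} {t} z≤n

  low≤ : ∀ d → d ℕ.< t → lowC (suc d) ≤ totalC
  low≤ d lt = ≤-trans (cert (0≤+ (0≤levelC (suc d)) (0≤sumUp d)) (+-assoc (lowC (suc d)) (levelC (suc d)) (sumUp d))) (sumUp-mono lt)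

  level≤ : ∀ d → d ℕ.< t → levelC (suc d) ≤ totalC
  level≤ d lt = ≤-trans (cert (0≤+ (0≤lowC (suc d)) (0≤sumUp d)) (l (lowC (suc d)) (levelC (suc d)) (sumUp d))) (sumUp-mono lt)
    where
    l : ∀ a b c → a + b + c ≡ b + (a + c)
    l = solve-∀ ringℚ

  Large : ℕ → ℕ → Set
  Large d n = (suc (suc (suc d ℕ.+ suc d)) ℕ.≤ n) × (nat 2 * (tuples# (suc d) * tuples# (suc d) * two^ (suc d)) ≤ nat n - nat (suc d)) ×
    (4 ℕ.* (suc d ℕ.* suc d) ℕ.≤ n) × (sumC s (suc d) < scale n)

  AllLarge : ℕ → Set
  AllLarge n = (∀ d → d ℕ.< t → Large d n) × (16 ℕ.* w ℕ.≤ n) × (suc (suc t) ℕ.≤ n) × (2 ℕ.≤ root n) × (pw (suc t) (nat 4) * totalC < scale n)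

  ev-large : Eventually AllLarge
  ev-large = ev-× (ev-all t λ d → ev-× (ev-≥ _) (ev-× (ev-map (λ n h → undiff (≤-trans (diff h) (≤-reflexive (l (nat n) _ (nat (suc d)))))) (ev-nat (nat 2 * (tuples# (suc d) * tuples# (suc d) * two^ (suc d)) + nat (suc d)))) (ev-× (ev-≥ _) (ev-scale _))))
      (ev-× (ev-≥ _) (ev-× (ev-≥ _) (ev-× (ev-root 2) (ev-scale _))))
    where
    l : ∀ n z k → n - (z + k) ≡ n - k - z
    l = solve-∀ ringℚ

pw-sq : ∀ k x → pw k x * pw k x * (pw k x * pw k x) ≡ pw k (x * x * (x * x))
pw-sq k x = trans (cong₂ _*_ (pw-* k x x) (pw-* k x x)) (pw-* k (x * x) (x * x))

pw4-cancel : ∀ {x y} → 0ℚ ≤ y → pw 4 x ≤ pw 4 y → x ≤ y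
pw4-cancel 0≤y le = ≮⇒≥ λ lt → <⇒≱ (pw-mono< 3 0≤y lt) le

module Contradiction (r n : ℕ) (large : Constants.AllLarge r n) (f : Alternating.El n → ℚ) where
  open Constants r
  open Alternating n
  open TupleCalculus n

  2≤root : 2 ℕ.≤ root n
  2≤root = proj₁ (proj₂ (proj₂ (proj₂ large)))

  1≤n : 1 ℕ.≤ n
  1≤n = ℕ.≤-trans (s≤s z≤n) (proj₁ (proj₂ (proj₂ large)))

  0<n : 0ℚ < nat n
  0<n = <-≤-trans 0<1 (≤-trans (≤-reflexive (sym (+-identityʳ 1ℚ))) (nat-mono 1≤n))

  1≤nat : 1ℚ ≤ nat n
  1≤nat = ≤-trans (≤-reflexive (sym (+-identityʳ 1ℚ))) (nat-mono 1≤n)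

  q u : ℚ
  q = scale n
  u = pw 6 q

  1≤q : 1ℚ ≤ q
  1≤q = cert (0≤nat (root n)) refl

  0≤q : 0ℚ ≤ q
  0≤q = ≤-trans 0≤1 1≤q

  q≤2ν : q ≤ nat 2 * nat (root n)
  q≤2ν = ≤-trans (nat-mono (ℕ.≤-trans (ℕ.+-monoˡ-≤ (root n) (ℕ.≤-trans (s≤s z≤n) 2≤root)) (ℕ.≤-reflexive (cong (root n ℕ.+_) (sym (ℕ.+-identityʳ (root n))))))) (≤-reflexive (nat-* 2 (root n)))

  q≤n : q ≤ nat n
  q≤n = ≤-trans q≤2ν (≤-trans (*-monoˡ (0≤nat (root n)) (nat-mono 2≤root)) (≤-trans (≤-reflexive (cong (nat (root n) *_) (sym (*-identityʳ (nat (root n))))))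
      (≤-trans (pw-exp {2} {24} (≤-trans (≤-reflexive (sym (+-identityʳ 1ℚ))) (nat-mono (ℕ.≤-trans (s≤s z≤n) 2≤root))) (s≤s (s≤s z≤n))) (proj₁ (root-spec n)))))

  q²⁴≤ : pw 24 q ≤ pw 24 (nat 2) * nat n
  q²⁴≤ = ≤-trans (pw-mono 24 0≤q q≤2ν) (≤-trans (≤-reflexive (sym (pw-* 24 (nat 2) (nat (root n))))) (*-monoʳ (0≤pw 24 (0≤nat 2)) (proj₁ (root-spec n))))

  n≤q²⁴ : nat n ≤ pw 24 q
  n≤q²⁴ = <⇒≤ (proj₂ (root-spec n))

  u⁴ : u * u * (u * u) ≡ pw 24 q
  u⁴ = trans (cong₂ _*_ (sym (pw-+ 6 6 q)) (sym (pw-+ 6 6 q))) (sym (pw-+ 12 12 q))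

  1≤u : 1ℚ ≤ u
  1≤u = 1≤pw 6 1≤q

  module _ (f-idem : ∀ σ → f σ * f σ ≡ f σ) (0≤f : ∀ σ → 0ℚ ≤ f σ) (f≤1 : ∀ σ → f σ ≤ 1ℚ) (dense : 1ℚ < pw r (nat n) * E f)
    (no-bump : ∀ j → 1 ℕ.≤ j → j ℕ.≤ 4 ℕ.* r → ∀ (T J : Vec (Fin n) j) → InjV T → InjV J → pw 4 (M f T J) ≤ pw j (nat n) * pw 4 (E f * Pr T J)) where
    open LevelBounds n 0<n f f-idem 0≤f f≤1

    0<α : 0ℚ < α
    0<α = by (0ℚ <? α)
      where
      by : Dec (0ℚ < α) → 0ℚ < α
      by (yes p) = p
      by (no np) = ⊥-elim (<⇒≱ dense (≤-trans (*-monoʳ (0≤pw r (0≤nat n)) (≮⇒≥ np)) (≤-trans (≤-reflexive (*-zeroʳ (pw r (nat n)))) 0≤1)))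

    dense-q : 1ℚ ≤ pw s q * α
    dense-q = ≤-trans (<⇒≤ dense) (*-monoˡ 0≤α (≤-trans (pw-mono r (0≤nat n) n≤q²⁴) (≤-reflexive (pw-pw r 24 q))))

    cube-dense : 1ℚ ≤ pw three-r (nat n) * (α * α * α)
    cube-dense = ≤-trans (1≤pw 3 (<⇒≤ dense)) (≤-reflexive (trans (l (pw r (nat n)) α) (cong (_* (α * α * α)) (trans (cong (_* pw r (nat n)) (sym (pw-+ r r (nat n)))) (sym (pw-+ (r ℕ.+ r) r (nat n)))))))
      where
      l : ∀ p a → p * a * (p * a * (p * a * 1ℚ)) ≡ p * p * p * (a * a * a)
      l = solve-∀ ringℚ

    -- Since u⁴ = q^24 ≥ n, the condition in fourth powers gives a factor u^j after cancelling the
    -- exponent 4. Tuples shorter than k are covered because u ≥ 1.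
    local : ∀ k → k ℕ.≤ three-r → ∀ {j} → j ℕ.≤ k → ∀ (T J : Vec (Fin n) j) → InjV T → InjV J → M f T J ≤ pw k u * α * Pr T J
    -- `no-bump` starts at j = 1; for the empty tuple the coefficient is the mean α itself.
    local k k≤ {zero}  le []  []  iT iJ = ≤-trans (≤-reflexive (trans (PLF.ext 𝔾 λ σ → trans (cong (f σ *_) (𝟙-yes (σ ∙ [] ≟V []) refl)) (*-identityʳ (f σ))) (trans (sym (*-identityˡ α)) (sym (*-identityʳ (1ℚ * α))))))
      (≤-trans (*-monoˡ 0≤1 (*-monoˡ 0≤α (1≤pw k 1≤u))) (≤-reflexive (cong (pw k u * α *_) (sym (trans (PLF.ext 𝔾 λ σ → 𝟙-yes (σ ∙ [] ≟V []) refl) E-one)))))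
    local k k≤ {suc j} le T J iT iJ = ≤-trans (pw4-cancel (0≤* (0≤pw (suc j) 0≤u) 0≤Y) (≤-trans (no-bump (suc j) (s≤s z≤n) j≤ T J iT iJ) (≤-trans (*-monoˡ (0≤pw 4 0≤Y) nj) (≤-reflexive (pw-* 4 (pw (suc j) u) Y)))))
        (≤-trans (*-monoˡ 0≤Y (pw-exp 1≤u le)) (≤-reflexive (sym (*-assoc (pw k u) α (Pr T J)))))
      where
      Y = α * Pr T J
      0≤u = ≤-trans 0≤1 1≤u
      0≤Y : 0ℚ ≤ Y
      0≤Y = 0≤* 0≤α (PLF.nonneg 𝔾 λ σ → 0≤𝟙 (σ ∙ T ≟V J))
      j≤ : suc j ℕ.≤ 4 ℕ.* r
      j≤ = ℕ.≤-trans le (ℕ.≤-trans k≤ (ℕ.≤-trans (ℕ.≤-reflexive (trans (ℕ.+-assoc r r r) (cong (λ x → r ℕ.+ (r ℕ.+ x)) (sym (ℕ.+-identityʳ r))))) (ℕ.*-monoˡ-≤ r {3} {4} (s≤s (s≤s (s≤s z≤n))))))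
      nj : pw (suc j) (nat n) ≤ pw 4 (pw (suc j) u)
      nj = ≤-trans (pw-mono (suc j) (0≤nat n) n≤q²⁴) (≤-reflexive (trans (cong (pw (suc j)) (sym (pw-pw 4 6 q))) (trans (pw-pw (suc j) 4 u) (trans (cong (λ x → pw x u) (ℕ.*-comm (suc j) 4)) (sym (pw-pw 4 (suc j) u))))))

    each : ∀ d → d ℕ.< t → q * (triple (g d) * triple (g d)) ≤ totalC * six α
    each d lt = by (suc d ℕ.≤? three-r)
      where
      k = suc d
      ld = proj₁ large d lt
      0≤six : 0ℚ ≤ six α
      0≤six = 0≤* (0≤* (0≤* 0≤α 0≤α) 0≤α) (0≤* (0≤* 0≤α 0≤α) 0≤α)
      module L = At d k refl (proj₁ ld) (proj₁ (proj₂ ld))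
      by : Dec (k ℕ.≤ three-r) → q * (triple (g d) * triple (g d)) ≤ totalC * six α
      by (no gt) = ≤-trans (high-arith {T = triple (g d) * triple (g d)} {n = nat n} (0<pw three-r 0<n) (0≤sq (triple (g d))) (0≤levelC k) 0≤α
          (≤-trans (*-monoˡ (0≤sq (triple (g d))) (pw-exp {w} {k} 1≤nat (ℕ.≰⇒> gt))) L.trivial) cube-dense q≤n) (*-monoˡ 0≤six (level≤ d lt))
      by (yes le) = ≤-trans (Lo.low-level (0≤rootC k) B⁴ q⁴) (*-monoˡ 0≤six (low≤ d lt))
        where
        bs = block-size d n (proj₁ (proj₂ (proj₂ ld))) 0<n
        B = pw k u
        module Lo = L.Low s s (proj₁ bs) B q (blockC k) (s≤mers s) 0<α (1≤pw k 1≤u) 1≤q dense-q (<⇒≤ (proj₂ (proj₂ (proj₂ ld)))) (proj₁ (proj₂ bs)) (proj₁ (proj₂ (proj₂ bs)))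
          (0≤nat (8 ℕ.* (k ℕ.* k))) (proj₂ (proj₂ (proj₂ bs))) (Reduce.global n f (B * α) k (local k le))
        B⁴ : B * B * (B * B) ≤ rootC k * pw k (nat n)
        B⁴ = ≤-trans (≤-reflexive (trans (pw-sq k u) (cong (pw k) u⁴))) (≤-trans (pw-mono k (0≤pw 24 0≤q) q²⁴≤) (≤-reflexive (sym (pw-* k (pw 24 (nat 2)) (nat n)))))
        q⁴ : q * q * q * q ≤ B
        q⁴ = ≤-trans (≤-reflexive (l q)) (≤-trans (pw-exp {4} {6} 1≤q (s≤s (s≤s (s≤s (s≤s z≤n))))) (≤-trans (≤-reflexive (sym (*-identityʳ u))) (pw-exp {1} {k} 1≤u (s≤s z≤n))))
          where
          l : ∀ q → q * q * q * q ≡ q * (q * (q * (q * 1ℚ)))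
          l = solve-∀ ringℚ

    contradiction : E (λ s → Convolution.conv n f f s * f s) ≡ 0ℚ → ⊥
    contradiction z = no-cancellation t q totalC (0≤sumUp t) 0<α z each last 0≤q (proj₂ (proj₂ (proj₂ (proj₂ large))))
      where
      hs = high-size three-r n (proj₁ (proj₂ large))
      module HP = HighPart w (proj₁ hs) (proj₁ (proj₂ hs)) (proj₁ (proj₂ (proj₂ large))) pairC 0≤pairC (proj₂ (proj₂ hs))
      0≤six : 0ℚ ≤ six α
      0≤six = 0≤* (0≤* (0≤* 0≤α 0≤α) 0≤α) (0≤* (0≤* 0≤α 0≤α) 0≤α)
      last : q * (triple HP.v * triple HP.v) ≤ totalC * six α
      last = ≤-trans (high-arith {T = triple HP.v * triple HP.v} {n = nat n} (0<pw three-r 0<n) (0≤sq (triple HP.v)) 0≤highC 0≤α HP.high-part cube-dense q≤n) (*-monoˡ 0≤six high≤)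

-- Counting

nat-^ : ∀ a k → nat (a ℕ.^ k) ≡ pw k (nat a)
nat-^ a zero    = +-identityʳ 1ℚ
nat-^ a (suc k) = trans (nat-* a (a ℕ.^ k)) (cong (nat a *_) (nat-^ a k))

nat-mono< : ∀ {a b} → a ℕ.< b → nat a < nat b
nat-mono< {a} lt = <-≤-trans (≤-<-trans (≤-reflexive (sym (+-identityˡ (nat a)))) (+-monoˡ-< (nat a) 0<1)) (nat-mono lt)

any-vec? : ∀ {n} t {P : Vec (Fin n) t → Set} → (∀ v → Dec (P v)) → Dec (∃ P)
any-vec? zero    d = map′ (λ p → [] , p) (λ { ([] , p) → p }) (d [])
any-vec? (suc t) d = map′ (λ { (i , v , p) → i ∷ v , p }) (λ { (i ∷ v , p) → i , v , p }) (any? λ i → any-vec? t λ v → d (i ∷ v))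

module Counting (n : ℕ) where
  open Alternating n
  open TupleCalculus n

  bq-∧ : ∀ a b → bq (a ∧ b) ≡ bq a * bq b
  bq-∧ true  b = sym (*-identityˡ (bq b))
  bq-∧ false b = sym (*-zeroˡ (bq b))

  nat-length : ∀ {X : Set} (P : X → Bool) xs → nat (length (filterᵇ P xs)) ≡ sumL xs λ x → bq (P x)
  nat-length P []       = refl
  nat-length P (x ∷ xs) with P x
  ... | true  = cong (1ℚ +_) (nat-length P xs)
  ... | false = trans (nat-length P xs) (sym (+-identityˡ _))

  sum-filter : ∀ {X : Set} (P : X → Bool) (F : X → ℚ) xs → sumL (filterᵇ P xs) F ≡ sumL xs λ x → bq (P x) * F x
  sum-filter P F []       = refl
  sum-filter P F (x ∷ xs) with P x
  ... | true  = cong₂ _+_ (sym (*-identityˡ (F x))) (sum-filter P F xs)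
  ... | false = trans (sum-filter P F xs) (trans (sym (+-identityˡ _)) (cong (_+ sumL xs (λ x → bq (P x) * F x)) (sym (*-zeroˡ (F x)))))

  nat-count : ∀ P → nat (count n P) ≡ sumL elems λ g → bq (P (fn g))
  nat-count P = trans (nat-length P (altGroup n)) (trans (sum-filter isAltᵇ (λ σ → bq (P σ)) (allVecs n n)) (trans (sum-allVecs n n _) (sym (sum-elems λ σ → bq (P σ)))))

  card-E : ∀ F → card * E F ≡ sumL elems F
  card-E F = trans (sym (*-assoc card _ _)) (trans (cong (_* sumL elems F) (inv-r card 0<card)) (*-identityˡ _))

  nat-count-E : ∀ P → nat (count n P) ≡ card * E λ g → bq (P (fn g))
  nat-count-E P = trans (nat-count P) (sym (card-E λ g → bq (P (fn g))))

  nat-total : nat (count n (λ _ → true)) ≡ card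
  nat-total = nat-count λ _ → true

  umvirate-𝟙 : ∀ {t} (is js : Vec (Fin n) t) g → bq (umvirateᵇ is js (fn g)) ≡ 𝟙 (g ∙ is ≟V js)
  umvirate-𝟙 {t} is js g = by (umvirateᵇ is js (fn g)) refl
    where
    P : Fin t → Bool
    P k = toℕ (g $ lookup is k) ℕ.≡ᵇ toℕ (lookup js k)
    all≡ : umvirateᵇ is js (fn g) ≡ andF P
    all≡ = trans (cong and (map-tabulate (λ k → k) P)) (and-tab P)
    T⇒≡ : ∀ b → Data.Bool.T b → b ≡ true
    T⇒≡ true _ = refl
    to : umvirateᵇ is js (fn g) ≡ true → g ∙ is ≡ js
    to e = lookup-ext λ k → trans (lookup-∙ g is k) (Fin.toℕ-injective (ℕ.≡ᵇ⇒≡ _ _ (subst Data.Bool.T (sym (andF-elim P (trans (sym all≡) e) k)) tt)))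
    from : g ∙ is ≡ js → umvirateᵇ is js (fn g) ≡ true
    from e = trans all≡ (andF-intro P λ k → T⇒≡ (P k) (ℕ.≡⇒≡ᵇ _ _ (cong toℕ (trans (sym (lookup-∙ g is k)) (cong (λ v → lookup v k) e)))))
    by : ∀ b → umvirateᵇ is js (fn g) ≡ b → bq b ≡ 𝟙 (g ∙ is ≟V js)
    by true  e = sym (𝟙-yes (g ∙ is ≟V js) (to e))
    by false e = sym (𝟙-no (g ∙ is ≟V js) λ r → F≢T (trans (sym e) (from r)))
      where
      F≢T : ¬ false ≡ true
      F≢T ()

  module Subset (A : Perm n → Bool) where
    f : El → ℚ
    f g = bq (A (fn g))

    bq² : ∀ b → bq b * bq b ≡ bq b
    bq² true  = refl
    bq² false = refl

    0≤bq : ∀ b → 0ℚ ≤ bq b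
    0≤bq true  = 0≤1
    0≤bq false = ≤-refl

    bq≤1 : ∀ b → bq b ≤ 1ℚ
    bq≤1 true  = ≤-refl
    bq≤1 false = 0≤1

    nat-A : nat (count n A) ≡ card * E f
    nat-A = nat-count-E A

    nat-U : ∀ {t} (is js : Vec (Fin n) t) → nat (count n (umvirateᵇ is js)) ≡ card * Pr is js
    nat-U is js = trans (nat-count-E (umvirateᵇ is js)) (cong (card *_) (PLF.ext 𝔾 (umvirate-𝟙 is js)))

    nat-AU : ∀ {t} (is js : Vec (Fin n) t) → nat (count n (λ σ → A σ ∧ umvirateᵇ is js σ)) ≡ card * M f is js
    nat-AU is js = trans (nat-count-E λ σ → A σ ∧ umvirateᵇ is js σ) (cong (card *_) (PLF.ext 𝔾 λ g → trans (bq-∧ (A (fn g)) (umvirateᵇ is js (fn g))) (cong (f g *_) (umvirate-𝟙 is js g))))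

    -- The density increment by n^(t/4), raised to the fourth power and cleared of denominators. As
    -- an inequality between natural numbers it is decidable.
    Bump : ∀ {t} → Vec (Fin n) t → Vec (Fin n) t → Set
    Bump {t} is js = n ℕ.^ t ℕ.* (count n A ℕ.* count n (umvirateᵇ is js)) ℕ.^ 4 ℕ.≤ (count n (λ σ → A σ ∧ umvirateᵇ is js σ) ℕ.* count n (λ _ → true)) ℕ.^ 4

    bump? : ∀ {t} (is js : Vec (Fin n) t) → Dec (Bump is js)
    bump? {t} is js = n ℕ.^ t ℕ.* (count n A ℕ.* count n (umvirateᵇ is js)) ℕ.^ 4 ℕ.≤? (count n (λ σ → A σ ∧ umvirateᵇ is js σ) ℕ.* count n (λ _ → true)) ℕ.^ 4

    no-bump-ℚ : ∀ {t} (is js : Vec (Fin n) t) → ¬ Bump is js → pw 4 (M f is js) ≤ pw t (nat n) * pw 4 (E f * Pr is js)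
    no-bump-ℚ {t} is js nb = *-cancelˡ (0<pw 4 (0<* 0<card 0<card)) (≤-cong left right (nat-mono (ℕ.<⇒≤ (ℕ.≰⇒> nb))))
      where
      cA = count n A ; cU = count n (umvirateᵇ is js) ; cAU = count n (λ σ → A σ ∧ umvirateᵇ is js σ) ; c1 = count n (λ _ → true)
      left : nat ((cAU ℕ.* c1) ℕ.^ 4) ≡ pw 4 (card * card) * pw 4 (M f is js)
      left = trans (nat-^ (cAU ℕ.* c1) 4) (trans (cong (pw 4) (trans (nat-* cAU c1) (trans (cong₂ _*_ (nat-AU is js) nat-total) (l card (M f is js))))) (sym (pw-* 4 (card * card) (M f is js))))
        where
        l : ∀ c m → c * m * c ≡ c * c * m
        l = solve-∀ ringℚ
      right : nat (n ℕ.^ t ℕ.* (cA ℕ.* cU) ℕ.^ 4) ≡ pw 4 (card * card) * (pw t (nat n) * pw 4 (E f * Pr is js))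
      right = trans (nat-* (n ℕ.^ t) ((cA ℕ.* cU) ℕ.^ 4)) (trans (cong₂ _*_ (nat-^ n t) (trans (nat-^ (cA ℕ.* cU) 4) (trans (cong (pw 4) (trans (nat-* cA cU) (trans (cong₂ _*_ nat-A (nat-U is js)) (l card (E f) (Pr is js))))) (sym (pw-* 4 (card * card) (E f * Pr is js))))))
          (m (pw t (nat n)) (pw 4 (card * card)) (pw 4 (E f * Pr is js))))
        where
        l : ∀ c a p → c * a * (c * p) ≡ c * c * (a * p)
        l = solve-∀ ringℚ
        m : ∀ a b c → a * (b * c) ≡ b * (a * c)
        m = solve-∀ ringℚ

    dense-ℚ : ∀ r → count n (λ _ → true) ℕ.< n ℕ.^ r ℕ.* count n A → 1ℚ < pw r (nat n) * E f
    dense-ℚ r lt = ≰⇒> λ le → <⇒≱ (nat-mono< lt) (≤-trans (≤-reflexive (trans (nat-* (n ℕ.^ r) (count n A)) (trans (cong₂ _*_ (nat-^ n r) nat-A) (l (pw r (nat n)) card (E f)))))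
        (≤-trans (*-monoʳ (<⇒≤ 0<card) le) (≤-reflexive (trans (*-identityʳ card) (sym nat-total)))))
      where
      l : ∀ p c a → p * (c * a) ≡ c * (p * a)
      l = solve-∀ ringℚ

    product-free-ℚ : ProductFree A → E (λ s → Convolution.conv n f f s * f s) ≡ 0ℚ
    product-free-ℚ pf = trans (PLF.ext 𝔾 λ s → trans (sym (PLF.sclr 𝔾 (f s) λ x → f x * f (x ⁻¹ · s))) (trans (PLF.ext 𝔾 λ x → trans (cong (λ g → f x * f (x ⁻¹ · s) * bq (A g)) (s≡ x s)) (vanish x (x ⁻¹ · s) (A (fn x)) (A (fn (x ⁻¹ · s))) refl refl)) (PLF.zer 𝔾))) (PLF.zer 𝔾)
      where
      s≡ : ∀ x s → fn s ≡ fn x ∘ₚ fn (x ⁻¹ · s)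
      s≡ x s = trans (cong fn (trans (sym (idˡ s)) (trans (cong (_· s) (sym (invʳ x))) (assoc x (x ⁻¹) s)))) (·-fn x (x ⁻¹ · s))
      vanish : ∀ x y a b → A (fn x) ≡ a → A (fn y) ≡ b → bq a * bq b * bq (A (fn x ∘ₚ fn y)) ≡ 0ℚ
      vanish x y true  true  ea eb = trans (cong (λ c → 1ℚ * 1ℚ * bq c) (pf (fn x) (fn y) (ok x) (ok y) ea eb)) (*-zeroʳ (1ℚ * 1ℚ))
      vanish x y true  false ea eb = trans (cong (_* bq (A (fn x ∘ₚ fn y))) (*-zeroʳ 1ℚ)) (*-zeroˡ (bq (A (fn x ∘ₚ fn y))))
      vanish x y false b     ea eb = trans (cong (_* bq (A (fn x ∘ₚ fn y))) (*-zeroˡ (bq b))) (*-zeroˡ (bq (A (fn x ∘ₚ fn y))))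

    umvirate-nonempty : ∀ {t} (is js : Vec (Fin n) t) → suc (suc t) ℕ.≤ n → InjV is → InjV js → 0 ℕ.< count n (umvirateᵇ is js)
    umvirate-nonempty {t} is js le i j = by (count n (umvirateᵇ is js)) refl
      where
      by : ∀ c → count n (umvirateᵇ is js) ≡ c → 0 ℕ.< c
      by (suc c) e = s≤s z≤n
      by zero    e = ⊥-elim (<⇒≱ 0<1 (≤-trans (≤-reflexive (sym (Pr-fall is js le i j))) (≤-reflexive (trans (cong (_* fall t) Pr0) (*-zeroˡ (fall t))))))
        where
        Pr0 : Pr is js ≡ 0ℚ
        Pr0 = trans (sym (*-identityˡ _)) (trans (cong (_* Pr is js) (sym (trans (*-comm _ card) (inv-r card 0<card)))) (trans (*-assoc (inv card 0<card) card (Pr is js))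
          (trans (cong (inv card 0<card *_) (trans (sym (nat-U is js)) (cong nat e))) (*-zeroʳ (inv card 0<card)))))

-- Finite search for a bump

module Search (r n : ℕ) (large : Constants.AllLarge r n) (A : Perm n → Bool) (pf : ProductFree A) (lt : count n (λ _ → true) ℕ.< n ℕ.^ r ℕ.* count n A) where
  open Alternating n
  open Counting n
  open Subset A
  open TupleCalculus n using (M; Pr)

  Found : ℕ → Set
  Found t = ∃ λ (is : Vec (Fin n) t) → ∃ λ (js : Vec (Fin n) t) → 1 ℕ.≤ t × InjV is × InjV js × Bump is js

  found? : ∀ t → Dec (Found t)
  found? t = any-vec? t λ is → any-vec? t λ js → (1 ℕ.≤? t) ×-dec (decInj is ×-dec (decInj js ×-dec bump? is js))

  not-found : ¬ (∃ λ (k : Fin (suc (4 ℕ.* r))) → Found (toℕ k)) → ⊥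
  not-found none = Contradiction.contradiction r n large f (λ σ → bq² (A (fn σ))) (λ σ → 0≤bq (A (fn σ))) (λ σ → bq≤1 (A (fn σ))) (dense-ℚ r lt) nb (product-free-ℚ pf)
    where
    nb : ∀ j → 1 ℕ.≤ j → j ℕ.≤ 4 ℕ.* r → ∀ (T J : Vec (Fin n) j) → InjV T → InjV J → pw 4 (M f T J) ≤ pw j (nat n) * pw 4 (E f * Pr T J)
    nb j 1≤j j≤ T J iT iJ = no-bump-ℚ T J λ bump → none (Fin.fromℕ< (s≤s j≤) , subst Found (sym (Fin.toℕ-fromℕ< (s≤s j≤))) (T , J , 1≤j , iT , iJ , bump))

  room : ∀ {t} → t ℕ.≤ 4 ℕ.* r → suc (suc t) ℕ.≤ n
  room t≤ = ℕ.≤-trans (s≤s (s≤s t≤)) (ℕ.≤-trans 4r (proj₁ (proj₂ large)))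
    where
    4r : suc (suc (4 ℕ.* r)) ℕ.≤ 16 ℕ.* suc (r ℕ.+ r ℕ.+ r)
    4r = ℕ.≤-trans (ℕ.+-mono-≤ {2} {16} (s≤s (s≤s z≤n)) (ℕ.*-mono-≤ {4} {16} (s≤s (s≤s (s≤s (s≤s z≤n)))) (ℕ.≤-trans (ℕ.m≤m+n r r) (ℕ.m≤m+n (r ℕ.+ r) r)))) (ℕ.≤-reflexive (sym (ℕ.*-suc 16 (r ℕ.+ r ℕ.+ r))))

  -- The analysis only refutes the absence of bumps. There are finitely many tuples of length at
  -- most 4 r and being a bump is decidable, so exhaustive search turns the refutation into a
  -- witness.
  result : ∃ λ t → (t ℕ.≤ 4 ℕ.* r) × Found t
  result = by (any? λ k → found? (toℕ k))
    where
    by : Dec (∃ λ (k : Fin (suc (4 ℕ.* r))) → Found (toℕ k)) → ∃ λ t → (t ℕ.≤ 4 ℕ.* r) × Found t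
    by (yes (k , F)) = toℕ k , ℕ.≤-pred (Fin.toℕ<n k) , F
    by (no none)     = ⊥-elim (not-found none)

theorem1p5 : (r : ℕ) → ∃[ N ] ((n : ℕ) → N ℕ.≤ n →
    (A : Perm n → Bool) → ProductFree A →
    count n (λ _ → true) ℕ.< n ℕ.^ r ℕ.* count n A →
    ∃[ t ] (1 ℕ.≤ t × t ℕ.≤ 4 ℕ.* r × ∃[ is ] ∃[ js ] (Distinct {n} {t} is × Distinct js ×
      0 ℕ.< count n (umvirateᵇ is js) ×
      n ℕ.^ t ℕ.* (count n A ℕ.* count n (umvirateᵇ is js)) ℕ.^ 4
        ℕ.≤ (count n (λ σ → A σ ∧ umvirateᵇ is js σ) ℕ.* count n (λ _ → true)) ℕ.^ 4)))
theorem1p5 r = proj₁ (Constants.ev-large r) , λ n N≤n A pf lt →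
  let module S = Search r n (proj₂ (Constants.ev-large r) n N≤n) A pf lt
      (t , t≤ , is , js , 1≤t , iI , iJ , bump) = S.result
  in t , 1≤t , t≤ , is , js , (λ k l → iI) , (λ k l → iJ) , Counting.Subset.umvirate-nonempty n A is js (S.room t≤) iI iJ , bump
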